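{- There is a constant $c\geq 0$ such that the following holds. Let $P$ be a fixed pattern graph with $k$ vertices and pathwidth $p$. Then there exists an algorithm that takes as input an $n$-vertex host graph $H$ and counts the number of subgraphs of $H$ that are isomorphic to $P$ in time $$O\bigl(n^{(\frac12-\tau)k+2p+c}+n^{k/3+3p+c}\bigr),$$ where $c$ is independent of the constants $k,p,\tau$, and $$\tau=\begin{cases}\dfrac{(3-\omega)(1-\alpha)}{36-6(1+\omega)(1+\alpha)} & \text{if }\alpha\leq 1/2,\\[2mm] \dfrac{1}{18} & \text{if }\alpha\geq 1/2.\end{cases}$$
   Context: $P$ is fixed, so $k$ and $p$ are constants independent of $n$ (the constant hidden in $O(\cdot)$ may depend on $P$). $\omega$ is the limiting exponent of square matrix multiplication, $2\leq\omega<2.3728639$. $\alpha$ is the limiting exponent such that multiplying an $N\times N^\alpha$ matrix with an $N^\alpha\times N$ matrix takes $N^{2+o(1)}$ arithmetic operations, $0.3<\alpha\leq 3-\omega$; one has $\alpha=1$ if and only if $\omega=2$. Convention used in all running times: the product of an $N\times M$ matrix and an $M\times N$ matrix can be computed using (M1) $O(N^{2-\alpha\beta}M^\beta+N^2)$ arithmetic operations when $M\leq N$, where $\beta=(\omega-2)/(1-\alpha)$ (read $\beta=0$ if $\alpha=1$), and (M2) $O(N^{\omega-1}M)$ arithmetic operations when $M\geq N$. -}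

module Defs where

open import Algebra.Bundles using (CommutativeMonoid)
open import Algebra.Properties.Monoid.Sum using (sum)
open import Data.Bool.Base using (Bool; false; T; if_then_else_)
open import Data.Fin.Base as Fin using (Fin; toℕ)
open import Data.Fin.Subset using (Subset; ∣_∣) renaming (_∈_ to _∈ˢ_)
open import Data.Integer.Base as ℤ using (ℤ; +_; -[1+_])
import Data.Integer.Properties as ℤₚ
import Data.Integer.Tactic.RingSolver as ℤ-Solver
open import Data.List.Base as List
  using (List; []; _∷_; _++_; concat; drop; foldr; head; length; tabulate)
open import Data.List.Membership.Propositional using (_∈_)
open import Data.List.Relation.Unary.Unique.Propositional using (Unique)
open import Data.Maybe.Base using (Maybe; just; nothing)
open import Data.Nat.Base as ℕ using (ℕ; zero; suc; NonZero; z≤n; s≤s)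
import Data.Nat.Coprimality as Coprime
import Data.Nat.Properties as ℕₚ
import Data.Nat.Tactic.RingSolver as ℕ-Solver
open import Data.Product.Base using (Σ-syntax; ∃-syntax; _×_; _,_; proj₁; proj₂)
open import Data.Rational.Base as ℚ using (ℚ; mkℚ; 0ℚ; 1ℚ; ½; _/_; ↥_; ↧ₙ_)
import Data.Rational.Properties as ℚₚ
import Data.Rational.Unnormalised.Base as ℚᵘ
import Data.Rational.Unnormalised.Properties as ℚᵘₚ
open import Data.Sum.Base using (_⊎_; inj₁; inj₂)
open import Data.Vec.Base using (Vec; lookup)
open import Function.Bundles using (_⇔_)
open import Function.Definitions using (Injective)
open import Relation.Binary.PropositionalEquality
open import Relation.Nullary.Decidable using (Dec; yes; no; ⌊_⌋)
open import Relation.Nullary.Negation using (¬_)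

Cauchy : (ℕ → ℚ) → Set
Cauchy s = ∀ ε → 0ℚ ℚ.< ε →
  ∃[ N ] ∀ m n → N ℕ.≤ m → N ℕ.≤ n → ℚ.∣ s m ℚ.- s n ∣ ℚ.≤ ε

record ℝ : Set where
  field
    seq    : ℕ → ℚ
    cauchy : Cauchy seq

open ℝ public

module ℝ-lemmas where
  open import Algebra.Properties.CommutativeSemigroup
    (CommutativeMonoid.commutativeSemigroup ℚₚ.+-0-commutativeMonoid)
    using (interchange)

  cancel : ∀ a b → a ≡ (a ℚ.- b) ℚ.+ b
  cancel a b = sym (trans (ℚₚ.+-assoc a (ℚ.- b) b)
                   (trans (cong (a ℚ.+_) (ℚₚ.+-inverseˡ b)) (ℚₚ.+-identityʳ a)))

  telescope : ∀ a b c → a ℚ.- c ≡ (a ℚ.- b) ℚ.+ (b ℚ.- c)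
  telescope a b c = trans (cong (ℚ._- c) (cancel a b)) (ℚₚ.+-assoc (a ℚ.- b) b (ℚ.- c))

  +-interchange-- : ∀ a b c d → a ℚ.+ b ℚ.- (c ℚ.+ d) ≡ (a ℚ.- c) ℚ.+ (b ℚ.- d)
  +-interchange-- a b c d = trans (cong ((a ℚ.+ b) ℚ.+_) (ℚₚ.neg-distrib-+ c d))
                                  (interchange a b (ℚ.- c) (ℚ.- d))

  *-distribˡ-- : ∀ a b c → a ℚ.* (b ℚ.- c) ≡ a ℚ.* b ℚ.- a ℚ.* c
  *-distribˡ-- a b c = trans (ℚₚ.*-distribˡ-+ a b (ℚ.- c))
                             (cong (a ℚ.* b ℚ.+_) (sym (ℚₚ.neg-distribʳ-* a c)))

  product-difference : ∀ a b c d → a ℚ.* b ℚ.- c ℚ.* d ≡ a ℚ.* (b ℚ.- d) ℚ.+ d ℚ.* (a ℚ.- c)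
  product-difference a b c d = trans (telescope (a ℚ.* b) (a ℚ.* d) (c ℚ.* d))
    (sym (cong₂ ℚ._+_ (*-distribˡ-- a b d)
      (trans (*-distribˡ-- d a c) (cong₂ ℚ._-_ (ℚₚ.*-comm d a) (ℚₚ.*-comm d c)))))

  half-pos : ∀ {ε} → 0ℚ ℚ.< ε → 0ℚ ℚ.< ½ ℚ.* ε
  half-pos {ε} 0<ε = ℚₚ.*-monoʳ-<-pos ½ 0<ε

  halves : ∀ ε → ½ ℚ.* ε ℚ.+ ½ ℚ.* ε ≡ ε
  halves ε = trans (sym (ℚₚ.*-distribʳ-+ ε ½ ½)) (ℚₚ.*-identityˡ ε)

  const-cauchy : ∀ q → Cauchy (λ _ → q)
  const-cauchy q ε 0<ε = 0 , λ _ _ _ _ →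
    subst (ℚ._≤ ε) (sym (cong ℚ.∣_∣ (ℚₚ.+-inverseʳ q))) (ℚₚ.<⇒≤ 0<ε)

  neg-cauchy : ∀ {s} → Cauchy s → Cauchy (λ n → ℚ.- s n)
  neg-cauchy {s} cs ε 0<ε with cs ε 0<ε
  ... | N , h = N , λ m n N≤m N≤n →
    subst (ℚ._≤ ε) (trans (sym (ℚₚ.∣-p∣≡∣p∣ (s m ℚ.- s n))) (cong ℚ.∣_∣ (ℚₚ.neg-distrib-+ (s m) (ℚ.- s n)))) (h m n N≤m N≤n)

  add-cauchy : ∀ {s t} → Cauchy s → Cauchy t → Cauchy (λ n → s n ℚ.+ t n)
  add-cauchy {s} {t} cs ct ε 0<ε
    with cs (½ ℚ.* ε) (half-pos 0<ε) | ct (½ ℚ.* ε) (half-pos 0<ε)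
  ... | N₁ , h₁ | N₂ , h₂ = N₁ ℕ.⊔ N₂ , λ m n N≤m N≤n → begin
      ℚ.∣ s m ℚ.+ t m ℚ.- (s n ℚ.+ t n) ∣              ≡⟨ cong ℚ.∣_∣ (+-interchange-- (s m) (t m) (s n) (t n)) ⟩
      ℚ.∣ (s m ℚ.- s n) ℚ.+ (t m ℚ.- t n) ∣            ≤⟨ ℚₚ.∣p+q∣≤∣p∣+∣q∣ (s m ℚ.- s n) (t m ℚ.- t n) ⟩
      ℚ.∣ s m ℚ.- s n ∣ ℚ.+ ℚ.∣ t m ℚ.- t n ∣          ≤⟨ ℚₚ.+-mono-≤
          (h₁ m n (ℕₚ.m⊔n≤o⇒m≤o N₁ N₂ N≤m) (ℕₚ.m⊔n≤o⇒m≤o N₁ N₂ N≤n))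
          (h₂ m n (ℕₚ.m⊔n≤o⇒n≤o N₁ N₂ N≤m) (ℕₚ.m⊔n≤o⇒n≤o N₁ N₂ N≤n)) ⟩
      ½ ℚ.* ε ℚ.+ ½ ℚ.* ε                              ≡⟨ halves ε ⟩
      ε                                                ∎
    where
    open ℚₚ.≤-Reasoning

  bounded : ∀ {s} → Cauchy s → Σ[ B ∈ ℚ ] 0ℚ ℚ.< B × ∃[ N ] ∀ n → N ℕ.≤ n → ℚ.∣ s n ∣ ℚ.≤ B
  bounded {s} cs with cs 1ℚ (ℚₚ.positive⁻¹ 1ℚ)
  ... | N , h = 1ℚ ℚ.+ ℚ.∣ s N ∣
              , ℚₚ.+-mono-<-≤ (ℚₚ.positive⁻¹ 1ℚ) (ℚₚ.0≤∣p∣ (s N))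
              , N , λ n N≤n → begin
      ℚ.∣ s n ∣                          ≡⟨ cong ℚ.∣_∣ (cancel (s n) (s N)) ⟩
      ℚ.∣ (s n ℚ.- s N) ℚ.+ s N ∣        ≤⟨ ℚₚ.∣p+q∣≤∣p∣+∣q∣ (s n ℚ.- s N) (s N) ⟩
      ℚ.∣ s n ℚ.- s N ∣ ℚ.+ ℚ.∣ s N ∣    ≤⟨ ℚₚ.+-monoˡ-≤ ℚ.∣ s N ∣ (h n N N≤n ℕₚ.≤-refl) ⟩
      1ℚ ℚ.+ ℚ.∣ s N ∣                   ∎
    where
    open ℚₚ.≤-Reasoning

  -- A tolerance δ with B δ = ½ ε.
  split : ∀ B ε → 0ℚ ℚ.< B → 0ℚ ℚ.< ε → Σ[ δ ∈ ℚ ] 0ℚ ℚ.< δ × B ℚ.* δ ≡ ½ ℚ.* ε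
  split B ε 0<B 0<ε = δ , 0<δ , eq
    where
    instance
      B⁺ : ℚ.Positive B
      B⁺ = ℚ.positive 0<B
      B≢0 : ℚ.NonZero B
      B≢0 = ℚₚ.pos⇒nonZero B
      B⁻¹⁺ : ℚ.Positive (ℚ.1/ B)
      B⁻¹⁺ = ℚₚ.1/pos⇒pos B
    δ : ℚ
    δ = ℚ.1/ B ℚ.* (½ ℚ.* ε)
    0<δ : 0ℚ ℚ.< δ
    0<δ = subst (ℚ._< δ) (ℚₚ.*-zeroʳ (ℚ.1/ B)) (ℚₚ.*-monoʳ-<-pos (ℚ.1/ B) (half-pos 0<ε))
    eq : B ℚ.* δ ≡ ½ ℚ.* ε
    eq = trans (sym (ℚₚ.*-assoc B (ℚ.1/ B) (½ ℚ.* ε)))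
         (trans (cong (ℚ._* (½ ℚ.* ε)) (ℚₚ.*-inverseʳ B)) (ℚₚ.*-identityˡ (½ ℚ.* ε)))

  ∣*∣-mono : ∀ {p q a b} → ℚ.∣ p ∣ ℚ.≤ a → ℚ.∣ q ∣ ℚ.≤ b → 0ℚ ℚ.≤ a →
             ℚ.∣ p ℚ.* q ∣ ℚ.≤ a ℚ.* b
  ∣*∣-mono {p} {q} {a} {b} p≤a q≤b 0≤a = begin
      ℚ.∣ p ℚ.* q ∣         ≡⟨ ℚₚ.∣p*q∣≡∣p∣*∣q∣ p q ⟩
      ℚ.∣ p ∣ ℚ.* ℚ.∣ q ∣   ≤⟨ ℚₚ.*-monoʳ-≤-nonNeg ℚ.∣ q ∣ {{ℚₚ.∣-∣-nonNeg q}} p≤a ⟩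
      a ℚ.* ℚ.∣ q ∣         ≤⟨ ℚₚ.*-monoˡ-≤-nonNeg a {{ℚ.nonNegative 0≤a}} q≤b ⟩
      a ℚ.* b               ∎
    where open ℚₚ.≤-Reasoning

  mul-cauchy : ∀ {s t} → Cauchy s → Cauchy t → Cauchy (λ n → s n ℚ.* t n)
  mul-cauchy {s} {t} cs ct ε 0<ε with bounded cs | bounded ct
  ... | A , 0<A , Nₐ , hₐ | B , 0<B , N_b , h_b
    with split A ε 0<A 0<ε | split B ε 0<B 0<ε
  ... | δₜ , 0<δₜ , eqₜ | δₛ , 0<δₛ , eqₛ
    with cs δₛ 0<δₛ | ct δₜ 0<δₜ
  ... | Nₛ , hₛ | Nₜ , hₜ = (Nₐ ℕ.⊔ N_b) ℕ.⊔ (Nₛ ℕ.⊔ Nₜ) , λ m n N≤m N≤n →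
      let leftᵐ  = ℕₚ.m⊔n≤o⇒m≤o (Nₐ ℕ.⊔ N_b) (Nₛ ℕ.⊔ Nₜ) N≤m
          leftⁿ  = ℕₚ.m⊔n≤o⇒m≤o (Nₐ ℕ.⊔ N_b) (Nₛ ℕ.⊔ Nₜ) N≤n
          rightᵐ = ℕₚ.m⊔n≤o⇒n≤o (Nₐ ℕ.⊔ N_b) (Nₛ ℕ.⊔ Nₜ) N≤m
          rightⁿ = ℕₚ.m⊔n≤o⇒n≤o (Nₐ ℕ.⊔ N_b) (Nₛ ℕ.⊔ Nₜ) N≤n
      in begin
      ℚ.∣ s m ℚ.* t m ℚ.- s n ℚ.* t n ∣
        ≡⟨ cong ℚ.∣_∣ (product-difference (s m) (t m) (s n) (t n)) ⟩
      ℚ.∣ s m ℚ.* (t m ℚ.- t n) ℚ.+ t n ℚ.* (s m ℚ.- s n) ∣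
        ≤⟨ ℚₚ.∣p+q∣≤∣p∣+∣q∣ (s m ℚ.* (t m ℚ.- t n)) (t n ℚ.* (s m ℚ.- s n)) ⟩
      ℚ.∣ s m ℚ.* (t m ℚ.- t n) ∣ ℚ.+ ℚ.∣ t n ℚ.* (s m ℚ.- s n) ∣
        ≤⟨ ℚₚ.+-mono-≤
             (∣*∣-mono {s m} {t m ℚ.- t n}
                (hₐ m (ℕₚ.m⊔n≤o⇒m≤o Nₐ N_b leftᵐ))
                (hₜ m n (ℕₚ.m⊔n≤o⇒n≤o Nₛ Nₜ rightᵐ) (ℕₚ.m⊔n≤o⇒n≤o Nₛ Nₜ rightⁿ))
                (ℚₚ.<⇒≤ 0<A))
             (∣*∣-mono {t n} {s m ℚ.- s n}
                (h_b n (ℕₚ.m⊔n≤o⇒n≤o Nₐ N_b leftⁿ))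
                (hₛ m n (ℕₚ.m⊔n≤o⇒m≤o Nₛ Nₜ rightᵐ) (ℕₚ.m⊔n≤o⇒m≤o Nₛ Nₜ rightⁿ))
                (ℚₚ.<⇒≤ 0<B)) ⟩
      A ℚ.* δₜ ℚ.+ B ℚ.* δₛ
        ≡⟨ cong₂ ℚ._+_ eqₜ eqₛ ⟩
      ½ ℚ.* ε ℚ.+ ½ ℚ.* ε
        ≡⟨ halves ε ⟩
      ε ∎
    where
    open ℚₚ.≤-Reasoning

open ℝ-lemmas

fromℚ : ℚ → ℝ
seq    (fromℚ q) _ = q
cauchy (fromℚ q)   = const-cauchy q

fromℕ : ℕ → ℝ
fromℕ n = fromℚ (mkℚ (+ n) 0 (Coprime.sym (Coprime.1-coprimeTo n)))

infixl 6 _+ʳ_ _-ʳ_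
infixl 7 _*ʳ_
infix  8 -ʳ_
infix  4 _≤ʳ_ _<ʳ_ _≃ʳ_

_+ʳ_ : ℝ → ℝ → ℝ
seq    (x +ʳ y) n = seq x n ℚ.+ seq y n
cauchy (x +ʳ y)   = add-cauchy {seq x} {seq y} (cauchy x) (cauchy y)

-ʳ_ : ℝ → ℝ
seq    (-ʳ x) n = ℚ.- seq x n
cauchy (-ʳ x)   = neg-cauchy {seq x} (cauchy x)

_-ʳ_ : ℝ → ℝ → ℝ
x -ʳ y = x +ʳ (-ʳ y)

_*ʳ_ : ℝ → ℝ → ℝ
seq    (x *ʳ y) n = seq x n ℚ.* seq y n
cauchy (x *ʳ y)   = mul-cauchy {seq x} {seq y} (cauchy x) (cauchy y)

record _≤ʳ_ (x y : ℝ) : Set where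
  constructor *≤*
  field
    below : ∀ ε → 0ℚ ℚ.< ε → ∃[ N ] ∀ n → N ℕ.≤ n → seq x n ℚ.≤ seq y n ℚ.+ ε

record _<ʳ_ (x y : ℝ) : Set where
  constructor *<*
  field
    gap        : ℚ
    gap-pos    : 0ℚ ℚ.< gap
    index      : ℕ
    separation : ∀ n → index ℕ.≤ n → seq x n ℚ.+ gap ℚ.≤ seq y n

_≃ʳ_ : ℝ → ℝ → Set
x ≃ʳ y = x ≤ʳ y × y ≤ʳ x

-- The largest m ≤ bound satisfying P, given that P holds at 0.
largest : {P : ℕ → Set} → (∀ m → Dec (P m)) → ℕ → ℕ
largest P? zero    = zero
largest P? (suc b) with P? (suc b)
... | yes _ = suc b
... | no  _ = largest P? b

pos neg : ℚ → ℕ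
pos q = ℤ.∣ ↥ q ℤ.⊔ + 0 ∣
neg q = pos (ℚ.- q)

-- (m / k) ^ b ≤ n ^ (↥ q), where q = ↥ q / b.
Fits : (n : ℕ) (q : ℚ) (k m : ℕ) → Set
Fits n q k m = m ℕ.^ ↧ₙ q ℕ.* n ℕ.^ neg q ℕ.≤ k ℕ.^ ↧ₙ q ℕ.* n ℕ.^ pos q

fits? : ∀ n q k m → Dec (Fits n q k m)
fits? n q k m = _ ℕₚ.≤? _

-- ⌊ k n^q ⌋
floorPow : (n : ℕ) (q : ℚ) (k : ℕ) → ℕ
floorPow n q k = largest (fits? n q k) (k ℕ.* n ℕ.^ pos q)

module floorPow-lemmas where

  open import Algebra.Properties.Group ℚₚ.+-0-group using (⁻¹-involutive)

  largest-yes : ∀ {P : ℕ → Set} (P? : ∀ m → Dec (P m)) (b : ℕ) → P 0 → P (largest P? b)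
  largest-yes P? zero    P0 = P0
  largest-yes P? (suc b) P0 with P? (suc b)
  ... | yes p = p
  ... | no  _ = largest-yes P? b P0

  largest-no : ∀ {P : ℕ → Set} (P? : ∀ m → Dec (P m)) (b : ℕ) → ¬ P (suc b) → ¬ P (suc (largest P? b))
  largest-no P? zero    ¬P = ¬P
  largest-no P? (suc b) ¬P with P? (suc b)
  ... | yes _  = ¬P
  ... | no ¬P′ = largest-no P? b ¬P′

  pos-neg : ∀ q → + pos q ≡ ↥ q ℤ.+ + neg q
  pos-neg (mkℚ (+ zero)  _ _) = refl
  pos-neg (mkℚ (+ suc a) _ _) = sym (ℤₚ.+-identityʳ (+ suc a))
  pos-neg (mkℚ -[1+ a ]  _ _) = sym (ℤₚ.n⊖n≡0 (suc a))

  ^-cancel-≤ : ∀ a b e .{{_ : NonZero e}} → a ℕ.^ e ℕ.≤ b ℕ.^ e → a ℕ.≤ b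
  ^-cancel-≤ a b e h = ℕₚ.≮⇒≥ λ b<a → ℕₚ.<⇒≱ (ℕₚ.^-monoˡ-< e b<a) h

  ^-distribʳ-* : ∀ a b e → (a ℕ.* b) ℕ.^ e ≡ a ℕ.^ e ℕ.* b ℕ.^ e
  ^-distribʳ-* a b zero    = refl
  ^-distribʳ-* a b (suc e) = trans (cong (a ℕ.* b ℕ.*_) (^-distribʳ-* a b e))
                                   (ℕₚ.[m*n]*[o*p]≡[m*o]*[n*p] a b (a ℕ.^ e) (b ℕ.^ e))

  bernoulli : ∀ E d → (E ℕ.+ d) ℕ.* E ℕ.^ d ℕ.≤ E ℕ.* suc E ℕ.^ d
  bernoulli E zero    = ℕₚ.≤-reflexive (cong (ℕ._* 1) (ℕₚ.+-identityʳ E))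
  bernoulli E (suc d) = begin
      (E ℕ.+ suc d) ℕ.* (E ℕ.* X)            ≡⟨ eq₁ E d X ⟩
      E ℕ.* ((E ℕ.+ d) ℕ.* X) ℕ.+ E ℕ.* X    ≤⟨ ℕₚ.+-monoʳ-≤ (E ℕ.* ((E ℕ.+ d) ℕ.* X))
                                                 (ℕₚ.*-monoˡ-≤ X (ℕₚ.m≤m+n E d)) ⟩
      E ℕ.* ((E ℕ.+ d) ℕ.* X) ℕ.+ (E ℕ.+ d) ℕ.* X ≡⟨ eq₂ E ((E ℕ.+ d) ℕ.* X) ⟩
      suc E ℕ.* ((E ℕ.+ d) ℕ.* X)            ≤⟨ ℕₚ.*-monoʳ-≤ (suc E) (bernoulli E d) ⟩
      suc E ℕ.* (E ℕ.* suc E ℕ.^ d)          ≡⟨ eq₃ E (suc E) (suc E ℕ.^ d) ⟩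
      E ℕ.* (suc E ℕ.* suc E ℕ.^ d)          ∎
    where
    open ℕₚ.≤-Reasoning
    X = E ℕ.^ d
    eq₁ : ∀ E d X → (E ℕ.+ suc d) ℕ.* (E ℕ.* X) ≡ E ℕ.* ((E ℕ.+ d) ℕ.* X) ℕ.+ E ℕ.* X
    eq₁ = ℕ-Solver.solve-∀
    eq₂ : ∀ E Y → E ℕ.* Y ℕ.+ Y ≡ suc E ℕ.* Y
    eq₂ = ℕ-Solver.solve-∀
    eq₃ : ∀ E F Y → F ℕ.* (E ℕ.* Y) ≡ E ℕ.* (F ℕ.* Y)
    eq₃ = ℕ-Solver.solve-∀

  -- n ≤ (1 + 1/E)^(n E)
  bernoulli′ : ∀ n E .{{_ : NonZero E}} →
               n ℕ.* E ℕ.^ (n ℕ.* E) ℕ.≤ suc E ℕ.^ (n ℕ.* E)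
  bernoulli′ n E = ℕₚ.*-cancelˡ-≤ E (begin
      E ℕ.* (n ℕ.* Y)              ≤⟨ ℕₚ.m≤n+m (E ℕ.* (n ℕ.* Y)) (E ℕ.* Y) ⟩
      E ℕ.* Y ℕ.+ E ℕ.* (n ℕ.* Y)  ≡⟨ eq E n Y ⟩
      (E ℕ.+ n ℕ.* E) ℕ.* Y        ≤⟨ bernoulli E (n ℕ.* E) ⟩
      E ℕ.* suc E ℕ.^ (n ℕ.* E)    ∎)
    where
    open ℕₚ.≤-Reasoning
    Y = E ℕ.^ (n ℕ.* E)
    eq : ∀ E n Y → E ℕ.* Y ℕ.+ E ℕ.* (n ℕ.* Y) ≡ (E ℕ.+ n ℕ.* E) ℕ.* Y
    eq = ℕ-Solver.solve-∀

  module _ (n : ℕ) .{{_ : NonZero n}} where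

    floorPow-fits : ∀ q k → Fits n q k (floorPow n q k)
    floorPow-fits q k = largest-yes (fits? n q k) (k ℕ.* n ℕ.^ pos q) z≤n

    floorPow-maximal : ∀ q k → ¬ Fits n q k (suc (floorPow n q k))
    floorPow-maximal q k = largest-no (fits? n q k) M λ fits → ℕₚ.<-irrefl refl (begin-strict
        M ℕ.^ b                              <⟨ ℕₚ.^-monoˡ-< b (ℕₚ.n<1+n M) ⟩
        suc M ℕ.^ b                          ≤⟨ ℕₚ.m≤m*n _ (n ℕ.^ neg q) {{ℕₚ.m^n≢0 n (neg q)}} ⟩
        suc M ℕ.^ b ℕ.* n ℕ.^ neg q          ≤⟨ fits ⟩
        k ℕ.^ b ℕ.* n ℕ.^ pos q              ≤⟨ ℕₚ.*-monoʳ-≤ (k ℕ.^ b) (begin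
            n ℕ.^ pos q           ≤⟨ ℕₚ.^-monoʳ-≤ n (ℕₚ.m≤m*n (pos q) b) ⟩
            n ℕ.^ (pos q ℕ.* b)   ≡⟨ ℕₚ.^-*-assoc n (pos q) b ⟨
            (n ℕ.^ pos q) ℕ.^ b   ∎) ⟩
        k ℕ.^ b ℕ.* (n ℕ.^ pos q) ℕ.^ b      ≡⟨ ^-distribʳ-* k (n ℕ.^ pos q) b ⟨
        M ℕ.^ b                              ∎)
      where
      open ℕₚ.≤-Reasoning
      M = k ℕ.* n ℕ.^ pos q
      b = ↧ₙ q

    -- The inequality q ≤ q′ + 1/d with cleared denominators.
    clear : ∀ q q′ d .{{_ : NonZero d}} → q ℚ.≤ q′ ℚ.+ (+ 1 / d) →
            pos q ℕ.* (↧ₙ q′ ℕ.* d) ℕ.+ neg q′ ℕ.* (↧ₙ q ℕ.* d)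
              ℕ.≤ (neg q ℕ.* (↧ₙ q′ ℕ.* d) ℕ.+ pos q′ ℕ.* (↧ₙ q ℕ.* d)) ℕ.+ ↧ₙ q ℕ.* ↧ₙ q′
    clear q@(mkℚ _ _ _) q′@(mkℚ _ _ _) (suc d) h = ℤₚ.drop‿+≤+ (begin
        + (pos q ℕ.* (b′ ℕ.* D) ℕ.+ neg q′ ℕ.* (b ℕ.* D))
          ≡⟨ cong₂ ℤ._+_ (push (pos q) b′) (push (neg q′) b) ⟩
        + pos q ℤ.* (+ b′ ℤ.* + D) ℤ.+ + neg q′ ℤ.* (+ b ℤ.* + D)
          ≡⟨ cong (λ z → z ℤ.* (+ b′ ℤ.* + D) ℤ.+ + neg q′ ℤ.* (+ b ℤ.* + D)) (pos-neg q) ⟩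
        (↥ q ℤ.+ + neg q) ℤ.* (+ b′ ℤ.* + D) ℤ.+ + neg q′ ℤ.* (+ b ℤ.* + D)
          ≡⟨ eq₁ (↥ q) (+ neg q) (+ neg q′) (+ b) (+ b′) (+ D) ⟩
        ↥ q ℤ.* (+ b′ ℤ.* + D) ℤ.+ rest
          ≤⟨ ℤₚ.+-monoˡ-≤ rest cross ⟩
        (↥ q′ ℤ.* + D ℤ.+ + 1 ℤ.* + b′) ℤ.* + b ℤ.+ rest
          ≡⟨ eq₂ (↥ q′) (+ neg q) (+ neg q′) (+ b) (+ b′) (+ D) ⟩
        (+ neg q ℤ.* (+ b′ ℤ.* + D) ℤ.+ (↥ q′ ℤ.+ + neg q′) ℤ.* (+ b ℤ.* + D)) ℤ.+ + b ℤ.* + b′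
          ≡⟨ cong (λ z → (+ neg q ℤ.* (+ b′ ℤ.* + D) ℤ.+ z ℤ.* (+ b ℤ.* + D)) ℤ.+ + b ℤ.* + b′)
               (sym (pos-neg q′)) ⟩
        (+ neg q ℤ.* (+ b′ ℤ.* + D) ℤ.+ + pos q′ ℤ.* (+ b ℤ.* + D)) ℤ.+ + b ℤ.* + b′
          ≡⟨ cong₂ ℤ._+_ (cong₂ ℤ._+_ (push (neg q) b′) (push (pos q′) b)) (ℤₚ.pos-* b b′) ⟨
        + ((neg q ℕ.* (b′ ℕ.* D) ℕ.+ pos q′ ℕ.* (b ℕ.* D)) ℕ.+ b ℕ.* b′) ∎)
      where
      open ℤₚ.≤-Reasoning
      D = suc d
      b = ↧ₙ q
      b′ = ↧ₙ q′
      rest = + neg q ℤ.* (+ b′ ℤ.* + D) ℤ.+ + neg q′ ℤ.* (+ b ℤ.* + D)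
      push : ∀ x y → + (x ℕ.* (y ℕ.* D)) ≡ + x ℤ.* (+ y ℤ.* + D)
      push x y = trans (ℤₚ.pos-* x (y ℕ.* D)) (cong (+ x ℤ.*_) (ℤₚ.pos-* y D))
      eq₁ : ∀ a n n′ b b′ D → (a ℤ.+ n) ℤ.* (b′ ℤ.* D) ℤ.+ n′ ℤ.* (b ℤ.* D)
            ≡ a ℤ.* (b′ ℤ.* D) ℤ.+ (n ℤ.* (b′ ℤ.* D) ℤ.+ n′ ℤ.* (b ℤ.* D))
      eq₁ = ℤ-Solver.solve-∀
      eq₂ : ∀ a′ n n′ b b′ D →
            (a′ ℤ.* D ℤ.+ + 1 ℤ.* b′) ℤ.* b ℤ.+ (n ℤ.* (b′ ℤ.* D) ℤ.+ n′ ℤ.* (b ℤ.* D))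
            ≡ (n ℤ.* (b′ ℤ.* D) ℤ.+ (a′ ℤ.+ n′) ℤ.* (b ℤ.* D)) ℤ.+ b ℤ.* b′
      eq₂ = ℤ-Solver.solve-∀
      crossᵘ : ℚ.toℚᵘ q ℚᵘ.≤ ℚ.toℚᵘ q′ ℚᵘ.+ ℚᵘ.mkℚᵘ (+ 1) d
      crossᵘ = ℚᵘₚ.≤-respʳ-≃
        (ℚᵘₚ.≃-trans (ℚₚ.toℚᵘ-homo-+ q′ (+ 1 / D))
          (ℚᵘₚ.+-congʳ (ℚ.toℚᵘ q′) (ℚₚ.toℚᵘ-fromℚᵘ (ℚᵘ.mkℚᵘ (+ 1) d))))
        (ℚₚ.toℚᵘ-mono-≤ h)
      cross : ↥ q ℤ.* (+ b′ ℤ.* + D) ℤ.≤ (↥ q′ ℤ.* + D ℤ.+ + 1 ℤ.* + b′) ℤ.* + b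
      cross = subst (λ z → ↥ q ℤ.* z ℤ.≤ (↥ q′ ℤ.* + D ℤ.+ + 1 ℤ.* + b′) ℤ.* + b)
                    (ℤₚ.pos-* b′ D) (ℚᵘₚ.drop-*≤* crossᵘ)

    floorPow-close : ∀ q q′ k l E .{{_ : NonZero E}} →
      q ℚ.≤ q′ ℚ.+ (_/_ (+ 1) (n ℕ.* E) {{ℕₚ.m*n≢0 n E}}) →
      floorPow n q k ℕ.* l ℕ.* E ℕ.≤ k ℕ.* suc (floorPow n q′ l) ℕ.* suc E
    floorPow-close q q′ k l E h = ^-cancel-≤ (m ℕ.* l ℕ.* E) (k ℕ.* sm′ ℕ.* suc E) d (begin
        (m ℕ.* l ℕ.* E) ℕ.^ d                  ≡⟨ ^-distribʳ-* (m ℕ.* l) E d ⟩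
        (m ℕ.* l) ℕ.^ d ℕ.* E ℕ.^ d            ≤⟨ ℕₚ.*-monoˡ-≤ (E ℕ.^ d) root ⟩
        (k ℕ.* sm′) ℕ.^ d ℕ.* n ℕ.* E ℕ.^ d    ≡⟨ ℕₚ.*-assoc ((k ℕ.* sm′) ℕ.^ d) n (E ℕ.^ d) ⟩
        (k ℕ.* sm′) ℕ.^ d ℕ.* (n ℕ.* E ℕ.^ d)  ≤⟨ ℕₚ.*-monoʳ-≤ ((k ℕ.* sm′) ℕ.^ d) (bernoulli′ n E) ⟩
        (k ℕ.* sm′) ℕ.^ d ℕ.* suc E ℕ.^ d      ≡⟨ ^-distribʳ-* (k ℕ.* sm′) (suc E) d ⟨
        (k ℕ.* sm′ ℕ.* suc E) ℕ.^ d            ∎)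
      where
      open ℕₚ.≤-Reasoning
      d = n ℕ.* E
      instance
        d≢0 : NonZero d
        d≢0 = ℕₚ.m*n≢0 n E
      m = floorPow n q k
      sm′ = suc (floorPow n q′ l)
      b = ↧ₙ q
      b′ = ↧ₙ q′
      bb = b ℕ.* b′
      B = d ℕ.* bb
      raise : ∀ x e a f → (x ℕ.^ e ℕ.* n ℕ.^ a) ℕ.^ f ≡ x ℕ.^ (e ℕ.* f) ℕ.* n ℕ.^ (a ℕ.* f)
      raise x e a f = trans (^-distribʳ-* (x ℕ.^ e) (n ℕ.^ a) f)
                            (cong₂ ℕ._*_ (ℕₚ.^-*-assoc x e f) (ℕₚ.^-*-assoc n a f))
      exponent₁ : b ℕ.* (b′ ℕ.* d) ≡ B
      exponent₁ = lemma b b′ d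
        where
        lemma : ∀ b b′ d → b ℕ.* (b′ ℕ.* d) ≡ d ℕ.* (b ℕ.* b′)
        lemma = ℕ-Solver.solve-∀
      exponent₂ : b′ ℕ.* (b ℕ.* d) ≡ B
      exponent₂ = lemma b b′ d
        where
        lemma : ∀ b b′ d → b′ ℕ.* (b ℕ.* d) ≡ d ℕ.* (b ℕ.* b′)
        lemma = ℕ-Solver.solve-∀
      below : m ℕ.^ B ℕ.* n ℕ.^ (neg q ℕ.* (b′ ℕ.* d)) ℕ.≤ k ℕ.^ B ℕ.* n ℕ.^ (pos q ℕ.* (b′ ℕ.* d))
      below = subst₂ ℕ._≤_
        (trans (raise m b (neg q) (b′ ℕ.* d)) (cong (λ e → m ℕ.^ e ℕ.* n ℕ.^ (neg q ℕ.* (b′ ℕ.* d))) exponent₁))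
        (trans (raise k b (pos q) (b′ ℕ.* d)) (cong (λ e → k ℕ.^ e ℕ.* n ℕ.^ (pos q ℕ.* (b′ ℕ.* d))) exponent₁))
        (ℕₚ.^-monoˡ-≤ (b′ ℕ.* d) (floorPow-fits q k))
      above : l ℕ.^ B ℕ.* n ℕ.^ (pos q′ ℕ.* (b ℕ.* d)) ℕ.≤ sm′ ℕ.^ B ℕ.* n ℕ.^ (neg q′ ℕ.* (b ℕ.* d))
      above = subst₂ ℕ._≤_
        (trans (raise l b′ (pos q′) (b ℕ.* d)) (cong (λ e → l ℕ.^ e ℕ.* n ℕ.^ (pos q′ ℕ.* (b ℕ.* d))) exponent₂))
        (trans (raise sm′ b′ (neg q′) (b ℕ.* d)) (cong (λ e → sm′ ℕ.^ e ℕ.* n ℕ.^ (neg q′ ℕ.* (b ℕ.* d))) exponent₂))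
        (ℕₚ.^-monoˡ-≤ (b ℕ.* d) (ℕₚ.<⇒≤ (ℕₚ.≰⇒> (floorPow-maximal q′ l))))
      s = neg q ℕ.* (b′ ℕ.* d) ℕ.+ pos q′ ℕ.* (b ℕ.* d)
      swap : ∀ x y e f → (x ℕ.* y) ℕ.^ B ℕ.* n ℕ.^ (e ℕ.+ f) ≡ (x ℕ.^ B ℕ.* n ℕ.^ e) ℕ.* (y ℕ.^ B ℕ.* n ℕ.^ f)
      swap x y e f = trans (cong₂ ℕ._*_ (^-distribʳ-* x y B) (ℕₚ.^-distribˡ-+-* n e f))
                           (ℕₚ.[m*n]*[o*p]≡[m*o]*[n*p] (x ℕ.^ B) (y ℕ.^ B) (n ℕ.^ e) (n ℕ.^ f))
      product : (m ℕ.* l) ℕ.^ B ℕ.≤ (k ℕ.* sm′) ℕ.^ B ℕ.* n ℕ.^ bb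
      product = ℕₚ.*-cancelʳ-≤ _ _ (n ℕ.^ s) {{ℕₚ.m^n≢0 n s}} (begin
        (m ℕ.* l) ℕ.^ B ℕ.* n ℕ.^ s
          ≡⟨ swap m l (neg q ℕ.* (b′ ℕ.* d)) (pos q′ ℕ.* (b ℕ.* d)) ⟩
        (m ℕ.^ B ℕ.* n ℕ.^ (neg q ℕ.* (b′ ℕ.* d))) ℕ.* (l ℕ.^ B ℕ.* n ℕ.^ (pos q′ ℕ.* (b ℕ.* d)))
          ≤⟨ ℕₚ.*-mono-≤ below above ⟩
        (k ℕ.^ B ℕ.* n ℕ.^ (pos q ℕ.* (b′ ℕ.* d))) ℕ.* (sm′ ℕ.^ B ℕ.* n ℕ.^ (neg q′ ℕ.* (b ℕ.* d)))
          ≡⟨ swap k sm′ (pos q ℕ.* (b′ ℕ.* d)) (neg q′ ℕ.* (b ℕ.* d)) ⟨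
        (k ℕ.* sm′) ℕ.^ B ℕ.* n ℕ.^ (pos q ℕ.* (b′ ℕ.* d) ℕ.+ neg q′ ℕ.* (b ℕ.* d))
          ≤⟨ ℕₚ.*-monoʳ-≤ ((k ℕ.* sm′) ℕ.^ B) (ℕₚ.^-monoʳ-≤ n (clear q q′ d h)) ⟩
        (k ℕ.* sm′) ℕ.^ B ℕ.* n ℕ.^ (s ℕ.+ bb)
          ≡⟨ cong (λ z → (k ℕ.* sm′) ℕ.^ B ℕ.* n ℕ.^ z) (ℕₚ.+-comm s bb) ⟩
        (k ℕ.* sm′) ℕ.^ B ℕ.* n ℕ.^ (bb ℕ.+ s)
          ≡⟨ cong ((k ℕ.* sm′) ℕ.^ B ℕ.*_) (ℕₚ.^-distribˡ-+-* n bb s) ⟩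
        (k ℕ.* sm′) ℕ.^ B ℕ.* (n ℕ.^ bb ℕ.* n ℕ.^ s)
          ≡⟨ ℕₚ.*-assoc ((k ℕ.* sm′) ℕ.^ B) (n ℕ.^ bb) (n ℕ.^ s) ⟨
        (k ℕ.* sm′) ℕ.^ B ℕ.* n ℕ.^ bb ℕ.* n ℕ.^ s ∎)
      root : (m ℕ.* l) ℕ.^ d ℕ.≤ (k ℕ.* sm′) ℕ.^ d ℕ.* n
      root = ^-cancel-≤ _ _ bb (subst₂ ℕ._≤_
        (sym (ℕₚ.^-*-assoc (m ℕ.* l) d bb))
        (sym (trans (^-distribʳ-* ((k ℕ.* sm′) ℕ.^ d) n bb)
                    (cong (ℕ._* n ℕ.^ bb) (ℕₚ.^-*-assoc (k ℕ.* sm′) d bb))))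
        product)

  shift : ∀ {a b ε} → a ℚ.≤ b ℚ.+ ε → a ℚ.- b ℚ.≤ ε
  shift {a} {b} {ε} le = subst (a ℚ.- b ℚ.≤_)
    (trans (cong (ℚ._- b) (ℚₚ.+-comm b ε))
      (trans (ℚₚ.+-assoc ε b (ℚ.- b))
        (trans (cong (ε ℚ.+_) (ℚₚ.+-inverseʳ b)) (ℚₚ.+-identityʳ ε))))
    (ℚₚ.+-monoˡ-≤ (ℚ.- b) le)

  ≤+⇒∣-∣≤ : ∀ {p q ε} → p ℚ.≤ q ℚ.+ ε → q ℚ.≤ p ℚ.+ ε → ℚ.∣ p ℚ.- q ∣ ℚ.≤ ε
  ≤+⇒∣-∣≤ {p} {q} {ε} h h′ with ℚₚ.∣p∣≡p∨∣p∣≡-p (p ℚ.- q)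
  ... | inj₁ eq = subst (ℚ._≤ ε) (sym eq) (shift h)
  ... | inj₂ eq = subst (ℚ._≤ ε) (sym (trans eq flip)) (shift h′)
    where
    flip : ℚ.- (p ℚ.- q) ≡ q ℚ.- p
    flip = trans (ℚₚ.neg-distrib-+ p (ℚ.- q))
             (trans (ℚₚ.+-comm (ℚ.- p) (ℚ.- (ℚ.- q))) (cong (ℚ._- p) (⁻¹-involutive q)))

  ∣-∣≤⇒≤+ : ∀ {p q ε} → ℚ.∣ p ℚ.- q ∣ ℚ.≤ ε → p ℚ.≤ q ℚ.+ ε
  ∣-∣≤⇒≤+ {p} {q} {ε} h = begin
      p                            ≡⟨ ℝ-lemmas.cancel p q ⟩
      (p ℚ.- q) ℚ.+ q              ≤⟨ ℚₚ.+-monoˡ-≤ q (p≤∣p∣ (p ℚ.- q)) ⟩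
      ℚ.∣ p ℚ.- q ∣ ℚ.+ q          ≤⟨ ℚₚ.+-monoˡ-≤ q h ⟩
      ε ℚ.+ q                      ≡⟨ ℚₚ.+-comm ε q ⟩
      q ℚ.+ ε                      ∎
    where
    open ℚₚ.≤-Reasoning
    p≤∣p∣ : ∀ p → p ℚ.≤ ℚ.∣ p ∣
    p≤∣p∣ (mkℚ (+ _) _ _)    = ℚₚ.≤-refl
    p≤∣p∣ (mkℚ -[1+ _ ] _ _) = ℚ.*≤* ℤ.-≤+

  -- m/k ≤ m′/l + a/d with cleared denominators.
  fraction-≤ : ∀ m k m′ l ε → 0ℚ ℚ.< ε →
    (m ℕ.* suc l ℕ.* ↧ₙ ε ℕ.≤ suc k ℕ.* m′ ℕ.* ↧ₙ ε ℕ.+ suc k ℕ.* suc l) →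
    + m / suc k ℚ.≤ + m′ / suc l ℚ.+ ε
  fraction-≤ m k m′ l (mkℚ (+ zero) d c) (ℚ.*<* (ℤ.+<+ ()))
  fraction-≤ m k m′ l (mkℚ -[1+ _ ] d c) (ℚ.*<* ())
  fraction-≤ m k m′ l ε@(mkℚ (+ suc a) d c) _ h = ℚₚ.toℚᵘ-cancel-≤
      (ℚᵘₚ.≤-respˡ-≃ (ℚᵘₚ.≃-sym (ℚₚ.toℚᵘ-fromℚᵘ (ℚᵘ.mkℚᵘ (+ m) k)))
        (ℚᵘₚ.≤-respʳ-≃ (ℚᵘₚ.≃-sym
          (ℚᵘₚ.≃-trans (ℚₚ.toℚᵘ-homo-+ (+ m′ / suc l) ε)
            (ℚᵘₚ.+-congˡ (ℚ.toℚᵘ ε) (ℚₚ.toℚᵘ-fromℚᵘ (ℚᵘ.mkℚᵘ (+ m′) l)))))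
          (ℚᵘ.*≤* cross)))
    where
    open ℤₚ.≤-Reasoning
    K = suc k
    L = suc l
    D = suc d
    enough : m ℕ.* (L ℕ.* D) ℕ.≤ (m′ ℕ.* D ℕ.+ suc a ℕ.* L) ℕ.* K
    enough = ℕₚ.≤-trans (ℕₚ.≤-reflexive (sym (ℕₚ.*-assoc m L D)))
      (ℕₚ.≤-trans h (ℕₚ.≤-trans (ℕₚ.m≤m+n _ (a ℕ.* L ℕ.* K)) (ℕₚ.≤-reflexive (eq K m′ D L a))))
      where
      eq : ∀ K m′ D L a → K ℕ.* m′ ℕ.* D ℕ.+ K ℕ.* L ℕ.+ a ℕ.* L ℕ.* K
                          ≡ (m′ ℕ.* D ℕ.+ suc a ℕ.* L) ℕ.* K
      eq = ℕ-Solver.solve-∀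
    cross : + m ℤ.* + (L ℕ.* D) ℤ.≤ (+ m′ ℤ.* + D ℤ.+ + suc a ℤ.* + L) ℤ.* + K
    cross = begin
      + m ℤ.* + (L ℕ.* D)                        ≡⟨ ℤₚ.pos-* m (L ℕ.* D) ⟨
      + (m ℕ.* (L ℕ.* D))                        ≤⟨ ℤ.+≤+ enough ⟩
      + ((m′ ℕ.* D ℕ.+ suc a ℕ.* L) ℕ.* K)       ≡⟨ ℤₚ.pos-* (m′ ℕ.* D ℕ.+ suc a ℕ.* L) K ⟩
      + (m′ ℕ.* D ℕ.+ suc a ℕ.* L) ℤ.* + K       ≡⟨ cong (ℤ._* + K)
                                                       (cong₂ ℤ._+_ (ℤₚ.pos-* m′ D) (ℤₚ.pos-* (suc a) L)) ⟩
      (+ m′ ℤ.* + D ℤ.+ + suc a ℤ.* + L) ℤ.* + K ∎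

  pow-cauchy : ∀ n .{{_ : NonZero n}} (x : ℝ) →
    Cauchy (λ j → + floorPow n (seq x j) (suc j) / suc j)
  pow-cauchy n x ε 0<ε = N , λ i j N≤i N≤j → ≤+⇒∣-∣≤ (close i j N≤i N≤j) (close j i N≤j N≤i)
    where
    tolerance : ∀ E .{{_ : NonZero E}} → ℚ
    tolerance E = _/_ (+ 1) (n ℕ.* E) {{ℕₚ.m*n≢0 n E}}
    0<tolerance : ∀ E .{{_ : NonZero E}} → 0ℚ ℚ.< tolerance E
    0<tolerance E = ℚₚ.positive⁻¹ (tolerance E) {{ℚₚ.normalize-pos 1 (n ℕ.* E) {{ℕₚ.m*n≢0 n E}}}}
    N₀ = proj₁ (cauchy x (tolerance 1) (0<tolerance 1))
    B = suc (2 ℕ.* suc (floorPow n (seq x N₀) (suc N₀)))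
    d = ↧ₙ ε
    E = B ℕ.* (2 ℕ.* d)
    N₁ = proj₁ (cauchy x (tolerance E) (0<tolerance E))
    N = N₀ ℕ.⊔ (N₁ ℕ.⊔ (2 ℕ.* d))
    fp : ℕ → ℕ
    fp i = floorPow n (seq x i) (suc i)
    bound : ∀ i → N₀ ℕ.≤ i → suc (fp i) ℕ.≤ suc i ℕ.* B
    bound i N₀≤i = begin
      suc (fp i)                                       ≤⟨ s≤s (ℕₚ.m≤m*n (fp i) (suc N₀)) ⟩
      suc (fp i ℕ.* suc N₀)                            ≡⟨ cong suc (ℕₚ.*-identityʳ _) ⟨
      suc (fp i ℕ.* suc N₀ ℕ.* 1)                      ≤⟨ s≤s (floorPow-close n (seq x i) (seq x N₀) (suc i) (suc N₀) 1
           (∣-∣≤⇒≤+ (proj₂ (cauchy x (tolerance 1) (0<tolerance 1)) i N₀ N₀≤i ℕₚ.≤-refl))) ⟩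
      suc (suc i ℕ.* suc (fp N₀) ℕ.* 2)                ≤⟨ ℕₚ.+-monoˡ-≤ (suc i ℕ.* suc (fp N₀) ℕ.* 2) (s≤s (z≤n {i})) ⟩
      suc i ℕ.+ suc i ℕ.* suc (fp N₀) ℕ.* 2            ≡⟨ eq (suc i) (suc (fp N₀)) ⟩
      suc i ℕ.* B                                      ∎
      where
      open ℕₚ.≤-Reasoning
      eq : ∀ i f → i ℕ.+ i ℕ.* f ℕ.* 2 ≡ i ℕ.* suc (2 ℕ.* f)
      eq = ℕ-Solver.solve-∀
    close : ∀ i j → N ℕ.≤ i → N ℕ.≤ j → + fp i / suc i ℚ.≤ + fp j / suc j ℚ.+ ε
    close i j N≤i N≤j = fraction-≤ (fp i) i (fp j) j ε 0<ε (ℕₚ.*-cancelˡ-≤ (B ℕ.* 2) (begin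
        B ℕ.* 2 ℕ.* (fp i ℕ.* L ℕ.* d)
          ≡⟨ eq₁ B (fp i) L d ⟩
        fp i ℕ.* L ℕ.* E
          ≤⟨ floorPow-close n (seq x i) (seq x j) K L E
               (∣-∣≤⇒≤+ (proj₂ (cauchy x (tolerance E) (0<tolerance E)) i j
                 (ℕₚ.m⊔n≤o⇒m≤o N₁ (2 ℕ.* d) (ℕₚ.m⊔n≤o⇒n≤o N₀ _ N≤i))
                 (ℕₚ.m⊔n≤o⇒m≤o N₁ (2 ℕ.* d) (ℕₚ.m⊔n≤o⇒n≤o N₀ _ N≤j)))) ⟩
        K ℕ.* suc (fp j) ℕ.* suc E
          ≡⟨ eq₂ K (fp j) E ⟩
        K ℕ.* fp j ℕ.* E ℕ.+ (K ℕ.* E ℕ.+ K ℕ.* suc (fp j))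
          ≤⟨ ℕₚ.+-monoʳ-≤ (K ℕ.* fp j ℕ.* E) (ℕₚ.+-mono-≤
               (ℕₚ.*-monoʳ-≤ K (ℕₚ.*-monoʳ-≤ B 2d≤L))
               (ℕₚ.*-monoʳ-≤ K (bound j (ℕₚ.m⊔n≤o⇒m≤o N₀ _ N≤j)))) ⟩
        K ℕ.* fp j ℕ.* E ℕ.+ (K ℕ.* (B ℕ.* L) ℕ.+ K ℕ.* (L ℕ.* B))
          ≡⟨ eq₃ K (fp j) L B d ⟩
        B ℕ.* 2 ℕ.* (K ℕ.* fp j ℕ.* d ℕ.+ K ℕ.* L) ∎))
      where
      open ℕₚ.≤-Reasoning
      K = suc i
      L = suc j
      2d≤L : 2 ℕ.* d ℕ.≤ L
      2d≤L = ℕₚ.m≤n⇒m≤1+n (ℕₚ.m⊔n≤o⇒n≤o N₁ (2 ℕ.* d) (ℕₚ.m⊔n≤o⇒n≤o N₀ _ N≤j))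
      eq₁ : ∀ B f L d → B ℕ.* 2 ℕ.* (f ℕ.* L ℕ.* d) ≡ f ℕ.* L ℕ.* (B ℕ.* (2 ℕ.* d))
      eq₁ = ℕ-Solver.solve-∀
      eq₂ : ∀ K f E → K ℕ.* suc f ℕ.* suc E ≡ K ℕ.* f ℕ.* E ℕ.+ (K ℕ.* E ℕ.+ K ℕ.* suc f)
      eq₂ = ℕ-Solver.solve-∀
      eq₃ : ∀ K f L B d → K ℕ.* f ℕ.* (B ℕ.* (2 ℕ.* d)) ℕ.+ (K ℕ.* (B ℕ.* L) ℕ.+ K ℕ.* (L ℕ.* B))
            ≡ B ℕ.* 2 ℕ.* (K ℕ.* f ℕ.* d ℕ.+ K ℕ.* L)
      eq₃ = ℕ-Solver.solve-∀

infixr 8 _^ʳ_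

-- n^x as the limit of ⌊ k n^q ⌋ / k, where k → ∞ and q → x.
_^ʳ_ : (n : ℕ) .{{_ : NonZero n}} → ℝ → ℝ
seq    (n ^ʳ x) j = + floorPow n (seq x j) (suc j) / suc j
cauchy (n ^ʳ x)   = floorPow-lemmas.pow-cauchy n x

-- Cells are addressed by naturals.  An integer used as an address stands
-- for its absolute value, and division by zero yields zero.
data Instr : Set where
  const                : (target : ℕ) (value : ℤ) → Instr
  add sub mul quotient : (target left right : ℕ) → Instr
  load                 : (target pointer : ℕ) → Instr
  store                : (pointer source : ℕ) → Instr
  jump                 : (label : ℕ) → Instr
  jumpIfPositive       : (cell label : ℕ) → Instr

Memory : Set
Memory = ℕ → ℤ

record Config : Set where
  constructor _,_
  field
    pc     : ℕ
    memory : Memory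

open Config

_[_≔_] : Memory → ℕ → ℤ → Memory
(mem [ a ≔ z ]) b = if ⌊ a ℕₚ.≟ b ⌋ then z else mem b

_quot_ : ℤ → ℤ → ℤ
i quot (+ zero)    = + 0
i quot j@(+ suc _) = i ℤ./ j
i quot j@(-[1+ _ ]) = i ℤ./ j

exec : Instr → Config → Config
exec (const t z)          (pc , mem) = suc pc , mem [ t ≔ z ]
exec (add t l r)          (pc , mem) = suc pc , mem [ t ≔ mem l ℤ.+ mem r ]
exec (sub t l r)          (pc , mem) = suc pc , mem [ t ≔ mem l ℤ.- mem r ]
exec (mul t l r)          (pc , mem) = suc pc , mem [ t ≔ mem l ℤ.* mem r ]
exec (quotient t l r)     (pc , mem) = suc pc , mem [ t ≔ mem l quot mem r ]
exec (load t p)           (pc , mem) = suc pc , mem [ t ≔ mem ℤ.∣ mem p ∣ ]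
exec (store p s)          (pc , mem) = suc pc , mem [ ℤ.∣ mem p ∣ ≔ mem s ]
exec (jump l)             (pc , mem) = l , mem
exec (jumpIfPositive c l) (pc , mem) = (if ⌊ + 0 ℤₚ.<? mem c ⌋ then l else suc pc) , mem

Program : Set
Program = List Instr

fetch : Program → ℕ → Maybe Instr
fetch prog pc = head (drop pc prog)

Fitting : ℕ → Memory → Set
Fitting W mem = ∀ a → ℤ.∣ mem a ∣ ℕ.≤ W

-- A run of the given number of steps in which every word occurring in
-- memory has absolute value at most W.  A program halts by leaving its
-- own code.
data Run (prog : Program) (W : ℕ) : Config → ℕ → Memory → Set where
  halt : ∀ {c} → Fitting W (memory c) → fetch prog (pc c) ≡ nothing →
         Run prog W c 0 (memory c)
  step : ∀ {c i t mem} → Fitting W (memory c) → fetch prog (pc c) ≡ just i →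
         Run prog W (exec i c) t mem → Run prog W c (suc t) mem

contents : List ℤ → Memory
contents []       _       = + 0
contents (z ∷ zs) zero    = z
contents (z ∷ zs) (suc a) = contents zs a

_StartsWith_ : Memory → List ℤ → Set
mem StartsWith zs = ∀ (i : Fin (length zs)) → mem (toℕ i) ≡ List.lookup zs i

-- The words of an algorithm hold numbers that are polynomially bounded in
-- the length and the largest entry of its input, i.e. they have
-- logarithmically many bits.
record Algorithm : Set where
  field
    program : Program
    scale   : ℕ
    degree  : ℕ

  capacity : List ℤ → ℕ
  capacity input =
    scale ℕ.* (length input ℕ.+ foldr (λ z m → ℤ.∣ z ∣ ℕ.⊔ m) 0 input) ℕ.^ degree

Computes : Algorithm → (input output : List ℤ) (time : ℝ) → Set
Computes A input output time = ∃[ t ] ∃[ mem ]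
    Run program (capacity input) (0 , contents input) t mem
  × mem StartsWith output
  × fromℕ t ≤ʳ time
  where open Algorithm A

Matrix : Set → ℕ → ℕ → Set
Matrix A m n = Fin m → Fin n → A

rowMajor : ∀ {A m n} → Matrix A m n → List A
rowMajor M = concat (tabulate (λ i → tabulate (M i)))

_⊡_ : ∀ {l m n} → Matrix ℤ l m → Matrix ℤ m n → Matrix ℤ l n
(A ⊡ B) i j = sum ℤₚ.+-0-monoid (λ k → A i k ℤ.* B k j)

Multiplies : Algorithm → (N M : ℕ) (time : ℝ) → Set
Multiplies 𝓐 N M time = ∀ (A : Matrix ℤ N M) (B : Matrix ℤ M N) →
  Computes 𝓐 (+ N ∷ + M ∷ rowMajor A ++ rowMajor B) (rowMajor (A ⊡ B)) time

SquareExponent : ℝ → Set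
SquareExponent x = ∃[ 𝓐 ] ∃[ C ] ∀ N .{{_ : NonZero N}} →
  Multiplies 𝓐 N N (fromℕ C *ʳ N ^ʳ x)

-- Matrices with inner dimension up to N^a are multiplied in time N^(2+o(1)).
RectangularExponent : ℝ → Set
RectangularExponent a = ∃[ 𝓐 ] ∀ ε → fromℕ 0 <ʳ ε → ∃[ C ]
  ∀ N M .{{_ : NonZero N}} .{{_ : NonZero M}} → fromℕ M ≤ʳ N ^ʳ a →
  Multiplies 𝓐 N M (fromℕ C *ʳ N ^ʳ (fromℕ 2 +ʳ ε))

record MatrixMultiplicationExponents (ω α : ℝ) : Set where
  field
    ω-achieved : ∀ ε → fromℕ 0 <ʳ ε → SquareExponent (ω +ʳ ε)
    ω-least    : ∀ x → SquareExponent x → ω ≤ʳ x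
    2≤ω        : fromℕ 2 ≤ʳ ω
    -- ω < 2.3728639; normalising that literal in ℚ does not terminate in
    -- reasonable time.
    10⁷ω<23728639 : fromℕ 10000000 *ʳ ω <ʳ fromℕ 23728639

    α-achieved : ∀ a → a <ʳ α → RectangularExponent a
    α-greatest : ∀ a → RectangularExponent a → a ≤ʳ α
    0·3<α      : fromℚ (+ 3 / 10) <ʳ α
    α≤3-ω      : α ≤ʳ fromℕ 3 -ʳ ω
    α≃1⇔ω≃2    : α ≃ʳ fromℕ 1 ⇔ ω ≃ʳ fromℕ 2

    β     : ℝ
    β-α<1 : α <ʳ fromℕ 1 → β *ʳ (fromℕ 1 -ʳ α) ≃ʳ ω -ʳ fromℕ 2
    β-α≃1 : α ≃ʳ fromℕ 1 → β ≃ʳ fromℕ 0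

    M1 : ∃[ 𝓐 ] ∃[ C ] ∀ N M .{{_ : NonZero N}} .{{_ : NonZero M}} → M ℕ.≤ N →
         Multiplies 𝓐 N M
           (fromℕ C *ʳ (N ^ʳ (fromℕ 2 -ʳ α *ʳ β) *ʳ M ^ʳ β +ʳ N ^ʳ fromℕ 2))
    M2 : ∃[ 𝓐 ] ∃[ C ] ∀ N M .{{_ : NonZero N}} .{{_ : NonZero M}} → N ℕ.≤ M →
         Multiplies 𝓐 N M (fromℕ C *ʳ (N ^ʳ (ω -ʳ fromℕ 1) *ʳ fromℕ M))

-- The denominator below is positive since α ≤ 1/2 and ω < 3, and both
-- clauses agree at α = 1/2.
record IsTau (ω α τ : ℝ) : Set where
  field
    τ-α≤½ : α ≤ʳ fromℚ ½ →
      τ *ʳ (fromℕ 36 -ʳ fromℕ 6 *ʳ (fromℕ 1 +ʳ ω) *ʳ (fromℕ 1 +ʳ α))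
        ≃ʳ (fromℕ 3 -ʳ ω) *ʳ (fromℕ 1 -ʳ α)
    τ-α≥½ : fromℚ ½ ≤ʳ α → τ ≃ʳ fromℚ (+ 1 / 18)

record Graph (n : ℕ) : Set where
  field
    adj         : Fin n → Fin n → Bool
    symmetric   : ∀ u v → adj u v ≡ adj v u
    irreflexive : ∀ v → adj v v ≡ false

open Graph

-- A vertex set together with the neighbourhood of every vertex.  The
-- representation is canonical: equal subgraphs are propositionally equal.
record Subgraph (n : ℕ) : Set where
  field
    vertices   : Subset n
    neighbours : Vec (Subset n) n

  Vertex : Fin n → Set
  Vertex v = v ∈ˢ vertices

  Edge : Fin n → Fin n → Set
  Edge u v = v ∈ˢ lookup neighbours u

record _IsSubgraphOf_ {n} (S : Subgraph n) (H : Graph n) : Set where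
  open Subgraph S
  field
    edge-symmetric : ∀ u v → Edge u v → Edge v u
    edge-vertex    : ∀ u v → Edge u v → Vertex u
    edge-adj       : ∀ u v → Edge u v → T (adj H u v)

record _IsIsomorphicTo_ {n k} (S : Subgraph n) (P : Graph k) : Set where
  open Subgraph S
  field
    to        : Fin k → Fin n
    injective : Injective _≡_ _≡_ to
    image     : ∀ v → Vertex v ⇔ (∃[ i ] to i ≡ v)
    edges     : ∀ i j → T (adj P i j) ⇔ Edge (to i) (to j)

SubgraphCount : ∀ {k n} → Graph k → Graph n → ℕ → Set
SubgraphCount {n = n} P H m = Σ[ Ss ∈ List (Subgraph n) ]
    Unique Ss
  × (∀ S → S ∈ Ss ⇔ (S IsSubgraphOf H × S IsIsomorphicTo P))
  × length Ss ≡ m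

record PathDecomposition {k} (P : Graph k) : Set where
  field
    size         : ℕ
    bag          : Fin size → Subset k
    covers       : ∀ v → ∃[ i ] v ∈ˢ bag i
    covers-edges : ∀ u v → T (adj P u v) → ∃[ i ] (u ∈ˢ bag i × v ∈ˢ bag i)
    contiguous   : ∀ v {h i j} → h Fin.≤ i → i Fin.≤ j →
                   v ∈ˢ bag h → v ∈ˢ bag j → v ∈ˢ bag i

HasWidth≤ : ∀ {k} {P : Graph k} → PathDecomposition P → ℕ → Set
HasWidth≤ D w = ∀ i → ∣ bag i ∣ ℕ.≤ suc w
  where open PathDecomposition D

HasPathwidth : ∀ {k} → Graph k → ℕ → Set
HasPathwidth P p =
    (∃[ D ] HasWidth≤ {P = P} D p)
  × (∀ w → (∃[ D ] HasWidth≤ {P = P} D w) → p ℕ.≤ w)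

encode : ∀ {n} → Graph n → List ℤ
encode {n} H = + n ∷ rowMajor (λ u v → if adj H u v then + 1 else + 0)

CountsSubgraphsInTimeO : ∀ {k} → Graph k → (∀ n .{{_ : NonZero n}} → ℝ) → Set
CountsSubgraphsInTimeO P f = ∃[ 𝓐 ] ∃[ C ]
  ∀ n .{{_ : NonZero n}} (H : Graph n) → ∃[ m ]
    SubgraphCount P H m × Computes 𝓐 (encode H) (+ m ∷ []) (fromℕ C *ʳ f n)

{-# OPTIONS --safe #-}

-- Up to the factor |Aut P|, the subgraphs of H isomorphic to P are the injective
-- homomorphisms g from P to H.  Writing injectivity as the product of 1 − [g u = g v]
-- over the pairs u ≠ v and expanding it expresses their number as a combination, with
-- a number of terms bounded in k, of homomorphism counts of quotients of P.
--
-- A quotient with N vertices is counted in one of two ways.  If 9 N ≤ 5 k, its vertices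
-- are split into parts X, Y, Z of sizes at most about N/3; every edge lies within
-- two of them, so the count is a sum of entries of a product of an n^|X| × n^|Y| and an
-- n^|Y| × n^|Z| matrix, and since ω < 12/5 it takes time n^(4k/9 + O(1)).  Otherwise
-- fewer than 4 k / 9 blocks of the quotient have several vertices of P.  These are pinned,
-- and the singleton blocks are eliminated in the order of their last bags in a path
-- decomposition of P, with tables indexed by the pinned blocks and at most p others:
-- time n^(4k/9 + p + O(1)).  Always τ ≤ 1/18, so 4k/9 ≤ (1/2 − τ) k, and the first summand
-- of the bound suffices.

module Submission where

open import Algebra.Properties.Monoid.Sum using (sum)
open import Data.Bool.Base using (true; false; T; if_then_else_)
import Data.Bool.Properties as Boolₚ
open import Data.Empty using (⊥; ⊥-elim)
open import Data.Fin.Base as Fin using (Fin; toℕ)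
import Data.Fin.Properties as Finₚ
open import Data.Fin.Subset using (Subset; ∣_∣) renaming (_∈_ to _∈ˢ_; _-_ to _-ˢ_)
import Data.Fin.Subset.Properties as Subsetₚ
open import Data.Integer as ℤ using (ℤ; +_; -[1+_])
import Data.Integer.Properties as ℤₚ
open import Data.Integer.Tactic.RingSolver renaming (solve-∀ to ℤ-solve-∀)
open import Data.List.Base as List
  using (List; []; _∷_; _++_; length; map; take; drop; foldr; concat; tabulate; filter; allFin; cartesianProduct;
         cartesianProductWith; deduplicate; upTo)
import Data.List.Membership.DecPropositional as DecMembership
open import Data.List.Membership.Propositional using (_∈_; _∉_)
open import Data.List.Membership.Propositional.Properties
  using (∈-++⁺ˡ; ∈-++⁺ʳ; ∈-++⁻; ∈-∃++; ∈-filter⁺; ∈-filter⁻; ∈-map⁺; ∈-map⁻; ∈-allFin; ∈-cartesianProduct⁺;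
         ∈-cartesianProductWith⁺; ∈-deduplicate⁺; ∈-deduplicate⁻; ∈-upTo⁺; ∈-upTo⁻)
import Data.List.Properties as Listₚ
open import Data.List.Relation.Binary.Permutation.Propositional as Perm using (_↭_)
import Data.List.Relation.Binary.Permutation.Propositional.Properties as Permₚ
open import Data.List.Relation.Unary.All as All using (All; []; _∷_)
import Data.List.Relation.Unary.All.Properties as Allₚ
open import Data.List.Relation.Unary.AllPairs as AllPairs using (AllPairs; []; _∷_)
open import Data.List.Relation.Unary.Any using (here; there)
import Data.List.Relation.Unary.Linked.Properties as Linkedₚ
import Data.List.Relation.Unary.Unique.DecPropositional.Properties as UniqueDecₚ
open import Data.List.Relation.Unary.Unique.Propositional using (Unique)
import Data.List.Relation.Unary.Unique.Propositional.Properties as Uniqueₚ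
import Data.List.Sort as Sort
open import Data.Maybe.Base using (just; nothing)
open import Data.Nat using (ℕ; zero; suc; _+_; _*_; _^_; _∸_; _≤_; _<_; NonZero; z≤n; s≤s)
import Data.Nat as ℕ
open import Data.Nat.Divisibility using (divides-refl)
import Data.Nat.DivMod as DivMod
import Data.Nat.Properties as ℕₚ
open import Data.Nat.Tactic.RingSolver renaming (solve-∀ to ℕ-solve-∀)
open import Data.Product using (Σ-syntax; ∃; ∃-syntax; _×_; _,_; proj₁; proj₂)
open import Data.Rational as ℚ using (ℚ; mkℚ; 0ℚ; 1ℚ; ½; _/_; ↥_; ↧ₙ_)
import Data.Rational.Properties as ℚₚ
import Data.Rational.Unnormalised.Base as ℚᵘ
import Data.Rational.Unnormalised.Properties as ℚᵘₚ
open import Data.Sum.Base using (_⊎_; inj₁; inj₂; [_,_]′)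
open import Data.Unit.Base using (⊤; tt)
open import Data.Vec.Base as Vec using (Vec; []; _∷_)
import Data.Vec.Properties as Vecₚ
open import Function.Base using (_∘_; case_of_)
open import Function.Bundles using (_⇔_; mk⇔; Equivalence)
open import Level using (0ℓ)
open import Relation.Binary.Bundles using (DecTotalOrder)
import Relation.Binary.Construct.On as On
open import Relation.Binary.PropositionalEquality
open import Relation.Nullary.Decidable
  using (Dec; yes; no; True; toWitness; ⌊_⌋; ¬?; T?; map′; dec⇒maybe; _⊎-dec_; _→-dec_; _×-dec_)
open import Relation.Nullary.Negation using (¬_; contradiction)
open import Tactic.RingSolver using (solve-∀)
open import Tactic.RingSolver.Core.AlmostCommutativeRing using (AlmostCommutativeRing; fromCommutativeRing)
open import Defs

-- The threshold 5/9 balances the two methods. With parts of size N/3 and ω < 12/5 a product takes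
-- time about n^(4N/5), which reaches n^(4k/9) at N = 5k/9; and a quotient with N vertices has at
-- most k - N blocks of several vertices, again 4k/9 at that point. The number 1/18 is 1/2 - 4/9. A
-- quotient of P may have much larger pathwidth than P. Pinning the blocks of several vertices
-- repairs this: what is left to eliminate is an induced subgraph of P, for which the decomposition
-- of P is still good. The cost model shapes the rest. Fast matrix multiplication is given as an
-- arbitrary machine program, so it has to run as a subroutine in a relocated memory, with words of
-- polynomial size. All other work is brought to one form of statement, a sum of products over all
-- values of some variables. Real exponents are known only through approximations, and their order
-- is not decidable; the two cases in the definition of τ therefore enter only through a
-- contradiction.

infixr 5 _∙_
_∙_ : ∀ {A : Set} {x y z : A} → x ≡ y → y ≡ z → x ≡ z
_∙_ = trans

-- Memory updates, placed code and straight-line execution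

update-same : ∀ (m : Memory) t z → (m [ t ≔ z ]) t ≡ z
update-same m t z with t ℕ.≟ t
... | yes _   = refl
... | no  t≢t = contradiction refl t≢t

update-other : ∀ (m : Memory) t z {c} → t ≢ c → (m [ t ≔ z ]) c ≡ m c
update-other m t z {c} t≢c with t ℕ.≟ c
... | yes t≡c = contradiction t≡c t≢c
... | no  _   = refl

Fitting-update : ∀ {W m} t {z} → Fitting W m → ℤ.∣ z ∣ ≤ W → Fitting W (m [ t ≔ z ])
Fitting-update t fit z≤W c with t ℕ.≟ c
... | yes _ = z≤W
... | no  _ = fit c

fetch-++ˡ : ∀ c₁ {c₂ : Program} j {i} → fetch c₁ j ≡ just i → fetch (c₁ ++ c₂) j ≡ just i
fetch-++ˡ (_ ∷ _)  zero    eq = eq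
fetch-++ˡ (_ ∷ c₁) (suc j) eq = fetch-++ˡ c₁ j eq
fetch-++ˡ []       zero    ()
fetch-++ˡ []       (suc j) ()

fetch-++ʳ : ∀ c₁ {c₂ : Program} j → fetch (c₁ ++ c₂) (length c₁ + j) ≡ fetch c₂ j
fetch-++ʳ []       j = refl
fetch-++ʳ (_ ∷ c₁) j = fetch-++ʳ c₁ j

fetch-end : ∀ c → fetch c (length c) ≡ nothing
fetch-end []      = refl
fetch-end (_ ∷ c) = fetch-end c

fetch-< : ∀ c j {i} → fetch c j ≡ just i → j < length c
fetch-< (_ ∷ c) zero    eq = s≤s z≤n
fetch-< (_ ∷ c) (suc j) eq = s≤s (fetch-< c j eq)
fetch-< []      zero    ()
fetch-< []      (suc j) ()

fetch-≥ : ∀ c j → fetch c j ≡ nothing → length c ≤ j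
fetch-≥ []      j       eq = z≤n
fetch-≥ (_ ∷ c) (suc j) eq = s≤s (fetch-≥ c j eq)
fetch-≥ (_ ∷ c) zero    ()

-- Only successful fetches are constrained, so the placement of a concatenation yields that of both
-- halves, and nothing is claimed about the surrounding instructions.
record Located (prog : Program) (o : ℕ) (code : List Instr) : Set where
  constructor located
  field
    at : ∀ j {i} → fetch code j ≡ just i → fetch prog (o + j) ≡ just i

open Located public

located-self : ∀ prog → Located prog 0 prog
located-self prog = located λ j eq → eq

located-++ˡ : ∀ {prog o} c₁ {c₂} → Located prog o (c₁ ++ c₂) → Located prog o c₁
located-++ˡ c₁ loc = located λ j eq → at loc j (fetch-++ˡ c₁ j eq)

located-++ʳ : ∀ {prog o} c₁ {c₂} → Located prog o (c₁ ++ c₂) → Located prog (o + length c₁) c₂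
located-++ʳ {prog} {o} c₁ loc = located λ j eq →
  trans (cong (fetch prog) (ℕₚ.+-assoc o (length c₁) j)) (at loc (length c₁ + j) (trans (fetch-++ʳ c₁ j) eq))

located-head : ∀ {prog o i is} → Located prog o (i ∷ is) → fetch prog o ≡ just i
located-head {prog} {o} loc = trans (cong (fetch prog) (sym (ℕₚ.+-identityʳ o))) (at loc 0 refl)

located-tail : ∀ {prog o i is} → Located prog o (i ∷ is) → Located prog (suc o) is
located-tail {prog} {o} loc = located λ j eq →
  trans (cong (fetch prog) (sym (ℕₚ.+-suc o j))) (at loc (suc j) eq)

data Reach (prog : Program) (W : ℕ) : Config → ℕ → Config → Set where
  done : ∀ {c} → Reach prog W c 0 c
  step : ∀ {c i t c′} → Fitting W (Config.memory c) → fetch prog (Config.pc c) ≡ just i →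
         Reach prog W (exec i c) t c′ → Reach prog W c (suc t) c′

reach-trans : ∀ {prog W c t c′ t′ c″} → Reach prog W c t c′ → Reach prog W c′ t′ c″ →
              Reach prog W c (t + t′) c″
reach-trans done            s = s
reach-trans (step fit eq r) s = step fit eq (reach-trans r s)

reach-run : ∀ {prog W c t c′} → Reach prog W c t c′ → Fitting W (Config.memory c′) →
            fetch prog (Config.pc c′) ≡ nothing → Run prog W c t (Config.memory c′)
reach-run done             fit′ end = halt fit′ end
reach-run (step fit eq r)  fit′ end = step fit eq (reach-run r fit′ end)

reach-pc : ∀ {prog W c t o o′ m} → o ≡ o′ → Reach prog W c t (o , m) → Reach prog W c t (o′ , m)
reach-pc refl r = r

reach-time : ∀ {prog W c t t′ c′} → t ≡ t′ → Reach prog W c t c′ → Reach prog W c t′ c′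
reach-time refl r = r

reach-from : ∀ {prog W c c′ t c″} → c ≡ c′ → Reach prog W c′ t c″ → Reach prog W c t c″
reach-from refl r = r

Plain : Instr → Set
Plain (jump _)             = ⊥
Plain (jumpIfPositive _ _) = ⊥
Plain _                    = ⊤

effect : Instr → Memory → Memory
effect i m = Config.memory (exec i (0 , m))

exec-plain : ∀ i → Plain i → ∀ o m → exec i (o , m) ≡ (suc o , effect i m)
exec-plain (const _ _)      _ _ _ = refl
exec-plain (add _ _ _)      _ _ _ = refl
exec-plain (sub _ _ _)      _ _ _ = refl
exec-plain (mul _ _ _)      _ _ _ = refl
exec-plain (quotient _ _ _) _ _ _ = refl
exec-plain (load _ _)       _ _ _ = refl
exec-plain (store _ _)      _ _ _ = refl

-- The one word that an instruction could make too large. Jumps write nothing and get the dummy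
-- value 0.
written : Instr → Memory → ℤ
written (const t z)          m = z
written (add t l r)          m = m l ℤ.+ m r
written (sub t l r)          m = m l ℤ.- m r
written (mul t l r)          m = m l ℤ.* m r
written (quotient t l r)     m = m l quot m r
written (load t p)           m = m ℤ.∣ m p ∣
written (store p s)          m = m s
written (jump l)             m = + 0
written (jumpIfPositive c l) m = + 0

Fitting-effect : ∀ {W m} i → Fitting W m → ℤ.∣ written i m ∣ ≤ W → Fitting W (effect i m)
Fitting-effect (const t z)          fit h = Fitting-update t fit h
Fitting-effect (add t l r)          fit h = Fitting-update t fit h
Fitting-effect (sub t l r)          fit h = Fitting-update t fit h
Fitting-effect (mul t l r)          fit h = Fitting-update t fit h
Fitting-effect (quotient t l r)     fit h = Fitting-update t fit h
Fitting-effect (load t p)           fit h = Fitting-update t fit h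
Fitting-effect {m = m} (store p s)  fit h = Fitting-update ℤ.∣ m p ∣ fit h
Fitting-effect (jump l)             fit h = fit
Fitting-effect (jumpIfPositive c l) fit h = fit

effects : List Instr → Memory → Memory
effects []       m = m
effects (i ∷ is) m = effects is (effect i m)

-- The cell written by `store` is known only at run time, so code with a `store` is excluded here
-- and its frame condition is argued by hand.
Untouched : ℕ → List Instr → Set
Untouched c []                        = ⊤
Untouched c (const t z ∷ is)          = t ≢ c × Untouched c is
Untouched c (add t l r ∷ is)          = t ≢ c × Untouched c is
Untouched c (sub t l r ∷ is)          = t ≢ c × Untouched c is
Untouched c (mul t l r ∷ is)          = t ≢ c × Untouched c is
Untouched c (quotient t l r ∷ is)     = t ≢ c × Untouched c is
Untouched c (load t p ∷ is)           = t ≢ c × Untouched c is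
Untouched c (store p s ∷ is)          = ⊥
Untouched c (jump l ∷ is)             = Untouched c is
Untouched c (jumpIfPositive a l ∷ is) = Untouched c is

effects-untouched : ∀ is m {c} → Untouched c is → effects is m c ≡ m c
effects-untouched []                        m u       = refl
effects-untouched (const t z ∷ is)          m (d , u) = effects-untouched is _ u ∙ update-other m t _ d
effects-untouched (add t l r ∷ is)          m (d , u) = effects-untouched is _ u ∙ update-other m t _ d
effects-untouched (sub t l r ∷ is)          m (d , u) = effects-untouched is _ u ∙ update-other m t _ d
effects-untouched (mul t l r ∷ is)          m (d , u) = effects-untouched is _ u ∙ update-other m t _ d
effects-untouched (quotient t l r ∷ is)     m (d , u) = effects-untouched is _ u ∙ update-other m t _ d
effects-untouched (load t p ∷ is)           m (d , u) = effects-untouched is _ u ∙ update-other m t _ d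
effects-untouched (jump l ∷ is)             m u       = effects-untouched is m u
effects-untouched (jumpIfPositive a l ∷ is) m u       = effects-untouched is m u

data Safe (W : ℕ) : List Instr → Memory → Memory → Set where
  []  : ∀ {m} → Safe W [] m m
  _∷_ : ∀ {i is m m′} → Plain i × Fitting W m → Safe W is (effect i m) m′ → Safe W (i ∷ is) m m′

safe-++ : ∀ {W c₁ c₂ m m′ m″} → Safe W c₁ m m′ → Safe W c₂ m′ m″ → Safe W (c₁ ++ c₂) m m″
safe-++ []      t = t
safe-++ (x ∷ s) t = x ∷ safe-++ s t

safe-reach : ∀ {prog W o code m m′} → Located prog o code → Safe W code m m′ →
             Reach prog W (o , m) (length code) (o + length code , m′)
safe-reach {o = o} loc [] = reach-pc (sym (ℕₚ.+-identityʳ o)) done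
safe-reach {prog} {W} {o} {i ∷ is} {m} loc ((p , fit) ∷ s) =
  step fit (located-head loc)
    (subst (λ c → Reach prog W c (length is) _) (sym (exec-plain i p o m))
      (reach-pc (sym (ℕₚ.+-suc o (length is))) (safe-reach (located-tail loc) s)))

-- A Hoare triple for code without jumps; it takes exactly as many steps as it has instructions, so
-- no time needs to be recorded.
record Exec (W : ℕ) (code : List Instr) (m : Memory) (Q : Memory → Set) : Set where
  constructor executed
  field
    {result} : Memory
    safe     : Safe W code m result
    fitting  : Fitting W result
    post     : Q result

open Exec public

stop : ∀ {W m} {Q : Memory → Set} → Fitting W m → Q m → Exec W [] m Q
stop fit q = executed [] fit q

-- Written in continuation style, so that a correctness proof follows the order of the code and
-- owes, for each instruction, only the size of the word that it writes.
go : ∀ {W i is m} {Q : Memory → Set} {_ : Plain i} → Fitting W m → ℤ.∣ written i m ∣ ≤ W →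
     (Fitting W (effect i m) → Exec W is (effect i m) Q) → Exec W (i ∷ is) m Q
go {i = i} {_} {_} {_} {p} fit h k with k (Fitting-effect i fit h)
... | executed s f q = executed ((p , fit) ∷ s) f q

exec-++ : ∀ {W c₁ c₂ m} {Q Q′ : Memory → Set} → Exec W c₁ m Q →
          (∀ m′ → Fitting W m′ → Q m′ → Exec W c₂ m′ Q′) → Exec W (c₁ ++ c₂) m Q′
exec-++ (executed s f q) k with k _ f q
... | executed s′ f′ q′ = executed (safe-++ s s′) f′ q′

weaken : ∀ {W c m} {Q Q′ : Memory → Set} → Exec W c m Q → (∀ {m′} → Q m′ → Q′ m′) → Exec W c m Q′
weaken (executed s f q) h = executed s f (h q)

exec-reach : ∀ {prog W o code m} {Q : Memory → Set} → Located prog o code → (e : Exec W code m Q) →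
             Reach prog W (o , m) (length code) (o + length code , result e)
exec-reach loc e = safe-reach loc (safe e)

-- Sum-of-products statements

infixl 4 _[_↦_]

_[_↦_] : ∀ {k} → (Fin k → ℕ) → Fin k → ℕ → Fin k → ℕ
(g [ v ↦ a ]) x = if ⌊ v Finₚ.≟ x ⌋ then a else g x

-- A variable missing from the list gets the position behind its end. `digitsCode` clears the
-- register at that position, in agreement with the value 0 that `digits` gives to such a variable.
position : ∀ {k} → List (Fin k) → Fin k → ℕ
position []       x = 0
position (v ∷ vs) x = if ⌊ v Finₚ.≟ x ⌋ then 0 else suc (position vs x)

-- A single counter replaces nested loops: its base-`n` digits are the values of the loop variables,
-- the head of the list being the least significant.
digits : ∀ {k} (n : ℕ) .{{_ : NonZero n}} → List (Fin k) → ℕ → Fin k → ℕ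
digits n []       j = λ _ → 0
digits n (v ∷ vs) j = digits n vs (j ℕ./ n) [ v ↦ j ℕ.% n ]

-- Horner evaluation with `h` as leading digit. A positive lead skips blocks of `n ^ length xs`
-- cells, which later puts the second matrix behind the first in the same array.
flat : ∀ {k} → ℕ → ℕ → (Fin k → ℕ) → List (Fin k) → ℕ
flat n h g []       = h
flat n h g (x ∷ xs) = g x + n * flat n h g xs

sum< : ℕ → (ℕ → ℤ) → ℤ
sum< zero    f = + 0
sum< (suc n) f = sum< n f ℤ.+ f n

record Ref (k : ℕ) : Set where
  constructor ref
  field
    array   : ℕ
    lead    : ℕ
    offset  : ℕ
    indices : List (Fin k)

open Ref public

-- For all values of the loop variables: target += coefficient · product of the factors.
record Stmt (k : ℕ) : Set where
  constructor stmt
  field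
    loops       : List (Fin k)
    coefficient : ℤ
    target      : Ref k
    factors     : List (Ref k)

open Stmt public

Arrays : Set
Arrays = ℕ → ℕ → ℤ

address : ∀ {k} → ℕ → Ref k → (Fin k → ℕ) → ℕ
address n ρ g = offset ρ + flat n (lead ρ) g (indices ρ)

weigh : ∀ {k} → ℕ → ℤ → List (Ref k) → Arrays → (Fin k → ℕ) → ℤ
weigh n c []       arr g = c
weigh n c (ρ ∷ ρs) arr g = weigh n c ρs arr g ℤ.* arr (array ρ) (address n ρ g)

contribution : ∀ {k} (n : ℕ) .{{_ : NonZero n}} → Stmt k → Arrays → ℕ → ℕ → ℕ → ℤ
contribution n s arr r a i =
  if ⌊ array (target s) ℕ.≟ r ⌋
  then (if ⌊ address n (target s) (digits n (loops s) i) ℕ.≟ a ⌋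
        then weigh n (coefficient s) (factors s) arr (digits n (loops s) i) else + 0)
  else + 0

-- The arrays after `j` iterations in closed form, used as the loop invariant. The factors are taken
-- from the initial arrays; this agrees with the machine because no factor of an admissible
-- statement lies in the target array.
partialResult : ∀ {k} (n : ℕ) .{{_ : NonZero n}} → Stmt k → Arrays → ℕ → Arrays
partialResult n s arr j r a = arr r a ℤ.+ sum< j (contribution n s arr r a)

perform : ∀ {k} (n : ℕ) .{{_ : NonZero n}} → Stmt k → Arrays → Arrays
perform n s arr = partialResult n s arr (n ^ length (loops s))

-- Registers: 0 holds n, 1 the start of the arrays, 2 the loop counter, 3 its
-- bound, 4 the digits still to be extracted, 5 an address, 6 a temporary, 7 a
-- product, and 8, 9, … the loop variables.  Entry a of array r is stored at
-- distance R a + r from the start of the arrays.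
module Code (K R : ℕ) where

  cell : ∀ {k} → List (Fin k) → Fin k → ℕ
  cell vs x = 8 + position vs x

  flatCode : ℕ → List ℕ → List Instr
  flatCode h []       = const 5 (+ h) ∷ []
  flatCode h (c ∷ cs) = flatCode h cs ++ mul 5 5 0 ∷ add 5 5 c ∷ []

  toAddress : ℕ → ℕ → List Instr
  toAddress a r = const 6 (+ a) ∷ add 5 5 6 ∷ const 6 (+ R) ∷ mul 5 5 6 ∷ const 6 (+ r) ∷ add 5 5 6 ∷ add 5 5 1 ∷ []

  addressCode : ∀ {k} → List (Fin k) → Ref k → List Instr
  addressCode vs ρ = flatCode (lead ρ) (map (cell vs) (indices ρ)) ++ toAddress (offset ρ) (array ρ)

  digitsCode : ∀ {k} → ℕ → List (Fin k) → List Instr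
  digitsCode i []       = const (8 + i) (+ 0) ∷ []
  digitsCode i (v ∷ vs) =
    -- The remainder is what the quotient times n leaves over. There is no copy instruction, so the
    -- quotient moves to register 4 by adding 0.
    quotient 5 4 0 ∷ mul 6 5 0 ∷ sub (8 + i) 4 6 ∷ const 6 (+ 0) ∷ add 4 5 6 ∷ digitsCode (suc i) vs

  weighCode : ∀ {k} → List (Fin k) → ℤ → List (Ref k) → List Instr
  weighCode vs c []       = const 7 c ∷ []
  weighCode vs c (ρ ∷ ρs) = weighCode vs c ρs ++ addressCode vs ρ ++ load 6 5 ∷ mul 7 7 6 ∷ []

  powerCode : ℕ → List Instr
  powerCode zero    = const 3 (+ 1) ∷ []
  powerCode (suc m) = powerCode m ++ mul 3 3 0 ∷ []

  counterCode : List Instr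
  counterCode = const 6 (+ 1) ∷ add 2 2 6 ∷ sub 6 3 2 ∷ []

  loopCode : ℕ → List Instr → List Instr
  loopCode o body = body ++ counterCode ++ jumpIfPositive 6 o ∷ []

  bodyCode : ∀ {k} → Stmt k → List Instr
  bodyCode s = (const 4 (+ 0) ∷ add 4 4 2 ∷ [])
    ++ digitsCode 0 (loops s)
    ++ weighCode (loops s) (coefficient s) (factors s)
    ++ addressCode (loops s) (target s)
    ++ load 6 5 ∷ add 6 6 7 ∷ store 5 6 ∷ []

  startCode : ℕ → List Instr
  startCode m = powerCode m ++ const 2 (+ 0) ∷ []

  stmtCode : ∀ {k} → ℕ → Stmt k → List Instr
  stmtCode o s = startCode (length (loops s))
    ++ loopCode (o + length (startCode (length (loops s)))) (bodyCode s)

quot-pos : ∀ a n .{{_ : NonZero n}} → (+ a) quot (+ n) ≡ + (a ℕ./ n)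
quot-pos a (suc n) = ℤₚ.*-identityˡ _

pos-minus : ∀ x y → + (x + y) ℤ.- + y ≡ + x
pos-minus x y = trans (cong (ℤ._- + y) (ℤₚ.pos-+ x y))
  (trans (ℤₚ.+-assoc (+ x) (+ y) (ℤ.- + y)) (trans (cong (ℤ._+_ (+ x)) (ℤₚ.+-inverseʳ (+ y))) (ℤₚ.+-identityʳ (+ x))))

digits-< : ∀ {k} n .{{_ : NonZero n}} (vs : List (Fin k)) j x → digits n vs j x < n
digits-< (suc n) []       j x = s≤s z≤n
digits-< n (v ∷ vs) j x with v Finₚ.≟ x
... | yes _ = DivMod.m%n<n j n
... | no  _ = digits-< n vs (j ℕ./ n) x

flat-≤ : ∀ {k} n h (g : Fin k → ℕ) → (∀ x → g x < n) → ∀ xs → suc (flat n h g xs) ≤ suc h * n ^ length xs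
flat-≤ n h g g< []       = ℕₚ.≤-reflexive (sym (ℕₚ.*-identityʳ _))
flat-≤ n h g g< (x ∷ xs) = begin
  suc (g x) + n * flat n h g xs     ≤⟨ ℕₚ.+-monoˡ-≤ (n * flat n h g xs) (g< x) ⟩
  n + n * flat n h g xs             ≡⟨ ℕₚ.*-suc n _ ⟨
  n * suc (flat n h g xs)           ≤⟨ ℕₚ.*-monoʳ-≤ n (flat-≤ n h g g< xs) ⟩
  n * (suc h * n ^ length xs)       ≡⟨ eq n (suc h) (n ^ length xs) ⟩
  suc h * (n * n ^ length xs)       ∎
  where
  open ℕₚ.≤-Reasoning
  eq : ∀ n h x → n * (h * x) ≡ h * (n * x)
  eq = ℕ-solve-∀

module Correct (K R n W : ℕ) (8<K : 8 < K) .{{nz : NonZero n}} where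

  open Code K R

  -- The arrays start behind the `K` low cells, behind the input in the cells up to n², and behind
  -- the copies of the low input cells that are made before the registers come into use; `D` is the
  -- address `saved K` of the input phase. It can be computed from n by one addition and one
  -- multiplication.
  D : ℕ
  D = n * (n + (K + K))

  K+K≤D : K + K ≤ D
  K+K≤D = ℕₚ.≤-trans (ℕₚ.m≤n+m (K + K) n) (ℕₚ.m≤n*m (n + (K + K)) n)

  K≤D : K ≤ D
  K≤D = ℕₚ.≤-trans (ℕₚ.m≤m+n K K) K+K≤D

  -- Interleaving with stride `R` leaves every array unbounded, so no sizes have to be fixed in
  -- advance; in particular one array can hold the whole memory of a subroutine.
  at-array : ℕ → ℕ → ℕ
  at-array r a = D + (R * a + r)

  at-array-injective : ∀ {r r′ a a′} → r < R → r′ < R → at-array r a ≡ at-array r′ a′ → r ≡ r′ × a ≡ a′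
  at-array-injective {r} {r′} {a} {a′} r< r′< eq = r≡r′ , a≡a′
    where
    instance
      R≢0 : NonZero R
      R≢0 = ℕ.>-nonZero (ℕₚ.≤-<-trans z≤n r<)
    eq′ : R * a + r ≡ R * a′ + r′
    eq′ = ℕₚ.+-cancelˡ-≡ D _ _ eq
    mod : ∀ a r → r < R → (R * a + r) ℕ.% R ≡ r
    mod a r r< = trans (cong (ℕ._% R) (trans (ℕₚ.+-comm (R * a) r) (cong (r ℕ.+_) (ℕₚ.*-comm R a))))
      (trans (DivMod.[m+kn]%n≡m%n r a R) (DivMod.m<n⇒m%n≡m r<))
    r≡r′ : r ≡ r′
    r≡r′ = trans (sym (mod a r r<)) (trans (cong (ℕ._% R) eq′) (mod a′ r′ r′<))
    a≡a′ : a ≡ a′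
    a≡a′ = ℕₚ.*-cancelˡ-≡ a a′ R (ℕₚ.+-cancelʳ-≡ r _ _ (trans eq′ (cong (R * a′ ℕ.+_) (sym r≡r′))))

  record Rep (arr : Arrays) (m : Memory) : Set where
    constructor rep
    field
      cell-n : m 0 ≡ + n
      cell-D : m 1 ≡ + D
      cells  : ∀ {r} → r < R → ∀ a → m (at-array r a) ≡ arr r a

  open Rep public

  -- The cells from 2 to `K − 1` are scratch. Everything that `Rep` mentions lies outside of them.
  Same : Memory → Memory → Set
  Same m m′ = ∀ c → c < 2 ⊎ K ≤ c → m′ c ≡ m c

  K≤at-array : ∀ r a → K ≤ at-array r a
  K≤at-array r a = ℕₚ.≤-trans K≤D (ℕₚ.m≤m+n D _)

  rep-same : ∀ {arr m m′} → Same m m′ → Rep arr m → Rep arr m′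
  rep-same same (rep cn cD cs) = rep
    (same 0 (inj₁ (s≤s z≤n)) ∙ cn) (same 1 (inj₁ (s≤s (s≤s z≤n))) ∙ cD)
    (λ r< a → same _ (inj₂ (K≤at-array _ a)) ∙ cs r< a)

  rep-cong : ∀ {arr arr′ m} → (∀ r a → arr r a ≡ arr′ r a) → Rep arr m → Rep arr′ m
  rep-cong eq (rep cn cD cs) = rep cn cD (λ r< a → cs r< a ∙ eq _ a)

  apart : ∀ {a c} → 2 ≤ a → a < K → c < 2 ⊎ K ≤ c → a ≢ c
  apart 2≤a a<K (inj₁ c<2) refl = ℕₚ.<⇒≱ c<2 2≤a
  apart 2≤a a<K (inj₂ K≤c) refl = ℕₚ.<⇒≱ a<K K≤c

  record Values {k} (vs : List (Fin k)) (g : Fin k → ℕ) (m : Memory) : Set where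
    field
      value : ∀ x → m (cell vs x) ≡ + g x
  open Values public

  values-keep : ∀ {k vs} {g : Fin k → ℕ} {m m′} → (∀ c → 8 ≤ c → m′ c ≡ m c) → Values vs g m → Values vs g m′
  values-keep {vs = vs} keep v .value x = keep _ (ℕₚ.m≤m+n 8 (position vs x)) ∙ v .value x

  eq≤ : ∀ {z x} → z ≡ + x → x ≤ W → ℤ.∣ z ∣ ≤ W
  eq≤ refl h = h

  flatCode-ok : ∀ {k} (vs : List (Fin k)) g h idx {m} → Fitting W m → m 0 ≡ + n → Values vs g m →
    flat n h g idx ≤ W →
    Exec W (flatCode h (map (cell vs) idx)) m
      (λ m′ → m′ 5 ≡ + flat n h g idx × (∀ c → c ≢ 5 → m′ c ≡ m c))
  flatCode-ok vs g h [] {m} fit m0 v h≤W = go fit h≤W λ f → stop f (refl , λ c c≢ → update-other m 5 _ (c≢ ∘ sym))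
  flatCode-ok vs g h (x ∷ xs) {m} fit m0 v ≤W =
    exec-++ (flatCode-ok vs g h xs fit m0 v (ℕₚ.≤-trans (ℕₚ.≤-trans (ℕₚ.m≤n*m F n) (ℕₚ.m≤n+m (n * F) (g x))) ≤W))
      λ m₁ f₁ (e , keep) →
        let e₁ = cong₂ ℤ._*_ e (keep 0 (λ ()) ∙ m0) ∙ sym (ℤₚ.pos-* F n) ∙ cong +_ (ℕₚ.*-comm F n)
            e₂ = cong₂ ℤ._+_ e₁ (keep (cell vs x) (λ ()) ∙ v .value x) ∙ sym (ℤₚ.pos-+ (n * F) (g x))
                   ∙ cong +_ (ℕₚ.+-comm (n * F) (g x))
        in go f₁ (eq≤ e₁ (ℕₚ.≤-trans (ℕₚ.m≤n+m (n * F) (g x)) ≤W)) λ f₂ →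
           go f₂ (eq≤ e₂ ≤W) λ f₃ → stop f₃
             (e₂ , λ c c≢ → effects-untouched (mul 5 5 0 ∷ add 5 5 (cell vs x) ∷ []) m₁ ((c≢ ∘ sym) , (c≢ ∘ sym) , tt) ∙ keep c c≢)
    where F = flat n h g xs

  toAddress-ok : ∀ a r f {m} → Fitting W m → m 1 ≡ + D → m 5 ≡ + f → R ≤ W → r < R → at-array r (a + f) ≤ W →
    Exec W (toAddress a r) m (λ m′ → m′ 5 ≡ + at-array r (a + f) × (∀ c → c ≢ 5 → c ≢ 6 → m′ c ≡ m c))
  toAddress-ok a r f {m} fit m1 m5 R≤W r<R ≤W =
    go fit (ℕₚ.≤-trans (ℕₚ.m≤m+n a f) s≤W) λ f₁ →
    go f₁ (eq≤ e₁ s≤W) λ f₂ →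
    go f₂ R≤W λ f₃ →
    go f₃ (eq≤ e₂ (ℕₚ.≤-trans (ℕₚ.m≤m+n _ r) t≤W)) λ f₄ →
    go f₄ (ℕₚ.≤-trans (ℕₚ.<⇒≤ r<R) R≤W) λ f₅ →
    go f₅ (eq≤ e₃ t≤W) λ f₆ →
    go f₆ (eq≤ e₄ ≤W) λ f₇ →
    stop f₇ (e₄ , λ c n5 n6 → effects-untouched (toAddress a r) m
      (n6 ∘ sym , n5 ∘ sym , n6 ∘ sym , n5 ∘ sym , n6 ∘ sym , n5 ∘ sym , n5 ∘ sym , tt))
    where
    instance
      R≢0 : NonZero R
      R≢0 = ℕ.>-nonZero (ℕₚ.≤-<-trans z≤n r<R)
    t≤W : R * (a + f) + r ≤ W
    t≤W = ℕₚ.≤-trans (ℕₚ.m≤n+m _ D) ≤W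
    s≤W : a + f ≤ W
    s≤W = ℕₚ.≤-trans (ℕₚ.m≤n*m (a + f) R) (ℕₚ.≤-trans (ℕₚ.m≤m+n _ r) t≤W)
    e₁ : m 5 ℤ.+ + a ≡ + (a + f)
    e₁ = cong (ℤ._+ + a) m5 ∙ sym (ℤₚ.pos-+ f a) ∙ cong +_ (ℕₚ.+-comm f a)
    e₂ : (m 5 ℤ.+ + a) ℤ.* + R ≡ + (R * (a + f))
    e₂ = cong (ℤ._* + R) e₁ ∙ sym (ℤₚ.pos-* (a + f) R) ∙ cong +_ (ℕₚ.*-comm (a + f) R)
    e₃ : (m 5 ℤ.+ + a) ℤ.* + R ℤ.+ + r ≡ + (R * (a + f) + r)
    e₃ = cong (ℤ._+ + r) e₂ ∙ sym (ℤₚ.pos-+ _ r)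
    e₄ : (m 5 ℤ.+ + a) ℤ.* + R ℤ.+ + r ℤ.+ m 1 ≡ + at-array r (a + f)
    e₄ = cong₂ ℤ._+_ e₃ m1 ∙ sym (ℤₚ.pos-+ _ D) ∙ cong +_ (ℕₚ.+-comm _ D)

  addressCode-ok : ∀ {k} (vs : List (Fin k)) g ρ {m} → Fitting W m → m 0 ≡ + n → m 1 ≡ + D → Values vs g m →
    R ≤ W → array ρ < R → at-array (array ρ) (address n ρ g) ≤ W →
    Exec W (addressCode vs ρ) m
      (λ m′ → m′ 5 ≡ + at-array (array ρ) (address n ρ g) × (∀ c → c ≢ 5 → c ≢ 6 → m′ c ≡ m c))
  addressCode-ok vs g ρ {m} fit m0 m1 v R≤W r<R ≤W =
    exec-++ (flatCode-ok vs g (lead ρ) (indices ρ) fit m0 v f≤W) λ m₁ f₁ (e , keep) →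
    weaken (toAddress-ok (offset ρ) (array ρ) F f₁ (keep 1 (λ ()) ∙ m1) e R≤W r<R ≤W)
      λ (e′ , keep′) → e′ , λ c n5 n6 → keep′ c n5 n6 ∙ keep c n5
    where
    F = flat n (lead ρ) g (indices ρ)
    instance
      R≢0 : NonZero R
      R≢0 = ℕ.>-nonZero (ℕₚ.≤-<-trans z≤n r<R)
    f≤W : F ≤ W
    f≤W = ℕₚ.≤-trans (ℕₚ.m≤n+m F (offset ρ)) (ℕₚ.≤-trans (ℕₚ.m≤n*m _ R)
      (ℕₚ.≤-trans (ℕₚ.m≤m+n _ (array ρ)) (ℕₚ.≤-trans (ℕₚ.m≤n+m _ D) ≤W)))

  -- The frame condition leaves out one cell more than there are variables, the cleared one at
  -- `8 + (i + length vs)`.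
  digitsCode-ok : ∀ {k} i (vs : List (Fin k)) q {m} → Fitting W m → m 0 ≡ + n → m 4 ≡ + q → q ≤ W →
    Exec W (digitsCode i vs) m (λ m′ →
      (∀ x → m′ (8 + (i + position vs x)) ≡ + digits n vs q x)
      × (∀ c → c ≢ 4 → c ≢ 5 → c ≢ 6 → c < 8 + i ⊎ 8 + (i + length vs) < c → m′ c ≡ m c))
  digitsCode-ok i [] q {m} fit m0 m4 q≤W = go fit z≤n λ f₁ → stop f₁
    ( (λ x → cong (λ z → (m [ 8 + i ≔ + 0 ]) (8 + z)) (ℕₚ.+-identityʳ i) ∙ update-same m (8 + i) (+ 0))
    , λ c _ _ _ c∉ → update-other m (8 + i) (+ 0)
        λ { refl → [ ℕₚ.<-irrefl refl , (λ h → ℕₚ.<⇒≱ h (ℕₚ.+-monoʳ-≤ 8 (ℕₚ.m≤m+n i 0))) ]′ c∉ })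
  digitsCode-ok {k} i (v ∷ vs) q {m} fit m0 m4 q≤W =
    go fit (eq≤ e₁ (ℕₚ.≤-trans (DivMod.m/n≤m q n) q≤W)) λ f₁ →
    go f₁ (eq≤ e₂ (ℕₚ.≤-trans (DivMod.m/n*n≤m q n) q≤W)) λ f₂ →
    go f₂ (eq≤ e₃ (ℕₚ.≤-trans (DivMod.m%n≤m q n) q≤W)) λ f₃ →
    go f₃ z≤n λ f₄ →
    go f₄ (eq≤ e₄ q′≤W) λ f₅ →
    weaken (digitsCode-ok (suc i) vs q′ f₅ m0 e₄ q′≤W) λ { {m′} (vals , keep) →
      (λ x → lookup m′ x vals keep)
      , λ c n4 n5 n6 c∉ → keep c n4 n5 n6 (outside c∉)
        ∙ effects-untouched (quotient 5 4 0 ∷ mul 6 5 0 ∷ sub (8 + i) 4 6 ∷ const 6 (+ 0) ∷ add 4 5 6 ∷ []) m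
            (n5 ∘ sym , n6 ∘ sym , here≢ c∉ , n6 ∘ sym , n4 ∘ sym , tt) }
    where
    q′ = q ℕ./ n
    q′≤W : q′ ≤ W
    q′≤W = ℕₚ.≤-trans (DivMod.m/n≤m q n) q≤W
    e₁ : m 4 quot m 0 ≡ + q′
    e₁ = cong₂ _quot_ m4 m0 ∙ quot-pos q n
    e₂ : (m 4 quot m 0) ℤ.* m 0 ≡ + (q′ * n)
    e₂ = cong₂ ℤ._*_ e₁ m0 ∙ sym (ℤₚ.pos-* q′ n)
    e₃ : m 4 ℤ.- (m 4 quot m 0) ℤ.* m 0 ≡ + (q ℕ.% n)
    e₃ = cong₂ ℤ._-_ (m4 ∙ cong +_ (DivMod.m≡m%n+[m/n]*n q n)) e₂ ∙ pos-minus _ (q′ * n)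
    e₄ : (m 4 quot m 0) ℤ.+ + 0 ≡ + q′
    e₄ = ℤₚ.+-identityʳ _ ∙ e₁
    outside : ∀ {c} → c < 8 + i ⊎ 8 + (i + suc (length vs)) < c → c < 8 + suc i ⊎ 8 + (suc i + length vs) < c
    outside (inj₁ h) = inj₁ (ℕₚ.<-trans h (ℕₚ.+-monoʳ-< 8 (ℕₚ.n<1+n i)))
    outside {c} (inj₂ h) = inj₂ (subst (λ z → 8 + z < c) (ℕₚ.+-suc i (length vs)) h)
    here≢ : ∀ {c} → c < 8 + i ⊎ 8 + (i + suc (length vs)) < c → 8 + i ≢ c
    here≢ (inj₁ h) refl = ℕₚ.<-irrefl refl h
    here≢ (inj₂ h) refl = ℕₚ.<⇒≱ h (ℕₚ.+-monoʳ-≤ 8 (ℕₚ.m≤m+n i _))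
    m₃ : Memory
    m₃ = effects (quotient 5 4 0 ∷ mul 6 5 0 ∷ sub (8 + i) 4 6 ∷ const 6 (+ 0) ∷ add 4 5 6 ∷ []) m
    lookup : ∀ (m′ : Memory) x → (∀ x → m′ (8 + (suc i + position vs x)) ≡ + digits n vs q′ x) →
      (∀ c → c ≢ 4 → c ≢ 5 → c ≢ 6 → c < 8 + suc i ⊎ 8 + (suc i + length vs) < c → m′ c ≡ m₃ c) →
      m′ (8 + (i + position (v ∷ vs) x)) ≡ + digits n (v ∷ vs) q x
    lookup m′ x vals keep with v Finₚ.≟ x
    ... | yes _ = cong (λ z → m′ (8 + z)) (ℕₚ.+-identityʳ i)
                ∙ keep (8 + i) (λ ()) (λ ()) (λ ()) (inj₁ (ℕₚ.+-monoʳ-< 8 (ℕₚ.n<1+n i)))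
                ∙ update-same (effects (quotient 5 4 0 ∷ mul 6 5 0 ∷ []) m) (8 + i) _ ∙ e₃
    ... | no  _ = cong (λ z → m′ (8 + z)) (ℕₚ.+-suc i (position vs x)) ∙ vals x

weigh-≤ : ∀ {k} n c (ρs : List (Ref k)) arr g B → (∀ r a → ℤ.∣ arr r a ∣ ≤ B) →
          ℤ.∣ weigh n c ρs arr g ∣ ≤ ℤ.∣ c ∣ * B ^ length ρs
weigh-≤ n c []       arr g B bnd = ℕₚ.≤-reflexive (sym (ℕₚ.*-identityʳ _))
weigh-≤ n c (ρ ∷ ρs) arr g B bnd = begin
  ℤ.∣ weigh n c ρs arr g ℤ.* z ∣                 ≡⟨ ℤₚ.abs-* (weigh n c ρs arr g) z ⟩
  ℤ.∣ weigh n c ρs arr g ∣ * ℤ.∣ z ∣             ≤⟨ ℕₚ.*-mono-≤ (weigh-≤ n c ρs arr g B bnd) (bnd _ _) ⟩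
  ℤ.∣ c ∣ * B ^ length ρs * B                    ≡⟨ ℕₚ.*-assoc ℤ.∣ c ∣ _ B ⟩
  ℤ.∣ c ∣ * (B ^ length ρs * B)                  ≡⟨ cong (ℤ.∣ c ∣ *_) (ℕₚ.*-comm _ B) ⟩
  ℤ.∣ c ∣ * (B * B ^ length ρs)                  ∎
  where
  open ℕₚ.≤-Reasoning
  z = arr (array ρ) (address n ρ g)

sum<-zero : ∀ n f → (∀ i → f i ≡ + 0) → sum< n f ≡ + 0
sum<-zero zero    f eq = refl
sum<-zero (suc n) f eq = cong₂ ℤ._+_ (sum<-zero n f eq) (eq n)

sum<-≤ : ∀ n f B → (∀ i → ℤ.∣ f i ∣ ≤ B) → ℤ.∣ sum< n f ∣ ≤ n * B
sum<-≤ zero    f B bnd = z≤n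
sum<-≤ (suc n) f B bnd = ℕₚ.≤-trans (ℤₚ.∣i+j∣≤∣i∣+∣j∣ (sum< n f) (f n))
  (ℕₚ.≤-trans (ℕₚ.+-mono-≤ (sum<-≤ n f B bnd) (bnd n)) (ℕₚ.≤-reflexive (ℕₚ.+-comm (n * B) B)))

contribution-≢ : ∀ {k} n .{{_ : NonZero n}} (s : Stmt k) arr r a i → array (target s) ≢ r →
                 contribution n s arr r a i ≡ + 0
contribution-≢ n s arr r a i ne with array (target s) ℕ.≟ r
... | yes eq = contradiction eq ne
... | no  _  = refl

contribution-miss : ∀ {k} n .{{_ : NonZero n}} (s : Stmt k) arr r a i →
  address n (target s) (digits n (loops s) i) ≢ a → contribution n s arr r a i ≡ + 0
contribution-miss n s arr r a i ne with array (target s) ℕ.≟ r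
... | no  _ = refl
... | yes _ with address n (target s) (digits n (loops s) i) ℕ.≟ a
... | yes eq = contradiction eq ne
... | no  _  = refl

contribution-hit : ∀ {k} n .{{_ : NonZero n}} (s : Stmt k) arr i →
  contribution n s arr (array (target s)) (address n (target s) (digits n (loops s) i)) i
    ≡ weigh n (coefficient s) (factors s) arr (digits n (loops s) i)
contribution-hit n s arr i with array (target s) ℕ.≟ array (target s)
... | no  ne = contradiction refl ne
... | yes _ with address n (target s) (digits n (loops s) i) ℕ.≟ address n (target s) (digits n (loops s) i)
... | no  ne = contradiction refl ne
... | yes _  = refl

contribution-≤ : ∀ {k} n .{{_ : NonZero n}} (s : Stmt k) arr r a i B → (∀ r a → ℤ.∣ arr r a ∣ ≤ B) →
  ℤ.∣ contribution n s arr r a i ∣ ≤ ℤ.∣ coefficient s ∣ * B ^ length (factors s)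
contribution-≤ n s arr r a i B bnd with array (target s) ℕ.≟ r
... | no  _ = z≤n
... | yes _ with address n (target s) (digits n (loops s) i) ℕ.≟ a
... | no  _ = z≤n
... | yes _ = weigh-≤ n (coefficient s) (factors s) arr _ B bnd

partialResult-≢ : ∀ {k} n .{{_ : NonZero n}} (s : Stmt k) arr j r a → array (target s) ≢ r →
                  partialResult n s arr j r a ≡ arr r a
partialResult-≢ n s arr j r a ne =
  trans (cong (ℤ._+_ (arr r a)) (sum<-zero j _ λ i → contribution-≢ n s arr r a i ne)) (ℤₚ.+-identityʳ _)

partialResult-≤ : ∀ {k} n .{{_ : NonZero n}} (s : Stmt k) arr j r a B → (∀ r a → ℤ.∣ arr r a ∣ ≤ B) →
  ℤ.∣ partialResult n s arr j r a ∣ ≤ B + j * (ℤ.∣ coefficient s ∣ * B ^ length (factors s))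
partialResult-≤ n s arr j r a B bnd = ℕₚ.≤-trans (ℤₚ.∣i+j∣≤∣i∣+∣j∣ (arr r a) _)
  (ℕₚ.+-mono-≤ (bnd r a) (sum<-≤ j _ _ λ i → contribution-≤ n s arr r a i B bnd))

jump-taken : ∀ c l o (m : Memory) {d} → m c ≡ + suc d → exec (jumpIfPositive c l) (o , m) ≡ (l , m)
jump-taken c l o m eq rewrite eq = refl

jump-skipped : ∀ c l o (m : Memory) → m c ≡ + 0 → exec (jumpIfPositive c l) (o , m) ≡ (suc o , m)
jump-skipped c l o m eq rewrite eq = refl

module Loops (K R n W : ℕ) (8<K : 8 < K) .{{nz : NonZero n}} (R≤W : R ≤ W) where

  open Code K R
  open Correct K R n W 8<K

  low : ∀ {a} → a ≤ 8 → a < K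
  low a≤8 = ℕₚ.≤-<-trans a≤8 8<K

  Usable : ∀ {k} → Ref k → (Fin k → ℕ) → Set
  Usable ρ g = array ρ < R × at-array (array ρ) (address n ρ g) ≤ W

  Stored : ∀ {k} → Arrays → Memory → Ref k → Set
  Stored arr m ρ = ∀ a → m (at-array (array ρ) a) ≡ arr (array ρ) a

  weighCode-ok : ∀ {k} (vs : List (Fin k)) g c ρs arr B {m} → Fitting W m → m 0 ≡ + n → m 1 ≡ + D → Values vs g m →
    All (λ ρ → Usable ρ g × Stored arr m ρ) ρs → (∀ r a → ℤ.∣ arr r a ∣ ≤ B) → 1 ≤ B → ℤ.∣ c ∣ * B ^ length ρs ≤ W →
    Exec W (weighCode vs c ρs) m (λ m′ → m′ 7 ≡ weigh n c ρs arr g ×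
      (∀ a → a ≢ 5 → a ≢ 6 → a ≢ 7 → m′ a ≡ m a))
  weighCode-ok vs g c [] arr B {m} fit m0 m1 v [] bnd 1≤B ≤W =
    go fit (ℕₚ.≤-trans (ℕₚ.≤-reflexive (sym (ℕₚ.*-identityʳ _))) ≤W) λ f →
    stop f (refl , λ a _ _ n7 → update-other m 7 c (n7 ∘ sym))
  weighCode-ok vs g c (ρ ∷ ρs) arr B {m} fit m0 m1 v (((r<R , ad≤W) , st) ∷ us) bnd 1≤B ≤W =
    exec-++ (weighCode-ok vs g c ρs arr B fit m0 m1 v us bnd 1≤B c≤W) λ m₁ f₁ (e₁ , keep₁) →
    exec-++ (addressCode-ok vs g ρ f₁ (keep₁ 0 (λ ()) (λ ()) (λ ()) ∙ m0) (keep₁ 1 (λ ()) (λ ()) (λ ()) ∙ m1)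
      (values-keep (λ c 8≤c → keep₁ c (far 8≤c (ℕₚ.m≤m+n 6 2)) (far 8≤c (ℕₚ.m≤m+n 7 1)) (far 8≤c ℕₚ.≤-refl)) v) R≤W r<R ad≤W) λ m₂ f₂ (e₂ , keep₂) →
    let A = at-array (array ρ) (address n ρ g)
        K≤A = K≤at-array (array ρ) (address n ρ g)
        e₃ : m₂ ℤ.∣ m₂ 5 ∣ ≡ arr (array ρ) (address n ρ g)
        e₃ = cong (λ z → m₂ ℤ.∣ z ∣) e₂ ∙ keep₂ A (high K≤A five) (high K≤A six) ∙ keep₁ A (high K≤A five) (high K≤A six) (high K≤A (ℕₚ.m≤m+n 7 1)) ∙ st _
        e₄ : m₂ 7 ℤ.* m₂ ℤ.∣ m₂ 5 ∣ ≡ weigh n c (ρ ∷ ρs) arr g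
        e₄ = cong₂ ℤ._*_ (keep₂ 7 (λ ()) (λ ()) ∙ e₁) e₃
    in
    go f₂ (f₂ _) λ f₃ →
    go f₃ (subst (λ z → ℤ.∣ z ∣ ≤ W) (sym e₄) (ℕₚ.≤-trans (weigh-≤ n c (ρ ∷ ρs) arr g B bnd) ≤W)) λ f₄ →
    stop f₄ (e₄ , λ a n5 n6 n7 →
      effects-untouched (load 6 5 ∷ mul 7 7 6 ∷ []) m₂ (n6 ∘ sym , n7 ∘ sym , tt) ∙ keep₂ a n5 n6 ∙ keep₁ a n5 n6 n7)
    where
    five : 5 ≤ 8
    five = ℕₚ.m≤m+n 5 3
    six : 6 ≤ 8
    six = ℕₚ.m≤m+n 6 2
    far : ∀ {b c} → 8 ≤ c → suc b ≤ 8 → c ≢ b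
    far 8≤c b<8 refl = ℕₚ.<⇒≱ b<8 8≤c
    high : ∀ {b c} → K ≤ c → b ≤ 8 → c ≢ b
    high K≤c b≤8 refl = ℕₚ.<⇒≱ (low b≤8) K≤c
    c≤W : ℤ.∣ c ∣ * B ^ length ρs ≤ W
    c≤W = ℕₚ.≤-trans (ℕₚ.*-monoʳ-≤ ℤ.∣ c ∣ (ℕₚ.m≤n*m _ B {{ℕ.>-nonZero 1≤B}})) ≤W

  powerCode-ok : ∀ e {m} → Fitting W m → m 0 ≡ + n → n ^ e ≤ W →
    Exec W (powerCode e) m (λ m′ → m′ 3 ≡ + (n ^ e) × (∀ a → a ≢ 3 → m′ a ≡ m a))
  powerCode-ok zero    {m} fit m0 ≤W = go fit ≤W λ f → stop f (refl , λ a a≢ → update-other m 3 (+ 1) (a≢ ∘ sym))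
  powerCode-ok (suc e) fit m0 ≤W =
    exec-++ (powerCode-ok e fit m0 (ℕₚ.≤-trans (ℕₚ.m≤n*m _ n) ≤W)) λ m₁ f₁ (e₁ , keep) →
    let e₂ = cong₂ ℤ._*_ e₁ (keep 0 (λ ()) ∙ m0) ∙ sym (ℤₚ.pos-* (n ^ e) n) ∙ cong +_ (ℕₚ.*-comm (n ^ e) n) in
    go f₁ (eq≤ e₂ ≤W) λ f₂ → stop f₂ (e₂ , λ a a≢ → update-other m₁ 3 _ (a≢ ∘ sym) ∙ keep a a≢)

  startCode-ok : ∀ e {m} → Fitting W m → m 0 ≡ + n → n ^ e ≤ W →
    Exec W (startCode e) m (λ m′ → m′ 2 ≡ + 0 × m′ 3 ≡ + (n ^ e) × Same m m′)
  startCode-ok e fit m0 ≤W = exec-++ (powerCode-ok e fit m0 ≤W) λ m₁ f₁ (e₁ , keep) →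
    go f₁ z≤n λ f₂ → stop f₂ (refl , e₁ , λ a out →
      update-other m₁ 2 (+ 0) (apart ℕₚ.≤-refl (low (ℕₚ.m≤m+n 2 6)) out)
      ∙ keep a (apart (ℕₚ.m≤m+n 2 1) (low (ℕₚ.m≤m+n 3 5)) out ∘ sym))

  module _ {prog L body T} (loc : Located prog L (loopCode L body)) (T≤W : T ≤ W) (1≤W : 1 ≤ W)
    (I : ℕ → Memory → Set) (stable : ∀ j m m′ → Same m m′ → I j m → I j m′)
    (body-ok : ∀ j m → j < T → Fitting W m → I j m → m 2 ≡ + j → m 3 ≡ + T →
               Exec W body m (λ m′ → I (suc j) m′ × m′ 2 ≡ + j × m′ 3 ≡ + T)) where

    loop-cost : ℕ
    loop-cost = length body + 4

    private
      jumpAt : ℕ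
      jumpAt = L + length body + 3

    iteration : ∀ d j m → j + suc d ≡ T → Fitting W m → I j m → m 2 ≡ + j → m 3 ≡ + T →
      ∃[ m′ ] Reach prog W (L , m) (length body + 3) (jumpAt , m′) × Fitting W m′ × I (suc j) m′
        × m′ 2 ≡ + suc j × m′ 3 ≡ + T × m′ 6 ≡ + d
    iteration d j m eq fit inv m2 m3 = m₂
        , reach-trans (exec-reach (located-++ˡ body loc) b)
            (exec-reach (located-++ˡ counterCode (located-++ʳ body loc)) c)
        , fitting c
        , stable (suc j) m₁ m₂ (λ a out → cong (λ z → z a) (sym (post c)) ∙ effects-untouched counterCode m₁
            (apart (ℕₚ.m≤m+n 2 4) (low (ℕₚ.m≤m+n 6 2)) out , apart ℕₚ.≤-refl (low (ℕₚ.m≤m+n 2 6)) out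
            , apart (ℕₚ.m≤m+n 2 4) (low (ℕₚ.m≤m+n 6 2)) out , tt)) (proj₁ (post b))
        , cong (λ z → z 2) (sym (post c)) ∙ e₁ , cong (λ z → z 3) (sym (post c)) ∙ proj₂ (proj₂ (post b))
        , cong (λ z → z 6) (sym (post c)) ∙ e₂
      where
      j<T : j < T
      j<T = subst (j <_) eq (ℕₚ.m<m+n j (s≤s z≤n))
      b = body-ok j m j<T fit inv m2 m3
      m₁ = result b
      e₁ : m₁ 2 ℤ.+ + 1 ≡ + suc j
      e₁ = cong (ℤ._+ + 1) (proj₁ (proj₂ (post b))) ∙ sym (ℤₚ.pos-+ j 1) ∙ cong +_ (ℕₚ.+-comm j 1)
      e₂ : m₁ 3 ℤ.- (m₁ 2 ℤ.+ + 1) ≡ + d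
      e₂ = cong₂ ℤ._-_ (proj₂ (proj₂ (post b)) ∙ cong +_ (sym eq ∙ ℕₚ.+-suc j d ∙ ℕₚ.+-comm (suc j) d)) e₁ ∙ pos-minus d (suc j)
      c : Exec W counterCode m₁ (λ m′ → effects counterCode m₁ ≡ m′)
      c = go (fitting b) 1≤W λ f₁ → go f₁ (eq≤ e₁ (ℕₚ.≤-trans j<T T≤W)) λ f₂ →
          go f₂ (eq≤ e₂ (ℕₚ.≤-trans (ℕₚ.≤-trans (ℕₚ.n≤1+n d) (ℕₚ.m≤n+m (suc d) j)) (ℕₚ.≤-trans (ℕₚ.≤-reflexive eq) T≤W)))
          λ f₃ → stop f₃ refl
      m₂ = result c

    private
      jump-fetched : fetch prog jumpAt ≡ just (jumpIfPositive 6 L)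
      jump-fetched = located-head (located-++ʳ counterCode (located-++ʳ body loc))
      cost : ∀ x → (x + 3) + 1 ≡ x + 4
      cost = ℕ-solve-∀

    -- The test stands behind the body, so the body runs at least once; therefore the number of
    -- remaining iterations has the form `suc d`. This suffices because every bound is a power of
    -- the positive number n.
    loop-from : ∀ d j m → j + suc d ≡ T → Fitting W m → I j m → m 2 ≡ + j → m 3 ≡ + T →
      ∃[ m′ ] Reach prog W (L , m) (suc d * loop-cost) (L + length (loopCode L body) , m′) × Fitting W m′ × I T m′
    loop-from zero j m eq fit inv m2 m3 with iteration zero j m eq fit inv m2 m3
    ... | m₂ , reach , fit₂ , inv₂ , _ , _ , m6 = m₂
        , reach-time (cost (length body) ∙ sym (ℕₚ.+-identityʳ _)) (reach-pc pc-eq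
            (reach-trans reach (step fit₂ jump-fetched
              (reach-from (jump-skipped 6 L jumpAt m₂ m6) done))))
        , fit₂ , subst (λ z → I z m₂) (sym (ℕₚ.+-comm j 1) ∙ eq) inv₂
        where
        pc-eq : suc jumpAt ≡ L + length (loopCode L body)
        pc-eq = lemma L (length body) ∙ cong (L ℕ.+_) (sym (Listₚ.length-++ body))
          where
          lemma : ∀ L x → suc (L + x + 3) ≡ L + (x + 4)
          lemma = ℕ-solve-∀
    loop-from (suc e) j m eq fit inv m2 m3 with iteration (suc e) j m eq fit inv m2 m3
    ... | m₂ , reach , fit₂ , inv₂ , m2′ , m3′ , m6
      with loop-from e (suc j) m₂ (sym (ℕₚ.+-suc j (suc e)) ∙ eq) fit₂ inv₂ m2′ m3′
    ... | m′ , reach′ , fit′ , inv′ = m′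
        , reach-time (sym (ℕₚ.+-assoc (length body + 3) 1 _) ∙ cong (_+ suc e * loop-cost) (cost (length body)))
            (reach-trans reach (step fit₂ jump-fetched
              (reach-from (jump-taken 6 L jumpAt m₂ m6) reach′)))
        , fit′ , inv′

module Statements (K R n W : ℕ) (8<K : 8 < K) .{{nz : NonZero n}} (R≤W : R ≤ W) where

  open Code K R
  open Correct K R n W 8<K
  open Loops K R n W 8<K R≤W

  extent : ∀ {k} → Ref k → ℕ
  extent ρ = at-array (array ρ) (offset ρ + suc (lead ρ) * n ^ length (indices ρ))

  extent-usable : ∀ {k} (ρ : Ref k) g → (∀ x → g x < n) → array ρ < R → extent ρ ≤ W → Usable ρ g
  extent-usable ρ g g< r<R ≤W = r<R , ℕₚ.≤-trans
    (ℕₚ.+-monoʳ-≤ D (ℕₚ.+-monoˡ-≤ (array ρ) (ℕₚ.*-monoʳ-≤ R (ℕₚ.+-monoʳ-≤ (offset ρ)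
      (ℕₚ.<⇒≤ (flat-≤ n (lead ρ) g g< (indices ρ))))))) ≤W

  -- `value-ok` covers all partial sums at once: an old entry plus at most `n ^ length (loops s)`
  -- summands. `1≤B` makes the partial products in `weighCode` no larger than the bound for the full
  -- product.
  record Admissible {k} (s : Stmt k) (arr : Arrays) (B : ℕ) : Set where
    field
      registers : 8 + length (loops s) < K
      target-ok : array (target s) < R × extent (target s) ≤ W
      factors-ok : All (λ ρ → (array ρ < R × extent ρ ≤ W) × array (target s) ≢ array ρ) (factors s)
      power-ok  : n ^ length (loops s) ≤ W
      bounded   : ∀ r a → ℤ.∣ arr r a ∣ ≤ B
      1≤B       : 1 ≤ B
      value-ok  : B + n ^ length (loops s) * (ℤ.∣ coefficient s ∣ * B ^ length (factors s)) ≤ W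

  module _ {k} (s : Stmt k) (arr : Arrays) (B : ℕ) (ok : Admissible s arr B) where
    open Admissible ok

    private
      total = n ^ length (loops s)
      V = ℤ.∣ coefficient s ∣ * B ^ length (factors s)
      instance
        total≢0 : NonZero total
        total≢0 = ℕₚ.m^n≢0 n (length (loops s))
      V≤W : V ≤ W
      V≤W = ℕₚ.≤-trans (ℕₚ.m≤n*m V total) (ℕₚ.≤-trans (ℕₚ.m≤n+m (total * V) B) value-ok)
      tr = array (target s)

    bodyCode-ok : ∀ j m → j < total → Fitting W m → Rep (partialResult n s arr j) m → m 2 ≡ + j → m 3 ≡ + total →
      Exec W (bodyCode s) m (λ m′ → Rep (partialResult n s arr (suc j)) m′ × m′ 2 ≡ + j × m′ 3 ≡ + total)
    bodyCode-ok j m j<total fit rp m2 m3 =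
      exec-++ {c₁ = const 4 (+ 0) ∷ add 4 4 2 ∷ []}
        {Q = λ m₁ → m₁ 4 ≡ + j × (∀ a → a ≢ 4 → m₁ a ≡ m a)}
        (go fit z≤n λ f₁ → go f₁ (eq≤ e₁ j≤W) λ f₂ → stop f₂ (e₁ , λ a n4 →
          effects-untouched (const 4 (+ 0) ∷ add 4 4 2 ∷ []) m (n4 ∘ sym , n4 ∘ sym , tt)))
      λ m₁ f₁ (m₁4 , keep₁) →
      exec-++ (digitsCode-ok 0 (loops s) j f₁ (keep₁ 0 (λ ()) ∙ cell-n rp) m₁4 j≤W) λ m₂ f₂ (vals , keep₂) →
      let old : ∀ a → a < 4 ⊎ K ≤ a → m₂ a ≡ m a
          old a out = keep₂ a (off 4 4 out) (off 5 4 out) (off 6 4 out) (side out)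
            ∙ keep₁ a (off 4 4 out)
          v₂ : Values (loops s) g m₂
          v₂ = record { value = vals }
      in
      exec-++ (weighCode-ok (loops s) g (coefficient s) (factors s) arr B f₂
          (old 0 (inj₁ (s≤s z≤n)) ∙ cell-n rp) (old 1 (inj₁ (s≤s (s≤s z≤n))) ∙ cell-D rp) v₂
          (All.map (λ { {ρ} ((r< , ext) , ne) → extent-usable ρ g g< r< ext
             , λ a → old _ (inj₂ (K≤at-array _ a)) ∙ cells rp r< a ∙ partialResult-≢ n s arr j _ a ne }) factors-ok)
          bounded 1≤B V≤W) λ m₃ f₃ (m₃7 , keep₃) →
      let old₃ : ∀ a → a < 4 ⊎ K ≤ a → m₃ a ≡ m a
          old₃ a out = keep₃ a (off 5 4 out) (off 6 4 out) (off 7 4 out) ∙ old a out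
      in
      exec-++ (addressCode-ok (loops s) g (target s) f₃ (old₃ 0 (inj₁ (s≤s z≤n)) ∙ cell-n rp)
          (old₃ 1 (inj₁ (s≤s (s≤s z≤n))) ∙ cell-D rp)
          (values-keep (λ c 8≤c → keep₃ c (above 8≤c 5) (above 8≤c 6) (above 8≤c 7)) v₂) R≤W (proj₁ usable) (proj₂ usable))
      λ m₄ f₄ (m₄5 , keep₄) →
      let old₄ : ∀ a → a < 4 ⊎ K ≤ a → m₄ a ≡ m a
          old₄ a out = keep₄ a (off 5 4 out) (off 6 4 out) ∙ old₃ a out
          m₅ = effects (load 6 5 ∷ add 6 6 7 ∷ []) m₄
          e₅ : m₅ 6 ≡ partialResult n s arr j tr A ℤ.+ w
          e₅ = cong₂ ℤ._+_ (cong (λ z → m₄ ℤ.∣ z ∣) m₄5 ∙ old₄ _ (inj₂ (K≤at-array tr A)) ∙ cells rp (proj₁ usable) A)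
                           (keep₄ 7 (λ ()) (λ ()) ∙ m₃7)
          m₅5 : m₅ 5 ≡ + at-array tr A
          m₅5 = m₄5
          old₅ : ∀ a → a < 4 ⊎ K ≤ a → m₅ a ≡ m a
          old₅ a out = effects-untouched (load 6 5 ∷ add 6 6 7 ∷ []) m₄
            ((off 6 4 out ∘ sym) , (off 6 4 out ∘ sym) , tt) ∙ old₄ a out
          at≡ : ℤ.∣ m₅ 5 ∣ ≡ at-array tr A
          at≡ = cong ℤ.∣_∣ m₅5
          small : ∀ a → a < 4 → (m₅ [ ℤ.∣ m₅ 5 ∣ ≔ m₅ 6 ]) a ≡ m a
          small a a<4 = update-other m₅ ℤ.∣ m₅ 5 ∣ (m₅ 6)
            (λ eq → ℕₚ.<⇒≱ (ℕₚ.<-trans a<4 (low 4≤8)) (subst (K ≤_) (sym at≡ ∙ eq) (K≤at-array tr A)))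
            ∙ old₅ a (inj₁ a<4)
      in
      go f₄ (f₄ _) λ f₅ →
      go f₅ (subst (λ z → ℤ.∣ z ∣ ≤ W) (sym e₅) sum≤W) λ f₆ →
      go f₆ (f₆ 6) λ f₇ → stop f₇
        ( rep (small 0 (s≤s z≤n) ∙ cell-n rp) (small 1 (s≤s (s≤s z≤n)) ∙ cell-D rp)
            (λ {r} r<R a → updated m₅ at≡ e₅ old₅ r r<R a)
        , small 2 (s≤s (s≤s (s≤s z≤n))) ∙ m2 , small 3 (s≤s (s≤s (s≤s (s≤s z≤n)))) ∙ m3)
      where
      4≤8 : 4 ≤ 8
      4≤8 = ℕₚ.m≤m+n 4 4
      g = digits n (loops s) j
      g< = digits-< n (loops s) j
      A = address n (target s) g
      w = weigh n (coefficient s) (factors s) arr g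
      j≤W : j ≤ W
      j≤W = ℕₚ.≤-trans (ℕₚ.<⇒≤ j<total) power-ok
      e₁ : + 0 ℤ.+ m 2 ≡ + j
      e₁ = ℤₚ.+-identityˡ _ ∙ m2
      usable = extent-usable (target s) g g< (proj₁ target-ok) (proj₂ target-ok)
      off : ∀ b c {_ : True (c ℕ.≤? b)} {_ : True (b ℕ.≤? 8)} {a} → a < c ⊎ K ≤ a → a ≢ b
      off b c {p} {q} (inj₁ a<c) refl = ℕₚ.<⇒≱ a<c (toWitness p)
      off b c {p} {q} (inj₂ K≤a) refl = ℕₚ.<⇒≱ (low (toWitness q)) K≤a
      above : ∀ {c} → 8 ≤ c → ∀ b {_ : True (suc b ℕ.≤? 8)} → c ≢ b
      above 8≤c b {p} refl = ℕₚ.<⇒≱ (toWitness p) 8≤c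
      side : ∀ {a} → a < 4 ⊎ K ≤ a → a < 8 + 0 ⊎ 8 + (0 + length (loops s)) < a
      side (inj₁ h) = inj₁ (ℕₚ.<-≤-trans h 4≤8)
      side (inj₂ h) = inj₂ (ℕₚ.<-≤-trans registers h)
      sum≤W : ℤ.∣ partialResult n s arr j tr A ℤ.+ w ∣ ≤ W
      sum≤W = begin
        ℤ.∣ partialResult n s arr j tr A ℤ.+ w ∣           ≤⟨ ℤₚ.∣i+j∣≤∣i∣+∣j∣ (partialResult n s arr j tr A) w ⟩
        ℤ.∣ partialResult n s arr j tr A ∣ + ℤ.∣ w ∣       ≤⟨ ℕₚ.+-mono-≤ (partialResult-≤ n s arr j tr A B bounded)
                                                               (weigh-≤ n (coefficient s) (factors s) arr g B bounded) ⟩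
        B + j * V + V                                      ≡⟨ eq B j V ⟩
        B + suc j * V                                      ≤⟨ ℕₚ.+-monoʳ-≤ B (ℕₚ.*-monoˡ-≤ V j<total) ⟩
        B + total * V                                          ≤⟨ value-ok ⟩
        W                                                  ∎
        where
        open ℕₚ.≤-Reasoning
        eq : ∀ B j V → B + j * V + V ≡ B + suc j * V
        eq = ℕ-solve-∀
      updated : ∀ m₅ → ℤ.∣ m₅ 5 ∣ ≡ at-array tr A → m₅ 6 ≡ partialResult n s arr j tr A ℤ.+ w →
        (∀ a → a < 4 ⊎ K ≤ a → m₅ a ≡ m a) → ∀ r → r < R → ∀ a →
        (m₅ [ ℤ.∣ m₅ 5 ∣ ≔ m₅ 6 ]) (at-array r a) ≡ partialResult n s arr (suc j) r a
      updated m₅ at≡ e₅ old₅ r r<R a = trans cell-eq (ℤₚ.+-assoc (arr r a) _ _)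
        where
        other : at-array tr A ≢ at-array r a →
          (m₅ [ ℤ.∣ m₅ 5 ∣ ≔ m₅ 6 ]) (at-array r a) ≡ partialResult n s arr j r a ℤ.+ + 0
        other ne = update-other m₅ _ (m₅ 6) (λ eq → ne (sym at≡ ∙ eq)) ∙ old₅ _ (inj₂ (K≤at-array r a))
          ∙ cells rp r<R a ∙ sym (ℤₚ.+-identityʳ _)
        cell-eq : (m₅ [ ℤ.∣ m₅ 5 ∣ ≔ m₅ 6 ]) (at-array r a) ≡ partialResult n s arr j r a ℤ.+ contribution n s arr r a j
        cell-eq = by (tr ℕ.≟ r) (A ℕ.≟ a)
          where
          by : Dec (tr ≡ r) → Dec (A ≡ a) →
            (m₅ [ ℤ.∣ m₅ 5 ∣ ≔ m₅ 6 ]) (at-array r a) ≡ partialResult n s arr j r a ℤ.+ contribution n s arr r a j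
          by (no ne) _ = other (ne ∘ proj₁ ∘ at-array-injective (proj₁ usable) r<R)
                        ∙ cong (ℤ._+_ (partialResult n s arr j r a)) (sym (contribution-≢ n s arr r a j ne))
          by (yes refl) (no ne) = other (ne ∘ proj₂ ∘ at-array-injective {a = A} (proj₁ usable) r<R)
                        ∙ cong (ℤ._+_ (partialResult n s arr j tr a)) (sym (contribution-miss n s arr tr a j ne))
          by (yes refl) (yes refl) = cong (λ z → (m₅ [ z ≔ m₅ 6 ]) (at-array tr A)) at≡ ∙ update-same m₅ (at-array tr A) (m₅ 6) ∙ e₅
                        ∙ cong (ℤ._+_ (partialResult n s arr j tr A)) (sym (contribution-hit n s arr j))

    stmt-cost : ℕ
    stmt-cost = length (startCode (length (loops s))) + total * (length (bodyCode s) + 4)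

    stmtCode-ok : ∀ {prog o m} → Located prog o (stmtCode o s) → Fitting W m → Rep arr m →
      ∃[ m′ ] Reach prog W (o , m) stmt-cost (o + length (stmtCode o s) , m′) × Fitting W m′ × Rep (perform n s arr) m′
    stmtCode-ok {prog} {o} {m} loc fit rp = m′ , reach , fit′ , rp′
      where
      start = startCode (length (loops s))
      L = o + length start
      e = startCode-ok (length (loops s)) fit (cell-n rp) power-ok
      total≡ : total ≡ suc (ℕ.pred total)
      total≡ = sym (ℕₚ.suc-pred total)
      l = loop-from (located-++ʳ start loc) power-ok (ℕₚ.≤-trans (ℕ.>-nonZero⁻¹ total) power-ok)
            (λ j → Rep (partialResult n s arr j)) (λ j m m′ → rep-same) bodyCode-ok
            (ℕ.pred total) 0 (result e) (sym total≡) (fitting e)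
            (rep-same (proj₂ (proj₂ (post e))) (rep-cong (λ r a → sym (ℤₚ.+-identityʳ _)) rp))
            (proj₁ (post e)) (proj₁ (proj₂ (post e)))
      m′ = proj₁ l
      fit′ = proj₁ (proj₂ (proj₂ l))
      rp′ = proj₂ (proj₂ (proj₂ l))
      reach : Reach prog W (o , m) stmt-cost (o + length (stmtCode o s) , m′)
      reach = reach-time (cong (λ z → length start + z * (length (bodyCode s) + 4)) (sym total≡))
        (reach-pc (ℕₚ.+-assoc o (length start) _ ∙ cong (o ℕ.+_) (sym (Listₚ.length-++ start)))
          (reach-trans (exec-reach (located-++ˡ start loc) e) (proj₁ (proj₂ l))))

-- Moving the input into array 0

module InputCode (K R : ℕ) where

  open Code K R

  -- Input entries in the cells from 2 to `K − 1` would be destroyed by the registers and are copied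
  -- away before anything else happens. Cell 1 serves as the pointer for this; it holds a diagonal
  -- entry of the adjacency matrix, hence 0, and can be given up.
  saveCode : ℕ → List Instr
  saveCode zero    = []
  saveCode (suc i) = saveCode i ++ const 1 (+ (K + (2 + i))) ∷ add 1 1 0 ∷ mul 1 1 0 ∷ store 1 (2 + i) ∷ []

  originCode : List Instr
  originCode = const 1 (+ (K + K)) ∷ add 1 1 0 ∷ mul 1 1 0 ∷ []

  -- The division distinguishes the input cells below K, which have been saved,
  -- from the others without a jump.
  testCode locateCode transferCode copyCode : List Instr
  testCode     = const 6 (+ 1) ∷ add 4 2 6 ∷ const 6 (+ (K ∸ 1)) ∷ quotient 6 6 4 ∷ quotient 6 6 6 ∷ []
  locateCode   = const 5 (+ K) ∷ add 5 5 4 ∷ add 5 5 0 ∷ mul 5 5 0 ∷ sub 5 5 4 ∷ mul 5 5 6 ∷ add 4 4 5 ∷ []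
  transferCode = load 7 4 ∷ const 6 (+ R) ∷ mul 5 2 6 ∷ add 5 5 1 ∷ []
  copyCode     = testCode ++ locateCode ++ transferCode ++ store 5 7 ∷ []

  setupCode : List Instr
  setupCode = saveCode (K ∸ 2) ++ originCode ++ startCode 2

  inputCode : List Instr
  inputCode = setupCode ++ loopCode (length setupCode) copyCode

ifZero : ℕ → ℕ → ℕ → ℕ
ifZero zero    x y = x
ifZero (suc _) x y = y

inputArrays : Memory → Arrays
inputArrays m₀ r a = if ⌊ r ℕ.≟ 0 ⌋ then m₀ (suc a) else + 0

module Input (K R n W : ℕ) (8<K : 8 < K) .{{nz : NonZero n}} (R≤W : R ≤ W) where

  open Code K R
  open InputCode K R
  open Correct K R n W 8<K
  open Loops K R n W 8<K R≤W

  saved : ℕ → ℕ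
  saved i = n * (n + (K + i))

  saved-≤ : ∀ i → i ≤ K → saved i ≤ D
  saved-≤ i i≤K = ℕₚ.*-monoʳ-≤ n (ℕₚ.+-monoʳ-≤ n (ℕₚ.+-monoʳ-≤ K i≤K))

  saved-< : ∀ {i j} → i < j → saved i < saved j
  saved-< i<j = ℕₚ.*-monoʳ-< n (ℕₚ.+-monoʳ-< n (ℕₚ.+-monoʳ-< K i<j))

  K+i≤saved : ∀ i → K + i ≤ saved i
  K+i≤saved i = ℕₚ.≤-trans (ℕₚ.m≤n+m (K + i) n) (ℕₚ.m≤n*m _ n)

  n*n<saved : ∀ i → n * n < saved i
  n*n<saved i = ℕₚ.*-monoʳ-< n (ℕₚ.m<m+n n (ℕₚ.<-≤-trans (ℕₚ.≤-<-trans z≤n 8<K) (ℕₚ.m≤m+n K i)))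

  -- The quotient vanishes exactly if `K ≤ suc j`, that is, if the entry was read from a cell
  -- outside the registers and is still in its place.
  source : ℕ → ℕ
  source j = ifZero ((K ∸ 1) ℕ./ suc j) (suc j) (saved (suc j))

  1+K∸1 : suc (K ∸ 1) ≡ K
  1+K∸1 = ℕₚ.m+[n∸m]≡n {1} (ℕₚ.≤-trans (s≤s z≤n) 8<K)

  source-spec : ∀ j → (source j ≡ suc j × K ≤ suc j) ⊎ (source j ≡ saved (suc j) × suc j < K)
  source-spec j with (K ∸ 1) ℕ./ suc j in eq
  ... | zero  = inj₁ (refl , subst (_≤ suc j) 1+K∸1 (DivMod.m/n≡0⇒m<n eq))
  ... | suc _ = inj₂ (refl , subst (suc j <_) 1+K∸1 (s≤s (ℕₚ.≮⇒≥ λ lt →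
                  case trans (sym eq) (DivMod.m<n⇒m/n≡0 lt) of λ ())))

  K≤source : ∀ j → K ≤ source j
  K≤source j with source-spec j
  ... | inj₁ (eq , K≤) = subst (K ≤_) (sym eq) K≤
  ... | inj₂ (eq , _)  = subst (K ≤_) (sym eq) (ℕₚ.≤-trans (ℕₚ.m≤m+n K _) (K+i≤saved (suc j)))

  source<D : ∀ j → j < n * n → source j < D
  source<D j j< with source-spec j
  ... | inj₁ (eq , _)  = subst (_< D) (sym eq) (ℕₚ.≤-<-trans j< (n*n<saved K))
  ... | inj₂ (eq , <K) = subst (_< D) (sym eq) (saved-< <K)

  module _ (m₀ : Memory) (fit₀ : Fitting W m₀) (m₀-0 : m₀ 0 ≡ + n) (m₀-1 : m₀ 1 ≡ + 0)
           (beyond : ∀ c → n * n < c → m₀ c ≡ + 0)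
           (saved≤W : saved (n ^ 2) ≤ W) (extent≤W : at-array 0 (n ^ 2) ≤ W) where

    D≤W : D ≤ W
    D≤W = ℕₚ.≤-trans (ℕₚ.m≤m+n D _) extent≤W

    record Saving (i : ℕ) (m : Memory) : Set where
      constructor saving
      field
        size  : m 0 ≡ + n
        moved : ∀ {j} → 1 ≤ j → j < i → m (saved j) ≡ m₀ j
        kept  : ∀ {c} → i ≤ c → c < K ⊎ c ≤ n * n → m c ≡ m₀ c
        empty : ∀ {c} → D ≤ c → m c ≡ + 0

    save-ok : ∀ i → 2 + i ≤ K → Exec W (saveCode i) m₀ (Saving (2 + i))
    save-ok zero    _  = stop fit₀ (saving m₀-0
      -- The cell `saved 1` is never written. It lies behind the input and so holds 0, which happens
      -- to be the right value for the diagonal entry in cell 1.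
      (λ { {suc zero} _ _ → beyond _ (n*n<saved 1) ∙ sym m₀-1 ; {suc (suc _)} _ (s≤s (s≤s ())) })
      (λ _ _ → refl) (λ D≤c → beyond _ (ℕₚ.<-≤-trans (n*n<saved K) D≤c)))
    save-ok (suc i) i<K = exec-++ (save-ok i (ℕₚ.<⇒≤ i<K)) λ m f (saving size moved kept empty) →
      let a = 2 + i
          e₁ : + (K + a) ℤ.+ m 0 ≡ + (n + (K + a))
          e₁ = cong (ℤ._+_ (+ (K + a))) size ∙ sym (ℤₚ.pos-+ (K + a) n) ∙ cong +_ (ℕₚ.+-comm (K + a) n)
          e₂ : (+ (K + a) ℤ.+ m 0) ℤ.* m 0 ≡ + saved a
          e₂ = cong₂ ℤ._*_ e₁ size ∙ sym (ℤₚ.pos-* (n + (K + a)) n) ∙ cong +_ (ℕₚ.*-comm (n + (K + a)) n)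
          s≤W = ℕₚ.≤-trans (saved-≤ a (ℕₚ.<⇒≤ i<K)) D≤W
          m₁ = effects (const 1 (+ (K + a)) ∷ add 1 1 0 ∷ mul 1 1 0 ∷ []) m
          old : ∀ {c} → c ≢ 1 → m₁ c ≡ m c
          old c≢ = effects-untouched (const 1 (+ (K + a)) ∷ add 1 1 0 ∷ mul 1 1 0 ∷ []) m (c≢ ∘ sym , c≢ ∘ sym , c≢ ∘ sym , tt)
          at≡ : ℤ.∣ m₁ 1 ∣ ≡ saved a
          at≡ = cong ℤ.∣_∣ e₂
          other : ∀ {c} → c ≢ 1 → c ≢ saved a → (m₁ [ ℤ.∣ m₁ 1 ∣ ≔ m₁ a ]) c ≡ m c
          other c≢1 c≢s = update-other m₁ _ (m₁ a) (λ eq → c≢s (sym eq ∙ at≡)) ∙ old c≢1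
      in
      go f (ℕₚ.≤-trans (ℕₚ.≤-trans (ℕₚ.+-monoʳ-≤ K (ℕₚ.<⇒≤ i<K)) K+K≤D) D≤W) λ f₁ →
      go f₁ (eq≤ e₁ (ℕₚ.≤-trans (ℕₚ.m≤n*m _ n) s≤W)) λ f₂ →
      go f₂ (eq≤ e₂ s≤W) λ f₃ →
      go f₃ (f₃ a) λ f₄ → stop f₄ (saving
        (other (λ ()) (λ eq → ℕₚ.<⇒≱ (n*n<saved a) (subst (_≤ n * n) eq z≤n)) ∙ size)
        (λ {j} 1≤j j<i → case j ℕ.≟ a of λ
          { (yes refl) → cong (λ z → (m₁ [ z ≔ m₁ a ]) (saved a)) at≡ ∙ update-same m₁ (saved a) (m₁ a)
                          ∙ old (λ ()) ∙ kept ℕₚ.≤-refl (inj₁ i<K)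
          ; (no j≢a) → other (λ eq → ℕₚ.<⇒≱ (ℕₚ.<-≤-trans (s≤s (s≤s z≤n)) (ℕₚ.<⇒≤ 8<K)) (ℕₚ.≤-trans (ℕₚ.m≤m+n K j) (subst (K + j ≤_) eq (K+i≤saved j))))
                          (λ eq → ℕₚ.<-irrefl eq (saved-< (ℕₚ.≤∧≢⇒< (ℕₚ.≤-pred j<i) j≢a)))
                          ∙ moved 1≤j (ℕₚ.≤∧≢⇒< (ℕₚ.≤-pred j<i) j≢a) })
        (λ { {c} i≤c c-low → other (λ { refl → ℕₚ.<⇒≱ i≤c (s≤s z≤n) })
               (λ { refl → [ (λ h → ℕₚ.<⇒≱ h (ℕₚ.≤-trans (ℕₚ.m≤m+n K _) (K+i≤saved a)))
                           , (λ h → ℕₚ.<⇒≱ (n*n<saved a) h) ]′ c-low })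
               ∙ kept (ℕₚ.<⇒≤ i≤c) c-low })
        (λ {c} D≤c → other (λ { refl → ℕₚ.<⇒≱ (ℕₚ.<-≤-trans (s≤s (s≤s z≤n)) (ℕₚ.<⇒≤ 8<K)) (ℕₚ.≤-trans K≤D D≤c) })
               (λ { refl → ℕₚ.<⇒≱ (saved-< i<K) D≤c }) ∙ empty D≤c))

    copied : ℕ → Arrays
    copied j r a = if ⌊ r ℕ.≟ 0 ⌋ then (if ⌊ a ℕ.<? j ⌋ then m₀ (suc a) else + 0) else + 0

    Copying : ℕ → Memory → Set
    Copying j m = Rep (copied j) m × (∀ i → i < n * n → m (source i) ≡ m₀ (suc i))

    copying-stable : ∀ j m m′ → Same m m′ → Copying j m → Copying j m′
    copying-stable j m m′ same (rp , src) = rep-same same rp , λ i i< → same _ (inj₂ (K≤source i)) ∙ src i i<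

    copied-zero : ∀ r a → + 0 ≡ copied 0 r a
    copied-zero r a with r ℕ.≟ 0
    ... | yes _ = refl
    ... | no  _ = refl

    setup-ok : 0 < R → Exec W setupCode m₀ (λ m → Copying 0 m × m 2 ≡ + 0 × m 3 ≡ + (n ^ 2))
    setup-ok 0<R = exec-++ (save-ok (K ∸ 2) (ℕₚ.≤-reflexive 2+)) λ m f sv →
      let open Saving sv
          e₁ : + (K + K) ℤ.+ m 0 ≡ + (n + (K + K))
          e₁ = cong (ℤ._+_ (+ (K + K))) size ∙ sym (ℤₚ.pos-+ (K + K) n) ∙ cong +_ (ℕₚ.+-comm (K + K) n)
          e₂ : (+ (K + K) ℤ.+ m 0) ℤ.* m 0 ≡ + D
          e₂ = cong₂ ℤ._*_ e₁ size ∙ sym (ℤₚ.pos-* (n + (K + K)) n) ∙ cong +_ (ℕₚ.*-comm (n + (K + K)) n)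
          m₁ = effects originCode m
          old : ∀ {c} → c ≢ 1 → m₁ c ≡ m c
          old c≢ = effects-untouched originCode m (c≢ ∘ sym , c≢ ∘ sym , c≢ ∘ sym , tt)
          high : ∀ {c} → K ≤ c → c ≢ 1
          high = λ { K≤c refl → ℕₚ.<⇒≱ (ℕₚ.<-≤-trans (s≤s (s≤s z≤n)) (ℕₚ.<⇒≤ 8<K)) K≤c }
      in
      exec-++ {c₁ = originCode} {Q = λ m′ → m₁ ≡ m′}
        (go f (ℕₚ.≤-trans K+K≤D D≤W) λ f₁ → go f₁ (eq≤ e₁ (ℕₚ.≤-trans (ℕₚ.m≤n*m _ n) D≤W)) λ f₂ →
         go f₂ (eq≤ e₂ D≤W) λ f₃ → stop f₃ refl) λ { _ f₃ refl →
      weaken (startCode-ok 2 f₃ (old {0} (λ ()) ∙ size) n²≤W) λ { (e2 , e3 , same) →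
        copying-stable 0 m₁ _ same
          ( rep (old (λ ()) ∙ size) e₂
              (λ {r} _ a → old (high (K≤at-array r a)) ∙ empty (ℕₚ.m≤m+n D _) ∙ copied-zero r a)
          , λ i i< → old (high (K≤source i)) ∙ source-kept m sv i i< )
        , e2 , e3 } }
      where
      2+ : 2 + (K ∸ 2) ≡ K
      2+ = ℕₚ.m+[n∸m]≡n (ℕₚ.≤-trans (s≤s (s≤s z≤n)) 8<K)
      n²≤W : n ^ 2 ≤ W
      n²≤W = ℕₚ.≤-trans (ℕₚ.m≤n*m (n ^ 2) R {{ℕ.>-nonZero 0<R}}) (ℕₚ.≤-trans (ℕₚ.m≤m+n _ 0) (ℕₚ.≤-trans (ℕₚ.m≤n+m _ D) extent≤W))
      source-kept : ∀ m → Saving (2 + (K ∸ 2)) m → ∀ i → i < n * n → m (source i) ≡ m₀ (suc i)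
      source-kept m sv i i< with source-spec i
      ... | inj₁ (eq , K≤) = cong m eq ∙ Saving.kept sv (subst (_≤ suc i) (sym 2+) K≤) (inj₂ i<)
      ... | inj₂ (eq , <K) = cong m eq ∙ Saving.moved sv (s≤s z≤n) (subst (suc i <_) (sym 2+) <K)

    -- The convention that division by zero gives zero turns `x quot x` into the indicator of
    -- `x ≠ 0`.
    quot-self : ∀ x → (+ x) quot (+ x) ≡ + ifZero x 0 1
    quot-self zero    = refl
    quot-self (suc x) = quot-pos (suc x) (suc x) ∙ cong +_ (DivMod.n/n≡1 (suc x))

    module _ (0<R : 0 < R) (j : ℕ) (j<n² : j < n ^ 2) where
      private
        t = suc j
        x = (K ∸ 1) ℕ./ t
        bit : ℕ
        bit = ifZero x 0 1
        bit≤1 : ∀ x → ifZero x 0 1 ≤ 1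
        bit≤1 zero    = z≤n
        bit≤1 (suc _) = s≤s z≤n
        u = saved t ∸ t
        t≤s : t ≤ saved t
        t≤s = ℕₚ.≤-trans (ℕₚ.m≤n+m t K) (K+i≤saved t)
        j<nn : j < n * n
        j<nn = subst (j <_) (cong (n *_) (ℕₚ.*-identityʳ n)) j<n²
        s≤W : saved t ≤ W
        s≤W = ℕₚ.≤-trans (ℕₚ.*-monoʳ-≤ n (ℕₚ.+-monoʳ-≤ n (ℕₚ.+-monoʳ-≤ K j<n²))) saved≤W
        t≤W = ℕₚ.≤-trans t≤s s≤W
        u≤W = ℕₚ.≤-trans (ℕₚ.m∸n≤m (saved t) t) s≤W
        1≤W : 1 ≤ W
        1≤W = ℕₚ.≤-trans (s≤s z≤n) t≤W
        ad≤W : at-array 0 j ≤ W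
        ad≤W = ℕₚ.≤-trans (ℕₚ.+-monoʳ-≤ D (ℕₚ.+-monoˡ-≤ 0 (ℕₚ.*-monoʳ-≤ R (ℕₚ.<⇒≤ j<n²)))) extent≤W
        K≤ad = K≤at-array 0 j

      testCode-ok : ∀ {m} → Fitting W m → m 2 ≡ + j →
        Exec W testCode m (λ m′ → m′ 4 ≡ + t × m′ 6 ≡ + bit × (∀ c → c ≢ 4 → c ≢ 6 → m′ c ≡ m c))
      testCode-ok {m} fit m2 =
        go fit 1≤W λ f₁ →
        go f₁ (eq≤ e₁ t≤W) λ f₂ →
        go f₂ (ℕₚ.≤-trans (ℕₚ.m∸n≤m K 1) (ℕₚ.≤-trans K≤D D≤W)) λ f₃ →
        go f₃ (eq≤ e₂ (ℕₚ.≤-trans (DivMod.m/n≤m (K ∸ 1) (suc j)) (ℕₚ.≤-trans (ℕₚ.m∸n≤m K 1) (ℕₚ.≤-trans K≤D D≤W)))) λ f₄ →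
        go f₄ (eq≤ e₃ (ℕₚ.≤-trans (bit≤1 x) 1≤W)) λ f₅ →
        stop f₅ (e₁ , e₃ , λ c n4 n6 → effects-untouched testCode m (n6 ∘ sym , n4 ∘ sym , n6 ∘ sym , n6 ∘ sym , n6 ∘ sym , tt))
        where
        e₁ : m 2 ℤ.+ + 1 ≡ + t
        e₁ = cong (ℤ._+ + 1) m2 ∙ sym (ℤₚ.pos-+ j 1) ∙ cong +_ (ℕₚ.+-comm j 1)
        e₂ : (+ (K ∸ 1)) quot (m 2 ℤ.+ + 1) ≡ + x
        e₂ = cong (_quot_ (+ (K ∸ 1))) e₁ ∙ quot-pos (K ∸ 1) t
        q = (+ (K ∸ 1)) quot (m 2 ℤ.+ + 1)
        e₃ : (q quot q) ≡ + bit
        e₃ = cong₂ _quot_ e₂ e₂ ∙ quot-self x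

      -- The address is selected by arithmetic, as t + (`saved t` - t) · bit. The difference does
      -- not become negative because `saved t` is at least t.
      locateCode-ok : ∀ {m} → Fitting W m → m 0 ≡ + n → m 4 ≡ + t → m 6 ≡ + bit →
        Exec W locateCode m (λ m′ → m′ 4 ≡ + source j × (∀ c → c ≢ 4 → c ≢ 5 → m′ c ≡ m c))
      locateCode-ok {m} fit m0 m4 m6 =
        go fit (ℕₚ.≤-trans K≤D D≤W) λ f₆ →
        go f₆ (eq≤ e₄ (ℕₚ.≤-trans (K+i≤saved t) s≤W)) λ f₇ →
        go f₇ (eq≤ e₅ (ℕₚ.≤-trans (ℕₚ.m≤n*m _ n) s≤W)) λ f₈ →
        go f₈ (eq≤ e₆ s≤W) λ f₉ →
        go f₉ (eq≤ e₇ u≤W) λ f₁₀ →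
        go f₁₀ (eq≤ e₈ (ℕₚ.≤-trans (ℕₚ.*-monoʳ-≤ u (bit≤1 x)) (ℕₚ.≤-trans (ℕₚ.≤-reflexive (ℕₚ.*-identityʳ u)) u≤W))) λ f₁₁ →
        go f₁₁ (eq≤ e₉ (ℕₚ.≤-trans (ℕₚ.<⇒≤ (source<D j j<nn)) D≤W)) λ f₁₂ →
        stop f₁₂ (e₉ , λ c n4 n5 → effects-untouched locateCode m
          (n5 ∘ sym , n5 ∘ sym , n5 ∘ sym , n5 ∘ sym , n5 ∘ sym , n5 ∘ sym , n4 ∘ sym , tt))
        where
        e₄ : + K ℤ.+ m 4 ≡ + (K + t)
        e₄ = cong (ℤ._+_ (+ K)) m4 ∙ sym (ℤₚ.pos-+ K t)
        e₅ : + K ℤ.+ m 4 ℤ.+ m 0 ≡ + (n + (K + t))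
        e₅ = cong₂ ℤ._+_ e₄ m0 ∙ sym (ℤₚ.pos-+ (K + t) n) ∙ cong +_ (ℕₚ.+-comm (K + t) n)
        e₆ : (+ K ℤ.+ m 4 ℤ.+ m 0) ℤ.* m 0 ≡ + saved t
        e₆ = cong₂ ℤ._*_ e₅ m0 ∙ sym (ℤₚ.pos-* (n + (K + t)) n) ∙ cong +_ (ℕₚ.*-comm (n + (K + t)) n)
        e₇ : (+ K ℤ.+ m 4 ℤ.+ m 0) ℤ.* m 0 ℤ.- m 4 ≡ + u
        e₇ = cong₂ ℤ._-_ (e₆ ∙ cong +_ (sym (ℕₚ.m∸n+n≡m t≤s))) m4 ∙ pos-minus u t
        e₈ : ((+ K ℤ.+ m 4 ℤ.+ m 0) ℤ.* m 0 ℤ.- m 4) ℤ.* m 6 ≡ + (u * bit)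
        e₈ = cong₂ ℤ._*_ e₇ m6 ∙ sym (ℤₚ.pos-* u bit)
        pick : ∀ y → t + u * ifZero y 0 1 ≡ ifZero y t (saved t)
        pick zero    = cong (t ℕ.+_) (ℕₚ.*-zeroʳ u) ∙ ℕₚ.+-identityʳ t
        pick (suc _) = cong (t ℕ.+_) (ℕₚ.*-identityʳ u) ∙ ℕₚ.m+[n∸m]≡n t≤s
        e₉ : m 4 ℤ.+ ((+ K ℤ.+ m 4 ℤ.+ m 0) ℤ.* m 0 ℤ.- m 4) ℤ.* m 6 ≡ + source j
        e₉ = cong₂ ℤ._+_ m4 e₈ ∙ sym (ℤₚ.pos-+ t (u * bit)) ∙ cong +_ (pick x)

      transferCode-ok : ∀ {m} → Fitting W m → m 1 ≡ + D → m 2 ≡ + j → m 4 ≡ + source j → m (source j) ≡ m₀ t →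
        Exec W transferCode m (λ m′ → m′ 5 ≡ + at-array 0 j × m′ 7 ≡ m₀ t × (∀ c → c ≢ 5 → c ≢ 6 → c ≢ 7 → m′ c ≡ m c))
      transferCode-ok {m} fit m1 m2 m4 src =
        go fit (fit _) λ f₁₃ →
        go f₁₃ R≤W λ f₁₄ →
        go f₁₄ (eq≤ e₁₁ (ℕₚ.≤-trans (ℕₚ.m≤n+m (R * j + 0) D) ad≤W)) λ f₁₅ →
        go f₁₅ (eq≤ e₁₂ ad≤W) λ f₁₆ →
        stop f₁₆ (e₁₂ , cong (λ z → m ℤ.∣ z ∣) m4 ∙ src , λ c n5 n6 n7 → effects-untouched transferCode m
          (n7 ∘ sym , n6 ∘ sym , n5 ∘ sym , n5 ∘ sym , tt))
        where
        e₁₁ : m 2 ℤ.* + R ≡ + (R * j + 0)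
        e₁₁ = cong (ℤ._* + R) m2 ∙ sym (ℤₚ.pos-* j R) ∙ cong +_ (ℕₚ.*-comm j R ∙ sym (ℕₚ.+-identityʳ _))
        e₁₂ : m 2 ℤ.* + R ℤ.+ m 1 ≡ + at-array 0 j
        e₁₂ = cong₂ ℤ._+_ e₁₁ m1 ∙ sym (ℤₚ.pos-+ (R * j + 0) D) ∙ cong +_ (ℕₚ.+-comm (R * j + 0) D)

      private
        out : ∀ {c} → K ≤ c → c ≤ 8 → ⊥
        out K≤c c≤8 = ℕₚ.<⇒≱ (low c≤8) K≤c
        off : ∀ a {_ : True (4 ℕ.≤? a)} {_ : True (a ℕ.≤? 8)} {c} → c < 4 ⊎ K ≤ c → c ≢ a
        off a {p} {q} (inj₁ c<4) refl = ℕₚ.<⇒≱ c<4 (toWitness p)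
        off a {p} {q} (inj₂ K≤c) refl = out K≤c (toWitness q)

      copy-ok : ∀ m → Fitting W m → Copying j m → m 2 ≡ + j → m 3 ≡ + (n ^ 2) →
        Exec W copyCode m (λ m′ → Copying (suc j) m′ × m′ 2 ≡ + j × m′ 3 ≡ + (n ^ 2))
      copy-ok m fit (rp , src) m2 m3 =
        exec-++ (testCode-ok fit m2) λ m₁ f₁ (e₄ , e₆ , keep₁) →
        exec-++ (locateCode-ok f₁ (keep₁ 0 (λ ()) (λ ()) ∙ cell-n rp) e₄ e₆) λ m₂ f₂ (e₄′ , keep₂) →
        let old₂ : ∀ c → c < 4 ⊎ K ≤ c → m₂ c ≡ m c
            old₂ c o = keep₂ c (off 4 o) (off 5 o) ∙ keep₁ c (off 4 o) (off 6 o)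
        in
        exec-++ (transferCode-ok f₂ (old₂ 1 (inj₁ (s≤s (s≤s z≤n))) ∙ cell-D rp) (old₂ 2 (inj₁ (s≤s (s≤s (s≤s z≤n)))) ∙ m2) e₄′
          (old₂ _ (inj₂ (K≤source j)) ∙ src j j<nn)) λ m₃ f₃ (e₅ , e₇ , keep₃) →
        let old : ∀ c → c < 4 ⊎ K ≤ c → m₃ c ≡ m c
            old c o = keep₃ c (off 5 o) (off 6 o) (off 7 o) ∙ old₂ c o
        in
        go f₃ (f₃ 7) λ f₄ → stop f₄ (finish m rp src m2 m3 m₃ (cong ℤ.∣_∣ e₅) e₇ old)
        where
        finish : ∀ m → Rep (copied j) m → (∀ i → i < n * n → m (source i) ≡ m₀ (suc i)) → m 2 ≡ + j → m 3 ≡ + (n ^ 2) →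
          ∀ m₁₆ → ℤ.∣ m₁₆ 5 ∣ ≡ at-array 0 j → m₁₆ 7 ≡ m₀ t → (∀ c → c < 4 ⊎ K ≤ c → m₁₆ c ≡ m c) →
          Copying (suc j) (m₁₆ [ ℤ.∣ m₁₆ 5 ∣ ≔ m₁₆ 7 ])
            × (m₁₆ [ ℤ.∣ m₁₆ 5 ∣ ≔ m₁₆ 7 ]) 2 ≡ + j × (m₁₆ [ ℤ.∣ m₁₆ 5 ∣ ≔ m₁₆ 7 ]) 3 ≡ + (n ^ 2)
        finish m rp src m2 m3 m₁₆ at≡ read old =
          ( ( rep (other (λ eq → out (subst (K ≤_) eq K≤ad) (ℕₚ.m≤m+n 0 8)) ∙ old 0 (inj₁ (s≤s z≤n)) ∙ cell-n rp)
                  (other (λ eq → out (subst (K ≤_) eq K≤ad) (ℕₚ.m≤m+n 1 7)) ∙ old 1 (inj₁ (s≤s (s≤s z≤n))) ∙ cell-D rp)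
                  updated
            , λ i i< → other (λ eq → ℕₚ.<⇒≱ (source<D i i<) (subst (D ≤_) eq (ℕₚ.m≤m+n D _))) ∙ old _ (inj₂ (K≤source i)) ∙ src i i< )
          , other (λ eq → out (subst (K ≤_) eq K≤ad) (ℕₚ.m≤m+n 2 6)) ∙ old 2 (inj₁ (s≤s (s≤s (s≤s z≤n)))) ∙ m2
          , other (λ eq → out (subst (K ≤_) eq K≤ad) (ℕₚ.m≤m+n 3 5)) ∙ old 3 (inj₁ (s≤s (s≤s (s≤s (s≤s z≤n))))) ∙ m3 )
          where
          other : ∀ {c} → at-array 0 j ≢ c → (m₁₆ [ ℤ.∣ m₁₆ 5 ∣ ≔ m₁₆ 7 ]) c ≡ m₁₆ c
          other ne = update-other m₁₆ _ (m₁₆ 7) (λ eq → ne (sym at≡ ∙ eq))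
          updated : ∀ {r} → r < R → ∀ a → (m₁₆ [ ℤ.∣ m₁₆ 5 ∣ ≔ m₁₆ 7 ]) (at-array r a) ≡ copied (suc j) r a
          updated {r} r<R a = by (r ℕ.≟ 0) (a ℕ.≟ j)
            where
            unchanged : copied j r a ≡ copied (suc j) r a → at-array 0 j ≢ at-array r a →
              (m₁₆ [ ℤ.∣ m₁₆ 5 ∣ ≔ m₁₆ 7 ]) (at-array r a) ≡ copied (suc j) r a
            unchanged eq ne = other ne ∙ old _ (inj₂ (K≤at-array r a)) ∙ cells rp r<R a ∙ eq
            step≢ : a ≢ j → (if ⌊ a ℕ.<? j ⌋ then m₀ (suc a) else + 0) ≡ (if ⌊ a ℕ.<? suc j ⌋ then m₀ (suc a) else + 0)
            step≢ ne with a ℕ.<? j | a ℕ.<? suc j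
            ... | yes _ | yes _ = refl
            ... | no  _ | no  _ = refl
            ... | yes p | no ¬q = contradiction (ℕₚ.m≤n⇒m≤1+n p) ¬q
            ... | no ¬p | yes q = contradiction (ℕₚ.≤∧≢⇒< (ℕₚ.≤-pred q) ne) ¬p
            step= : m₀ (suc j) ≡ (if ⌊ j ℕ.<? suc j ⌋ then m₀ (suc j) else + 0)
            step= with j ℕ.<? suc j
            ... | yes _ = refl
            ... | no ¬p = contradiction (ℕₚ.n<1+n j) ¬p
            by : Dec (r ≡ 0) → Dec (a ≡ j) → (m₁₆ [ ℤ.∣ m₁₆ 5 ∣ ≔ m₁₆ 7 ]) (at-array r a) ≡ copied (suc j) r a
            by (yes refl) (yes refl) = cong (λ z → (m₁₆ [ z ≔ m₁₆ 7 ]) (at-array 0 j)) at≡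
              ∙ update-same m₁₆ (at-array 0 j) (m₁₆ 7) ∙ read ∙ step=
            by (yes refl) (no a≢j) = unchanged (step≢ a≢j) (λ eq → a≢j (sym (proj₂ (at-array-injective {a = j} 0<R r<R eq))))
            by (no r≢0) _ = unchanged (same r r≢0) (λ eq → r≢0 (sym (proj₁ (at-array-injective {a = j} 0<R r<R eq))))
              where
              same : ∀ r → r ≢ 0 → copied j r a ≡ copied (suc j) r a
              same zero    ne = contradiction refl ne
              same (suc _) ne = refl

    input-cost : ℕ
    input-cost = length setupCode + n ^ 2 * (length copyCode + 4)

    inputCode-ok : ∀ {prog} → 0 < R → Located prog 0 inputCode →
      ∃[ m ] Reach prog W (0 , m₀) input-cost (length inputCode , m) × Fitting W m × Rep (inputArrays m₀) m
    inputCode-ok {prog} 0<R loc = proj₁ l , reach , proj₁ (proj₂ (proj₂ l)) , rep-cong complete (proj₁ (proj₂ (proj₂ (proj₂ l))))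
      where
      instance
        T≢0 : NonZero (n ^ 2)
        T≢0 = ℕₚ.m^n≢0 n 2
      e = setup-ok 0<R
      n²≤W : n ^ 2 ≤ W
      n²≤W = ℕₚ.≤-trans (ℕₚ.m≤n*m (n ^ 2) R {{ℕ.>-nonZero 0<R}}) (ℕₚ.≤-trans (ℕₚ.m≤m+n _ 0) (ℕₚ.≤-trans (ℕₚ.m≤n+m _ D) extent≤W))
      l = loop-from (located-++ʳ setupCode loc) n²≤W (ℕₚ.≤-trans (ℕ.>-nonZero⁻¹ (n ^ 2)) n²≤W)
            Copying copying-stable (λ j m j< → copy-ok 0<R j j< m) (ℕ.pred (n ^ 2)) 0 (result e)
            (ℕₚ.suc-pred (n ^ 2)) (fitting e) (proj₁ (post e)) (proj₁ (proj₂ (post e))) (proj₂ (proj₂ (post e)))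
      reach : Reach prog W (0 , m₀) input-cost (length inputCode , proj₁ l)
      reach = reach-time (cong (λ z → length setupCode + z * (length copyCode + 4)) (ℕₚ.suc-pred (n ^ 2)))
        (reach-pc (sym (Listₚ.length-++ setupCode))
          (reach-trans (exec-reach (located-++ˡ setupCode loc) e) (proj₁ (proj₂ l))))
      complete : ∀ r a → copied (n ^ 2) r a ≡ inputArrays m₀ r a
      complete r a with r ℕ.≟ 0
      ... | no  _ = refl
      ... | yes _ with a ℕ.<? n ^ 2
      ... | yes _ = refl
      ... | no ¬p = sym (beyond (suc a) (s≤s (subst (_≤ a) (cong (n *_) (ℕₚ.*-identityʳ n)) (ℕₚ.≮⇒≥ ¬p))))

-- Relocating a subroutine

replace : ℕ → Memory → Arrays → Arrays
replace r q arr r′ a = if ⌊ r ℕ.≟ r′ ⌋ then q a else arr r′ a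

replace-same : ∀ r q arr a → replace r q arr r a ≡ q a
replace-same r q arr a with r ℕ.≟ r
... | yes _ = refl
... | no ne = contradiction refl ne

replace-other : ∀ {r r′} q arr a → r ≢ r′ → replace r q arr r′ a ≡ arr r′ a
replace-other {r} {r′} q arr a ne with r ℕ.≟ r′
... | yes eq = contradiction eq ne
... | no _   = refl

-- Counts only cells that are named in the instruction, with a sum as a bound for the maximum. Cells
-- reached through a pointer are bounded by the word size instead.
cellBound : Instr → ℕ
cellBound (const t _)          = t
cellBound (add t l r)          = t + (l + r)
cellBound (sub t l r)          = t + (l + r)
cellBound (mul t l r)          = t + (l + r)
cellBound (quotient t l r)     = t + (l + r)
cellBound (load t p)           = t + p
cellBound (store p s)          = p + s
cellBound (jump l)             = 0
cellBound (jumpIfPositive c l) = c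

cellsBound : Program → ℕ
cellsBound []       = 0
cellsBound (i ∷ is) = cellBound i + cellsBound is

fetch-cellBound : ∀ Q pc {i} → fetch Q pc ≡ just i → cellBound i ≤ cellsBound Q
fetch-cellBound (_ ∷ Q) zero     refl = ℕₚ.m≤m+n _ _
fetch-cellBound (j ∷ Q) (suc pc) eq   = ℕₚ.≤-trans (fetch-cellBound Q pc eq) (ℕₚ.m≤n+m _ (cellBound j))
fetch-cellBound []      zero     ()
fetch-cellBound []      (suc pc) ()

run-fitting : ∀ {Q W c t m} → Run Q W c t m → Fitting W (Config.memory c)
run-fitting (halt fit _)   = fit
run-fitting (step fit _ _) = fit

-- The memory of a subroutine is array r; every instruction becomes a block of
-- fixed length, so that labels are translated linearly.
module CallCode (K R : ℕ) where

  fetchCell putCell : ℕ → ℕ → ℕ → List Instr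
  fetchCell r dst a = const 5 (+ (R * a + r)) ∷ add 5 5 1 ∷ load dst 5 ∷ []
  putCell   r a src = const 5 (+ (R * a + r)) ∷ add 5 5 1 ∷ store 5 src ∷ []

  -- |x| = x (2 s + 1), where s = ⌊ x / (x² + 1) ⌋ is 0 or -1.
  signCode absCode : List Instr
  signCode = mul 7 6 6 ∷ const 5 (+ 1) ∷ add 7 7 5 ∷ quotient 7 6 7 ∷ []
  absCode  = signCode ++ add 7 7 7 ∷ add 7 7 5 ∷ mul 6 6 7 ∷ []

  pointerCode : ℕ → List Instr
  pointerCode r = const 5 (+ R) ∷ mul 6 6 5 ∷ const 5 (+ r) ∷ add 6 6 5 ∷ add 6 6 1 ∷ []

  plainCode : ℕ → Instr → List Instr
  plainCode r (const t z)          = (const 6 z ∷ []) ++ putCell r t 6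
  plainCode r (add t a b)          = fetchCell r 6 a ++ fetchCell r 7 b ++ (add 6 6 7 ∷ []) ++ putCell r t 6
  plainCode r (sub t a b)          = fetchCell r 6 a ++ fetchCell r 7 b ++ (sub 6 6 7 ∷ []) ++ putCell r t 6
  plainCode r (mul t a b)          = fetchCell r 6 a ++ fetchCell r 7 b ++ (mul 6 6 7 ∷ []) ++ putCell r t 6
  plainCode r (quotient t a b)     = fetchCell r 6 a ++ fetchCell r 7 b ++ (quotient 6 6 7 ∷ []) ++ putCell r t 6
  plainCode r (load t p)           = fetchCell r 6 p ++ absCode ++ pointerCode r ++ (load 6 6 ∷ []) ++ putCell r t 6
  plainCode r (store p s)          = fetchCell r 6 p ++ absCode ++ pointerCode r ++ fetchCell r 7 s ++ store 6 7 ∷ []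
  plainCode r (jump l)             = []
  plainCode r (jumpIfPositive c l) = fetchCell r 6 c

  exitCode : (ℕ → ℕ) → ℕ → Instr → List Instr
  exitCode label next (jump l)             = jump (label l) ∷ []
  exitCode label next (jumpIfPositive c l) = jumpIfPositive 6 (label l) ∷ jump next ∷ []
  exitCode label next _                    = jump next ∷ []

  -- 20 is the length of the longest translations, those of `load` and `store`, including the
  -- closing jump. The padding is never executed, since every translation ends with a jump.
  pad : List Instr → List Instr
  pad code = code ++ List.replicate (20 ∸ length code) (jump 0)

  block : ℕ → (ℕ → ℕ) → ℕ → Instr → List Instr
  block r label next i = pad (plainCode r i ++ exitCode label next i)

  blocks : ℕ → (ℕ → ℕ) → ℕ → Program → List Instr
  blocks r label o []       = []
  blocks r label o (i ∷ is) = block r label (o + 20) i ++ blocks r label (o + 20) is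

  -- The subroutine may halt by jumping to any label outside its code. Capping the label sends all
  -- of them to the place right behind the translated code, where the caller continues.
  labelFrom : ℕ → ℕ → ℕ → ℕ
  labelFrom o ℓ l = o + 20 * (l ℕ.⊓ ℓ)

  callCode : ℕ → ℕ → Program → List Instr
  callCode o r Q = blocks r (labelFrom o (length Q)) o Q

  block-length : ∀ r label next i → length (block r label next i) ≡ 20
  block-length r label next (const _ _)          = refl
  block-length r label next (add _ _ _)          = refl
  block-length r label next (sub _ _ _)          = refl
  block-length r label next (mul _ _ _)          = refl
  block-length r label next (quotient _ _ _)     = refl
  block-length r label next (load _ _)           = refl
  block-length r label next (store _ _)          = refl
  block-length r label next (jump _)             = refl
  block-length r label next (jumpIfPositive _ _) = refl

  blocks-length : ∀ r label o Q → length (blocks r label o Q) ≡ 20 * length Q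
  blocks-length r label o []      = refl
  blocks-length r label o (i ∷ Q) = Listₚ.length-++ (block r label (o + 20) i)
    ∙ cong₂ _+_ (block-length r label (o + 20) i) (blocks-length r label (o + 20) Q)
    ∙ sym (ℕₚ.*-suc 20 (length Q))

  located-block : ∀ {prog r label} o Q pc {i} → Located prog o (blocks r label o Q) → fetch Q pc ≡ just i →
    Located prog (o + 20 * pc) (block r label (o + 20 * pc + 20) i)
  located-block {prog} {r} {label} o (i ∷ Q) zero loc refl =
    subst (λ z → Located prog z (block r label (z + 20) i)) (sym (ℕₚ.+-identityʳ o)) (located-++ˡ (block r label (o + 20) i) loc)
  located-block {prog} {r} {label} o (i ∷ Q) (suc pc) {i′} loc eq =
    subst (λ z → Located prog z (block r label (z + 20) i′))
      (ℕₚ.+-assoc o 20 (20 * pc) ∙ cong (o ℕ.+_) (sym (ℕₚ.*-suc 20 pc)))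
      (located-block (o + 20) Q pc
        (subst (λ z → Located prog (o + z) (blocks r label (o + 20) Q)) (block-length r label (o + 20) i)
          (located-++ʳ (block r label (o + 20) i) loc)) eq)
  located-block o [] zero    loc ()
  located-block o [] (suc _) loc ()

square-pos : ∀ x → x ℤ.* x ≡ + (ℤ.∣ x ∣ * ℤ.∣ x ∣)
square-pos (+ a)    = sym (ℤₚ.pos-* a a)
square-pos -[1+ a ] = refl

private
  a<1+a*a : ∀ a → a < suc (a * a)
  a<1+a*a zero    = s≤s z≤n
  a<1+a*a (suc a) = s≤s (ℕₚ.m≤m*n (suc a) (suc a))

quot-sign⁺ : ∀ a → (+ a) quot (+ suc (a * a)) ≡ + 0
quot-sign⁺ a = quot-pos a (suc (a * a)) ∙ cong +_ (DivMod.m<n⇒m/n≡0 (a<1+a*a a))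

-- Integer division leaves a nonnegative remainder, so a value strictly between -1 and 0 is rounded
-- down to -1. The nonzero remainder selects this case in the definition of the division.
quot-sign⁻ : ∀ a → -[1+ a ] quot (+ suc (suc a * suc a)) ≡ -[1+ 0 ]
quot-sign⁻ a with suc a ℕ.% suc (suc a * suc a) | DivMod.m<n⇒m%n≡m (a<1+a*a (suc a))
... | _ | refl = cong (λ z → + 1 ℤ.* -[1+ z ]) (DivMod.m<n⇒m/n≡0 (a<1+a*a (suc a)))

module Calls (K R n W : ℕ) (8<K : 8 < K) .{{nz : NonZero n}} (R≤W : R ≤ W) where

  open Code K R
  open CallCode K R
  open Correct K R n W 8<K
  open Loops K R n W 8<K R≤W

  module _ (r : ℕ) (r<R : r < R) (arr : Arrays) (M : ℕ) (M≤W : at-array r M ≤ W) (MM≤W : 2 + M * M ≤ W) where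

    within : ∀ {a} → a ≤ M → at-array r a ≤ W
    within a≤M = ℕₚ.≤-trans (ℕₚ.+-monoʳ-≤ D (ℕₚ.+-monoˡ-≤ r (ℕₚ.*-monoʳ-≤ R a≤M))) M≤W

    holds : ∀ {q m} → Rep (replace r q arr) m → ∀ a → m (at-array r a) ≡ q a
    holds {q} rp a = cells rp r<R a ∙ replace-same r q arr a

    rep-keep : ∀ {q m m′} → Rep (replace r q arr) m → (∀ c → c ≢ 5 → c ≢ 6 → c ≢ 7 → m′ c ≡ m c) → Rep (replace r q arr) m′
    rep-keep rp keep = rep-same (λ c out → keep c (ne (ℕₚ.m≤m+n 2 3) (ℕₚ.m≤m+n 5 3) out)
      (ne (ℕₚ.m≤m+n 2 4) (ℕₚ.m≤m+n 6 2) out) (ne (ℕₚ.m≤m+n 2 5) (ℕₚ.m≤m+n 7 1) out)) rp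
      where
      ne : ∀ {a c} → 2 ≤ a → a ≤ 8 → c < 2 ⊎ K ≤ c → c ≢ a
      ne 2≤a a≤8 out eq = apart 2≤a (low a≤8) out (sym eq)

    rep-store : ∀ {q m} t z → Rep (replace r q arr) m → Rep (replace r (q [ t ≔ z ]) arr) (m [ at-array r t ≔ z ])
    rep-store {q} {m} t z rp = rep
      (update-other m _ z (small 0 z≤n) ∙ cell-n rp)
      (update-other m _ z (small 1 (s≤s z≤n)) ∙ cell-D rp)
      (λ {r′} r′< a → by r′< a (r ℕ.≟ r′) (t ℕ.≟ a))
      where
      small : ∀ c → c ≤ 8 → at-array r t ≢ c
      small c c≤8 refl = ℕₚ.<⇒≱ (low c≤8) (K≤at-array r t)
      by : ∀ {r′} → r′ < R → ∀ a → Dec (r ≡ r′) → Dec (t ≡ a) →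
           (m [ at-array r t ≔ z ]) (at-array r′ a) ≡ replace r (q [ t ≔ z ]) arr r′ a
      by r′< a (yes refl) (yes refl) = update-same m _ z ∙ sym (replace-same r (q [ t ≔ z ]) arr t ∙ update-same q t z)
      by r′< a (yes refl) (no ne) = update-other m _ z (ne ∘ proj₂ ∘ at-array-injective {a = t} r<R r<R)
        ∙ holds rp a ∙ sym (replace-same r (q [ t ≔ z ]) arr a ∙ update-other q t z ne)
      by r′< a (no ne) _ = update-other m _ z (ne ∘ proj₁ ∘ at-array-injective {a = t} r<R r′<)
        ∙ cells rp r′< a ∙ replace-other q arr a ne ∙ sym (replace-other (q [ t ≔ z ]) arr a ne)

    private
      static : ∀ a → + (R * a + r) ℤ.+ + D ≡ + at-array r a
      static a = sym (ℤₚ.pos-+ (R * a + r) D) ∙ cong +_ (ℕₚ.+-comm (R * a + r) D)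

    fetchCell-ok : ∀ {q m} dst a → 5 ≢ dst → a ≤ M → Fitting W m → Rep (replace r q arr) m →
      Exec W (fetchCell r dst a) m (λ m′ → m′ dst ≡ q a × (∀ c → c ≢ 5 → c ≢ dst → m′ c ≡ m c))
    fetchCell-ok {q} {m} dst a 5≢ a≤M fit rp =
      go fit (ℕₚ.≤-trans (ℕₚ.m≤n+m (R * a + r) D) (within a≤M)) λ f₁ →
      go f₁ (eq≤ e₁ (within a≤M)) λ f₂ →
      go f₂ (f₂ ℤ.∣ + (R * a + r) ℤ.+ m 1 ∣) λ f₃ →
      stop f₃ (update-same m₂ dst _ ∙ cong (λ z → m₂ ℤ.∣ z ∣) e₁
                 ∙ effects-untouched (const 5 (+ (R * a + r)) ∷ add 5 5 1 ∷ []) m (ne , ne , tt) ∙ holds rp a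
              , λ c n5 nd → effects-untouched (fetchCell r dst a) m (n5 ∘ sym , n5 ∘ sym , nd ∘ sym , tt))
      where
      m₂ = effects (const 5 (+ (R * a + r)) ∷ add 5 5 1 ∷ []) m
      e₁ : + (R * a + r) ℤ.+ m 1 ≡ + at-array r a
      e₁ = cong (ℤ._+_ (+ (R * a + r))) (cell-D rp) ∙ static a
      ne : 5 ≢ at-array r a
      ne eq = ℕₚ.<⇒≱ (low (ℕₚ.m≤m+n 5 3)) (subst (K ≤_) (sym eq) (K≤at-array r a))

    putCell-ok : ∀ {q m z} a → a ≤ M → Fitting W m → Rep (replace r q arr) m → m 6 ≡ z →
      Exec W (putCell r a 6) m (Rep (replace r (q [ a ≔ z ]) arr))
    putCell-ok {q} {m} a a≤M fit rp refl =
      go fit (ℕₚ.≤-trans (ℕₚ.m≤n+m (R * a + r) D) (within a≤M)) λ f₁ →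
      go f₁ (eq≤ e₁ (within a≤M)) λ f₂ →
      go f₂ (f₂ 6) λ f₃ →
      stop f₃ (subst (λ z → Rep (replace r (q [ a ≔ m 6 ]) arr) (m₂ [ z ≔ m 6 ])) (sym (cong ℤ.∣_∣ e₁))
        (rep-store a (m 6) (rep-keep rp (λ c n5 _ _ →
          effects-untouched (const 5 (+ (R * a + r)) ∷ add 5 5 1 ∷ []) m (n5 ∘ sym , n5 ∘ sym , tt)))))
      where
      m₂ = effects (const 5 (+ (R * a + r)) ∷ add 5 5 1 ∷ []) m
      e₁ : + (R * a + r) ℤ.+ m 1 ≡ + at-array r a
      e₁ = cong (ℤ._+_ (+ (R * a + r))) (cell-D rp) ∙ static a

    private
      1≤W : 1 ≤ W
      1≤W = ℕₚ.≤-trans (s≤s z≤n) MM≤W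

    -- An address stands for its absolute value, but scaling by `R` and shifting does not respect
    -- the sign; hence the sign is removed before the pointer is relocated. The square in the sign
    -- computation is the reason for the bound `2 + M * M` on words.
    absCode-ok : ∀ {m} → Fitting W m → ℤ.∣ m 6 ∣ ≤ M →
      Exec W absCode m (λ m′ → m′ 6 ≡ + ℤ.∣ m 6 ∣ × (∀ c → c ≢ 5 → c ≢ 6 → c ≢ 7 → m′ c ≡ m c))
    absCode-ok {m} fit x≤M =
      exec-++ {c₁ = signCode} {Q = λ m′ → Sign (m 6) (m′ 7) × m′ 5 ≡ + 1 × (∀ c → c ≢ 5 → c ≢ 7 → m′ c ≡ m c)}
        (go fit (eq≤ e₁ (ℕₚ.≤-trans (ℕₚ.n≤1+n _) sq≤W)) λ f₁ →
         go f₁ 1≤W λ f₂ →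
         go f₂ (eq≤ e₂ sq≤W) λ f₃ →
         go f₃ (sign≤ sg) λ f₄ →
         stop f₄ (sg , refl , λ c n5 n7 → effects-untouched signCode m (n7 ∘ sym , n5 ∘ sym , n7 ∘ sym , n7 ∘ sym , tt)))
      λ m₁ f₁ (sg₁ , e5 , keep) →
      let e₆ = keep 6 (λ ()) (λ ()) in
      go f₁ (double≤ sg₁) λ f₂ →
      go f₂ (subst (λ z → ℤ.∣ m₁ 7 ℤ.+ m₁ 7 ℤ.+ z ∣ ≤ W) (sym e5) (odd≤ sg₁)) λ f₃ →
      go f₃ (eq≤ (cong₂ (λ x o → x ℤ.* (m₁ 7 ℤ.+ m₁ 7 ℤ.+ o)) e₆ e5 ∙ abs≡ sg₁) (ℕₚ.≤-trans x≤M (ℕₚ.≤-trans M≤MM (ℕₚ.≤-trans (ℕₚ.m≤n+m (M * M) 2) MM≤W)))) λ f₄ →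
      stop f₄ (cong₂ (λ x o → x ℤ.* (m₁ 7 ℤ.+ m₁ 7 ℤ.+ o)) e₆ e5 ∙ abs≡ sg₁
        , λ c n5 n6 n7 → effects-untouched (add 7 7 7 ∷ add 7 7 5 ∷ mul 6 6 7 ∷ []) m₁ (n7 ∘ sym , n7 ∘ sym , n6 ∘ sym , tt) ∙ keep c n5 n7)
      where
      data Sign : ℤ → ℤ → Set where
        plus : ∀ {a} → Sign (+ a) (+ 0)
        minus    : ∀ {a} → Sign -[1+ a ] -[1+ 0 ]
      M≤MM : M ≤ M * M
      M≤MM = lemma M
        where
        lemma : ∀ M → M ≤ M * M
        lemma zero    = z≤n
        lemma (suc M) = ℕₚ.m≤m*n (suc M) (suc M)
      sq≤W : suc (ℤ.∣ m 6 ∣ * ℤ.∣ m 6 ∣) ≤ W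
      sq≤W = ℕₚ.≤-trans (s≤s (ℕₚ.*-mono-≤ x≤M x≤M)) (ℕₚ.≤-trans (ℕₚ.n≤1+n _) MM≤W)
      e₁ : m 6 ℤ.* m 6 ≡ + (ℤ.∣ m 6 ∣ * ℤ.∣ m 6 ∣)
      e₁ = square-pos (m 6)
      e₂ : m 6 ℤ.* m 6 ℤ.+ + 1 ≡ + suc (ℤ.∣ m 6 ∣ * ℤ.∣ m 6 ∣)
      e₂ = cong (ℤ._+ + 1) e₁ ∙ cong +_ (ℕₚ.+-comm _ 1)
      sign : ∀ x → Sign x (x quot (+ suc (ℤ.∣ x ∣ * ℤ.∣ x ∣)))
      sign (+ a)    = subst (Sign (+ a)) (sym (quot-sign⁺ a)) plus
      sign -[1+ a ] = subst (Sign -[1+ a ]) (sym (quot-sign⁻ a)) minus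
      sg : Sign (m 6) (m 6 quot (m 6 ℤ.* m 6 ℤ.+ + 1))
      sg = subst (Sign (m 6)) (cong (m 6 quot_) (sym e₂)) (sign (m 6))
      sign≤ : ∀ {x s} → Sign x s → ℤ.∣ s ∣ ≤ W
      sign≤ plus = z≤n
      sign≤ minus    = 1≤W
      double≤ : ∀ {x s} → Sign x s → ℤ.∣ s ℤ.+ s ∣ ≤ W
      double≤ plus = z≤n
      double≤ minus    = ℕₚ.≤-trans (s≤s (s≤s z≤n)) MM≤W
      odd≤ : ∀ {x s} → Sign x s → ℤ.∣ s ℤ.+ s ℤ.+ + 1 ∣ ≤ W
      odd≤ plus = 1≤W
      odd≤ minus    = 1≤W
      abs≡ : ∀ {x s} → Sign x s → x ℤ.* (s ℤ.+ s ℤ.+ + 1) ≡ + ℤ.∣ x ∣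
      abs≡ {+ a} plus = ℤₚ.*-identityʳ (+ a)
      abs≡ { -[1+ a ]} minus = ℤₚ.*-comm -[1+ a ] -[1+ 0 ] ∙ ℤₚ.-1*i≡-i -[1+ a ]

    pointerCode-ok : ∀ {m} p → p ≤ M → Fitting W m → m 1 ≡ + D → m 6 ≡ + p →
      Exec W (pointerCode r) m (λ m′ → m′ 6 ≡ + at-array r p × (∀ c → c ≢ 5 → c ≢ 6 → m′ c ≡ m c))
    pointerCode-ok {m} p p≤M fit m1 m6 =
      go fit R≤W λ f₁ →
      go f₁ (eq≤ e₁ (ℕₚ.≤-trans (ℕₚ.m≤m+n (R * p) r) Rp≤W)) λ f₂ →
      go f₂ (ℕₚ.≤-trans (ℕₚ.<⇒≤ r<R) R≤W) λ f₃ →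
      go f₃ (eq≤ e₂ Rp≤W) λ f₄ →
      go f₄ (eq≤ e₃ (within p≤M)) λ f₅ →
      stop f₅ (e₃ , λ c n5 n6 → effects-untouched (pointerCode r) m (n5 ∘ sym , n6 ∘ sym , n5 ∘ sym , n6 ∘ sym , n6 ∘ sym , tt))
      where
      Rp≤W : R * p + r ≤ W
      Rp≤W = ℕₚ.≤-trans (ℕₚ.m≤n+m _ D) (within p≤M)
      e₁ : m 6 ℤ.* + R ≡ + (R * p)
      e₁ = cong (ℤ._* + R) m6 ∙ sym (ℤₚ.pos-* p R) ∙ cong +_ (ℕₚ.*-comm p R)
      e₂ : m 6 ℤ.* + R ℤ.+ + r ≡ + (R * p + r)
      e₂ = cong (ℤ._+ + r) e₁ ∙ sym (ℤₚ.pos-+ (R * p) r)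
      e₃ : m 6 ℤ.* + R ℤ.+ + r ℤ.+ m 1 ≡ + at-array r p
      e₃ = cong₂ ℤ._+_ e₂ m1 ∙ static p

module Simulation (K R n W : ℕ) (8<K : 8 < K) .{{nz : NonZero n}} (R≤W : R ≤ W) where

  open Code K R
  open CallCode K R
  open Correct K R n W 8<K
  open Loops K R n W 8<K R≤W
  open Calls K R n W 8<K R≤W

  -- `V` is the word size of the subroutine and `M` bounds the cells it can reach. Its words serve
  -- as addresses, whence `V ≤ M`.
  module _ (r : ℕ) (r<R : r < R) (arr : Arrays) (M : ℕ) (M≤W : at-array r M ≤ W) (MM≤W : 2 + M * M ≤ W)
           (V : ℕ) (V≤M : V ≤ M) where

    private
      V≤W : V ≤ W
      V≤W = ℕₚ.≤-trans (lemma V≤M) MM≤W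
        where
        lemma : ∀ {V M} → V ≤ M → V ≤ 2 + M * M
        lemma {V} {zero}  z≤n = z≤n
        lemma {V} {suc M} h   = ℕₚ.≤-trans h (ℕₚ.≤-trans (ℕₚ.m≤m*n (suc M) (suc M)) (ℕₚ.m≤n+m _ 2))

      Rep′ : Memory → Memory → Set
      Rep′ q m = Rep (replace r q arr) m

      written-≤ : ∀ {q : Memory} {t z} → Fitting V (q [ t ≔ z ]) → ℤ.∣ z ∣ ≤ W
      written-≤ {q} {t} {z} fit = ℕₚ.≤-trans (subst (λ w → ℤ.∣ w ∣ ≤ V) (update-same q t z) (fit t)) V≤W

    binary-ok : ∀ i {p : Plain i} (f : ℤ → ℤ → ℤ) → (∀ m → written i m ≡ f (m 6) (m 7)) →
      (∀ m → effect i m ≡ m [ 6 ≔ f (m 6) (m 7) ]) → ∀ {q m} t a b → t + (a + b) ≤ M →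
      Fitting V (q [ t ≔ f (q a) (q b) ]) → Fitting W m → Rep′ q m →
      Exec W (fetchCell r 6 a ++ fetchCell r 7 b ++ (i ∷ []) ++ putCell r t 6) m (Rep′ (q [ t ≔ f (q a) (q b) ]))
    binary-ok i {p} f w e {q} {m} t a b ≤M fitq fit rp =
      exec-++ (fetchCell-ok r r<R arr M M≤W MM≤W 6 a (λ ()) (ℕₚ.≤-trans (ℕₚ.≤-trans (ℕₚ.m≤m+n a b) (ℕₚ.m≤n+m (a + b) t)) ≤M) fit rp) λ m₁ f₁ (e₁ , keep₁) →
      let rp₁ = rep-keep r r<R arr M M≤W MM≤W rp (λ c n5 n6 n7 → keep₁ c n5 n6) in
      exec-++ (fetchCell-ok r r<R arr M M≤W MM≤W 7 b (λ ()) (ℕₚ.≤-trans (ℕₚ.≤-trans (ℕₚ.m≤n+m b a) (ℕₚ.m≤n+m (a + b) t)) ≤M) f₁ rp₁) λ m₂ f₂ (e₂ , keep₂) →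
      let rp₂ = rep-keep r r<R arr M M≤W MM≤W rp₁ (λ c n5 n6 n7 → keep₂ c n5 n7)
          v = cong₂ f (keep₂ 6 (λ ()) (λ ()) ∙ e₁) e₂
      in
      exec-++ {c₁ = i ∷ []} {Q = λ m′ → Rep′ q m′ × m′ 6 ≡ f (q a) (q b)}
        (go {_} {i} {_} {_} {_} {p} f₂ (subst (λ z → ℤ.∣ z ∣ ≤ W) (sym (w m₂ ∙ v)) (written-≤ {q} {t} fitq)) λ f₃ → stop f₃
          ( rep-keep r r<R arr M M≤W MM≤W rp₂ (λ c n5 n6 n7 → cong (λ z → z c) (e m₂) ∙ update-other m₂ 6 _ (n6 ∘ sym))
          , cong (λ z → z 6) (e m₂) ∙ v))
      λ m₃ f₃ (rp₃ , e₃) → putCell-ok r r<R arr M M≤W MM≤W t (ℕₚ.≤-trans (ℕₚ.m≤m+n t (a + b)) ≤M) f₃ rp₃ e₃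

    pointer-ok : ∀ {q m} p → p ≤ M → Fitting V q → Fitting W m → Rep′ q m →
      Exec W (fetchCell r 6 p ++ absCode ++ pointerCode r) m
        (λ m′ → m′ 6 ≡ + at-array r ℤ.∣ q p ∣ × Rep′ q m′)
    pointer-ok {q} {m} p p≤M fitq fit rp =
      exec-++ (fetchCell-ok r r<R arr M M≤W MM≤W 6 p (λ ()) p≤M fit rp) λ m₁ f₁ (e₁ , keep₁) →
      exec-++ (absCode-ok r r<R arr M M≤W MM≤W f₁ (subst (λ z → ℤ.∣ z ∣ ≤ M) (sym e₁) (ℕₚ.≤-trans (fitq p) V≤M))) λ m₂ f₂ (e₂ , keep₂) →
      weaken (pointerCode-ok r r<R arr M M≤W MM≤W ℤ.∣ q p ∣ (ℕₚ.≤-trans (fitq p) V≤M) f₂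
        (keep₂ 1 (λ ()) (λ ()) (λ ()) ∙ keep₁ 1 (λ ()) (λ ()) ∙ cell-D rp) (e₂ ∙ cong (+_ ∘ ℤ.∣_∣) e₁)) λ (e₃ , keep₃) →
      e₃ , rep-keep r r<R arr M M≤W MM≤W rp (λ c n5 n6 n7 → keep₃ c n5 n6 ∙ keep₂ c n5 n6 n7 ∙ keep₁ c n5 n6)

    plainCode-ok : ∀ i → Plain i → cellBound i ≤ M → ∀ {q m} → Fitting V q → Fitting V (effect i q) → Fitting W m →
      Rep′ q m → Exec W (plainCode r i) m (Rep′ (effect i q))
    plainCode-ok (const t z) _ ≤M {q} {m} fitq fitq′ fit rp =
      exec-++ {c₁ = const 6 z ∷ []} {Q = λ m′ → Rep′ q m′ × m′ 6 ≡ z}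
        (go fit (written-≤ {q} {t} fitq′) λ f₁ → stop f₁
          ( rep-keep r r<R arr M M≤W MM≤W rp (λ c n5 n6 n7 → update-other m 6 z (n6 ∘ sym)) , refl))
      λ m₁ f₁ (rp₁ , e₁) → putCell-ok r r<R arr M M≤W MM≤W t ≤M f₁ rp₁ e₁
    plainCode-ok (add t a b)      _ ≤M fitq fitq′ fit rp = binary-ok (add 6 6 7) ℤ._+_ (λ _ → refl) (λ _ → refl) t a b ≤M fitq′ fit rp
    plainCode-ok (sub t a b)      _ ≤M fitq fitq′ fit rp = binary-ok (sub 6 6 7) ℤ._-_ (λ _ → refl) (λ _ → refl) t a b ≤M fitq′ fit rp
    plainCode-ok (mul t a b)      _ ≤M fitq fitq′ fit rp = binary-ok (mul 6 6 7) ℤ._*_ (λ _ → refl) (λ _ → refl) t a b ≤M fitq′ fit rp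
    plainCode-ok (quotient t a b) _ ≤M fitq fitq′ fit rp = binary-ok (quotient 6 6 7) _quot_ (λ _ → refl) (λ _ → refl) t a b ≤M fitq′ fit rp
    plainCode-ok (load t p) _ ≤M {q} {m} fitq fitq′ fit rp =
      subst (λ code → Exec W code m (Rep′ (effect (load t p) q))) (assoc (fetchCell r 6 p) absCode (pointerCode r))
      (exec-++ (pointer-ok p (ℕₚ.≤-trans (ℕₚ.m≤n+m p t) ≤M) fitq fit rp) λ m₁ f₁ (e₁ , rp₁) →
       exec-++ {c₁ = load 6 6 ∷ []} {Q = λ m′ → Rep′ q m′ × m′ 6 ≡ q ℤ.∣ q p ∣}
        (go f₁ (f₁ ℤ.∣ m₁ 6 ∣) λ f₂ → stop f₂
          ( rep-keep r r<R arr M M≤W MM≤W rp₁ (λ c n5 n6 n7 → update-other m₁ 6 _ (n6 ∘ sym))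
          , cong (λ z → m₁ ℤ.∣ z ∣) e₁ ∙ holds r r<R arr M M≤W MM≤W {q} rp₁ ℤ.∣ q p ∣))
       λ m₂ f₂ (rp₂ , e₂) → putCell-ok r r<R arr M M≤W MM≤W t (ℕₚ.≤-trans (ℕₚ.m≤m+n t p) ≤M) f₂ rp₂ e₂)
      where
      assoc : ∀ (a b c {d} : List Instr) → (a ++ b ++ c) ++ d ≡ a ++ b ++ c ++ d
      assoc a b c {d} = Listₚ.++-assoc a (b ++ c) d ∙ cong (a ++_) (Listₚ.++-assoc b c d)
    plainCode-ok (store p s) _ ≤M {q} {m} fitq fitq′ fit rp =
      subst (λ code → Exec W code m (Rep′ (effect (store p s) q))) (assoc (fetchCell r 6 p) absCode (pointerCode r))
      (exec-++ (pointer-ok p (ℕₚ.≤-trans (ℕₚ.m≤m+n p s) ≤M) fitq fit rp) λ m₁ f₁ (e₁ , rp₁) →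
       exec-++ (fetchCell-ok r r<R arr M M≤W MM≤W 7 s (λ ()) (ℕₚ.≤-trans (ℕₚ.m≤n+m s p) ≤M) f₁ rp₁) λ m₂ f₂ (e₂ , keep₂) →
       let rp₂ = rep-keep r r<R arr M M≤W MM≤W rp₁ (λ c n5 n6 n7 → keep₂ c n5 n7) in
       go f₂ (f₂ 7) λ f₃ → stop f₃
         (subst₂ (λ a z → Rep′ (q [ ℤ.∣ q p ∣ ≔ q s ]) (m₂ [ a ≔ z ])) (sym (cong ℤ.∣_∣ (keep₂ 6 (λ ()) (λ ()) ∙ e₁))) (sym e₂)
           (rep-store r r<R arr M M≤W MM≤W ℤ.∣ q p ∣ (q s) rp₂)))
      where
      assoc : ∀ (a b c {d} : List Instr) → (a ++ b ++ c) ++ d ≡ a ++ b ++ c ++ d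
      assoc a b c {d} = Listₚ.++-assoc a (b ++ c) d ∙ cong (a ++_) (Listₚ.++-assoc b c d)

    module _ {prog o} (Q : Program) (Q≤M : cellsBound Q ≤ M) (loc : Located prog o (callCode o r Q)) where

      label : ℕ → ℕ
      label = labelFrom o (length Q)

      label-inside : ∀ {l} → l ≤ length Q → label l ≡ o + 20 * l
      label-inside l≤ = cong (λ z → o + 20 * z) (ℕₚ.m≤n⇒m⊓n≡m l≤)

      record Simulated (m : Memory) (pc : ℕ) (c : Config) (steps : ℕ) : Set where
        constructor simulated
        field
          {time}   : ℕ
          {memory} : Memory
          time-≤   : time ≤ 20 * steps
          reach    : Reach prog W (label pc , m) time (label (Config.pc c) , memory)
          fits     : Fitting W memory
          stores   : Rep′ (Config.memory c) memory

      private
        from-block : ∀ {m pc t o′ m′} → pc < length Q → Reach prog W (o + 20 * pc , m) t (o′ , m′) →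
                     Reach prog W (label pc , m) t (o′ , m′)
        from-block {m} pc< = reach-from (cong (_, m) (label-inside (ℕₚ.<⇒≤ pc<)))

        short : ∀ pc i → length (plainCode r i) + length (exitCode label (o + 20 * pc + 20) i) ≤ 20 * 1
        short pc i = ℕₚ.≤-trans (ℕₚ.≤-trans (ℕₚ.≤-reflexive (sym (Listₚ.length-++ (plainCode r i)))) (ℕₚ.m≤m+n _ _))
          (ℕₚ.≤-reflexive (sym (Listₚ.length-++ code {List.replicate (20 ∸ length code) (jump 0)}) ∙ block-length r label (o + 20 * pc + 20) i))
          where code = plainCode r i ++ exitCode label (o + 20 * pc + 20) i

        next-label : ∀ pc → pc < length Q → o + 20 * pc + 20 ≡ label (suc pc)
        next-label pc pc< = ℕₚ.+-assoc o (20 * pc) 20 ∙ cong (o ℕ.+_) (ℕₚ.+-comm (20 * pc) 20 ∙ sym (ℕₚ.*-suc 20 pc)) ∙ sym (label-inside pc<)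

      simulate-plain : ∀ i → Plain i → (∀ next → exitCode label next i ≡ jump next ∷ []) →
        ∀ pc q m → fetch Q pc ≡ just i → Fitting V q → Fitting V (effect i q) →
        Fitting W m → Rep′ q m → Simulated m pc (suc pc , effect i q) 1
      simulate-plain i p ex pc q m eq fitq fitq′ fit rp =
        simulated (subst (λ z → length (plainCode r i) + length z ≤ 20) (ex _) (short pc i))
          (from-block pc< (reach-trans (exec-reach (located-++ˡ (plainCode r i) whole) e)
            (step (fitting e) (located-head (subst (Located prog _) (ex _) (located-++ʳ (plainCode r i) whole)))
              (reach-pc (next-label pc pc<) done))))
          (fitting e) (post e)
        where
        pc< = fetch-< Q pc eq
        blk = located-block {r = r} {label} o Q pc loc eq
        whole = located-++ˡ (plainCode r i ++ exitCode label (o + 20 * pc + 20) i) blk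
        e = plainCode-ok i p (ℕₚ.≤-trans (fetch-cellBound Q pc eq) Q≤M) fitq fitq′ fit rp

      simulate-jump : ∀ l pc q m → fetch Q pc ≡ just (jump l) → Fitting W m → Rep′ q m → Simulated m pc (l , q) 1
      simulate-jump l pc q m eq fit rp =
        simulated (ℕₚ.m≤m+n 1 19) (from-block pc< (step fit (located-head (located-++ˡ (jump (label l) ∷ [])
          (located-block {r = r} {label} o Q pc loc eq))) done)) fit rp
        where pc< = fetch-< Q pc eq

      simulate-branch : ∀ c l pc q m → fetch Q pc ≡ just (jumpIfPositive c l) → Fitting W m → Rep′ q m →
        Simulated m pc (exec (jumpIfPositive c l) (pc , q)) 1
      simulate-branch c l pc q m eq fit rp = by ⌊ + 0 ℤₚ.<? q c ⌋ refl
        where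
        pc< = fetch-< Q pc eq
        i = jumpIfPositive c l
        e = fetchCell-ok r r<R arr M M≤W MM≤W 6 c (λ ()) (ℕₚ.≤-trans (fetch-cellBound Q pc eq) Q≤M) fit rp
        m₁ = result e
        rp₁ = rep-keep r r<R arr M M≤W MM≤W rp (λ c n5 n6 n7 → proj₂ (post e) c n5 n6)
        whole = located-++ˡ (fetchCell r 6 c ++ exitCode label (o + 20 * pc + 20) i) (located-block {r = r} {label} o Q pc loc eq)
        at-exit = located-++ʳ (fetchCell r 6 c) whole
        first : Reach prog W (o + 20 * pc , m) 3 (o + 20 * pc + 3 , m₁)
        first = exec-reach (located-++ˡ (fetchCell r 6 c) whole) e
        by : ∀ b → ⌊ + 0 ℤₚ.<? q c ⌋ ≡ b → Simulated m pc ((if ⌊ + 0 ℤₚ.<? q c ⌋ then l else suc pc) , q) 1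
        by true eqb rewrite eqb = simulated (ℕₚ.m≤m+n 4 16)
          (from-block pc< (reach-trans first (step (fitting e) (located-head at-exit)
            (reach-from (cong (λ b → (if b then label l else suc (o + 20 * pc + 3)) , m₁)
              (cong (λ z → ⌊ + 0 ℤₚ.<? z ⌋) (proj₁ (post e)) ∙ eqb)) done))))
          (fitting e) rp₁
        by false eqb rewrite eqb = simulated (ℕₚ.m≤m+n 5 15)
          (from-block pc< (reach-trans first (step (fitting e) (located-head at-exit)
            (reach-from (cong (λ b → (if b then label l else suc (o + 20 * pc + 3)) , m₁)
              (cong (λ z → ⌊ + 0 ℤₚ.<? z ⌋) (proj₁ (post e)) ∙ eqb))
              (step (fitting e) (located-head (located-tail at-exit)) (reach-pc (next-label pc pc<) done))))))
          (fitting e) rp₁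

      simulate-step : ∀ i pc q m → fetch Q pc ≡ just i → Fitting V q → Fitting V (effect i q) → Fitting W m → Rep′ q m →
        Simulated m pc (exec i (pc , q)) 1
      simulate-step i@(const _ _)          pc q m eq fitq fitq′ = simulate-plain i tt (λ _ → refl) pc q m eq fitq fitq′
      simulate-step i@(add _ _ _)          pc q m eq fitq fitq′ = simulate-plain i tt (λ _ → refl) pc q m eq fitq fitq′
      simulate-step i@(sub _ _ _)          pc q m eq fitq fitq′ = simulate-plain i tt (λ _ → refl) pc q m eq fitq fitq′
      simulate-step i@(mul _ _ _)          pc q m eq fitq fitq′ = simulate-plain i tt (λ _ → refl) pc q m eq fitq fitq′
      simulate-step i@(quotient _ _ _)     pc q m eq fitq fitq′ = simulate-plain i tt (λ _ → refl) pc q m eq fitq fitq′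
      simulate-step i@(load _ _)           pc q m eq fitq fitq′ = simulate-plain i tt (λ _ → refl) pc q m eq fitq fitq′
      simulate-step i@(store _ _)          pc q m eq fitq fitq′ = simulate-plain i tt (λ _ → refl) pc q m eq fitq fitq′
      simulate-step (jump l)               pc q m eq fitq fitq′ = simulate-jump l pc q m eq
      simulate-step (jumpIfPositive c l)   pc q m eq fitq fitq′ = simulate-branch c l pc q m eq

      memory-exec : ∀ i pc q → Config.memory (exec i (pc , q)) ≡ effect i q
      memory-exec (const _ _)          pc q = refl
      memory-exec (add _ _ _)          pc q = refl
      memory-exec (sub _ _ _)          pc q = refl
      memory-exec (mul _ _ _)          pc q = refl
      memory-exec (quotient _ _ _)     pc q = refl
      memory-exec (load _ _)           pc q = refl
      memory-exec (store _ _)          pc q = refl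
      memory-exec (jump _)             pc q = refl
      memory-exec (jumpIfPositive _ _) pc q = refl

      -- No instruction of a block is repeated, so each simulated step costs at most the block
      -- length 20. When the subroutine has left its code, the capped label is the end of the
      -- translation.
      simulate-run : ∀ {pc q steps q′} → Run Q V (pc , q) steps q′ → ∀ m → Fitting W m → Rep′ q m →
        ∃[ t ] ∃[ m′ ] t ≤ 20 * steps × Reach prog W (label pc , m) t (o + length (callCode o r Q) , m′)
          × Fitting W m′ × Rep′ q′ m′
      simulate-run {pc} (halt fitq eq) m fit rp = 0 , m , z≤n , reach-pc end done , fit , rp
        where
        end : label pc ≡ o + length (callCode o r Q)
        end = cong (λ z → o + 20 * z) (ℕₚ.m≥n⇒m⊓n≡n (fetch-≥ Q pc eq)) ∙ cong (o ℕ.+_) (sym (blocks-length r label o Q))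
      simulate-run {pc} {q} {suc steps} (step {i = i} fitq eq run) m fit rp
        with simulate-step i pc q m eq fitq (subst (Fitting V) (memory-exec i pc q) (run-fitting run)) fit rp
      ... | simulated {t₁} {m₁} t₁≤ r₁ f₁ rp₁ with simulate-run run m₁ f₁ rp₁
      ... | t₂ , m₂ , t₂≤ , r₂ , f₂ , rp₂ =
        t₁ + t₂ , m₂ , subst (t₁ + t₂ ≤_) (sym (ℕₚ.*-suc 20 steps)) (ℕₚ.+-mono-≤ t₁≤ t₂≤) , reach-trans r₁ r₂ , f₂ , rp₂

-- Running times and a Hoare logic

-- The capacity of an `Algorithm` is a monomial, so all bounds on values and addresses are kept in
-- this form. The exponents are wasteful, which affects only the number of bits of a word and not
-- the running time.
record Poly (f : ℕ → ℕ) : Set where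
  constructor poly
  field
    factor   : ℕ
    exponent : ℕ
    below    : ∀ n .{{_ : NonZero n}} → f n ≤ factor * n ^ exponent

open Poly public

poly-const : ∀ c → Poly (λ _ → c)
poly-const c = poly c 0 λ n → ℕₚ.≤-reflexive (sym (ℕₚ.*-identityʳ c))

poly-power : ∀ e → Poly (λ n → n ^ e)
poly-power e = poly 1 e λ n → ℕₚ.≤-reflexive (sym (ℕₚ.*-identityˡ (n ^ e)))

poly-+ : ∀ {f g} → Poly f → Poly g → Poly (λ n → f n + g n)
poly-+ {f} {g} (poly c d h) (poly c′ d′ h′) = poly (c + c′) (d + d′) λ n → begin
  f n + g n                                ≤⟨ ℕₚ.+-mono-≤ (h n) (h′ n) ⟩
  c * n ^ d + c′ * n ^ d′                  ≤⟨ ℕₚ.+-mono-≤ (ℕₚ.*-monoʳ-≤ c (ℕₚ.^-monoʳ-≤ n (ℕₚ.m≤m+n d d′)))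
                                                           (ℕₚ.*-monoʳ-≤ c′ (ℕₚ.^-monoʳ-≤ n (ℕₚ.m≤n+m d′ d))) ⟩
  c * n ^ (d + d′) + c′ * n ^ (d + d′)     ≡⟨ ℕₚ.*-distribʳ-+ (n ^ (d + d′)) c c′ ⟨
  (c + c′) * n ^ (d + d′)                  ∎
  where open ℕₚ.≤-Reasoning

poly-* : ∀ {f g} → Poly f → Poly g → Poly (λ n → f n * g n)
poly-* {f} {g} (poly c d h) (poly c′ d′ h′) = poly (c * c′) (d + d′) λ n → begin
  f n * g n                         ≤⟨ ℕₚ.*-mono-≤ (h n) (h′ n) ⟩
  (c * n ^ d) * (c′ * n ^ d′)       ≡⟨ ℕₚ.[m*n]*[o*p]≡[m*o]*[n*p] c (n ^ d) c′ (n ^ d′) ⟩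
  (c * c′) * (n ^ d * n ^ d′)       ≡⟨ cong (c * c′ *_) (ℕₚ.^-distribˡ-+-* n d d′) ⟨
  (c * c′) * n ^ (d + d′)           ∎
  where open ℕₚ.≤-Reasoning

poly-^ : ∀ {f} → Poly f → ∀ e → Poly (λ n → f n ^ e)
poly-^ p zero    = poly-const 1
poly-^ p (suc e) = poly-* p (poly-^ p e)

run-final-fitting : ∀ {Q W c t m} → Run Q W c t m → Fitting W m
run-final-fitting (halt fit _)   = fit
run-final-fitting (step _ _ run) = run-final-fitting run

max-≤ : ∀ zs {B} → (∀ a → ℤ.∣ contents zs a ∣ ≤ B) → foldr (λ z m → ℤ.∣ z ∣ ℕ.⊔ m) 0 zs ≤ B
max-≤ []       h = z≤n
max-≤ (z ∷ zs) h = ℕₚ.⊔-lub (h 0) (max-≤ zs (h ∘ suc))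

length-rows : ∀ {A : Set} m {n} (f : Fin m → List A) → (∀ i → length (f i) ≡ n) → length (concat (tabulate f)) ≡ m * n
length-rows zero    f eq = refl
length-rows (suc m) f eq = Listₚ.length-++ (f Fin.zero) ∙ cong₂ _+_ (eq Fin.zero) (length-rows m (f ∘ Fin.suc) (eq ∘ Fin.suc))

length-rowMajor : ∀ {A : Set} m n (M : Matrix A m n) → length (rowMajor M) ≡ m * n
length-rowMajor m n M = length-rows m (λ i → tabulate (M i)) (λ i → Listₚ.length-tabulate (M i))

-- `Time n C t` stands for t ≤ C n^x up to a fixed factor. The program logic uses only these four
-- closure properties and never meets a real number; `powerClock` supplies them for real x.
record Clock : Set₁ where
  field
    Time      : ∀ n → .{{NonZero n}} → ℕ → ℕ → Set
    time-zero : ∀ n .{{_ : NonZero n}} → Time n 0 0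
    time-+    : ∀ n .{{_ : NonZero n}} {C C′ t t′} → Time n C t → Time n C′ t′ → Time n (C + C′) (t + t′)
    time-*    : ∀ n .{{_ : NonZero n}} c {C t} → Time n C t → Time n (c * C) (c * t)
    time-≤    : ∀ n .{{_ : NonZero n}} {C t t′} → t ≤ t′ → Time n C t′ → Time n C t

ComputesWithin : Clock → Algorithm → ∀ n → .{{NonZero n}} → ℕ → (input output : List ℤ) → Set
ComputesWithin clock 𝓐 n C input output = ∃[ t ] ∃[ mem ]
  Run (Algorithm.program 𝓐) (Algorithm.capacity 𝓐 input) (0 , contents input) t mem × mem StartsWith output × Clock.Time clock n C t

MultipliesWithin : Clock → Algorithm → (a b C : ℕ) → Set
MultipliesWithin clock 𝓐 a b C = ∀ n .{{_ : NonZero n}} (A : Matrix ℤ (n ^ a) (n ^ b)) (B : Matrix ℤ (n ^ b) (n ^ a)) →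
  ComputesWithin clock 𝓐 n C (+ (n ^ a) ∷ + (n ^ b) ∷ rowMajor A ++ rowMajor B) (rowMajor (A ⊡ B))

data Cmd (k : ℕ) : Set where
  assign : Stmt k → Cmd k
  call   : ℕ → Cmd k

Assertion : Set₁
Assertion = ∀ n → .{{NonZero n}} → Graph n → Arrays → Set

module Programs (K R : ℕ) (𝓐 : Algorithm) where

  open Algorithm 𝓐
  open Code K R
  open CallCode K R

  cmdCode : ∀ {k} → ℕ → Cmd k → List Instr
  cmdCode o (assign s) = stmtCode o s
  cmdCode o (call r)   = callCode o r program

  compile : ∀ {k} → ℕ → List (Cmd k) → List Instr
  compile o []       = []
  compile o (c ∷ cs) = cmdCode o c ++ compile (o + length (cmdCode o c)) cs

module Logic (k K R : ℕ) (8<K : 8 < K) (𝓐 : Algorithm) (clock : Clock) where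

  open Clock clock
  open Algorithm 𝓐
  open Code K R
  open CallCode K R
  open Programs K R 𝓐

  Holds : ∀ n (W : ℕ) → .{{NonZero n}} → Arrays → Memory → Set
  Holds n W arr m = Fitting W m × Correct.Rep K R n W 8<K arr m

  Bounded : ℕ → Arrays → Set
  Bounded B arr = ∀ r a → ℤ.∣ arr r a ∣ ≤ B

  -- `B` bounds the array entries before the code runs and `bound` afterwards; `word` is a word size
  -- that suffices. Being polynomial, they can be chained along a program of fixed length. `W` stays
  -- arbitrary above `word n`, because one word size has to serve the whole program.
  record Outcome (code : ℕ → List Instr) (Pre Post : Assertion) (B : ℕ → ℕ) : Set where
    field
      bound word : ℕ → ℕ
      constant   : ℕ
      bound-poly : Poly bound
      word-poly  : Poly word
      run : ∀ n .{{_ : NonZero n}} H W → R ≤ W → word n ≤ W → ∀ {prog o m arr} → Located prog o (code o) →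
            Holds n W arr m → Bounded (B n) arr → Pre n H arr →
            ∃[ t ] ∃[ m′ ] ∃[ arr′ ] Reach prog W (o , m) t (o + length (code o) , m′) × Holds n W arr′ m′
              × Bounded (bound n) arr′ × Post n H arr′ × Time n constant t

  outcome-weaken : ∀ {code Pre Post Post′ B} → (∀ n .{{_ : NonZero n}} H {arr} → Post n H arr → Post′ n H arr) →
    Outcome code Pre Post B → Outcome code Pre Post′ B
  outcome-weaken imp out = record
    { bound = Outcome.bound out ; word = Outcome.word out ; constant = Outcome.constant out
    ; bound-poly = Outcome.bound-poly out ; word-poly = Outcome.word-poly out
    ; run = λ n H W R≤W w≤W loc hld bnd pre → case Outcome.run out n H W R≤W w≤W loc hld bnd pre of λ
        { (t , m , arr , reach , hld′ , bnd′ , pst , T) → t , m , arr , reach , hld′ , bnd′ , imp n H pst , T } }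

  Hoare : List (Cmd k) → Assertion → Assertion → Set
  Hoare cs Pre Post = ∀ {B} → Poly B → Outcome (λ o → compile o cs) Pre Post B

  HoareCmd : Cmd k → Assertion → Assertion → Set
  HoareCmd c Pre Post = ∀ {B} → Poly B → Outcome (λ o → cmdCode o c) Pre Post B

  hoare-[] : ∀ {Pre Post : Assertion} → (∀ n .{{_ : NonZero n}} H {arr} → Pre n H arr → Post n H arr) → Hoare [] Pre Post
  hoare-[] imp {B} pB = record
    { bound = B ; word = λ _ → 0 ; constant = 0 ; bound-poly = pB ; word-poly = poly-const 0
    ; run = λ n H W _ _ {prog} {o} {m} {arr} loc hld bnd pre →
        0 , m , arr , reach-pc (sym (ℕₚ.+-identityʳ o)) done , hld , bnd , imp n H pre , time-zero n }

  hoare-∷ : ∀ {c cs} {Pre Mid Post : Assertion} → HoareCmd c Pre Mid → Hoare cs Mid Post → Hoare (c ∷ cs) Pre Post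
  hoare-∷ {c} {cs} h hs {B} pB = record
    { bound = O₂.bound ; word = λ n → O₁.word n + O₂.word n ; constant = O₁.constant + O₂.constant
    ; bound-poly = O₂.bound-poly ; word-poly = poly-+ O₁.word-poly O₂.word-poly
    ; run = λ n H W R≤W w≤W {prog} {o} {m} {arr} loc hld bnd pre →
        case O₁.run n H W R≤W (ℕₚ.≤-trans (ℕₚ.m≤m+n _ _) w≤W) (located-++ˡ (cmdCode o c) loc) hld bnd pre of λ
          { (t₁ , m₁ , arr₁ , r₁ , hld₁ , bnd₁ , mid , T₁) →
        case O₂.run n H W R≤W (ℕₚ.≤-trans (ℕₚ.m≤n+m _ _) w≤W) (located-++ʳ (cmdCode o c) loc) hld₁ bnd₁ mid of λ
          { (t₂ , m₂ , arr₂ , r₂ , hld₂ , bnd₂ , pst , T₂) →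
            t₁ + t₂ , m₂ , arr₂
            , reach-pc (ℕₚ.+-assoc o (length (cmdCode o c)) _ ∙ cong (o ℕ.+_) (sym (Listₚ.length-++ (cmdCode o c)))) (reach-trans r₁ r₂)
            , hld₂ , bnd₂ , pst , time-+ n T₁ T₂ } } }
    where
    module O₁ = Outcome (h pB)
    module O₂ = Outcome (hs O₁.bound-poly)

  hoare-++ : ∀ cs {ds} {Pre Mid Post : Assertion} → Hoare cs Pre Mid → Hoare ds Mid Post → Hoare (cs ++ ds) Pre Post
  hoare-++ cs {ds} {Pre} {Mid} {Post} h hs {B} pB = record
    { bound = O₂.bound ; word = λ n → O₁.word n + O₂.word n ; constant = O₁.constant + O₂.constant
    ; bound-poly = O₂.bound-poly ; word-poly = poly-+ O₁.word-poly O₂.word-poly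
    ; run = λ n H W R≤W w≤W {prog} {o} {m} {arr} loc hld bnd pre →
        let loc′ = subst (Located prog o) (compile-++ o cs) loc in
        case O₁.run n H W R≤W (ℕₚ.≤-trans (ℕₚ.m≤m+n _ _) w≤W) (located-++ˡ (compile o cs) loc′) hld bnd pre of λ
          { (t₁ , m₁ , arr₁ , r₁ , hld₁ , bnd₁ , mid , T₁) →
        case O₂.run n H W R≤W (ℕₚ.≤-trans (ℕₚ.m≤n+m _ _) w≤W) (located-++ʳ (compile o cs) loc′) hld₁ bnd₁ mid of λ
          { (t₂ , m₂ , arr₂ , r₂ , hld₂ , bnd₂ , pst , T₂) →
            t₁ + t₂ , m₂ , arr₂
            , reach-pc (ℕₚ.+-assoc o (length (compile o cs)) _
                ∙ cong (o ℕ.+_) (sym (cong length (compile-++ o cs) ∙ Listₚ.length-++ (compile o cs)))) (reach-trans r₁ r₂)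
            , hld₂ , bnd₂ , pst , time-+ n T₁ T₂ } } }
    where
    module O₁ = Outcome (h pB)
    module O₂ = Outcome (hs O₁.bound-poly)
    compile-++ : ∀ o cs → compile o (cs ++ ds) ≡ compile o cs ++ compile (o + length (compile o cs)) ds
    compile-++ o []       = cong (λ z → compile z ds) (sym (ℕₚ.+-identityʳ o))
    compile-++ o (c ∷ cs) = cong (cmdCode o c ++_) (compile-++ (o + length (cmdCode o c)) cs
      ∙ cong (λ z → compile (o + length (cmdCode o c)) cs ++ compile z ds)
          (ℕₚ.+-assoc o (length (cmdCode o c)) _ ∙ cong (o ℕ.+_) (sym (Listₚ.length-++ (cmdCode o c)))))
      ∙ sym (Listₚ.++-assoc (cmdCode o c) _ _)

  hoare-one : ∀ {c} {Pre Post : Assertion} → HoareCmd c Pre Post → Hoare (c ∷ []) Pre Post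
  hoare-one {c} {Post = Post} h = hoare-∷ {c} {[]} {Mid = Post} h (hoare-[] {Post} (λ n H p → p))

  private
    size : Ref k → ℕ → ℕ
    size ρ n = n ^ 1 * (n ^ 1 + (K + K)) + (R * (offset ρ + suc (lead ρ) * n ^ length (indices ρ)) + array ρ)

    size-poly : ∀ ρ → Poly (size ρ)
    size-poly ρ = poly-+ (poly-* (poly-power 1) (poly-+ (poly-power 1) (poly-const _)))
      (poly-+ (poly-* (poly-const R) (poly-+ (poly-const (offset ρ)) (poly-* (poly-const (suc (lead ρ))) (poly-power (length (indices ρ)))))) (poly-const (array ρ)))

    sizes : List (Ref k) → ℕ → ℕ
    sizes []       n = 0
    sizes (ρ ∷ ρs) n = size ρ n + sizes ρs n

    sizes-poly : ∀ ρs → Poly (sizes ρs)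
    sizes-poly []       = poly-const 0
    sizes-poly (ρ ∷ ρs) = poly-+ (size-poly ρ) (sizes-poly ρs)

    sizes-≤ : ∀ {P : Ref k → Set} n {W} ρs → sizes ρs n ≤ W → All P ρs → All (λ ρ → size ρ n ≤ W × P ρ) ρs
    sizes-≤ n []       ≤W []       = []
    sizes-≤ n (ρ ∷ ρs) ≤W (p ∷ ps) = (ℕₚ.≤-trans (ℕₚ.m≤m+n _ _) ≤W , p) ∷ sizes-≤ n ρs (ℕₚ.≤-trans (ℕₚ.m≤n+m _ (size ρ n)) ≤W) ps

  hoare-assign : ∀ s {Pre Post : Assertion} → 8 + length (loops s) < K → array (target s) < R →
    All (λ ρ → array ρ < R × array (target s) ≢ array ρ) (factors s) →
    (∀ n .{{_ : NonZero n}} → Time n 1 (n ^ length (loops s))) →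
    (∀ n .{{_ : NonZero n}} H arr → Pre n H arr → Post n H (perform n s arr)) →
    HoareCmd (assign s) Pre Post
  hoare-assign s regs tr<R fs time imp {B} pB = record
    { bound = bnd ; word = word ; constant = c * 1
    ; bound-poly = bnd-poly
    ; word-poly = poly-+ (poly-power m) (poly-+ (sizes-poly (target s ∷ factors s)) bnd-poly)
    ; run = λ n H W R≤W w≤W {prog} {o} {mem} {arr} loc hld bounded pre →
        let open Correct K R n W 8<K
            open Statements K R n W 8<K R≤W
            w₁ = ℕₚ.≤-trans (ℕₚ.m≤m+n (n ^ m) _) w≤W
            w₂ = ℕₚ.≤-trans (ℕₚ.m≤n+m _ (n ^ m)) w≤W
            w₃ = ℕₚ.≤-trans (ℕₚ.m≤m+n (sizes (target s ∷ factors s) n) _) w₂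
            w₄ = ℕₚ.≤-trans (ℕₚ.m≤n+m (bnd n) _) w₂
            fit-size : ∀ ρ → size ρ n ≤ W → extent ρ ≤ W
            fit-size ρ = subst (λ z → z * (z + (K + K)) + (R * (offset ρ + suc (lead ρ) * n ^ length (indices ρ)) + array ρ) ≤ W) (ℕₚ.*-identityʳ n)
            -- The successor ensures that the bound is at least 1, as `Admissible` requires.
            bounded′ : Bounded (suc (B n)) arr
            bounded′ r a = ℕₚ.m≤n⇒m≤1+n (bounded r a)
            ok : Admissible s arr (suc (B n))
            ok = record
              { registers = regs
              ; target-ok = tr<R , fit-size (target s) (ℕₚ.≤-trans (ℕₚ.m≤m+n _ _) w₃)
              ; factors-ok = All.map (λ { {ρ} (sz , r< , ne) → (r< , fit-size ρ sz) , ne })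
                  (sizes-≤ n (factors s) (ℕₚ.≤-trans (ℕₚ.m≤n+m _ (size (target s) n)) w₃) fs)
              ; power-ok = w₁ ; bounded = bounded′ ; 1≤B = s≤s z≤n ; value-ok = w₄ }
        in case stmtCode-ok s arr (suc (B n)) ok loc (proj₁ hld) (proj₂ hld) of λ
          { (mem′ , r , fit′ , rp′) → stmt-cost s arr (suc (B n)) ok , mem′ , perform n s arr , r , (fit′ , rp′)
            , (λ r a → partialResult-≤ n s arr (n ^ m) r a (suc (B n)) bounded′) , imp n H arr pre
            , time-≤ n (cost n) (time-* n c (time n)) } }
    where
    m = length (loops s)
    c = length (startCode m) + (length (bodyCode s) + 4)
    bnd : ℕ → ℕ
    bnd n = suc (B n) + n ^ m * (ℤ.∣ coefficient s ∣ * suc (B n) ^ length (factors s))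
    bnd-poly : Poly bnd
    bnd-poly = poly-+ (poly-+ (poly-const 1) pB)
      (poly-* (poly-power m) (poly-* (poly-const ℤ.∣ coefficient s ∣) (poly-^ (poly-+ (poly-const 1) pB) (length (factors s)))))
    word : ℕ → ℕ
    word n = n ^ m + (sizes (target s ∷ factors s) n + bnd n)
    cost : ∀ n .{{_ : NonZero n}} → length (startCode m) + n ^ m * (length (bodyCode s) + 4) ≤ c * n ^ m
    cost n = begin
      x + n ^ m * y            ≤⟨ ℕₚ.+-monoˡ-≤ (n ^ m * y) (ℕₚ.m≤m*n x (n ^ m) {{ℕₚ.m^n≢0 n m}}) ⟩
      x * n ^ m + n ^ m * y    ≡⟨ cong (x * n ^ m ℕ.+_) (ℕₚ.*-comm (n ^ m) y) ⟩
      x * n ^ m + y * n ^ m    ≡⟨ ℕₚ.*-distribʳ-+ (n ^ m) x y ⟨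
      c * n ^ m                ∎
      where
      open ℕₚ.≤-Reasoning
      x = length (startCode m)
      y = length (bodyCode s) + 4

  -- The array has to agree with the initial memory of the subroutine everywhere, including the
  -- zeros behind its input. Afterwards only the output at the start of the array is known; the
  -- subroutine may leave anything behind it.
  hoare-call : ∀ r a b {Pre Post : Assertion} → r < R → ∀ C →
    (∀ n .{{_ : NonZero n}} H arr → Pre n H arr → Σ[ A ∈ Matrix ℤ (n ^ a) (n ^ b) ] Σ[ B ∈ Matrix ℤ (n ^ b) (n ^ a) ]
      (∀ i → arr r i ≡ contents (+ (n ^ a) ∷ + (n ^ b) ∷ rowMajor A ++ rowMajor B) i)
      × (∀ q → q StartsWith rowMajor (A ⊡ B) → Post n H (replace r q arr))
      × ComputesWithin clock 𝓐 n C (+ (n ^ a) ∷ + (n ^ b) ∷ rowMajor A ++ rowMajor B) (rowMajor (A ⊡ B))) →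
    HoareCmd (call r) Pre Post
  hoare-call r a b {Pre} {Post} r<R C prepare {B} pB = record
    { bound = λ n → B n + cap n ; word = word ; constant = 20 * C
    ; bound-poly = poly-+ pB cap-poly
    ; word-poly = poly-+ (poly-+ (poly-* (poly-power 1) (poly-+ (poly-power 1) (poly-const (K + K)))) (poly-+ (poly-* (poly-const R) lim-poly) (poly-const r)))
                         (poly-+ (poly-const 2) (poly-* lim-poly lim-poly))
    ; run = λ n H W R≤W w≤W {prog} {o} {mem} {arr} loc hld bounded pre →
        case prepare n H arr pre of λ { (A , B′ , eq , finish , t , q , sub-run , q-ok , T) →
        let open Correct K R n W 8<K
            input = + (n ^ a) ∷ + (n ^ b) ∷ rowMajor A ++ rowMajor B′
            V≤ : capacity input ≤ cap n
            V≤ = ℕₚ.*-monoʳ-≤ scale (ℕₚ.^-monoˡ-≤ degree (ℕₚ.+-mono-≤ (ℕₚ.≤-reflexive (input-length n A B′))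
                  (max-≤ input (λ i → subst (λ z → ℤ.∣ z ∣ ≤ B n) (eq i) (bounded r i)))))
            rp : Rep (replace r (contents input) arr) mem
            rp = rep-cong (λ r′ i → replaced arr input eq r′ i) (proj₂ hld)
            M≤W : at-array r (lim n) ≤ W
            M≤W = subst (λ z → z * (z + (K + K)) + (R * lim n + r) ≤ W) (ℕₚ.*-identityʳ n) (ℕₚ.≤-trans (ℕₚ.m≤m+n _ _) w≤W)
        in case Simulation.simulate-run K R n W 8<K R≤W r r<R arr (lim n) M≤W (ℕₚ.≤-trans (ℕₚ.m≤n+m _ _) w≤W)
                  (capacity input) (ℕₚ.≤-trans V≤ (ℕₚ.m≤n+m _ (cellsBound program))) program (ℕₚ.m≤m+n _ (cap n)) loc
                  sub-run mem (proj₁ hld) rp of λ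
          { (t′ , mem′ , t′≤ , reach , fit′ , rp′) →
             t′ , mem′ , replace r q arr
             , reach-from (cong (_, mem) (sym (ℕₚ.+-identityʳ o))) reach , (fit′ , rp′)
             , (λ r′ i → after n arr q bounded (λ i → ℕₚ.≤-trans (run-final-fitting sub-run i) V≤) r′ i)
             , finish q q-ok , time-≤ n t′≤ (time-* n 20 T) } } }
    where
    cap lim word : ℕ → ℕ
    cap n = scale * (2 + (n ^ a * n ^ b + n ^ b * n ^ a) + B n) ^ degree
    -- A cell that is reached is either named in the program or the value of a word, so this sum
    -- bounds both.
    lim n = cellsBound program + cap n
    word n = (n ^ 1 * (n ^ 1 + (K + K)) + (R * lim n + r)) + (2 + lim n * lim n)
    cap-poly : Poly cap
    cap-poly = poly-* (poly-const scale) (poly-^ (poly-+ (poly-+ (poly-const 2)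
      (poly-+ (poly-* (poly-power a) (poly-power b)) (poly-* (poly-power b) (poly-power a)))) pB) degree)
    lim-poly : Poly lim
    lim-poly = poly-+ (poly-const _) cap-poly
    input-length : ∀ n (A : Matrix ℤ (n ^ a) (n ^ b)) (B′ : Matrix ℤ (n ^ b) (n ^ a)) →
      length (+ (n ^ a) ∷ + (n ^ b) ∷ rowMajor A ++ rowMajor B′) ≡ 2 + (n ^ a * n ^ b + n ^ b * n ^ a)
    input-length n A B′ = cong (λ z → suc (suc z)) (Listₚ.length-++ (rowMajor A)
      ∙ cong₂ _+_ (length-rowMajor (n ^ a) (n ^ b) A) (length-rowMajor (n ^ b) (n ^ a) B′))
    replaced : ∀ arr input → (∀ i → arr r i ≡ contents input i) → ∀ r′ i → arr r′ i ≡ replace r (contents input) arr r′ i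
    replaced arr input eq r′ i with r ℕ.≟ r′
    ... | yes refl = eq i
    ... | no _     = refl
    after : ∀ n arr q → Bounded (B n) arr → (∀ i → ℤ.∣ q i ∣ ≤ cap n) → ∀ r′ i → ℤ.∣ replace r q arr r′ i ∣ ≤ B n + cap n
    after n arr q h h′ r′ i with r ℕ.≟ r′
    ... | yes _ = ℕₚ.≤-trans (h′ i) (ℕₚ.m≤n+m _ (B n))
    ... | no _  = ℕₚ.≤-trans (h r′ i) (ℕₚ.m≤m+n _ _)

-- Iterated sums over assignments and base-n digits

Assignment : ℕ → Set
Assignment k = Fin k → ℕ

sum<-cong : ∀ n {f g} → (∀ i → i < n → f i ≡ g i) → sum< n f ≡ sum< n g
sum<-cong zero    eq = refl
sum<-cong (suc n) eq = cong₂ ℤ._+_ (sum<-cong n (λ i i< → eq i (ℕₚ.m≤n⇒m≤1+n i<))) (eq n (ℕₚ.n<1+n n))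

sum<-append : ∀ a b f → sum< (a + b) f ≡ sum< a f ℤ.+ sum< b (λ i → f (a + i))
sum<-append a zero    f = trans (cong (λ z → sum< z f) (ℕₚ.+-identityʳ a)) (sym (ℤₚ.+-identityʳ _))
sum<-append a (suc b) f = trans (cong (λ z → sum< z f) (ℕₚ.+-suc a b))
  (trans (cong (ℤ._+ f (a + b)) (sum<-append a b f)) (ℤₚ.+-assoc (sum< a f) _ _))

sum<-split : ∀ N n f → sum< (N * n) f ≡ sum< N (λ q → sum< n (λ i → f (i + q * n)))
sum<-split zero    n f = refl
sum<-split (suc N) n f = trans (cong (λ z → sum< z f) (ℕₚ.+-comm n (N * n))) (trans (sum<-append (N * n) n f)
  (cong₂ ℤ._+_ (sum<-split N n f) (sum<-cong n (λ i _ → cong f (ℕₚ.+-comm (N * n) i)))))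

sum<-vanish : ∀ n {f} → (∀ i → i < n → f i ≡ + 0) → sum< n f ≡ + 0
sum<-vanish n eq = trans (sum<-cong n eq) (sum<-zero n _ λ _ → refl)

sum<-single : ∀ n {f} c → c < n → (∀ i → i < n → i ≢ c → f i ≡ + 0) → sum< n f ≡ f c
sum<-single (suc n) {f} c c< eq with c ℕ.≟ n
... | yes refl = trans (cong (ℤ._+ f n) (sum<-vanish n λ i i< → eq i (ℕₚ.m≤n⇒m≤1+n i<) (ℕₚ.<⇒≢ i<))) (ℤₚ.+-identityˡ _)
... | no c≢n   = trans (cong₂ ℤ._+_
    (sum<-single n c (ℕₚ.≤∧≢⇒< (ℕₚ.≤-pred c<) c≢n) (λ i i< → eq i (ℕₚ.m≤n⇒m≤1+n i<)))
    (eq n (ℕₚ.n<1+n n) (λ n≡c → c≢n (sym n≡c)))) (ℤₚ.+-identityʳ _)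

sum<-*ˡ : ∀ n c f → sum< n (λ i → c ℤ.* f i) ≡ c ℤ.* sum< n f
sum<-*ˡ zero    c f = sym (ℤₚ.*-zeroʳ c)
sum<-*ˡ (suc n) c f = trans (cong (ℤ._+ c ℤ.* f n) (sum<-*ˡ n c f)) (sym (ℤₚ.*-distribˡ-+ c _ _))

-- The first variable of the list is summed innermost.
sums : ∀ {k} → ℕ → List (Fin k) → (Assignment k → ℤ) → Assignment k → ℤ
sums n []       F g = F g
sums n (x ∷ xs) F g = sums n xs (λ h → sum< n (λ a → F (h [ x ↦ a ]))) g

origin : ∀ {k} → Assignment k
origin _ = 0

digit-step : ∀ n .{{_ : NonZero n}} i q → i < n → (i + q * n) ℕ./ n ≡ q × (i + q * n) ℕ.% n ≡ i
digit-step n i q i<n =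
    trans (DivMod.+-distrib-/-∣ʳ i (divides-refl q)) (trans (cong₂ _+_ (DivMod.m<n⇒m/n≡0 i<n) (DivMod.m*n/n≡m q n)) refl)
  , trans (DivMod.[m+kn]%n≡m%n i q n) (DivMod.m<n⇒m%n≡m i<n)

-- Splitting off the least significant digit of the counter splits off the innermost sum. The high
-- part `a` fixes the variables `zs`, which are not summed.
sums-digits : ∀ {k} n .{{_ : NonZero n}} (xs zs : List (Fin k)) F a →
  sum< (n ^ length xs) (λ i → F (digits n (xs ++ zs) (i + a * n ^ length xs))) ≡ sums n xs F (digits n zs a)
sums-digits n []       zs F a = trans (ℤₚ.+-identityˡ _) (cong (λ z → F (digits n zs z)) (ℕₚ.*-identityʳ a))
sums-digits n (x ∷ xs) zs F a = begin
  sum< (n * N) (λ i → F (digits n (x ∷ xs ++ zs) (i + a * (n * N))))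
    ≡⟨ cong (λ z → sum< z (λ i → F (digits n (x ∷ xs ++ zs) (i + a * (n * N))))) (ℕₚ.*-comm n N) ⟩
  sum< (N * n) (λ i → F (digits n (x ∷ xs ++ zs) (i + a * (n * N))))
    ≡⟨ sum<-split N n _ ⟩
  sum< N (λ q → sum< n (λ b → F (digits n (x ∷ xs ++ zs) (b + q * n + a * (n * N)))))
    ≡⟨ sum<-cong N (λ q _ → sum<-cong n (λ b b< → peel b q b<)) ⟩
  sum< N (λ q → sum< n (λ b → F (digits n (xs ++ zs) (q + a * N) [ x ↦ b ])))
    ≡⟨ sums-digits n xs zs (λ h → sum< n (λ b → F (h [ x ↦ b ]))) a ⟩
  sums n xs (λ h → sum< n (λ b → F (h [ x ↦ b ]))) (digits n zs a) ∎
  where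
  open ≡-Reasoning
  N = n ^ length xs
  eq : ∀ b q a n N → b + q * n + a * (n * N) ≡ b + (q + a * N) * n
  eq = ℕ-solve-∀
  peel : ∀ b q → b < n → F (digits n (x ∷ xs ++ zs) (b + q * n + a * (n * N))) ≡ F (digits n (xs ++ zs) (q + a * N) [ x ↦ b ])
  peel b q b< = trans (cong (λ z → F (digits n (x ∷ xs ++ zs) z)) (eq b q a n N))
    (cong₂ (λ y z → F (digits n (xs ++ zs) y [ x ↦ z ])) (proj₁ (digit-step n b (q + a * N) b<)) (proj₂ (digit-step n b (q + a * N) b<)))

update-at : ∀ {k} (g : Assignment k) x a → (g [ x ↦ a ]) x ≡ a
update-at g x a with x Finₚ.≟ x
... | yes _ = refl
... | no ne = contradiction refl ne

update-≢ : ∀ {k} (g : Assignment k) {x y} a → x ≢ y → (g [ x ↦ a ]) y ≡ g y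
update-≢ g {x} {y} a ne with x Finₚ.≟ y
... | yes eq = contradiction eq ne
... | no _   = refl

digits-suffix : ∀ {k} n .{{_ : NonZero n}} (xs : List (Fin k)) {zs} i a {z} → i < n ^ length xs → z ∉ xs →
  digits n (xs ++ zs) (i + a * n ^ length xs) z ≡ digits n zs a z
digits-suffix n [] {zs} zero a _ _ = cong (λ w → digits n zs w _) (ℕₚ.*-identityʳ a)
digits-suffix n [] (suc i) a (s≤s ()) _
digits-suffix n (x ∷ xs) {zs} i a {z} i< z∉ = begin
  digits n (x ∷ xs ++ zs) (i + a * (n * N)) z
    ≡⟨ cong (λ w → digits n (x ∷ xs ++ zs) w z) split ⟩
  digits n (x ∷ xs ++ zs) (i ℕ.% n + (i ℕ./ n + a * N) * n) z
    ≡⟨ update-≢ (digits n (xs ++ zs) ((i ℕ.% n + (i ℕ./ n + a * N) * n) ℕ./ n)) _ (λ eq → z∉ (here (sym eq))) ⟩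
  digits n (xs ++ zs) ((i ℕ.% n + (i ℕ./ n + a * N) * n) ℕ./ n) z
    ≡⟨ cong (λ w → digits n (xs ++ zs) w z) (proj₁ (digit-step n _ (i ℕ./ n + a * N) (DivMod.m%n<n i n))) ⟩
  digits n (xs ++ zs) (i ℕ./ n + a * N) z
    ≡⟨ digits-suffix n xs (i ℕ./ n) a (DivMod.m<n*o⇒m/o<n (subst (i <_) (ℕₚ.*-comm n N) i<)) (z∉ ∘ there) ⟩
  digits n zs a z ∎
  where
  open ≡-Reasoning
  N = n ^ length xs
  eq : ∀ r q a n N → r + q * n + a * (n * N) ≡ r + (q + a * N) * n
  eq = ℕ-solve-∀
  split : i + a * (n * N) ≡ i ℕ.% n + (i ℕ./ n + a * N) * n
  split = trans (cong (_+ a * (n * N)) (DivMod.m≡m%n+[m/n]*n i n)) (eq (i ℕ.% n) (i ℕ./ n) a n N)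

flat-cong : ∀ {k} n h {g g′ : Assignment k} xs → (∀ x → x ∈ xs → g x ≡ g′ x) → flat n h g xs ≡ flat n h g′ xs
flat-cong n h []       eq = refl
flat-cong n h (x ∷ xs) eq = cong₂ (λ a b → a + n * b) (eq x (here refl)) (flat-cong n h xs (λ y y∈ → eq y (there y∈)))

flat-lead : ∀ {k} n h (g : Assignment k) xs → flat n h g xs ≡ flat n 0 g xs + h * n ^ length xs
flat-lead n h g []       = sym (ℕₚ.*-identityʳ h)
flat-lead n h g (x ∷ xs) = trans (cong (λ z → g x + n * z) (flat-lead n h g xs)) (eq (g x) n (flat n 0 g xs) h (n ^ length xs))
  where
  eq : ∀ a n f h N → a + n * (f + h * N) ≡ a + n * f + h * (n * N)
  eq = ℕ-solve-∀

flat-++ : ∀ {k} n h (g : Assignment k) xs ys → flat n h g (xs ++ ys) ≡ flat n (flat n h g ys) g xs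
flat-++ n h g []       ys = refl
flat-++ n h g (x ∷ xs) ys = cong (λ z → g x + n * z) (flat-++ n h g xs ys)

flat-< : ∀ {k} n (g : Assignment k) → (∀ x → g x < n) → ∀ xs → flat n 0 g xs < n ^ length xs
flat-< n g g< xs = ℕₚ.≤-trans (flat-≤ n 0 g g< xs) (ℕₚ.≤-reflexive (ℕₚ.*-identityˡ _))

unique-head : ∀ {k} {x : Fin k} {xs} → Unique (x ∷ xs) → ∀ {y} → y ∈ xs → x ≢ y
unique-head (x∉ ∷ _) y∈ = All.lookup x∉ y∈

flat-digits : ∀ {k} n .{{_ : NonZero n}} (zs : List (Fin k)) a → Unique zs → a < n ^ length zs → flat n 0 (digits n zs a) zs ≡ a
flat-digits n []       zero    u       a< = refl
flat-digits n []       (suc a) u       (s≤s ())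
flat-digits n (z ∷ zs) a       u@(_ ∷ us) a< = begin
  digits n (z ∷ zs) a z + n * flat n 0 (digits n (z ∷ zs) a) zs
    ≡⟨ cong₂ (λ x y → x + n * y) (update-at (digits n zs (a ℕ./ n)) z _)
         (flat-cong n 0 zs (λ y y∈ → update-≢ (digits n zs (a ℕ./ n)) _ (unique-head u y∈))) ⟩
  a ℕ.% n + n * flat n 0 (digits n zs (a ℕ./ n)) zs
    ≡⟨ cong (λ y → a ℕ.% n + n * y) (flat-digits n zs (a ℕ./ n) us (DivMod.m<n*o⇒m/o<n (subst (a <_) (ℕₚ.*-comm n _) a<))) ⟩
  a ℕ.% n + n * (a ℕ./ n)
    ≡⟨ cong (a ℕ.% n ℕ.+_) (ℕₚ.*-comm n _) ⟩
  a ℕ.% n + a ℕ./ n * n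
    ≡⟨ DivMod.m≡m%n+[m/n]*n a n ⟨
  a ∎
  where open ≡-Reasoning

digits-flat : ∀ {k} n .{{_ : NonZero n}} (g : Assignment k) → (∀ x → g x < n) → ∀ zs x → x ∈ zs →
  digits n zs (flat n 0 g zs) x ≡ g x
digits-flat n g g< (z ∷ zs) x x∈ = trans
  (cong₂ (λ p q → (digits n zs p [ z ↦ q ]) x) (proj₁ st) (proj₂ st)) (by (z Finₚ.≟ x) x∈)
  where
  F = flat n 0 g zs
  comm : g z + n * F ≡ g z + F * n
  comm = cong (g z ℕ.+_) (ℕₚ.*-comm n F)
  st : (g z + n * F) ℕ./ n ≡ F × (g z + n * F) ℕ.% n ≡ g z
  st = subst (λ w → w ℕ./ n ≡ F × w ℕ.% n ≡ g z) (sym comm) (digit-step n (g z) F (g< z))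
  by : Dec (z ≡ x) → x ∈ z ∷ zs → (digits n zs F [ z ↦ g z ]) x ≡ g x
  by (yes refl) _            = update-at (digits n zs F) z _
  by (no ne)    (here x≡z)   = contradiction (sym x≡z) ne
  by (no ne)    (there x∈zs) = trans (update-≢ (digits n zs F) _ ne) (digits-flat n g g< zs x x∈zs)

-- The shape of every statement of the counting program: `zs` index the table that is filled, and
-- `xs`, the low digits of the counter, are summed out.
tabulated : ∀ {k} → List (Fin k) → List (Fin k) → ℤ → ℕ → ℕ → ℕ → List (Ref k) → Stmt k
tabulated xs zs c r h off ρs = stmt (xs ++ zs) c (ref r h off zs) ρs

module _ {k} (n : ℕ) .{{_ : NonZero n}} (xs zs : List (Fin k)) (c : ℤ) (r h off : ℕ) (ρs : List (Ref k)) (arr : Arrays)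
         (unique : Unique (xs ++ zs)) where

  private
    s = tabulated xs zs c r h off ρs
    N = n ^ length xs
    m = length zs
    w : Assignment k → ℤ
    w = weigh n c ρs arr
    total : n ^ length (xs ++ zs) ≡ n ^ m * N
    total = trans (cong (n ^_) (Listₚ.length-++ xs)) (trans (ℕₚ.^-distribˡ-+-* n (length xs) m) (ℕₚ.*-comm N (n ^ m)))
    disjoint : ∀ {z} → z ∈ zs → z ∉ xs
    disjoint = go′ xs unique
      where
      go′ : ∀ xs → Unique (xs ++ zs) → ∀ {z} → z ∈ zs → z ∉ xs
      go′ (x ∷ xs) u z∈ (here refl)  = unique-head u (∈-++⁺ʳ xs z∈) refl
      go′ (x ∷ xs) (_ ∷ u) z∈ (there z∈xs) = go′ xs u z∈ z∈xs
    unique-zs : Unique zs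
    unique-zs = drop′ xs unique
      where
      drop′ : ∀ xs → Unique (xs ++ zs) → Unique zs
      drop′ []       u       = u
      drop′ (x ∷ xs) (_ ∷ u) = drop′ xs u

    target-address : ∀ i q → i < N → q < n ^ m →
      address n (target s) (digits n (xs ++ zs) (i + q * N)) ≡ off + (q + h * n ^ m)
    target-address i q i< q< = cong (off ℕ.+_) (trans (flat-lead n h _ zs) (cong (_+ h * n ^ m)
      (trans (flat-cong n 0 zs (λ z z∈ → digits-suffix n xs i q i< (disjoint z∈))) (flat-digits n zs q unique-zs q<))))

  -- Exactly the counters with high part `a` write to this cell, and their low parts run through all
  -- values of `xs`.
  perform-hit : ∀ a → a < n ^ m →
    perform n s arr r (off + (a + h * n ^ m)) ≡ arr r (off + (a + h * n ^ m)) ℤ.+ sums n xs w (digits n zs a)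
  perform-hit a a< = cong (ℤ._+_ (arr r cell)) (begin
    sum< (n ^ length (xs ++ zs)) f
      ≡⟨ cong (λ z → sum< z f) total ⟩
    sum< (n ^ m * N) f
      ≡⟨ sum<-split (n ^ m) N f ⟩
    sum< (n ^ m) (λ q → sum< N (λ i → f (i + q * N)))
      ≡⟨ sum<-single (n ^ m) a a< (λ q q< q≢a → sum<-vanish N λ i i< → contribution-miss n s arr r cell (i + q * N)
           (λ eq → q≢a (ℕₚ.+-cancelʳ-≡ _ q a (ℕₚ.+-cancelˡ-≡ off _ _ (trans (sym (target-address i q i< q<)) eq))))) ⟩
    sum< N (λ i → f (i + a * N))
      ≡⟨ sum<-cong N (λ i i< → trans (cong (λ z → contribution n s arr r z (i + a * N)) (sym (target-address i a i< a<)))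
                                     (contribution-hit n s arr (i + a * N))) ⟩
    sum< N (λ i → w (digits n (xs ++ zs) (i + a * N)))
      ≡⟨ sums-digits n xs zs w a ⟩
    sums n xs w (digits n zs a) ∎)
    where
    open ≡-Reasoning
    cell = off + (a + h * n ^ m)
    f : ℕ → ℤ
    f = contribution n s arr r cell

  perform-miss : ∀ cell → (∀ a → a < n ^ m → off + (a + h * n ^ m) ≢ cell) → perform n s arr r cell ≡ arr r cell
  perform-miss cell ne = trans (cong (ℤ._+_ (arr r cell)) (trans (cong (λ z → sum< z (contribution n s arr r cell)) total)
    (trans (sum<-split (n ^ m) N _) (sum<-vanish (n ^ m) λ q q< → sum<-vanish N λ i i< →
      contribution-miss n s arr r cell (i + q * N) λ eq → ne q q< (trans (sym (target-address i q i< q<)) eq)))))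
    (ℤₚ.+-identityʳ _)

-- Elimination along a path decomposition

Edge : ℕ → Set
Edge k = Fin k × Fin k

hostEntries : ∀ {n} → Graph n → List ℤ
hostEntries H = rowMajor (λ u v → if Graph.adj H u v then + 1 else + 0)

-- In a row-major matrix the column is the least significant digit, and `flat` expects that digit at
-- the head; so `v` precedes `u`.
edgeRef : ∀ {k} → Edge k → Ref k
edgeRef (u , v) = ref 0 0 0 (v ∷ u ∷ [])

edgeValue : ∀ {k n} → Graph n → Edge k → Assignment k → ℤ
edgeValue {n = n} H e g = contents (hostEntries H) (address n (edgeRef e) g)

edgeProduct : ∀ {k n} → Graph n → List (Edge k) → Assignment k → ℤ
edgeProduct H []       g = + 1
edgeProduct H (e ∷ es) g = edgeProduct H es g ℤ.* edgeValue H e g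

weigh-edges : ∀ {k n} (H : Graph n) c (es : List (Edge k)) arr g → (∀ a → arr 0 a ≡ contents (hostEntries H) a) →
  weigh n c (map edgeRef es) arr g ≡ c ℤ.* edgeProduct H es g
weigh-edges H c []       arr g eq = sym (ℤₚ.*-identityʳ c)
weigh-edges H c (e ∷ es) arr g eq = trans (cong₂ ℤ._*_ (weigh-edges H c es arr g eq) (eq _)) (ℤₚ.*-assoc c _ _)

DependsOn : ∀ {k} → List (Fin k) → (Assignment k → ℤ) → Set
DependsOn S F = ∀ g g′ → (∀ x → x ∈ S → g x ≡ g′ x) → F g ≡ F g′

Within : ∀ {k} → List (Fin k) → Edge k → Set
Within S (u , v) = u ∈ S × v ∈ S

edgeValue-depends : ∀ {k n} (H : Graph n) {S} (e : Edge k) → Within S e → DependsOn S (edgeValue H e)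
edgeValue-depends {n = n} H (u , v) (u∈ , v∈) g g′ eq =
  cong₂ (λ a b → contents (hostEntries H) (a + n * (b + n * 0))) (eq v v∈) (eq u u∈)

edgeProduct-depends : ∀ {k n} (H : Graph n) {S} (es : List (Edge k)) → All (Within S) es → DependsOn S (edgeProduct H es)
edgeProduct-depends H []       []       g g′ eq = refl
edgeProduct-depends H (e ∷ es) (w ∷ ws) g g′ eq = cong₂ ℤ._*_ (edgeProduct-depends H es ws g g′ eq) (edgeValue-depends H e w g g′ eq)

Touches : ∀ {k} → Fin k → Edge k → Set
Touches x (u , v) = u ≡ x ⊎ v ≡ x

touches? : ∀ {k} (x : Fin k) e → Dec (Touches x e)
touches? x (u , v) = (u Finₚ.≟ x) ⊎-dec (v Finₚ.≟ x)

touching avoiding : ∀ {k} → Fin k → List (Edge k) → List (Edge k)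
touching x = filter (touches? x)
avoiding x = filter (¬? ∘ touches? x)

edgeProduct-split : ∀ {k n} (H : Graph n) {P : Edge k → Set} (P? : ∀ e → Dec (P e)) es g →
  edgeProduct H es g ≡ edgeProduct H (filter P? es) g ℤ.* edgeProduct H (filter (¬? ∘ P?) es) g
edgeProduct-split H P? []       g = refl
edgeProduct-split H P? (e ∷ es) g with P? e
... | yes _ = trans (cong (ℤ._* _) (edgeProduct-split H P? es g)) (swap (edgeProduct H (filter P? es) g) _ _)
  where
  swap : ∀ a b c → a ℤ.* b ℤ.* c ≡ a ℤ.* c ℤ.* b
  swap = ℤ-solve-∀
... | no _  = trans (cong (ℤ._* _) (edgeProduct-split H P? es g)) (ℤₚ.*-assoc (edgeProduct H (filter P? es) g) _ _)

edgeProduct-update : ∀ {k n} (H : Graph n) x a (es : List (Edge k)) g →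
  edgeProduct H (avoiding x es) (g [ x ↦ a ]) ≡ edgeProduct H (avoiding x es) g
edgeProduct-update {n = n} H x a []       g = refl
edgeProduct-update {n = n} H x a ((u , v) ∷ es) g with u Finₚ.≟ x | v Finₚ.≟ x
... | yes _  | _      = edgeProduct-update H x a es g
... | no _   | yes _  = edgeProduct-update H x a es g
... | no u≢x | no v≢x = cong₂ ℤ._*_ (edgeProduct-update H x a es g)
  (cong₂ (λ a b → contents (hostEntries H) (a + n * (b + n * 0)))
    (update-≢ g a (v≢x ∘ sym)) (update-≢ g a (u≢x ∘ sym)))

InRange : ∀ {k} → ℕ → Assignment k → Set
InRange n g = ∀ x → g x < n

update-inRange : ∀ {k n} {g : Assignment k} {x a} → InRange n g → a < n → InRange n (g [ x ↦ a ])
update-inRange {x = x} g< a< y with x Finₚ.≟ y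
... | yes _ = a<
... | no _  = g< y

sums-cong : ∀ {k} n (xs : List (Fin k)) {F F′} → (∀ g → InRange n g → F g ≡ F′ g) → ∀ g → InRange n g →
  sums n xs F g ≡ sums n xs F′ g
sums-cong n []       eq g g< = eq g g<
sums-cong n (x ∷ xs) eq g g< = sums-cong n xs (λ h h< → sum<-cong n λ a a< → eq _ (update-inRange h< a<)) g g<

sums-ext : ∀ {k} n (xs : List (Fin k)) {F F′} → (∀ h → F h ≡ F′ h) → ∀ g → sums n xs F g ≡ sums n xs F′ g
sums-ext n []       eq g = eq g
sums-ext n (x ∷ xs) eq g = sums-ext n xs (λ h → sum<-cong n λ a _ → eq _) g

sums-*ˡ : ∀ {k} n (xs : List (Fin k)) c F g → sums n xs (λ h → c ℤ.* F h) g ≡ c ℤ.* sums n xs F g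
sums-*ˡ n []       c F g = refl
sums-*ˡ n (x ∷ xs) c F g = trans (sums-ext n xs (λ h → sum<-*ˡ n c (λ a → F (h [ x ↦ a ]))) g) (sums-*ˡ n xs c _ g)

unique-⊆-length : ∀ {A : Set} {xs ys : List A} → Unique xs → (∀ {z} → z ∈ xs → z ∈ ys) → length xs ≤ length ys
unique-⊆-length []            incl = z≤n
unique-⊆-length {xs = x ∷ xs} (x∉ ∷ u) incl with ∈-∃++ (incl (here refl))
... | as , bs , refl = subst (suc (length xs) ≤_)
    (sym (trans (Listₚ.length-++ as) (trans (ℕₚ.+-suc (length as) (length bs)) (cong suc (sym (Listₚ.length-++ as))))))
    (s≤s (unique-⊆-length u keep))
  where
  keep : ∀ {z} → z ∈ xs → z ∈ as ++ bs
  keep z∈ with ∈-++⁻ as (incl (there z∈))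
  ... | inj₁ z∈as          = ∈-++⁺ˡ z∈as
  ... | inj₂ (here z≡x)    = contradiction (sym z≡x) (All.lookup x∉ z∈)
  ... | inj₂ (there z∈bs)  = ∈-++⁺ʳ as z∈bs

unique-length : ∀ {k} {xs : List (Fin k)} → Unique xs → length xs ≤ k
unique-length {k} {xs} u = subst (length xs ≤_) (Listₚ.length-tabulate {n = k} (λ i → i)) (unique-⊆-length {ys = allFin k} u (λ {z} _ → ∈-allFin z))

Value : Set
Value = ∀ n → .{{NonZero n}} → Graph n → ℤ

Family : ℕ → Set
Family k = ∀ n → .{{NonZero n}} → Graph n → Assignment k → ℤ

-- Array 0 holds the host graph and array 1 the result so far; arrays from r on are unused.
Ready : ℕ → Value → Assertion
Ready r v n H arr = (∀ a → arr 0 a ≡ contents (hostEntries H) a) × arr 1 0 ≡ v n H × (∀ r′ → r ≤ r′ → ∀ a → arr r′ a ≡ + 0)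

Tabled : ∀ {k} → ℕ → List (Fin k) → Family k → Value → Assertion
Tabled r S Φ v n H arr = Ready (suc r) v n H arr × (∀ a → a < n ^ length S → arr r a ≡ Φ n H (digits n S a))

perform-≢ : ∀ {k} n .{{_ : NonZero n}} (s : Stmt k) arr r a → array (target s) ≢ r → perform n s arr r a ≡ arr r a
perform-≢ n s arr r a = partialResult-≢ n s arr (n ^ length (loops s)) r a

lookup-table : ∀ {k} n .{{_ : NonZero n}} {S : List (Fin k)} {Φ : Assignment k → ℤ} {r} {arr : Arrays} → DependsOn S Φ →
  (∀ a → a < n ^ length S → arr r a ≡ Φ (digits n S a)) → ∀ g → InRange n g → arr r (address n (ref r 0 0 S) g) ≡ Φ g
lookup-table n {S} dep tab g g< = trans (tab _ (flat-< n g g< S)) (dep _ _ (λ x x∈ → digits-flat n g g< S x x∈))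

module Elimination (k R : ℕ) (𝓐 : Algorithm) (clock : Clock) where

  private
    8<K : 8 < 9 + k
    8<K = ℕₚ.m≤m+n 9 k

  open Clock clock
  open Programs (9 + k) R 𝓐 public
  open Logic k (9 + k) R 8<K 𝓐 clock public

  Allowed : ℕ → Set
  Allowed m = ∀ n .{{_ : NonZero n}} → Time n 1 (n ^ m)

  -- A schedule for variable elimination with its side conditions: `S` indexes the current table,
  -- the second list holds the edges not yet multiplied in, and the last one the variables still to
  -- be summed out. Eliminating x multiplies the table with all edges at x and sums over x, which
  -- needs a loop over `x ∷ S′`; the pinned variables are summed at the very end.
  data Plan (pinned : List (Fin k)) : List (Fin k) → List (Edge k) → List (Fin k) → Set where
    finish    : ∀ {S es} → Plan pinned S es []
    eliminate : ∀ {S es x rem} S′ → Unique (x ∷ S′) → Allowed (suc (length S′)) → (∀ y → y ∈ S → y ∈ x ∷ S′) →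
                All (Within (x ∷ S′)) (touching x es) → Plan pinned S′ (avoiding x es) rem → Plan pinned S es (x ∷ rem)

  module _ (pinned : List (Fin k)) (c : ℤ) where

    finishStmt : ℕ → List (Fin k) → List (Edge k) → Stmt k
    finishStmt r S es = tabulated pinned [] c 1 0 0 (ref r 0 0 S ∷ map edgeRef es)

    eliminateStmt : ℕ → Fin k → List (Fin k) → List (Fin k) → List (Edge k) → Stmt k
    eliminateStmt r x S S′ es = tabulated (x ∷ []) S′ (+ 1) (suc r) 0 0 (ref r 0 0 S ∷ map edgeRef (touching x es))

    planCmds : ∀ {S es rem} → ℕ → Plan pinned S es rem → List (Cmd k)
    planCmds {S} {es} r finish = assign (finishStmt r S es) ∷ []
    planCmds {S} {es} {x ∷ _} r (eliminate S′ _ _ _ _ plan) = assign (eliminateStmt r x S S′ es) ∷ planCmds (suc r) plan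

    module _ (pinned-unique : Unique pinned) (pinned-allowed : Allowed (length pinned)) where

      private
        registers : ∀ {xs : List (Fin k)} → Unique xs → 8 + length xs < 9 + k
        registers u = s≤s (ℕₚ.+-monoʳ-≤ 8 (unique-length u))

        edges-usable : ∀ {t} (es : List (Edge k)) → 0 < R → t ≢ 0 → All (λ ρ → array ρ < R × t ≢ array ρ) (map edgeRef es)
        edges-usable []       0<R t≢0 = []
        edges-usable (e ∷ es) 0<R t≢0 = (0<R , t≢0) ∷ edges-usable es 0<R t≢0

        ++-[] : ∀ {xs : List (Fin k)} → Unique xs → Unique (xs ++ [])
        ++-[] {xs} = subst Unique (sym (Listₚ.++-identityʳ xs))

      finish-hoare : ∀ {S es} r (Φ : Family k) v → 2 ≤ r → r < R → (∀ n .{{_ : NonZero n}} H → DependsOn S (Φ n H)) →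
        HoareCmd (assign (finishStmt r S es)) (Tabled r S Φ v)
          (Ready (suc r) (λ n H → v n H ℤ.+ c ℤ.* sums n pinned (λ g → Φ n H g ℤ.* edgeProduct H es g) origin))
      finish-hoare {S} {es} r Φ v 2≤r r<R dep = hoare-assign (finishStmt r S es) (registers (++-[] pinned-unique))
        (ℕₚ.<-trans (ℕₚ.<-≤-trans (s≤s (s≤s z≤n)) 2≤r) r<R)
        ((r<R , (λ { refl → ℕₚ.<⇒≱ 2≤r ℕₚ.≤-refl })) ∷ edges-usable es (ℕₚ.≤-<-trans z≤n r<R) (λ ()))
        (subst Allowed (sym (cong length (Listₚ.++-identityʳ pinned))) pinned-allowed)
        λ n H arr ((adj , out , fresh) , tab) →
          ( (λ a → trans (perform-≢ n s arr 0 a (λ ())) (adj a))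
          , trans (perform-hit n pinned [] c 1 0 0 (factors s) arr (++-[] pinned-unique) 0 (s≤s z≤n))
              (cong₂ ℤ._+_ out (trans
                (sums-cong n pinned (λ g g< → trans (cong₂ ℤ._*_ (weigh-edges H c es arr g adj) (lookup-table n {r = r} {arr} (dep n H) tab g g<))
                  (swap c (edgeProduct H es g) (Φ n H g))) origin (λ _ → ℕ.>-nonZero⁻¹ n))
                (sums-*ˡ n pinned c _ origin)))
          , λ r′ r<r′ a → trans (perform-≢ n s arr r′ a (λ { refl → ℕₚ.<⇒≱ 2≤r (ℕₚ.≤-trans (ℕₚ.n≤1+n r) r<r′) })) (fresh r′ r<r′ a) )
        where
        s = finishStmt r S es
        swap : ∀ a b c → a ℤ.* b ℤ.* c ≡ a ℤ.* (c ℤ.* b)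
        swap = ℤ-solve-∀

      eliminate-hoare : ∀ {S S′ es} x r (Φ : Family k) v → 2 ≤ r → suc r < R → (∀ n .{{_ : NonZero n}} H → DependsOn S (Φ n H)) →
        Unique (x ∷ S′) → Allowed (suc (length S′)) →
        HoareCmd (assign (eliminateStmt r x S S′ es)) (Tabled r S Φ v)
          (Tabled (suc r) S′ (λ n H g → sum< n (λ a → Φ n H (g [ x ↦ a ]) ℤ.* edgeProduct H (touching x es) (g [ x ↦ a ]))) v)
      eliminate-hoare {S} {S′} {es} x r Φ v 2≤r r<R dep unique allowed = hoare-assign s (registers unique) r<R
        ((ℕₚ.<-trans (ℕₚ.n<1+n r) r<R , ℕₚ.1+n≢n) ∷ edges-usable (touching x es) (ℕₚ.≤-<-trans z≤n r<R) (λ ()))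
        allowed
        λ n H arr ((adj , out , fresh) , tab) →
          ( (λ a → trans (perform-≢ n s arr 0 a (λ ())) (adj a))
          , trans (perform-≢ n s arr 1 0 (λ eq → ℕₚ.<⇒≱ (s≤s 2≤r) (ℕₚ.≤-trans (ℕₚ.≤-reflexive eq) (s≤s z≤n)))) out
          , λ r′ r<r′ a → trans (perform-≢ n s arr r′ a (λ { refl → ℕₚ.<-irrefl refl r<r′ })) (fresh r′ (ℕₚ.<⇒≤ r<r′) a) )
          , λ a a< → trans (cong (perform n s arr (suc r)) (sym (ℕₚ.+-identityʳ a)))
              (trans (perform-hit n (x ∷ []) S′ (+ 1) (suc r) 0 0 (factors s) arr unique a a<)
              (trans (cong₂ ℤ._+_ (fresh (suc r) ℕₚ.≤-refl _)
                (sum<-cong n λ b b< → let g = digits n S′ a [ x ↦ b ] in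
                  trans (cong₂ ℤ._*_ (weigh-edges H (+ 1) (touching x es) arr g adj)
                    (lookup-table n {r = r} {arr} (dep n H) tab g (update-inRange (digits-< n S′ a) b<)))
                  (swap (edgeProduct H (touching x es) g) (Φ n H g))))
              (ℤₚ.+-identityˡ _)))
        where
        s = eliminateStmt r x S S′ es
        swap : ∀ b c → + 1 ℤ.* b ℤ.* c ≡ c ℤ.* b
        swap = ℤ-solve-∀

      -- Distributivity: edges that avoid x are moved out of the sum over x. The sum that remains
      -- depends only on the values on `S′` and becomes the next table.
      plan-hoare : ∀ {S es rem} r (Φ : Family k) v (plan : Plan pinned S es rem) → 2 ≤ r → r + length rem < R →
        (∀ n .{{_ : NonZero n}} H → DependsOn S (Φ n H)) →
        Hoare (planCmds r plan) (Tabled r S Φ v)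
          (Ready (suc r + length rem) (λ n H → v n H ℤ.+ c ℤ.* sums n (rem ++ pinned) (λ g → Φ n H g ℤ.* edgeProduct H es g) origin))
      plan-hoare {S} {es} r Φ v finish 2≤r r<R dep = hoare-∷ {assign (finishStmt r S es)} {[]} (finish-hoare {S} {es} r Φ v 2≤r (subst (_< R) (ℕₚ.+-identityʳ r) r<R) dep)
        (hoare-[] λ n H {arr} → λ (adj , out , fresh) → adj , out , λ r′ r< → fresh r′ (ℕₚ.≤-trans (ℕₚ.≤-reflexive (sym (ℕₚ.+-identityʳ (suc r)))) r<))
      plan-hoare {S} {es} {x ∷ rem} r Φ v (eliminate S′ unique allowed incl within plan) 2≤r r<R dep =
        hoare-∷ {assign (eliminateStmt r x S S′ es)} {planCmds (suc r) plan} (eliminate-hoare {S} {S′} {es} x r Φ v 2≤r (ℕₚ.≤-<-trans (ℕₚ.m≤m+n (suc r) _) r<R′) dep unique allowed)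
          (λ {B} pB → convert pB (plan-hoare (suc r) Φ′ v plan (ℕₚ.m≤n⇒m≤1+n 2≤r) r<R′ dep′ pB))
        where
        r<R′ : suc r + length rem < R
        r<R′ = subst (_< R) (ℕₚ.+-suc r (length rem)) r<R
        Φ′ : Family k
        Φ′ n H g = sum< n (λ a → Φ n H (g [ x ↦ a ]) ℤ.* edgeProduct H (touching x es) (g [ x ↦ a ]))
        agree : ∀ {g g′ : Assignment k} a → (∀ y → y ∈ S′ → g y ≡ g′ y) → ∀ y → y ∈ x ∷ S′ → (g [ x ↦ a ]) y ≡ (g′ [ x ↦ a ]) y
        agree a eq y y∈ with x Finₚ.≟ y | y∈
        ... | yes _ | _          = refl
        ... | no ne | here y≡x   = contradiction (sym y≡x) ne
        ... | no _  | there y∈S′ = eq y y∈S′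
        dep′ : ∀ n .{{_ : NonZero n}} H → DependsOn S′ (Φ′ n H)
        dep′ n H g g′ eq = sum<-cong n λ a _ → cong₂ ℤ._*_
          (dep n H _ _ (λ y y∈ → agree {g} {g′} a eq y (incl y y∈)))
          (edgeProduct-depends H (touching x es) within _ _ (agree {g} {g′} a eq))
        total : ∀ n .{{_ : NonZero n}} H → sums n (rem ++ pinned) (λ g → Φ′ n H g ℤ.* edgeProduct H (avoiding x es) g) origin
          ≡ sums n (x ∷ rem ++ pinned) (λ g → Φ n H g ℤ.* edgeProduct H es g) origin
        total n H = sums-cong n (rem ++ pinned) (λ g g< →
          trans (ℤₚ.*-comm (Φ′ n H g) _) (trans (sym (sum<-*ˡ n (edgeProduct H (avoiding x es) g) _))
          (sum<-cong n λ a _ → regroup g a)))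
          origin (λ _ → ℕ.>-nonZero⁻¹ n)
          where
          swap : ∀ a b c → a ℤ.* (b ℤ.* c) ≡ b ℤ.* (c ℤ.* a)
          swap = ℤ-solve-∀
          regroup : ∀ g a → let g′ = g [ x ↦ a ] in
            edgeProduct H (avoiding x es) g ℤ.* (Φ n H g′ ℤ.* edgeProduct H (touching x es) g′) ≡ Φ n H g′ ℤ.* edgeProduct H es g′
          regroup g a = trans (cong (ℤ._* (Φ n H g′ ℤ.* edgeProduct H (touching x es) g′)) (sym (edgeProduct-update H x a es g)))
            (trans (swap (edgeProduct H (avoiding x es) g′) (Φ n H g′) (edgeProduct H (touching x es) g′))
            (cong (ℤ._*_ (Φ n H g′)) (sym (edgeProduct-split H (touches? x) es g′))))
            where g′ = g [ x ↦ a ]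
        convert : ∀ {B} → Poly B → Outcome (λ o → compile o (planCmds (suc r) plan)) (Tabled (suc r) S′ Φ′ v)
            (Ready (suc (suc r) + length rem) (λ n H → v n H ℤ.+ c ℤ.* sums n (rem ++ pinned) (λ g → Φ′ n H g ℤ.* edgeProduct H (avoiding x es) g) origin)) B →
          Outcome (λ o → compile o (planCmds (suc r) plan)) (Tabled (suc r) S′ Φ′ v)
            (Ready (suc r + suc (length rem)) (λ n H → v n H ℤ.+ c ℤ.* sums n (x ∷ rem ++ pinned) (λ g → Φ n H g ℤ.* edgeProduct H es g) origin)) B
        convert pB = outcome-weaken λ n H (adj , out , fresh) → adj
          , trans out (cong (λ z → v n H ℤ.+ c ℤ.* z) (total n H))
          , λ r′ r≤ → fresh r′ (subst (_≤ r′) (cong suc (ℕₚ.+-suc r (length rem))) r≤)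

      -- The elimination starts from a table without indices, whose single entry is the empty
      -- product 1.
      fullPlan-hoare : ∀ {es rem} r v (plan : Plan pinned [] es rem) → 2 ≤ r → r + length rem < R → Allowed 0 →
        Hoare (assign (tabulated [] [] (+ 1) r 0 0 []) ∷ planCmds r plan) (Ready r v)
          (Ready (suc r + length rem) (λ n H → v n H ℤ.+ c ℤ.* sums n (rem ++ pinned) (edgeProduct H es) origin))
      fullPlan-hoare {es} {rem} r v plan 2≤r r<R allowed = hoare-∷ {assign s} {planCmds r plan}
        (hoare-assign s (ℕₚ.m≤m+n 9 k) (ℕₚ.≤-<-trans (ℕₚ.m≤m+n r _) r<R) [] allowed
          λ n H arr (adj , out , fresh) →
            ( (λ a → trans (perform-≢ n s arr 0 a (λ { refl → ℕₚ.<⇒≱ 2≤r z≤n })) (adj a))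
            , trans (perform-≢ n s arr 1 0 (λ { refl → ℕₚ.<⇒≱ 2≤r ℕₚ.≤-refl })) out
            , λ r′ r<r′ a → trans (perform-≢ n s arr r′ a (λ { refl → ℕₚ.<-irrefl refl r<r′ })) (fresh r′ (ℕₚ.<⇒≤ r<r′) a) )
            , λ { zero _ → trans (perform-hit {k} n [] [] (+ 1) r 0 0 [] arr [] 0 (s≤s z≤n)) (cong (ℤ._+ + 1) (fresh r ℕₚ.≤-refl 0))
                ; (suc _) (s≤s ()) })
        λ pB → outcome-weaken {Post′ = Ready (suc r + length rem) (λ n H → v n H ℤ.+ c ℤ.* sums n (rem ++ pinned) (edgeProduct H es) origin)} (λ n H (adj , out , fresh) → adj
          , trans out (cong (λ z → v n H ℤ.+ c ℤ.* z) (sums-cong n (rem ++ pinned) (λ g _ → ℤₚ.*-identityˡ (edgeProduct H es g)) origin (λ _ → ℕ.>-nonZero⁻¹ n)))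
          , fresh) (plan-hoare r (λ _ _ _ → + 1) v plan 2≤r r<R (λ n H g g′ eq → refl) pB)
        where s = tabulated [] [] (+ 1) r 0 0 []

-- Counting by one matrix product

contents-++ˡ : ∀ xs {ys} c → c < length xs → contents (xs ++ ys) c ≡ contents xs c
contents-++ˡ (x ∷ xs) zero    c< = refl
contents-++ˡ (x ∷ xs) (suc c) c< = contents-++ˡ xs c (ℕₚ.≤-pred c<)

contents-++ʳ : ∀ xs {ys} c → contents (xs ++ ys) (length xs + c) ≡ contents ys c
contents-++ʳ []       c = refl
contents-++ʳ (x ∷ xs) c = contents-++ʳ xs c

contents-beyond : ∀ xs c → length xs ≤ c → contents xs c ≡ + 0
contents-beyond []       c       h       = refl
contents-beyond (x ∷ xs) (suc c) (s≤s h) = contents-beyond xs c h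

contents-lookup : ∀ xs (i : Fin (length xs)) → List.lookup xs i ≡ contents xs (toℕ i)
contents-lookup (x ∷ xs) Fin.zero    = refl
contents-lookup (x ∷ xs) (Fin.suc i) = contents-lookup xs i

contents-tabulate : ∀ n (f : Fin n → ℤ) j → contents (tabulate f) (toℕ j) ≡ f j
contents-tabulate (suc n) f Fin.zero    = refl
contents-tabulate (suc n) f (Fin.suc j) = contents-tabulate n (f ∘ Fin.suc) j

contents-entry : ∀ m n (M : Matrix ℤ m n) i j → contents (rowMajor M) (toℕ j + n * toℕ i) ≡ M i j
contents-entry (suc m) n M Fin.zero j =
  trans (cong (contents (rowMajor M)) (trans (cong (toℕ j ℕ.+_) (ℕₚ.*-zeroʳ n)) (ℕₚ.+-identityʳ _)))
  (trans (contents-++ˡ (tabulate (M Fin.zero)) (toℕ j) (subst (toℕ j <_) (sym (Listₚ.length-tabulate (M Fin.zero))) (Finₚ.toℕ<n j)))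
  (contents-tabulate n (M Fin.zero) j))
contents-entry (suc m) n M (Fin.suc i) j =
  trans (cong (contents (rowMajor M)) (trans (eq (toℕ j) n (toℕ i)) (cong (_+ (toℕ j + n * toℕ i)) (sym (Listₚ.length-tabulate (M Fin.zero))))))
  (trans (contents-++ʳ (tabulate (M Fin.zero)) (toℕ j + n * toℕ i)) (contents-entry m n (M ∘ Fin.suc) i j))
  where
  eq : ∀ j n i → j + n * suc i ≡ n + (j + n * i)
  eq = ℕ-solve-∀

contents-grid : ∀ m n (φ : ℕ → ℤ) c → c < m * n → contents (rowMajor {m = m} {n} (λ i j → φ (toℕ j + n * toℕ i))) c ≡ φ c
contents-grid m zero    φ c c< = contradiction (subst (c <_) (ℕₚ.*-zeroʳ m) c<) ℕₚ.n≮0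
contents-grid m n@(suc _) φ c c< = begin
  contents (rowMajor M) c                      ≡⟨ cong (contents (rowMajor M)) c≡ ⟩
  contents (rowMajor M) (toℕ j + n * toℕ i)    ≡⟨ contents-entry m n M i j ⟩
  φ (toℕ j + n * toℕ i)                        ≡⟨ cong φ c≡ ⟨
  φ c                                          ∎
  where
  open ≡-Reasoning
  M : Matrix ℤ m n
  M i j = φ (toℕ j + n * toℕ i)
  i : Fin m
  i = Fin.fromℕ< (DivMod.m<n*o⇒m/o<n c<)
  j : Fin n
  j = Fin.fromℕ< (DivMod.m%n<n c n)
  c≡ : c ≡ toℕ j + n * toℕ i
  c≡ = trans (DivMod.m≡m%n+[m/n]*n c n) (cong₂ _+_ (sym (Finₚ.toℕ-fromℕ< _)) (trans (ℕₚ.*-comm (c ℕ./ n) n) (cong (n *_) (sym (Finₚ.toℕ-fromℕ< _)))))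

sum≡sum< : ∀ n (f : ℕ → ℤ) → sum ℤₚ.+-0-monoid {n} (f ∘ toℕ) ≡ sum< n f
sum≡sum< zero    f = refl
sum≡sum< (suc n) f = trans (cong (ℤ._+_ (f 0)) (sum≡sum< n (f ∘ suc)))
  (trans (cong (ℤ._+ sum< n (f ∘ suc)) (sym (ℤₚ.+-identityˡ (f 0)))) (sym (sum<-append 1 n f)))

sums-++ : ∀ {k} n (xs ys : List (Fin k)) F g → sums n (xs ++ ys) F g ≡ sums n ys (sums n xs F) g
sums-++ n []       ys F g = refl
sums-++ n (x ∷ xs) ys F g = sums-++ n xs ys (λ h → sum< n (λ a → F (h [ x ↦ a ]))) g

sums-ones : ∀ {k} n (xs : List (Fin k)) c g → sums n xs (λ _ → + c) g ≡ + (c * n ^ length xs)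
sums-ones n []       c g = cong +_ (sym (ℕₚ.*-identityʳ c))
sums-ones n (x ∷ xs) c g = trans (cong (λ z → sums n xs (λ _ → z) g) (ones n))
  (trans (sums-ones n xs (c * n) g) (cong +_ (ℕₚ.*-assoc c n _)))
  where
  ones : ∀ m → sum< m (λ _ → + c) ≡ + (c * m)
  ones zero    = cong +_ (sym (ℕₚ.*-zeroʳ c))
  ones (suc m) = trans (cong (ℤ._+ + c) (ones m)) (cong +_ (trans (ℕₚ.+-comm (c * m) c) (sym (ℕₚ.*-suc c m))))

depends-update : ∀ {k} {S : List (Fin k)} {F x a} → DependsOn S F → x ∉ S → ∀ g → F (g [ x ↦ a ]) ≡ F g
depends-update {a = a} dep x∉ g = dep _ _ (λ y y∈ → update-≢ g a (λ { refl → x∉ y∈ }))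

sums-factor : ∀ {k} n (xs : List (Fin k)) {S C} → DependsOn S C → (∀ x → x ∈ xs → x ∉ S) → ∀ F g →
  sums n xs (λ h → C h ℤ.* F h) g ≡ C g ℤ.* sums n xs F g
sums-factor n []       dep out F g = refl
sums-factor n (x ∷ xs) {S} {C} dep out F g = trans (ext xs (λ h → trans
    (sum<-cong n (λ a _ → cong (ℤ._* F (h [ x ↦ a ])) (depends-update dep (out x (here refl)) h)))
    (sum<-*ˡ n (C h) (λ a → F (h [ x ↦ a ])))) g)
  (sums-factor n xs dep (λ y y∈ → out y (there y∈)) _ g)
  where
  ext : ∀ ys {F F′} → (∀ h → F h ≡ F′ h) → ∀ g → sums n ys F g ≡ sums n ys F′ g
  ext []       eq g = eq g
  ext (y ∷ ys) eq g = ext ys (λ h → sum<-cong n λ a _ → eq _) g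

sums-depends : ∀ {k} n (xs : List (Fin k)) {S F} → DependsOn (xs ++ S) F → DependsOn S (sums n xs F)
sums-depends n []       dep = dep
sums-depends n (x ∷ xs) dep = sums-depends n xs (λ g g′ eq → sum<-cong n (λ a _ → dep _ _ (λ y y∈ → agree g g′ a eq y y∈)))
  where
  agree : ∀ g g′ a {S} → (∀ y → y ∈ S → g y ≡ g′ y) → ∀ y → y ∈ x ∷ S → (g [ x ↦ a ]) y ≡ (g′ [ x ↦ a ]) y
  agree g g′ a eq y y∈ with x Finₚ.≟ y | y∈
  ... | yes _ | _         = refl
  ... | no ne | here y≡x  = contradiction (sym y≡x) ne
  ... | no _  | there y∈S = eq y y∈S

digits-prefix : ∀ {k} n .{{_ : NonZero n}} (xs : List (Fin k)) {zs} i a {z} → i < n ^ length xs → z ∈ xs →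
  digits n (xs ++ zs) (i + a * n ^ length xs) z ≡ digits n xs i z
digits-prefix n (x ∷ xs) {zs} i a {z} i< z∈ = begin
  digits n (x ∷ xs ++ zs) (i + a * (n * N)) z
    ≡⟨ cong (λ w → digits n (x ∷ xs ++ zs) w z) split ⟩
  (digits n (xs ++ zs) (j ℕ./ n) [ x ↦ j ℕ.% n ]) z
    ≡⟨ cong₂ (λ p q → (digits n (xs ++ zs) p [ x ↦ q ]) z) (proj₁ st) (proj₂ st) ⟩
  (digits n (xs ++ zs) (i ℕ./ n + a * N) [ x ↦ i ℕ.% n ]) z
    ≡⟨ by (x Finₚ.≟ z) z∈ ⟩
  (digits n xs (i ℕ./ n) [ x ↦ i ℕ.% n ]) z ∎
  where
  open ≡-Reasoning
  N = n ^ length xs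
  j = i ℕ.% n + (i ℕ./ n + a * N) * n
  st = digit-step n (i ℕ.% n) (i ℕ./ n + a * N) (DivMod.m%n<n i n)
  eq : ∀ r q a n N → r + q * n + a * (n * N) ≡ r + (q + a * N) * n
  eq = ℕ-solve-∀
  split : i + a * (n * N) ≡ j
  split = trans (cong (_+ a * (n * N)) (DivMod.m≡m%n+[m/n]*n i n)) (eq (i ℕ.% n) (i ℕ./ n) a n N)
  by : Dec (x ≡ z) → z ∈ x ∷ xs →
    (digits n (xs ++ zs) (i ℕ./ n + a * N) [ x ↦ i ℕ.% n ]) z ≡ (digits n xs (i ℕ./ n) [ x ↦ i ℕ.% n ]) z
  by (yes refl) _ = trans (update-at (digits n (xs ++ zs) (i ℕ./ n + a * N)) x _) (sym (update-at (digits n xs (i ℕ./ n)) x _))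
  by (no ne) (here z≡x) = contradiction (sym z≡x) ne
  by (no ne) (there z∈xs) = trans (update-≢ (digits n (xs ++ zs) (i ℕ./ n + a * N)) _ ne)
    (trans (digits-prefix n xs (i ℕ./ n) a (DivMod.m<n*o⇒m/o<n (subst (i <_) (ℕₚ.*-comm n N) i<)) z∈xs)
      (sym (update-≢ (digits n xs (i ℕ./ n)) _ ne)))

module _ {k} (n : ℕ) .{{_ : NonZero n}} (X Y Z : List (Fin k)) (F G : Assignment k → ℤ)
         (F-dep : DependsOn (Y ++ X) F) (G-dep : DependsOn (Z ++ Y) G)
         (Y∩X : ∀ x → x ∈ X → x ∉ Y) (Y∩Z : ∀ z → z ∈ Z → z ∉ Y) (Z∩Y : ∀ y → y ∈ Y → y ∉ Z) where

  -- Rows, columns and the inner index of the two matrices encode assignments of `X`, `Z` and `Y`.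
  -- The two factors decode different numbers, but as each depends only on its own variables, both
  -- can be evaluated at one assignment, decoded over `Y ++ Z ++ X`; then `sums-digits` applies.
  product-entry : ∀ g → InRange n g →
    sum< (n ^ length Y) (λ l → F (digits n (Y ++ X) (l + n ^ length Y * flat n 0 g X))
                           ℤ.* G (digits n (Z ++ Y) (flat n 0 g Z + n ^ length Z * l)))
      ≡ sums n Y (λ h → F h ℤ.* G h) g
  product-entry g g< = trans
    (sum<-cong M λ l l< → cong₂ ℤ._*_ (F-dep _ _ (F-agree l l<)) (G-dep _ _ (G-agree l l<)))
    (trans (sums-digits n Y (Z ++ X) (λ h → F h ℤ.* G h) m)
      (sums-depends n Y {Z ++ X} (λ h h′ eq → cong₂ ℤ._*_
         (F-dep h h′ (λ x x∈ → eq x (YX⊆ x∈))) (G-dep h h′ (λ x x∈ → eq x (ZY⊆ x∈))))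
        (digits n (Z ++ X) m) g (λ x x∈ → digits-flat n g g< (Z ++ X) x x∈)))
    where
    M = n ^ length Y
    m = flat n 0 g (Z ++ X)
    i = flat n 0 g X
    j = flat n 0 g Z
    YX⊆ : ∀ {x} → x ∈ Y ++ X → x ∈ Y ++ Z ++ X
    YX⊆ x∈ = [ ∈-++⁺ˡ , (λ x∈X → ∈-++⁺ʳ Y (∈-++⁺ʳ Z x∈X)) ]′ (∈-++⁻ Y x∈)
    ZY⊆ : ∀ {x} → x ∈ Z ++ Y → x ∈ Y ++ Z ++ X
    ZY⊆ x∈ = [ (λ x∈Z → ∈-++⁺ʳ Y (∈-++⁺ˡ x∈Z)) , ∈-++⁺ˡ ]′ (∈-++⁻ Z x∈)
    h : ℕ → Assignment k
    h l = digits n (Y ++ Z ++ X) (l + m * M)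
    h-Y : ∀ l → l < M → ∀ y → y ∈ Y → h l y ≡ digits n Y l y
    h-Y l l< y y∈ = digits-prefix n Y l m l< y∈
    h-else : ∀ l → l < M → ∀ x → x ∈ Z ++ X → x ∉ Y → h l x ≡ g x
    h-else l l< x x∈ x∉ = trans (digits-suffix n Y l m l< x∉) (digits-flat n g g< (Z ++ X) x x∈)
    F-agree : ∀ l → l < M → ∀ x → x ∈ Y ++ X → digits n (Y ++ X) (l + M * i) x ≡ h l x
    F-agree l l< x x∈ = trans (cong (λ w → digits n (Y ++ X) (l + w) x) (ℕₚ.*-comm M i)) (case ∈-++⁻ Y x∈ of λ
      { (inj₁ x∈Y) → trans (digits-prefix n Y l i l< x∈Y) (sym (h-Y l l< x x∈Y))
      ; (inj₂ x∈X) → trans (digits-suffix n Y l i l< (Y∩X x x∈X)) (trans (digits-flat n g g< X x x∈X)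
                       (sym (h-else l l< x (∈-++⁺ʳ Z x∈X) (Y∩X x x∈X)))) })
    G-agree : ∀ l → l < M → ∀ x → x ∈ Z ++ Y → digits n (Z ++ Y) (j + n ^ length Z * l) x ≡ h l x
    G-agree l l< x x∈ = trans (cong (λ w → digits n (Z ++ Y) (j + w) x) (ℕₚ.*-comm (n ^ length Z) l)) (case ∈-++⁻ Z x∈ of λ
      { (inj₁ x∈Z) → trans (digits-prefix n Z j l (flat-< n g g< Z) x∈Z) (trans (digits-flat n g g< Z x x∈Z)
                       (sym (h-else l l< x (∈-++⁺ˡ x∈Z) (Y∩Z x x∈Z))))
      ; (inj₂ x∈Y) → trans (digits-suffix n Z j l (flat-< n g g< Z) (Z∩Y x x∈Y)) (sym (h-Y l l< x x∈Y)) })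

module MatrixTerm (k R : ℕ) (𝓐 : Algorithm) (clock : Clock) where

  open Clock clock
  open Elimination k R 𝓐 clock

  -- `Z≅X` is imposed by the available multiplication, which takes an N × M and an M × N matrix. It
  -- also makes both matrices equally large, so that lead 1 places the second one.
  record Splitting (X Y Z : List (Fin k)) : Set where
    field
      unique-YX : Unique (Y ++ X)
      unique-ZY : Unique (Z ++ Y)
      unique-ZX : Unique (Z ++ X)
      unique-X  : Unique X
      unique-Y  : Unique Y
      Y∩X       : ∀ x → x ∈ X → x ∉ Y
      Y∩Z       : ∀ z → z ∈ Z → z ∉ Y
      Z∩Y       : ∀ y → y ∈ Y → y ∉ Z
      Z≅X       : length Z ≡ length X
      allowed-X  : Allowed (length X)
      allowed-Y  : Allowed (length Y)
      allowed-YX : Allowed (length (Y ++ X))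
      allowed-ZY : Allowed (length (Z ++ Y))
      allowed-ZX : Allowed (length (Z ++ X))

  module _ (X Y Z : List (Fin k)) (EA EB EC : List (Edge k)) (c : ℤ) (r : ℕ) where

    -- The array `r` is built up as the input of the multiplication program. The two dimensions are
    -- obtained as sums of ones over `X` and `Y`; they occupy the cells 0 and 1, whence the offset 2
    -- of both matrices.
    rowsStmt columnsStmt leftStmt rightStmt closeStmt : Stmt k
    rowsStmt    = tabulated X [] (+ 1) r 0 0 []
    columnsStmt = tabulated Y [] (+ 1) r 0 1 []
    leftStmt    = tabulated [] (Y ++ X) (+ 1) r 0 2 (map edgeRef EA)
    rightStmt   = tabulated [] (Z ++ Y) (+ 1) r 1 2 (map edgeRef EB)
    closeStmt   = tabulated (Z ++ X) [] c 1 0 0 (ref r 0 0 (Z ++ X) ∷ map edgeRef EC)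

    matrixCmds : List (Cmd k)
    matrixCmds = assign rowsStmt ∷ assign columnsStmt ∷ assign leftStmt ∷ assign rightStmt ∷ call r ∷ assign closeStmt ∷ []

    module _ (2≤r : 2 ≤ r) (r<R : r < R) (split : Splitting X Y Z) (withinA : All (Within (Y ++ X)) EA)
             (withinB : All (Within (Z ++ Y)) EB) (withinC : All (Within (Z ++ X)) EC) (v : Value) where

      open Splitting split

      private
        r≢0 : r ≢ 0
        r≢0 refl = ℕₚ.<⇒≱ 2≤r z≤n

        r≢1 : r ≢ 1
        r≢1 refl = ℕₚ.<⇒≱ 2≤r ℕₚ.≤-refl

        ++-[] : ∀ {xs : List (Fin k)} → Unique xs → Unique (xs ++ [])
        ++-[] {xs} = subst Unique (sym (Listₚ.++-identityʳ xs))

        allowed-[] : ∀ {xs : List (Fin k)} → Allowed (length xs) → Allowed (length (xs ++ []))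
        allowed-[] {xs} = subst Allowed (sym (cong length (Listₚ.++-identityʳ xs)))

        registers : ∀ {xs : List (Fin k)} → Unique xs → 8 + length xs < 9 + k
        registers u = s≤s (ℕₚ.+-monoʳ-≤ 8 (unique-length u))

        usable : ∀ {t} (es : List (Edge k)) → t ≢ 0 → All (λ ρ → array ρ < R × t ≢ array ρ) (map edgeRef es)
        usable []       t≢0 = []
        usable (e ∷ es) t≢0 = (ℕₚ.≤-<-trans z≤n r<R , t≢0) ∷ usable es t≢0

      module Contents (n : ℕ) .{{nz : NonZero n}} (H : Graph n) (arr₀ : Arrays) (ready : Ready r v n H arr₀) where

        N M : ℕ
        N = n ^ length X
        M = n ^ length Y

        arr₁ arr₂ arr₃ arr₄ : Arrays
        arr₁ = perform n rowsStmt arr₀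
        arr₂ = perform n columnsStmt arr₁
        arr₃ = perform n leftStmt arr₂
        arr₄ = perform n rightStmt arr₃

        φA φB : ℕ → ℤ
        φA α = edgeProduct H EA (digits n (Y ++ X) α)
        φB α = edgeProduct H EB (digits n (Z ++ Y) α)

        A : Matrix ℤ N M
        A i l = φA (toℕ l + M * toℕ i)
        B : Matrix ℤ M N
        B l j = φB (toℕ j + N * toℕ l)

        other : ∀ {r′} a → r ≢ r′ → arr₄ r′ a ≡ arr₀ r′ a
        other {r′} a ne = trans (perform-≢ n rightStmt arr₃ r′ a ne) (trans (perform-≢ n leftStmt arr₂ r′ a ne)
          (trans (perform-≢ n columnsStmt arr₁ r′ a ne) (perform-≢ n rowsStmt arr₀ r′ a ne)))

        private
          fresh : ∀ a → arr₀ r a ≡ + 0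
          fresh = proj₂ (proj₂ ready) r ℕₚ.≤-refl

          miss₁ : ∀ a → 0 ≢ a → arr₁ r a ≡ + 0
          miss₁ a ne = trans (perform-miss n X [] (+ 1) r 0 0 [] arr₀ (++-[] unique-X) a (λ { zero _ eq → ne eq ; (suc _) (s≤s ()) })) (fresh a)
          miss₂ : ∀ a → 1 ≢ a → arr₂ r a ≡ arr₁ r a
          miss₂ a ne = perform-miss n Y [] (+ 1) r 0 1 [] arr₁ (++-[] unique-Y) a (λ { zero _ eq → ne eq ; (suc _) (s≤s ()) })
          miss₃ : ∀ a → (∀ α → α < n ^ length (Y ++ X) → 2 + α ≢ a) → arr₃ r a ≡ arr₂ r a
          miss₃ a ne = perform-miss n [] (Y ++ X) (+ 1) r 0 2 (map edgeRef EA) arr₂ unique-YX a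
            (λ α α< eq → ne α α< (trans (cong (λ z → 2 + z) (sym (ℕₚ.+-identityʳ α))) eq))
          miss₄ : ∀ a → (∀ α → α < n ^ length (Z ++ Y) → 2 + (α + 1 * n ^ length (Z ++ Y)) ≢ a) → arr₄ r a ≡ arr₃ r a
          miss₄ a ne = perform-miss n [] (Z ++ Y) (+ 1) r 1 2 (map edgeRef EB) arr₃ unique-ZY a ne

          size-YX : n ^ length (Y ++ X) ≡ N * M
          size-YX = trans (cong (n ^_) (Listₚ.length-++ Y)) (trans (ℕₚ.^-distribˡ-+-* n (length Y) (length X)) (ℕₚ.*-comm M N))
          size-ZY : n ^ length (Z ++ Y) ≡ N * M
          size-ZY = trans (cong (n ^_) (trans (Listₚ.length-++ Z) (cong (_+ length Y) Z≅X))) (ℕₚ.^-distribˡ-+-* n (length X) (length Y))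

          cell-0 : arr₄ r 0 ≡ + N
          cell-0 = trans (miss₄ 0 (λ _ _ ())) (trans (miss₃ 0 (λ _ _ ())) (trans (miss₂ 0 (λ ()))
            (trans (perform-hit n X [] (+ 1) r 0 0 [] arr₀ (++-[] unique-X) 0 (s≤s z≤n))
            (cong₂ ℤ._+_ (fresh 0) (trans (sums-ones n X 1 origin) (cong +_ (ℕₚ.*-identityˡ N)))))))

          cell-1 : arr₄ r 1 ≡ + M
          cell-1 = trans (miss₄ 1 (λ _ _ ())) (trans (miss₃ 1 (λ _ _ ()))
            (trans (perform-hit n Y [] (+ 1) r 0 1 [] arr₁ (++-[] unique-Y) 0 (s≤s z≤n))
            (cong₂ ℤ._+_ (miss₁ 1 (λ ())) (trans (sums-ones n Y 1 origin) (cong +_ (ℕₚ.*-identityˡ M))))))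

          adj₂ : ∀ a → arr₂ 0 a ≡ contents (hostEntries H) a
          adj₂ a = trans (perform-≢ n columnsStmt arr₁ 0 a r≢0) (trans (perform-≢ n rowsStmt arr₀ 0 a r≢0) (proj₁ ready a))
          adj₃ : ∀ a → arr₃ 0 a ≡ contents (hostEntries H) a
          adj₃ a = trans (perform-≢ n leftStmt arr₂ 0 a r≢0) (adj₂ a)

          cell-A : ∀ α → α < N * M → arr₄ r (2 + α) ≡ φA α
          cell-A α α< = trans (miss₄ (2 + α) (λ β _ eq → ℕₚ.<⇒≱ α< (subst (N * M ≤_) (ℕₚ.suc-injective (ℕₚ.suc-injective eq))
              (subst (λ z → N * M ≤ β + 1 * z) (sym size-ZY) (ℕₚ.≤-trans (ℕₚ.≤-reflexive (sym (ℕₚ.*-identityˡ _))) (ℕₚ.m≤n+m _ β))))))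
            (trans (cong (λ z → arr₃ r (2 + z)) (sym (ℕₚ.+-identityʳ α)))
            (trans (perform-hit n [] (Y ++ X) (+ 1) r 0 2 (map edgeRef EA) arr₂ unique-YX α (subst (α <_) (sym size-YX) α<))
            (trans (cong₂ ℤ._+_ (trans (miss₂ _ (λ ())) (miss₁ _ (λ ())))
                     (trans (weigh-edges H (+ 1) EA arr₂ (digits n (Y ++ X) α) adj₂) (ℤₚ.*-identityˡ (φA α))))
              (ℤₚ.+-identityˡ (φA α)))))

          cell-B : ∀ α → α < N * M → arr₄ r (2 + (N * M + α)) ≡ φB α
          cell-B α α< = trans (cong (λ z → arr₄ r (2 + z)) (trans (ℕₚ.+-comm (N * M) α)
              (cong (α ℕ.+_) (trans (sym size-ZY) (sym (ℕₚ.*-identityˡ _))))))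
            (trans (perform-hit n [] (Z ++ Y) (+ 1) r 1 2 (map edgeRef EB) arr₃ unique-ZY α (subst (α <_) (sym size-ZY) α<))
            (trans (cong₂ ℤ._+_
                (trans (miss₃ _ (λ β β< eq → ℕₚ.<⇒≱ (subst (β <_) size-YX β<)
                    (subst₂ _≤_ (trans (ℕₚ.*-identityˡ _) size-ZY) (sym (ℕₚ.suc-injective (ℕₚ.suc-injective eq))) (ℕₚ.m≤n+m (1 * n ^ length (Z ++ Y)) α))))
                  (trans (miss₂ _ (λ ())) (miss₁ _ (λ ()))))
                (trans (weigh-edges H (+ 1) EB arr₃ (digits n (Z ++ Y) α) adj₃) (ℤₚ.*-identityˡ (φB α))))
              (ℤₚ.+-identityˡ (φB α))))

          cell-beyond : ∀ α → N * M + N * M ≤ α → arr₄ r (2 + α) ≡ + 0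
          cell-beyond α ≤α = trans (miss₄ _ (λ β β< eq → ℕₚ.<⇒≱ (ℕₚ.+-mono-<-≤ (subst (β <_) size-ZY β<)
                (ℕₚ.≤-reflexive (trans (ℕₚ.*-identityˡ _) size-ZY))) (subst (N * M + N * M ≤_) (sym (ℕₚ.suc-injective (ℕₚ.suc-injective eq))) ≤α)))
            (trans (miss₃ _ (λ β β< eq → ℕₚ.<⇒≱ (subst (β <_) size-YX β<)
                (ℕₚ.≤-trans (ℕₚ.m≤m+n (N * M) (N * M)) (subst (N * M + N * M ≤_) (sym (ℕₚ.suc-injective (ℕₚ.suc-injective eq))) ≤α))))
            (trans (miss₂ _ (λ ())) (miss₁ _ (λ ()))))

          length-A : length (rowMajor A) ≡ N * M
          length-A = length-rowMajor N M A
          length-B : length (rowMajor B) ≡ N * M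
          length-B = trans (length-rowMajor M N B) (ℕₚ.*-comm M N)

        input-stored : ∀ i → arr₄ r i ≡ contents (+ N ∷ + M ∷ rowMajor A ++ rowMajor B) i
        input-stored zero          = cell-0
        input-stored (suc zero)    = cell-1
        input-stored (suc (suc α)) with α ℕ.<? N * M
        ... | yes α< = trans (cell-A α α<) (sym (trans (contents-++ˡ (rowMajor A) α (subst (α <_) (sym length-A) α<)) (contents-grid N M φA α α<)))
        ... | no α≮ with ℕₚ.m+[n∸m]≡n (ℕₚ.≮⇒≥ α≮)
        ...   | α≡ with (α ∸ N * M) ℕ.<? N * M
        ...     | yes β< = trans (cong (λ z → arr₄ r (2 + z)) (sym α≡)) (trans (cell-B (α ∸ N * M) β<)
                  (sym (trans (cong (contents (rowMajor A ++ rowMajor B)) (trans (sym α≡) (cong (_+ (α ∸ N * M)) (sym length-A))))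
                  (trans (contents-++ʳ (rowMajor A) (α ∸ N * M)) (contents-grid M N φB (α ∸ N * M) (subst (α ∸ N * M <_) (ℕₚ.*-comm N M) β<))))))
        ...     | no β≮ = trans (cell-beyond α (subst (N * M + N * M ≤_) α≡ (ℕₚ.+-monoʳ-≤ (N * M) (ℕₚ.≮⇒≥ β≮))))
                  (sym (contents-beyond (rowMajor A ++ rowMajor B) α (subst (_≤ α) (sym (trans (Listₚ.length-++ (rowMajor A)) (cong₂ _+_ length-A length-B)))
                    (subst (N * M + N * M ≤_) α≡ (ℕₚ.+-monoʳ-≤ (N * M) (ℕₚ.≮⇒≥ β≮))))))

        module _ (q : Memory) (q-ok : q StartsWith rowMajor (A ⊡ B)) where

          arr₅ : Arrays
          arr₅ = replace r q arr₄

          q-entry : ∀ i j → q (toℕ j + N * toℕ i) ≡ (A ⊡ B) i j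
          q-entry i j = trans (trans (cong q (sym (Finₚ.toℕ-fromℕ< c<))) (trans (q-ok (Fin.fromℕ< c<))
              (trans (contents-lookup (rowMajor (A ⊡ B)) (Fin.fromℕ< c<)) (cong (contents (rowMajor (A ⊡ B))) (Finₚ.toℕ-fromℕ< c<)))))
            (contents-entry N N (A ⊡ B) i j)
            where
            c< : toℕ j + N * toℕ i < length (rowMajor (A ⊡ B))
            c< = subst (toℕ j + N * toℕ i <_) (sym (length-rowMajor N N (A ⊡ B)))
              (ℕₚ.<-≤-trans (ℕₚ.+-monoˡ-< (N * toℕ i) (Finₚ.toℕ<n j)) (ℕₚ.≤-trans (ℕₚ.≤-reflexive (sym (ℕₚ.*-suc N (toℕ i)))) (ℕₚ.*-monoʳ-≤ N (Finₚ.toℕ<n i))))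

          looked-up : ∀ g → InRange n g → arr₅ r (address n (ref r 0 0 (Z ++ X)) g)
            ≡ sums n Y (λ h → edgeProduct H EA h ℤ.* edgeProduct H EB h) g
          looked-up g g< = begin
            arr₅ r (flat n 0 g (Z ++ X))                ≡⟨ replace-same r q arr₄ _ ⟩
            q (flat n 0 g (Z ++ X))                     ≡⟨ cong q index ⟩
            q (toℕ j + N * toℕ i)                       ≡⟨ q-entry i j ⟩
            (A ⊡ B) i j                                 ≡⟨ sum≡sum< M (λ l → φA (l + M * toℕ i) ℤ.* φB (toℕ j + N * l)) ⟩
            sum< M (λ l → φA (l + M * toℕ i) ℤ.* φB (toℕ j + N * l))
              ≡⟨ cong₂ (λ y z → sum< M (λ l → φA (l + M * y) ℤ.* φB (z + N * l))) (Finₚ.toℕ-fromℕ< i<) (Finₚ.toℕ-fromℕ< j<) ⟩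
            sum< M (λ l → φA (l + M * flat n 0 g X) ℤ.* φB (flat n 0 g Z + N * l))
              ≡⟨ cong (λ N → sum< M (λ l → φA (l + M * flat n 0 g X) ℤ.* φB (flat n 0 g Z + N * l))) (cong (n ^_) (sym Z≅X)) ⟩
            sum< M (λ l → φA (l + M * flat n 0 g X) ℤ.* φB (flat n 0 g Z + n ^ length Z * l))
              ≡⟨ product-entry n X Y Z (edgeProduct H EA) (edgeProduct H EB) (edgeProduct-depends H EA withinA)
                   (edgeProduct-depends H EB withinB) Y∩X Y∩Z Z∩Y g g< ⟩
            sums n Y (λ h → edgeProduct H EA h ℤ.* edgeProduct H EB h) g ∎
            where
            open ≡-Reasoning
            i< : flat n 0 g X < N
            i< = flat-< n g g< X
            j< : flat n 0 g Z < N
            j< = subst (λ z → flat n 0 g Z < n ^ z) Z≅X (flat-< n g g< Z)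
            i j : Fin N
            i = Fin.fromℕ< i<
            j = Fin.fromℕ< j<
            index : flat n 0 g (Z ++ X) ≡ toℕ j + N * toℕ i
            index = trans (flat-++ n 0 g Z X) (trans (flat-lead n _ g Z) (cong₂ _+_ (sym (Finₚ.toℕ-fromℕ< j<))
              (trans (cong₂ _*_ (sym (Finₚ.toℕ-fromℕ< i<)) (cong (n ^_) Z≅X)) (ℕₚ.*-comm _ N))))

          closed : Ready (suc r) (λ n H → v n H ℤ.+ c ℤ.* sums n (Y ++ Z ++ X) (λ g → edgeProduct H EC g ℤ.*
                     (edgeProduct H EA g ℤ.* edgeProduct H EB g)) origin) n H (perform n closeStmt arr₅)
          closed = (λ a → trans (perform-≢ n closeStmt arr₅ 0 a (λ ())) (adj₅ a))
            , trans (perform-hit n (Z ++ X) [] c 1 0 0 (factors closeStmt) arr₅ (++-[] unique-ZX) 0 (s≤s z≤n))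
                (cong₂ ℤ._+_ (trans (replace-other q arr₄ 0 r≢1) (trans (other 0 r≢1) (proj₁ (proj₂ ready))))
                  (trans (sums-cong n (Z ++ X) (λ g g< → trans
                      (cong₂ ℤ._*_ (weigh-edges H c EC arr₅ g adj₅) (looked-up g g<))
                      -- The edges of `EC` avoid `Y`, so their product may be moved inside the sum
                      -- over `Y` that the matrix product has carried out.
                      (trans (ℤₚ.*-assoc c _ _) (cong (ℤ._*_ c) (sym (sums-factor n Y (edgeProduct-depends H EC withinC)
                        (λ y y∈Y y∈ → [ (λ y∈Z → Z∩Y y y∈Y y∈Z) , (λ y∈X → Y∩X y y∈X y∈Y) ]′ (∈-++⁻ Z y∈))
                        (λ h → edgeProduct H EA h ℤ.* edgeProduct H EB h) g)))))
                    origin (λ _ → ℕ.>-nonZero⁻¹ n))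
                  (trans (sums-*ˡ n (Z ++ X) c _ origin) (cong (ℤ._*_ c) (sym (sums-++ n Y (Z ++ X) _ origin))))))
            , λ r′ r<r′ a → trans (perform-≢ n closeStmt arr₅ r′ a (λ { refl → ℕₚ.<⇒≱ 2≤r (ℕₚ.≤-trans (ℕₚ.n≤1+n r) r<r′) }))
                (trans (replace-other q arr₄ a (ℕₚ.<⇒≢ r<r′)) (trans (other a (ℕₚ.<⇒≢ r<r′)) (proj₂ (proj₂ ready) r′ (ℕₚ.<⇒≤ r<r′) a)))
            where
            adj₅ : ∀ a → arr₅ 0 a ≡ contents (hostEntries H) a
            adj₅ a = trans (replace-other q arr₄ a r≢0) (trans (other a r≢0) (proj₁ ready a))

      private
        -- A strongest postcondition: the arrays are the image of some initial arrays that satisfied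
        -- `Ready`. Their contents are worked out only at the call, where all four statements have
        -- been performed.
        Mid : (∀ n → .{{NonZero n}} → Arrays → Arrays) → Assertion
        Mid f n H arr = Σ[ arr₀ ∈ Arrays ] Ready r v n H arr₀ × arr ≡ f n arr₀

        Multiplied : Assertion
        Multiplied n H arr = Σ[ arr₀ ∈ Arrays ] Σ[ ready ∈ Ready r v n H arr₀ ] Σ[ q ∈ Memory ]
          q StartsWith rowMajor (Contents.A n H arr₀ ready ⊡ Contents.B n H arr₀ ready)
          × arr ≡ replace r q (Contents.arr₄ n H arr₀ ready)

        stage₁ stage₂ stage₃ stage₄ : ∀ n → .{{NonZero n}} → Arrays → Arrays
        stage₁ n arr = perform n rowsStmt arr
        stage₂ n arr = perform n columnsStmt (stage₁ n arr)
        stage₃ n arr = perform n leftStmt (stage₂ n arr)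
        stage₄ n arr = perform n rightStmt (stage₃ n arr)

      matrix-hoare : ∀ C → MultipliesWithin clock 𝓐 (length X) (length Y) C →
        Hoare matrixCmds (Ready r v) (Ready (suc r) (λ n H → v n H ℤ.+ c ℤ.* sums n (Y ++ Z ++ X) (λ g →
          edgeProduct H EC g ℤ.* (edgeProduct H EA g ℤ.* edgeProduct H EB g)) origin))
      matrix-hoare C mult =
        hoare-∷ {assign rowsStmt} {assign columnsStmt ∷ assign leftStmt ∷ assign rightStmt ∷ call r ∷ assign closeStmt ∷ []} {Mid = Mid stage₁}
          (hoare-assign rowsStmt (registers (++-[] unique-X)) r<R [] (allowed-[] {X} allowed-X) λ n H arr ready → arr , ready , refl)
        (hoare-∷ {assign columnsStmt} {assign leftStmt ∷ assign rightStmt ∷ call r ∷ assign closeStmt ∷ []} {Mid = Mid stage₂}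
          (hoare-assign columnsStmt (registers (++-[] unique-Y)) r<R [] (allowed-[] {Y} allowed-Y) λ { n H _ (arr , ready , refl) → arr , ready , refl })
        (hoare-∷ {assign leftStmt} {assign rightStmt ∷ call r ∷ assign closeStmt ∷ []} {Mid = Mid stage₃}
          (hoare-assign leftStmt (registers unique-YX) r<R (usable EA r≢0) allowed-YX λ { n H _ (arr , ready , refl) → arr , ready , refl })
        (hoare-∷ {assign rightStmt} {call r ∷ assign closeStmt ∷ []} {Mid = Mid stage₄}
          (hoare-assign rightStmt (registers unique-ZY) r<R (usable EB r≢0) allowed-ZY λ { n H _ (arr , ready , refl) → arr , ready , refl })
        (hoare-∷ {call r} {assign closeStmt ∷ []} {Mid = Multiplied}
          (hoare-call r (length X) (length Y) r<R C λ { n H _ (arr , ready , refl) →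
            let open Contents n H arr ready in
            A , B , input-stored , (λ q q-ok → arr , ready , q , q-ok , refl)
            , mult n A B })
        (hoare-one {assign closeStmt}
          (hoare-assign closeStmt (registers (++-[] unique-ZX)) (ℕₚ.<-trans (ℕₚ.<-≤-trans (s≤s (s≤s z≤n)) 2≤r) r<R)
            ((r<R , r≢1 ∘ sym) ∷ usable EC (λ ())) (allowed-[] {Z ++ X} allowed-ZX)
            λ { n H _ (arr , ready , q , q-ok , refl) → Contents.closed n H arr ready q q-ok }))))))

-- Inclusion–exclusion over coinciding vertices

sum<-+ : ∀ n f g → sum< n (λ i → f i ℤ.+ g i) ≡ sum< n f ℤ.+ sum< n g
sum<-+ zero    f g = refl
sum<-+ (suc n) f g = trans (cong (ℤ._+ (f n ℤ.+ g n)) (sum<-+ n f g)) (swap (sum< n f) (sum< n g) (f n) (g n))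
  where
  swap : ∀ a b c d → a ℤ.+ b ℤ.+ (c ℤ.+ d) ≡ a ℤ.+ c ℤ.+ (b ℤ.+ d)
  swap = ℤ-solve-∀

sum<-swap : ∀ m n (f : ℕ → ℕ → ℤ) → sum< m (λ i → sum< n (λ j → f i j)) ≡ sum< n (λ j → sum< m (λ i → f i j))
sum<-swap zero    n f = sym (sum<-zero n _ λ _ → refl)
sum<-swap (suc m) n f = trans (cong (ℤ._+ sum< n (f m)) (sum<-swap m n f)) (sym (sum<-+ n _ _))

-- Assignments are functions, and exchanging two updates changes them only up to pointwise equality;
-- summands must respect this before sums can be reordered.
Extensional : ∀ {k} → (Assignment k → ℤ) → Set
Extensional F = ∀ g g′ → (∀ x → g x ≡ g′ x) → F g ≡ F g′

update-cong : ∀ {k} {g g′ : Assignment k} x a → (∀ y → g y ≡ g′ y) → ∀ y → (g [ x ↦ a ]) y ≡ (g′ [ x ↦ a ]) y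
update-cong x a eq y with x Finₚ.≟ y
... | yes _ = refl
... | no _  = eq y

sum-extensional : ∀ {k} n {F : Assignment k → ℤ} x → Extensional F → Extensional (λ g → sum< n (λ a → F (g [ x ↦ a ])))
sum-extensional n x ext g g′ eq = sum<-cong n λ a _ → ext _ _ (update-cong x a eq)

update-swap : ∀ {k} (g : Assignment k) x y a b → x ≢ y → ∀ z → (g [ x ↦ a ] [ y ↦ b ]) z ≡ (g [ y ↦ b ] [ x ↦ a ]) z
update-swap g x y a b x≢y z with x Finₚ.≟ z | y Finₚ.≟ z
... | yes refl | yes refl = contradiction refl x≢y
... | yes refl | no _     = refl
... | no _     | yes refl = refl
... | no _     | no _     = refl

sums-swap : ∀ {k} n (x y : Fin k) xs {F} → Extensional F → ∀ g → sums n (x ∷ y ∷ xs) F g ≡ sums n (y ∷ x ∷ xs) F g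
sums-swap n x y xs {F} ext g with x Finₚ.≟ y
... | yes refl = refl
... | no x≢y   = sums-ext n xs (λ h → trans (sum<-swap n n (λ b a → F (h [ y ↦ b ] [ x ↦ a ])))
  (sum<-cong n λ a _ → sum<-cong n λ b _ → ext _ _ (update-swap h y x b a (x≢y ∘ sym)))) g

sums-permute : ∀ {k} n {xs ys : List (Fin k)} → xs ↭ ys → ∀ {F} → Extensional F → ∀ g → sums n xs F g ≡ sums n ys F g
sums-permute n Perm.refl                       ext g = refl
sums-permute n (Perm.prep x p)                 ext g = sums-permute n p (sum-extensional n x ext) g
sums-permute n (Perm.swap {xs = xs} x y p) {F} ext g = trans (sums-swap n x y xs ext g)
  (sums-permute n p (sum-extensional n x (sum-extensional n y ext)) g)
sums-permute n (Perm.trans p q)                ext g = trans (sums-permute n p ext g) (sums-permute n q ext g)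

without : ∀ {k} → Fin k → List (Fin k) → List (Fin k)
without v = filter (λ x → ¬? (v Finₚ.≟ x))

without-∉ : ∀ {k} (v : Fin k) xs → v ∉ xs → without v xs ≡ xs
without-∉ v []       v∉ = refl
without-∉ v (x ∷ xs) v∉ with v Finₚ.≟ x
... | yes v≡x = contradiction (here v≡x) v∉
... | no _    = cong (x ∷_) (without-∉ v xs (v∉ ∘ there))

sums-extract : ∀ {k} n (v : Fin k) xs → Unique xs → v ∈ xs → ∀ {F} → Extensional F → ∀ g →
  sums n xs F g ≡ sums n (v ∷ without v xs) F g
sums-extract n v (x ∷ xs) u@(_ ∷ us) v∈ {F} ext g with v Finₚ.≟ x
... | yes refl = cong (λ z → sums n (v ∷ z) F g) (sym (without-∉ v xs λ v∈xs → unique-head u v∈xs refl))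
... | no v≢x   = trans (sums-extract n v xs us (tail v∈) (sum-extensional n x ext) g) (sums-swap n x v (without v xs) ext g)
  where
  tail : v ∈ x ∷ xs → v ∈ xs
  tail (here v≡x)   = contradiction v≡x v≢x
  tail (there v∈xs) = v∈xs

coincide : ∀ {k} → Fin k → Fin k → Assignment k → ℤ
coincide u v g = if ⌊ g u ℕ.≟ g v ⌋ then + 1 else + 0

coincide-yes : ∀ {k} (u v : Fin k) g → g u ≡ g v → coincide u v g ≡ + 1
coincide-yes u v g eq with g u ℕ.≟ g v
... | yes _ = refl
... | no ne = contradiction eq ne

coincide-no : ∀ {k} (u v : Fin k) g → g u ≢ g v → coincide u v g ≡ + 0
coincide-no u v g ne with g u ℕ.≟ g v
... | yes eq = contradiction eq ne
... | no _   = refl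

-- Once v is summed innermost, the coincidence factor annihilates all of its values but the value of
-- u, so the sum over v collapses to a substitution.
sums-merge : ∀ {k} n {u v : Fin k} xs → Unique xs → v ∈ xs → u ≢ v → ∀ {F} → Extensional F → ∀ g → InRange n g →
  sums n xs (λ h → F h ℤ.* coincide u v h) g ≡ sums n (without v xs) (λ h → F (h [ v ↦ h u ])) g
sums-merge n {u} {v} xs unique v∈ u≢v {F} ext g g< = trans (sums-extract n v xs unique v∈ ext′ g)
  (sums-cong n (without v xs) (λ h h< → trans
    (sum<-single n (h u) (h< u) (λ a _ a≢ → trans (cong (ℤ._*_ (F (h [ v ↦ a ]))) (coincide-no u v (h [ v ↦ a ])
      (λ eq → a≢ (sym (trans (sym (update-≢ h a (u≢v ∘ sym))) (trans eq (update-at h v a))))))) (ℤₚ.*-zeroʳ (F (h [ v ↦ a ])))))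
    (trans (cong (ℤ._*_ (F (h [ v ↦ h u ]))) (coincide-yes u v (h [ v ↦ h u ])
      (trans (update-≢ h (h u) (u≢v ∘ sym)) (sym (update-at h v (h u)))))) (ℤₚ.*-identityʳ (F (h [ v ↦ h u ]))))) g g<)
  where
  ext′ : Extensional (λ h → F h ℤ.* coincide u v h)
  ext′ h h′ eq = cong₂ ℤ._*_ (ext h h′ eq) (cong₂ (λ a b → if ⌊ a ℕ.≟ b ⌋ then + 1 else + 0) (eq u) (eq v))

distinctProduct : ∀ {k} → List (Edge k) → Assignment k → ℤ
distinctProduct []            g = + 1
distinctProduct ((u , v) ∷ D) g = distinctProduct D g ℤ.* (+ 1 ℤ.- coincide u v g)

distinctProduct-ext : ∀ {k} (D : List (Edge k)) → Extensional (distinctProduct D)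
distinctProduct-ext []            g g′ eq = refl
distinctProduct-ext ((u , v) ∷ D) g g′ eq = cong₂ ℤ._*_ (distinctProduct-ext D g g′ eq)
  (cong₂ (λ a b → + 1 ℤ.- (if ⌊ a ℕ.≟ b ⌋ then + 1 else + 0)) (eq u) (eq v))

-- A pattern vertex x is identified with its representative rename x, one of the names.
record Term (k : ℕ) : Set where
  constructor term
  field
    coef   : ℤ
    names  : List (Fin k)
    rename : Fin k → Fin k

open Term public

-- Together these say that `rename` is a retraction onto `names`: its fibres are the blocks of a
-- partition of the pattern vertices, each with a chosen representative.
record Valid {k} (t : Term k) : Set where
  constructor valid
  field
    names-unique : Unique (names t)
    rename-into  : ∀ x → rename t x ∈ names t
    rename-fixed : ∀ x → x ∈ names t → rename t x ≡ x

open Valid public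

merge : ∀ {k} → Fin k → Fin k → Fin k → Fin k
merge v u x = if ⌊ v Finₚ.≟ x ⌋ then u else x

-- Expands the product of 1 − [g (ρ u) = g (ρ v)] over the pairs of D, identifying ρ u and ρ v in the second summand.
expand : ∀ {k} → Term k → List (Edge k) → List (Term k)
expand t            []            = t ∷ []
expand (term c xs ρ) ((u , v) ∷ D) with ρ u Finₚ.≟ ρ v
-- The two vertices have already been identified, so the factor vanishes identically.
... | yes _ = []
... | no _  = expand (term c xs ρ) D ++ expand (term (ℤ.- c) (without (ρ v) xs) (merge (ρ v) (ρ u) ∘ ρ)) D

merge-valid : ∀ {k c} {xs : List (Fin k)} {ρ} u v → Valid (term c xs ρ) → ρ u ≢ ρ v →
  Valid (term (ℤ.- c) (without (ρ v) xs) (merge (ρ v) (ρ u) ∘ ρ))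
merge-valid {xs = xs} {ρ} u v (valid unique into fixed) ne = valid (Uniqueₚ.filter⁺ (λ x → ¬? (ρ v Finₚ.≟ x)) unique)
  (λ x → into′ (ρ x) (into x)) (λ x x∈ → let (x∈xs , ≢x) = ∈-filter⁻ (λ x → ¬? (ρ v Finₚ.≟ x)) {xs = xs} x∈ in
    trans (cong (merge (ρ v) (ρ u)) (fixed x x∈xs)) (merge-≢ x ≢x))
  where
  merge-≢ : ∀ x → ρ v ≢ x → merge (ρ v) (ρ u) x ≡ x
  merge-≢ x ne′ with ρ v Finₚ.≟ x
  ... | yes eq = contradiction eq ne′
  ... | no _   = refl
  into′ : ∀ y → y ∈ xs → merge (ρ v) (ρ u) y ∈ without (ρ v) xs
  into′ y y∈ with ρ v Finₚ.≟ y
  ... | yes _  = ∈-filter⁺ (λ x → ¬? (ρ v Finₚ.≟ x)) (into u) (ne ∘ sym)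
  ... | no ρv≢ = ∈-filter⁺ (λ x → ¬? (ρ v Finₚ.≟ x)) y∈ ρv≢

expand-valid : ∀ {k} (t : Term k) D → Valid t → All Valid (expand t D)
expand-valid t             []            vd = vd ∷ []
expand-valid (term c xs ρ) ((u , v) ∷ D) vd with ρ u Finₚ.≟ ρ v
... | yes _ = []
... | no ne = Allₚ.++⁺ (expand-valid (term c xs ρ) D vd) (expand-valid _ D (merge-valid u v vd ne))

sums-minus : ∀ {k} n (xs : List (Fin k)) F F′ g → sums n xs (λ h → F h ℤ.- F′ h) g ≡ sums n xs F g ℤ.- sums n xs F′ g
sums-minus n xs F F′ g = trans (sums-ext n xs (λ h → cong (ℤ._+_ (F h)) (sym (ℤₚ.-1*i≡-i (F′ h)))) g)
  (trans (plus xs F (λ h → ℤ.- + 1 ℤ.* F′ h) g)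
    (cong (ℤ._+_ (sums n xs F g)) (trans (sums-*ˡ n xs (ℤ.- + 1) F′ g) (ℤₚ.-1*i≡-i _))))
  where
  plus : ∀ xs F F′ g → sums n xs (λ h → F h ℤ.+ F′ h) g ≡ sums n xs F g ℤ.+ sums n xs F′ g
  plus []       F F′ g = refl
  plus (x ∷ xs) F F′ g = trans (sums-ext n xs (λ h → sum<-+ n (λ a → F (h [ x ↦ a ])) (λ a → F′ (h [ x ↦ a ]))) g) (plus xs _ _ g)

termValue : ∀ {k} → ℕ → (Assignment k → ℤ) → Term k → ℤ
termValue n W t = coef t ℤ.* sums n (names t) (λ g → W (g ∘ rename t)) origin

sumTerms : ∀ {k} → (Term k → ℤ) → List (Term k) → ℤ
sumTerms f []       = + 0
sumTerms f (t ∷ ts) = f t ℤ.+ sumTerms f ts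

sumTerms-++ : ∀ {k} (f : Term k → ℤ) ts us → sumTerms f (ts ++ us) ≡ sumTerms f ts ℤ.+ sumTerms f us
sumTerms-++ f []       us = sym (ℤₚ.+-identityˡ _)
sumTerms-++ f (t ∷ ts) us = trans (cong (ℤ._+_ (f t)) (sumTerms-++ f ts us)) (sym (ℤₚ.+-assoc (f t) _ _))

-- The induction needs an arbitrary starting term. The sign of the second summand goes into `coef`,
-- and by `sums-merge` its coincidence factor removes the name `ρ v` from the summation.
expand-value : ∀ {k} n .{{_ : NonZero n}} (W : Assignment k → ℤ) → Extensional W → ∀ t D → Valid t →
  sumTerms (termValue n W) (expand t D)
    ≡ coef t ℤ.* sums n (names t) (λ g → W (g ∘ rename t) ℤ.* distinctProduct D (g ∘ rename t)) origin
expand-value n W ext t [] vd = trans (ℤₚ.+-identityʳ _)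
  (cong (ℤ._*_ (coef t)) (sums-ext n (names t) (λ h → sym (ℤₚ.*-identityʳ (W (h ∘ rename t)))) origin))
expand-value n W ext (term c xs ρ) ((u , v) ∷ D) vd with ρ u Finₚ.≟ ρ v
... | yes eq = sym (trans (cong (ℤ._*_ c) (trans (sums-ext n xs (λ h → trans
    (cong (λ z → W (h ∘ ρ) ℤ.* (distinctProduct D (h ∘ ρ) ℤ.* (+ 1 ℤ.- z))) (coincide-yes u v (h ∘ ρ) (cong h eq)))
    (zero-product (W (h ∘ ρ)) (distinctProduct D (h ∘ ρ)))) origin)
    (trans (sums-*ˡ n xs (+ 0) (λ _ → + 0) origin) (ℤₚ.*-zeroˡ (sums n xs (λ _ → + 0) origin))))) (ℤₚ.*-zeroʳ c))
  where
  zero-product : ∀ a b → a ℤ.* (b ℤ.* (+ 1 ℤ.- + 1)) ≡ + 0 ℤ.* + 0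
  zero-product = ℤ-solve-∀
... | no ne = begin
  sumTerms (termValue n W) (expand (term c xs ρ) D ++ expand t′ D)
    ≡⟨ sumTerms-++ (termValue n W) (expand (term c xs ρ) D) (expand t′ D) ⟩
  sumTerms (termValue n W) (expand (term c xs ρ) D) ℤ.+ sumTerms (termValue n W) (expand t′ D)
    ≡⟨ cong₂ ℤ._+_ (expand-value n W ext (term c xs ρ) D vd) (expand-value n W ext t′ D (merge-valid u v vd ne)) ⟩
  c ℤ.* sums n xs G origin ℤ.+ (ℤ.- c) ℤ.* sums n (without (ρ v) xs) (λ h → V (h ∘ (merge (ρ v) (ρ u) ∘ ρ))) origin
    ≡⟨ cong (λ z → c ℤ.* sums n xs G origin ℤ.+ (ℤ.- c) ℤ.* z) (sym merged) ⟩
  c ℤ.* sums n xs G origin ℤ.+ (ℤ.- c) ℤ.* sums n xs (λ h → G h ℤ.* coincide (ρ u) (ρ v) h) origin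
    ≡⟨ pull c (sums n xs G origin) _ ⟩
  c ℤ.* (sums n xs G origin ℤ.- sums n xs (λ h → G h ℤ.* coincide (ρ u) (ρ v) h) origin)
    ≡⟨ cong (ℤ._*_ c) (sums-minus n xs G _ origin) ⟨
  c ℤ.* sums n xs (λ h → G h ℤ.- G h ℤ.* coincide (ρ u) (ρ v) h) origin
    ≡⟨ cong (ℤ._*_ c) (sums-ext n xs (λ h → distribute (W (h ∘ ρ)) (distinctProduct D (h ∘ ρ)) (coincide (ρ u) (ρ v) h)) origin) ⟩
  c ℤ.* sums n xs (λ h → W (h ∘ ρ) ℤ.* (distinctProduct D (h ∘ ρ) ℤ.* (+ 1 ℤ.- coincide u v (h ∘ ρ)))) origin ∎
  where
  open ≡-Reasoning
  t′ = term (ℤ.- c) (without (ρ v) xs) (merge (ρ v) (ρ u) ∘ ρ)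
  V G : Assignment _ → ℤ
  V g = W g ℤ.* distinctProduct D g
  G h = V (h ∘ ρ)
  V-ext : Extensional V
  V-ext g g′ eq = cong₂ ℤ._*_ (ext g g′ eq) (distinctProduct-ext D g g′ eq)
  agree : ∀ h y → (h [ ρ v ↦ h (ρ u) ]) y ≡ h (merge (ρ v) (ρ u) y)
  agree h y with ρ v Finₚ.≟ y
  ... | yes _ = refl
  ... | no _  = refl
  merged : sums n xs (λ h → G h ℤ.* coincide (ρ u) (ρ v) h) origin
         ≡ sums n (without (ρ v) xs) (λ h → V (h ∘ (merge (ρ v) (ρ u) ∘ ρ))) origin
  merged = trans (sums-merge n xs (names-unique vd) (rename-into vd v) ne (λ g g′ eq → V-ext _ _ (λ x → eq (ρ x))) origin (λ _ → ℕ.>-nonZero⁻¹ n))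
    (sums-ext n (without (ρ v) xs) (λ h → V-ext _ _ (λ x → agree h (ρ x))) origin)
  pull : ∀ c a b → c ℤ.* a ℤ.+ (ℤ.- c) ℤ.* b ≡ c ℤ.* (a ℤ.- b)
  pull = ℤ-solve-∀
  distribute : ∀ a b z → a ℤ.* b ℤ.- a ℤ.* b ℤ.* z ≡ a ℤ.* (b ℤ.* (+ 1 ℤ.- z))
  distribute = ℤ-solve-∀

-- Elimination orders of quotients from a path decomposition

subset-length : ∀ {k} {xs : List (Fin k)} (S : Subset k) → Unique xs → (∀ x → x ∈ xs → x ∈ˢ S) → length xs ≤ ∣ S ∣
subset-length S []            incl = z≤n
subset-length {xs = x ∷ xs} S (x∉ ∷ u) incl = ℕₚ.≤-trans
  (s≤s (subset-length (S -ˢ x) u (λ y y∈ → Subsetₚ.x∈p∧x≢y⇒x∈p-y (incl y (there y∈)) (λ { refl → All.lookup x∉ y∈ refl }))))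
  (Subsetₚ.x∈p⇒∣p-x∣<∣p∣ (incl x (here refl)))

unique-permute : ∀ {A : Set} {xs ys : List A} → xs ↭ ys → Unique xs → Unique ys
unique-permute Perm.refl         u = u
unique-permute (Perm.prep x p)   (x∉ ∷ u) = Permₚ.All-resp-↭ p x∉ ∷ unique-permute p u
unique-permute (Perm.swap x y p) ((x≢y ∷ x∉) ∷ y∉ ∷ u) =
  ((x≢y ∘ sym) ∷ Permₚ.All-resp-↭ p y∉) ∷ Permₚ.All-resp-↭ p x∉ ∷ unique-permute p u
unique-permute (Perm.trans p q)  u = unique-permute q (unique-permute p u)

filter-partition : ∀ {A : Set} {P : A → Set} (P? : ∀ x → Dec (P x)) xs → xs ↭ filter P? xs ++ filter (¬? ∘ P?) xs
filter-partition P? []       = Perm.refl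
filter-partition P? (x ∷ xs) with P? x
... | yes _ = Perm.prep x (filter-partition P? xs)
... | no _  = Perm.trans (Perm.prep x (filter-partition P? xs)) (Perm.↭-sym (Permₚ.shift x (filter P? xs) _))

findLast : ∀ {m} {P : Fin m → Set} (P? : ∀ i → Dec (P i)) → ∃ P → ∃[ i ] P i × (∀ j → P j → j Fin.≤ i)
findLast {suc m} {P} P? (i₀ , p₀) with Finₚ.any? (P? ∘ Fin.suc)
... | yes later with findLast (P? ∘ Fin.suc) later
...   | i , p , last = Fin.suc i , p , λ { Fin.zero _ → z≤n ; (Fin.suc j) pj → s≤s (last j pj) }
findLast {suc m} P? (Fin.zero , p₀)  | no ¬later = Fin.zero , p₀ , λ { Fin.zero _ → z≤n ; (Fin.suc j) pj → contradiction (j , pj) ¬later }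
findLast {suc m} P? (Fin.suc i , p₀) | no ¬later = contradiction (i , p₀) ¬later

module Planning (k R : ℕ) (𝓐 : Algorithm) (clock : Clock) (P : Graph k) (p : ℕ)
                (D : PathDecomposition P) (width : HasWidth≤ D p) where

  open PathDecomposition D
  open Clock clock
  open Elimination k R 𝓐 clock

  last : Fin k → Fin size
  last x = proj₁ (findLast (λ i → x Subsetₚ.∈? bag i) (covers x))

  ∈-last : ∀ x → x ∈ˢ bag (last x)
  ∈-last x = proj₁ (proj₂ (findLast (λ i → x Subsetₚ.∈? bag i) (covers x)))

  ≤-last : ∀ x i → x ∈ˢ bag i → i Fin.≤ last x
  ≤-last x = proj₂ (proj₂ (findLast (λ i → x Subsetₚ.∈? bag i) (covers x)))

  stays : ∀ {x i j} → x ∈ˢ bag i → i Fin.≤ j → j Fin.≤ last x → x ∈ˢ bag j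
  stays {x} x∈ i≤j j≤ = contiguous x i≤j j≤ x∈ (∈-last x)

  Ordered : List (Fin k) → Set
  Ordered = AllPairs (λ x y → last x Fin.≤ last y)

  byLast : DecTotalOrder _ _ _
  byLast = On.decTotalOrder (Finₚ.≤-decTotalOrder size) last

  open Sort byLast using (sort; sort-↭; sort-↗)

  sort-ordered : ∀ xs → Ordered (sort xs)
  sort-ordered xs = Linkedₚ.Linked⇒AllPairs ℕₚ.≤-trans (sort-↗ xs)

  module _ (pinned : List (Fin k)) where

    record Coverable (rem : List (Fin k)) (e : Edge k) : Set where
      constructor coverable
      field
        left   : proj₁ e ∈ pinned ⊎ proj₁ e ∈ rem
        right  : proj₂ e ∈ pinned ⊎ proj₂ e ∈ rem
        shared : proj₁ e ∈ pinned ⊎ proj₂ e ∈ pinned ⊎ ∃[ b ] (proj₁ e ∈ˢ bag b × proj₂ e ∈ˢ bag b)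

    -- The invariant on table indices. An index that is not pinned lies in a bag `b` that comes no
    -- later than the last bag of any remaining vertex; contiguity then puts it also into the last
    -- bag of whichever vertex is eliminated next.
    Scope : List (Fin k) → Fin k → Set
    Scope rem y = y ∈ pinned ⊎ (y ∈ rem × ∃[ b ] (y ∈ˢ bag b × All (λ z → b Fin.≤ last z) rem))

    -- Eliminating x requires a table indexed by the pinned vertices and by the
    -- remaining vertices of the last bag which contains x.
    makePlan : Unique pinned → (∀ m → m ≤ length pinned + suc p → Allowed m) → ∀ S es rem → Ordered rem → Unique rem →
      (∀ y → y ∈ pinned → y ∉ rem) → (∀ y → y ∈ S → Scope rem y) → All (Coverable rem) es → Plan pinned S es rem
    makePlan unique-p allowed S es []        ord unique out scope cov = finish
    makePlan unique-p allowed S es (x ∷ rem) (x≤ ∷ ord) u@(_ ∷ unique) out scope cov =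
      eliminate S′ unique′ (allowed (suc (length S′)) short) scope-kept within
        (makePlan unique-p allowed S′ (avoiding x es) rem ord unique (λ y y∈ y∈rem → out y y∈ (there y∈rem)) scope′ cov′)
      where
      b = last x
      inBag? = λ y → y Subsetₚ.∈? bag b
      L = filter inBag? rem
      S′ = pinned ++ L
      in-L : ∀ {y} → y ∈ L → y ∈ rem × y ∈ˢ bag b
      in-L = ∈-filter⁻ inBag? {xs = rem}
      unique-L : Unique (x ∷ L)
      unique-L = All.tabulate (λ y∈ → unique-head u (proj₁ (in-L y∈))) ∷ Uniqueₚ.filter⁺ inBag? unique
      unique′ : Unique (x ∷ S′)
      unique′ = All.tabulate (λ y∈ → [ (λ y∈p → λ { refl → out x y∈p (here refl) }) , (λ y∈L → unique-head unique-L y∈L) ]′ (∈-++⁻ pinned y∈))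
        ∷ Uniqueₚ.++⁺ unique-p (AllPairs.tail unique-L) (λ { (y∈p , y∈L) → out _ y∈p (there (proj₁ (in-L y∈L))) })
      short : suc (length S′) ≤ length pinned + suc p
      short = begin
        suc (length S′)                     ≡⟨ cong suc (Listₚ.length-++ pinned) ⟩
        suc (length pinned + length L)      ≡⟨ ℕₚ.+-suc (length pinned) (length L) ⟨
        -- The vertex x is counted together with `L`: all of them lie in the bag `b`, which has at
        -- most p + 1 elements.
        length pinned + length (x ∷ L)      ≤⟨ ℕₚ.+-monoʳ-≤ (length pinned) (ℕₚ.≤-trans
                                                (subset-length (bag b) unique-L (λ { y (here refl) → ∈-last x ; y (there y∈) → proj₂ (in-L y∈) })) (width b)) ⟩
        length pinned + suc p               ∎
        where open ℕₚ.≤-Reasoning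
      -- By the order of elimination the last bag of y is not before that of x. So `b` lies between
      -- a bag containing y and the last bag of y, and contiguity applies.
      follow : ∀ {y} → y ∈ rem → ∀ {i} → y ∈ˢ bag i → i Fin.≤ b → y ∈ L
      follow y∈ y∈i i≤b = ∈-filter⁺ inBag? y∈ (stays y∈i i≤b (All.lookup x≤ y∈))
      scope-kept : ∀ y → y ∈ S → y ∈ x ∷ S′
      scope-kept y y∈ with scope y y∈
      ... | inj₁ y∈p                                     = there (∈-++⁺ˡ y∈p)
      ... | inj₂ (here refl , _)                         = here refl
      ... | inj₂ (there y∈rem , i , y∈i , i≤b ∷ _)       = there (∈-++⁺ʳ pinned (follow y∈rem y∈i i≤b))
      neighbour : ∀ y → y ∈ pinned ⊎ y ∈ x ∷ rem → x ∈ pinned ⊎ y ∈ pinned ⊎ ∃[ i ] (x ∈ˢ bag i × y ∈ˢ bag i) → y ∈ x ∷ S′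
      neighbour y (inj₁ y∈p)           _                              = there (∈-++⁺ˡ y∈p)
      neighbour y (inj₂ (here refl))   _                              = here refl
      neighbour y (inj₂ (there y∈rem)) (inj₁ x∈p)                     = contradiction (here refl) (out x x∈p)
      neighbour y (inj₂ (there y∈rem)) (inj₂ (inj₁ y∈p))              = there (∈-++⁺ˡ y∈p)
      neighbour y (inj₂ (there y∈rem)) (inj₂ (inj₂ (i , x∈i , y∈i))) = there (∈-++⁺ʳ pinned (follow y∈rem y∈i (≤-last x i x∈i)))
      within : All (Within (x ∷ S′)) (touching x es)
      within = All.tabulate λ {e} e∈ → let (e∈es , touch) = ∈-filter⁻ (touches? x) {xs = es} e∈ in ok e (All.lookup cov e∈es) touch
        where
        turn : ∀ {A B C D : Set} → (A ⊎ B ⊎ C) → (C → D) → (B ⊎ A ⊎ D)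
        turn (inj₁ a)        f = inj₂ (inj₁ a)
        turn (inj₂ (inj₁ b)) f = inj₁ b
        turn (inj₂ (inj₂ c)) f = inj₂ (inj₂ (f c))
        ok : ∀ e → Coverable (x ∷ rem) e → Touches x e → Within (x ∷ S′) e
        ok (u , v) (coverable l r s) (inj₁ refl) = here refl , neighbour v r s
        ok (u , v) (coverable l r s) (inj₂ refl) = neighbour u l (turn s (λ (i , u∈ , v∈) → i , v∈ , u∈)) , here refl
      scope′ : ∀ y → y ∈ S′ → Scope rem y
      scope′ y y∈ with ∈-++⁻ pinned y∈
      ... | inj₁ y∈p = inj₁ y∈p
      ... | inj₂ y∈L = inj₂ (proj₁ (in-L y∈L) , b , proj₂ (in-L y∈L) , x≤)
      -- Edges at x have been used up, so removing x from the remaining vertices loses the end of no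
      -- edge that is left.
      cov′ : All (Coverable rem) (avoiding x es)
      cov′ = All.tabulate λ {e} e∈ → let (e∈es , ¬touch) = ∈-filter⁻ (¬? ∘ touches? x) {xs = es} e∈ in ok e (All.lookup cov e∈es) ¬touch
        where
        drop-x : ∀ {y} → y ≢ x → y ∈ pinned ⊎ y ∈ x ∷ rem → y ∈ pinned ⊎ y ∈ rem
        drop-x ne (inj₁ y∈p)           = inj₁ y∈p
        drop-x ne (inj₂ (here y≡x))    = contradiction y≡x ne
        drop-x ne (inj₂ (there y∈rem)) = inj₂ y∈rem
        ok : ∀ e → Coverable (x ∷ rem) e → ¬ Touches x e → Coverable rem e
        ok (u , v) (coverable l r s) ¬touch = coverable (drop-x (¬touch ∘ inj₁) l) (drop-x (¬touch ∘ inj₂) r) s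

  open DecMembership (Finₚ._≟_ {k}) using () renaming (_∈?_ to _∈ᴸ?_)

  renamed : (Fin k → Fin k) → List (Edge k) → List (Edge k)
  renamed ρ = map (λ (u , v) → ρ u , ρ v)

  module _ (t : Term k) (vd : Valid t) (es : List (Edge k)) (es-adj : All (λ e → ∃[ b ] (proj₁ e ∈ˢ bag b × proj₂ e ∈ˢ bag b)) es) where

    private
      ρ = rename t

    Single : Fin k → Set
    Single x = ∀ w → ρ w ≡ x → w ≡ x

    single? : ∀ x → Dec (Single x)
    single? x = Finₚ.all? (λ w → (ρ w Finₚ.≟ x) →-dec (w Finₚ.≟ x))

    multiples singles : List (Fin k)
    multiples = filter (¬? ∘ single?) (names t)
    singles   = sort (filter single? (names t))

    names-permuted : names t ↭ singles ++ multiples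
    names-permuted = Perm.trans (filter-partition single? (names t)) (Permₚ.++⁺ʳ multiples (Perm.↭-sym (sort-↭ _)))

    in-singles : ∀ {x} → x ∈ singles → x ∈ names t × Single x
    in-singles x∈ = ∈-filter⁻ single? {xs = names t} (Permₚ.∈-resp-↭ (sort-↭ _) x∈)

    in-multiples : ∀ {x} → x ∈ multiples → x ∈ names t × ¬ Single x
    in-multiples = ∈-filter⁻ (¬? ∘ single?) {xs = names t}

    -- A block with several vertices contains a vertex that is not its representative. Hence `ρ`
    -- maps the vertices that are not names onto a list containing all of `multiples`, and there are
    -- at most k - N of them.
    multiples-few : length (names t) + length multiples ≤ k
    multiples-few = ℕₚ.≤-trans (ℕₚ.+-monoʳ-≤ (length (names t)) (ℕₚ.≤-trans
        (unique-⊆-length (Uniqueₚ.filter⁺ (¬? ∘ single?) (names-unique vd)) doubled)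
        (ℕₚ.≤-reflexive (Listₚ.length-map ρ others))))
      (ℕₚ.≤-trans (ℕₚ.≤-reflexive (sym (Listₚ.length-++ (names t)))) (unique-length
        (Uniqueₚ.++⁺ (names-unique vd) (Uniqueₚ.filter⁺ notName? (Uniqueₚ.allFin⁺ k)) (λ { (x∈ , x∈o) → proj₂ (∈-filter⁻ notName? {xs = allFin k} x∈o) x∈ }))))
      where
      notName? = λ x → ¬? (x ∈ᴸ? names t)
      others = filter notName? (allFin k)
      doubled : ∀ {x} → x ∈ multiples → x ∈ map ρ others
      doubled {x} x∈ with Finₚ.¬∀⟶∃¬ k _ (λ w → (ρ w Finₚ.≟ x) →-dec (w Finₚ.≟ x)) (proj₂ (in-multiples x∈))
      ... | w , ¬imp with ρ w Finₚ.≟ x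
      ...   | no ne    = contradiction (λ eq → contradiction eq ne) ¬imp
      ...   | yes refl = ∈-map⁺ ρ (∈-filter⁺ notName? (∈-allFin w) (λ w∈ → ¬imp (λ _ → sym (rename-fixed vd w w∈))))

    -- An edge of the quotient whose ends are both singleton blocks is an edge of P itself and thus
    -- lies in a bag. Every other edge has a pinned end and puts no demand on the decomposition.
    eliminationPlan : (∀ m → m ≤ length multiples + suc p → Allowed m) → Plan multiples [] (renamed ρ es) singles
    eliminationPlan allowed = makePlan multiples (Uniqueₚ.filter⁺ (¬? ∘ single?) (names-unique vd)) allowed [] (renamed ρ es) singles
      (sort-ordered _) (unique-permute (Perm.↭-sym (sort-↭ _)) (Uniqueₚ.filter⁺ single? (names-unique vd)))
      (λ y y∈ y∈s → proj₂ (in-multiples y∈) (proj₂ (in-singles y∈s))) (λ _ ()) (Allₚ.map⁺ (All.map (λ {e} → cover e) es-adj))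
      where
      locate : ∀ u → ρ u ∈ multiples ⊎ ρ u ∈ singles
      locate u with ∈-++⁻ singles (Permₚ.∈-resp-↭ names-permuted (rename-into vd u))
      ... | inj₁ s = inj₂ s
      ... | inj₂ m = inj₁ m
      cover : ∀ e → ∃[ b ] (proj₁ e ∈ˢ bag b × proj₂ e ∈ˢ bag b) → Coverable multiples singles (ρ (proj₁ e) , ρ (proj₂ e))
      cover (u , v) (b , u∈ , v∈) = coverable (locate u) (locate v) (share (locate u) (locate v))
        where
        fixed : ∀ w → ρ w ∈ singles → w ≡ ρ w
        fixed w s = proj₂ (in-singles s) w refl
        share : ρ u ∈ multiples ⊎ ρ u ∈ singles → ρ v ∈ multiples ⊎ ρ v ∈ singles →
          ρ u ∈ multiples ⊎ ρ v ∈ multiples ⊎ ∃[ b ] (ρ u ∈ˢ bag b × ρ v ∈ˢ bag b)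
        share (inj₁ m) _        = inj₁ m
        share (inj₂ _) (inj₁ m) = inj₂ (inj₁ m)
        share (inj₂ s) (inj₂ s′) = inj₂ (inj₂ (b , subst (_∈ˢ bag b) (fixed u s) u∈ , subst (_∈ˢ bag b) (fixed v s′) v∈))

-- The cost of one quotient

unique-++⁻ : ∀ {A : Set} (xs : List A) {ys} → Unique (xs ++ ys) → Unique xs × Unique ys × (∀ {z} → z ∈ xs → z ∉ ys)
unique-++⁻ []       u        = [] , u , λ ()
unique-++⁻ (x ∷ xs) (x∉ ∷ u) with unique-++⁻ xs u
... | ux , uy , out = (Allₚ.++⁻ˡ xs x∉ ∷ ux) , uy , λ { (here refl) z∈ → All.lookup (Allₚ.++⁻ʳ xs x∉) z∈ refl ; (there z∈xs) z∈ → out z∈xs z∈ }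

-- `allowed` admits the exponents m ≤ 4k/9 + p + 1. In `mult` the exponent of a product for a ≤ b is
-- taken to be 7a/5 + b, from (M2) with ω - 1 ≤ 7/5, and the side condition says 7a/5 + b ≤ 4k/9 +
-- 2/5. Denominators are cleared so that the comparison stays within the natural numbers.
module Terms (k R : ℕ) (𝓐 : Algorithm) (clock : Clock) (P : Graph k) (p : ℕ)
             (D : PathDecomposition P) (width : HasWidth≤ D p)
             (allowed : ∀ m → 9 * m ≤ 4 * k + 9 * (p + 1) → ∀ n .{{_ : NonZero n}} → Clock.Time clock n 1 (n ^ m))
             (mult : ∀ a b → a ≤ b → 9 * (7 * a + 5 * b) ≤ 20 * k + 18 → Σ[ C ∈ ℕ ] MultipliesWithin clock 𝓐 a b C)
             (es : List (Edge k))
             (es-adj : All (λ e → ∃[ b ] (proj₁ e ∈ˢ PathDecomposition.bag D b × proj₂ e ∈ˢ PathDecomposition.bag D b)) es)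
             where

  open PathDecomposition D
  open Clock clock
  open Elimination k R 𝓐 clock
  open MatrixTerm k R 𝓐 clock
  open Planning k R 𝓐 clock P p D width
  open DecMembership (Finₚ._≟_ {k}) using () renaming (_∈?_ to _∈ᴸ?_)

  within? : ∀ S (e : Edge k) → Dec (Within S e)
  within? S (u , v) = (u ∈ᴸ? S) ×-dec (v ∈ᴸ? S)

  module _ (t : Term k) (vd : Valid t) (r : ℕ) (2≤r : 2 ≤ r) (r<R : r + k < R) (v : Value) where

    private
      edges′ = renamed (rename t) es
      N = length (names t)

    Result : Value
    Result n H = v n H ℤ.+ coef t ℤ.* sums n (names t) (edgeProduct H edges′) origin

    edges′-within : ∀ {S} → (∀ {x} → x ∈ names t → x ∈ S) → All (Within S) edges′
    edges′-within incl = Allₚ.map⁺ (All.tabulate λ {e} _ → incl (rename-into vd (proj₁ e)) , incl (rename-into vd (proj₂ e)))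

    edgeProduct-extensional : ∀ {n} (H : Graph n) (fs : List (Edge k)) → Extensional (edgeProduct H fs)
    edgeProduct-extensional H []       g g′ eq = refl
    edgeProduct-extensional {n} H ((u , w) ∷ fs) g g′ eq = cong₂ ℤ._*_ (edgeProduct-extensional H fs g g′ eq)
      (cong₂ (λ a b → contents (hostEntries H) (a + n * (b + n * 0))) (eq w) (eq u))

    module Small (small : 9 * N ≤ 5 * k) where

      -- The remainder modulo 3 goes to the middle part: the outer parts must be equally large, and
      -- a ≤ b is the case that (M2) treats.
      a b : ℕ
      a = N ℕ./ 3
      b = N ∸ (a + a)

      private
        xs = names t

      Y Z X : List (Fin k)
      Y = take b xs
      Z = take a (drop b xs)
      X = drop a (drop b xs)

      private
        joined : Y ++ Z ++ X ≡ xs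
        joined = trans (cong (Y ++_) (Listₚ.take++drop≡id a (drop b xs))) (Listₚ.take++drop≡id b xs)
        3a≤N : 3 * a ≤ N
        3a≤N = ℕₚ.≤-trans (ℕₚ.≤-reflexive (ℕₚ.*-comm 3 a)) (DivMod.m/n*n≤m N 3)
        2a≤N : a + a ≤ N
        2a≤N = ℕₚ.≤-trans (ℕₚ.≤-trans (ℕₚ.m≤m+n (a + a) a) (ℕₚ.≤-reflexive (eq a))) 3a≤N
          where
          eq : ∀ a → a + a + a ≡ 3 * a
          eq = ℕ-solve-∀
        2a+b : a + a + b ≡ N
        2a+b = ℕₚ.m+[n∸m]≡n 2a≤N
        N≤3a+2 : N ≤ 3 * a + 2
        N≤3a+2 = begin
          N                 ≡⟨ DivMod.m≡m%n+[m/n]*n N 3 ⟩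
          N ℕ.% 3 + a * 3   ≤⟨ ℕₚ.+-monoˡ-≤ (a * 3) (ℕₚ.≤-pred (DivMod.m%n<n N 3)) ⟩
          2 + a * 3         ≡⟨ eq a ⟩
          3 * a + 2         ∎
          where
          open ℕₚ.≤-Reasoning
          eq : ∀ a → 2 + a * 3 ≡ 3 * a + 2
          eq = ℕ-solve-∀
        a≤b : a ≤ b
        a≤b = ℕₚ.+-cancelˡ-≤ (a + a) a b (ℕₚ.≤-trans (ℕₚ.≤-trans (ℕₚ.≤-reflexive (eq a)) 3a≤N) (ℕₚ.≤-reflexive (sym 2a+b)))
          where
          eq : ∀ a → a + a + a ≡ 3 * a
          eq = ℕ-solve-∀
        length-Y : length Y ≡ b
        length-Y = trans (Listₚ.length-take b xs) (ℕₚ.m≤n⇒m⊓n≡m (ℕₚ.m∸n≤m N (a + a)))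
        length-rest : length (drop b xs) ≡ a + a
        length-rest = trans (Listₚ.length-drop b xs) (trans (cong (_∸ b) (sym 2a+b)) (ℕₚ.m+n∸n≡m (a + a) b))
        length-Z : length Z ≡ a
        length-Z = trans (Listₚ.length-take a (drop b xs)) (ℕₚ.m≤n⇒m⊓n≡m (subst (a ≤_) (sym length-rest) (ℕₚ.m≤m+n a a)))
        length-X : length X ≡ a
        length-X = trans (Listₚ.length-drop a (drop b xs)) (trans (cong (_∸ a) length-rest) (ℕₚ.m+n∸n≡m a a))
        -- a + b = N - a is at most 2N/3 + 2/3, hence at most 10k/27 + 2/3, which is below 4k/9 + 1.
        -- All terms are scaled by 27.
        bound : ∀ m → m ≤ a + b → 9 * m ≤ 4 * k + 9 * (p + 1)
        bound m m≤ = ℕₚ.*-cancelˡ-≤ 3 (begin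
          3 * (9 * m)                        ≤⟨ ℕₚ.*-monoʳ-≤ 3 (ℕₚ.*-monoʳ-≤ 9 m≤) ⟩
          3 * (9 * (a + b))                  ≤⟨ ℕₚ.+-cancelˡ-≤ (27 * a) _ _ step₁ ⟩
          18 * N + 18                        ≤⟨ ℕₚ.+-monoˡ-≤ 18 (ℕₚ.≤-trans (ℕₚ.≤-reflexive (eq₂ N)) (ℕₚ.*-monoʳ-≤ 2 small)) ⟩
          2 * (5 * k) + 18                   ≤⟨ ℕₚ.m≤m+n _ (2 * k + 27 * p + 9) ⟩
          2 * (5 * k) + 18 + (2 * k + 27 * p + 9) ≡⟨ eq₃ k p ⟩
          3 * (4 * k + 9 * (p + 1))          ∎)
          where
          open ℕₚ.≤-Reasoning
          eq₁ : ∀ a b → 27 * a + 3 * (9 * (a + b)) ≡ 27 * (a + a + b)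
          eq₁ = ℕ-solve-∀
          eq₂ : ∀ N → 18 * N ≡ 2 * (9 * N)
          eq₂ = ℕ-solve-∀
          eq₃ : ∀ k p → 2 * (5 * k) + 18 + (2 * k + 27 * p + 9) ≡ 3 * (4 * k + 9 * (p + 1))
          eq₃ = ℕ-solve-∀
          eq₄ : ∀ N → 27 * N ≡ 18 * N + 9 * N
          eq₄ = ℕ-solve-∀
          eq₅ : ∀ a N → 18 * N + 9 * (3 * a + 2) ≡ 27 * a + (18 * N + 18)
          eq₅ = ℕ-solve-∀
          step₁ : 27 * a + 3 * (9 * (a + b)) ≤ 27 * a + (18 * N + 18)
          step₁ = begin
            27 * a + 3 * (9 * (a + b))   ≡⟨ eq₁ a b ⟩
            27 * (a + a + b)             ≡⟨ cong (27 *_) 2a+b ⟩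
            27 * N                       ≡⟨ eq₄ N ⟩
            18 * N + 9 * N               ≤⟨ ℕₚ.+-monoʳ-≤ (18 * N) (ℕₚ.*-monoʳ-≤ 9 N≤3a+2) ⟩
            18 * N + 9 * (3 * a + 2)     ≡⟨ eq₅ a N ⟩
            27 * a + (18 * N + 18)       ∎
        -- 7a + 5b = 5N - 3a ≤ 4N + 2. The 2 is lost by rounding N/3 down and accounts for the 18 in
        -- the budget.
        cost : 9 * (7 * a + 5 * b) ≤ 20 * k + 18
        cost = begin
          9 * (7 * a + 5 * b)            ≤⟨ ℕₚ.*-monoʳ-≤ 9 (ℕₚ.+-cancelˡ-≤ (3 * a) _ _ step₁) ⟩
          9 * (4 * N + 2)                ≡⟨ eq₂ N ⟩
          4 * (9 * N) + 18               ≤⟨ ℕₚ.+-monoˡ-≤ 18 (ℕₚ.*-monoʳ-≤ 4 small) ⟩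
          4 * (5 * k) + 18               ≡⟨ eq₃ k ⟩
          20 * k + 18                    ∎
          where
          open ℕₚ.≤-Reasoning
          eq₁ : ∀ a b → 3 * a + (7 * a + 5 * b) ≡ 5 * (a + a + b)
          eq₁ = ℕ-solve-∀
          eq₂ : ∀ N → 9 * (4 * N + 2) ≡ 4 * (9 * N) + 18
          eq₂ = ℕ-solve-∀
          eq₃ : ∀ k → 4 * (5 * k) + 18 ≡ 20 * k + 18
          eq₃ = ℕ-solve-∀
          eq₄ : ∀ N → 5 * N ≡ 4 * N + N
          eq₄ = ℕ-solve-∀
          eq₅ : ∀ a N → 4 * N + (3 * a + 2) ≡ 3 * a + (4 * N + 2)
          eq₅ = ℕ-solve-∀
          step₁ : 3 * a + (7 * a + 5 * b) ≤ 3 * a + (4 * N + 2)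
          step₁ = begin
            3 * a + (7 * a + 5 * b)   ≡⟨ eq₁ a b ⟩
            5 * (a + a + b)           ≡⟨ cong (5 *_) 2a+b ⟩
            5 * N                     ≡⟨ eq₄ N ⟩
            4 * N + N                 ≤⟨ ℕₚ.+-monoʳ-≤ (4 * N) N≤3a+2 ⟩
            4 * N + (3 * a + 2)       ≡⟨ eq₅ a N ⟩
            3 * a + (4 * N + 2)       ∎
        unique-all : Unique (Y ++ Z ++ X)
        unique-all = subst Unique (sym joined) (names-unique vd)
        unique-Y = proj₁ (unique-++⁻ Y unique-all)
        unique-ZX = proj₁ (proj₂ (unique-++⁻ Y unique-all))
        Y∉ZX = λ {z} → proj₂ (proj₂ (unique-++⁻ Y unique-all)) {z}
        unique-Z = proj₁ (unique-++⁻ Z unique-ZX)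
        unique-X = proj₁ (proj₂ (unique-++⁻ Z unique-ZX))
        cat : ∀ {A B : List (Fin k)} {x y} → length A ≡ x → length B ≡ y → length (A ++ B) ≡ x + y
        cat {A} eA eB = trans (Listₚ.length-++ A) (cong₂ _+_ eA eB)
        may : ∀ {A : List (Fin k)} {m} → length A ≡ m → m ≤ a + b → Allowed (length A)
        may {A} refl m≤ = allowed (length A) (bound (length A) m≤)

      splitting : Splitting X Y Z
      splitting = record
        { unique-YX = Uniqueₚ.++⁺ unique-Y unique-X (λ (y∈ , x∈) → Y∉ZX y∈ (∈-++⁺ʳ Z x∈))
        ; unique-ZY = Uniqueₚ.++⁺ unique-Z unique-Y (λ (z∈ , y∈) → Y∉ZX y∈ (∈-++⁺ˡ z∈))
        ; unique-ZX = unique-ZX ; unique-X = unique-X ; unique-Y = unique-Y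
        ; Y∩X = λ x x∈ y∈ → Y∉ZX y∈ (∈-++⁺ʳ Z x∈)
        ; Y∩Z = λ z z∈ y∈ → Y∉ZX y∈ (∈-++⁺ˡ z∈)
        ; Z∩Y = λ y y∈ z∈ → Y∉ZX y∈ (∈-++⁺ˡ z∈)
        ; Z≅X = trans length-Z (sym length-X)
        ; allowed-X  = may {X} length-X (ℕₚ.m≤m+n a b)
        ; allowed-Y  = may {Y} length-Y (ℕₚ.m≤n+m b a)
        ; allowed-YX = may {Y ++ X} (cat {Y} {X} length-Y length-X) (ℕₚ.≤-reflexive (ℕₚ.+-comm b a))
        ; allowed-ZY = may {Z ++ Y} (cat {Z} {Y} length-Z length-Y) ℕₚ.≤-refl
        ; allowed-ZX = may {Z ++ X} (cat {Z} {X} length-Z length-X) (ℕₚ.+-monoʳ-≤ a a≤b) }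

      EA rest EB EC : List (Edge k)
      EA   = filter (within? (Y ++ X)) edges′
      rest = filter (¬? ∘ within? (Y ++ X)) edges′
      EB   = filter (within? (Z ++ Y)) rest
      EC   = filter (¬? ∘ within? (Z ++ Y)) rest

      private
        -- An edge is missed by both matrices only if it joins Z and X.
        withinC : All (Within (Z ++ X)) EC
        withinC = All.tabulate λ {e} e∈ →
          let (e∈rest , ¬ZY) = ∈-filter⁻ (¬? ∘ within? (Z ++ Y)) {xs = rest} e∈
              (e∈′ , ¬YX)    = ∈-filter⁻ (¬? ∘ within? (Y ++ X)) {xs = edges′} e∈rest
              (u∈ , v∈)      = All.lookup (edges′-within (λ x∈ → subst (_ ∈_) (sym joined) x∈)) e∈′
          in crossing ¬YX ¬ZY (parts u∈) (parts v∈)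
          where
          parts : ∀ {x} → x ∈ Y ++ Z ++ X → x ∈ Y ⊎ x ∈ Z ⊎ x ∈ X
          parts x∈ = [ inj₁ , (λ x∈ZX → inj₂ (∈-++⁻ Z x∈ZX)) ]′ (∈-++⁻ Y x∈)
          ZX : ∀ {x} → x ∈ Z ⊎ x ∈ X → x ∈ Z ++ X
          ZX = [ ∈-++⁺ˡ , ∈-++⁺ʳ Z ]′
          crossing : ∀ {u v} → ¬ Within (Y ++ X) (u , v) → ¬ Within (Z ++ Y) (u , v) →
            u ∈ Y ⊎ u ∈ Z ⊎ u ∈ X → v ∈ Y ⊎ v ∈ Z ⊎ v ∈ X → Within (Z ++ X) (u , v)
          crossing ¬YX ¬ZY (inj₁ u)        (inj₁ w)        = contradiction (∈-++⁺ˡ u , ∈-++⁺ˡ w) ¬YX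
          crossing ¬YX ¬ZY (inj₁ u)        (inj₂ (inj₁ w)) = contradiction (∈-++⁺ʳ Z u , ∈-++⁺ˡ w) ¬ZY
          crossing ¬YX ¬ZY (inj₁ u)        (inj₂ (inj₂ w)) = contradiction (∈-++⁺ˡ u , ∈-++⁺ʳ Y w) ¬YX
          crossing ¬YX ¬ZY (inj₂ (inj₁ u)) (inj₁ w)        = contradiction (∈-++⁺ˡ u , ∈-++⁺ʳ Z w) ¬ZY
          crossing ¬YX ¬ZY (inj₂ (inj₂ u)) (inj₁ w)        = contradiction (∈-++⁺ʳ Y u , ∈-++⁺ˡ w) ¬YX
          crossing ¬YX ¬ZY (inj₂ u)        (inj₂ w)        = ZX u , ZX w

        withinA : All (Within (Y ++ X)) EA
        withinA = Allₚ.all-filter (within? (Y ++ X)) edges′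
        withinB : All (Within (Z ++ Y)) EB
        withinB = Allₚ.all-filter (within? (Z ++ Y)) rest

      smallCmds : List (Cmd k)
      smallCmds = matrixCmds X Y Z EA EB EC (coef t) r

      small-hoare : Hoare smallCmds (Ready r v) (Ready (r + (2 + k)) Result)
      small-hoare pB = outcome-weaken {Post′ = Ready (r + (2 + k)) Result} (λ n H (adj , out , fresh) → adj
          , trans out (cong (λ z → v n H ℤ.+ coef t ℤ.* z) (trans
              (sums-ext n (Y ++ Z ++ X) (λ g → trans (swap (edgeProduct H EC g) (edgeProduct H EA g) (edgeProduct H EB g))
                (sym (trans (edgeProduct-split H (within? (Y ++ X)) edges′ g)
                  (cong (ℤ._*_ (edgeProduct H EA g)) (edgeProduct-split H (within? (Z ++ Y)) rest g))))) origin)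
              (cong (λ z → sums n z (edgeProduct H edges′) origin) joined)))
          , λ r′ r≤ → fresh r′ (ℕₚ.≤-trans (ℕₚ.≤-trans (ℕₚ.≤-reflexive (ℕₚ.+-comm 1 r)) (ℕₚ.+-monoʳ-≤ r (s≤s z≤n))) r≤))
        (matrix-hoare X Y Z EA EB EC (coef t) r 2≤r (ℕₚ.≤-<-trans (ℕₚ.m≤m+n r k) r<R) splitting withinA withinB withinC v (proj₁ times)
          (subst₂ (λ x y → MultipliesWithin clock 𝓐 x y (proj₁ times)) (sym length-X) (sym length-Y) (proj₂ times)) pB)
        where
        times = mult a b a≤b cost
        swap : ∀ x y z → x ℤ.* (y ℤ.* z) ≡ y ℤ.* (z ℤ.* x)
        swap = ℤ-solve-∀

    module Large (large : 5 * k < 9 * N) where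

      private
        pinned = multiples t vd es es-adj
        rem    = singles t vd es es-adj
        pinned-few : 9 * length pinned ≤ 4 * k
        pinned-few = ℕₚ.+-cancelˡ-≤ (5 * k) _ _ (begin
          5 * k + 9 * length pinned       ≤⟨ ℕₚ.+-monoˡ-≤ (9 * length pinned) (ℕₚ.<⇒≤ large) ⟩
          9 * N + 9 * length pinned       ≡⟨ ℕₚ.*-distribˡ-+ 9 N (length pinned) ⟨
          9 * (N + length pinned)         ≤⟨ ℕₚ.*-monoʳ-≤ 9 (multiples-few t vd es es-adj) ⟩
          9 * k                           ≡⟨ eq k ⟩
          5 * k + 4 * k                   ∎)
          where
          open ℕₚ.≤-Reasoning
          eq : ∀ k → 9 * k ≡ 5 * k + 4 * k
          eq = ℕ-solve-∀
        bound : ∀ m → m ≤ length pinned + suc p → 9 * m ≤ 4 * k + 9 * (p + 1)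
        bound m m≤ = begin
          9 * m                                 ≤⟨ ℕₚ.*-monoʳ-≤ 9 m≤ ⟩
          9 * (length pinned + suc p)           ≡⟨ ℕₚ.*-distribˡ-+ 9 (length pinned) (suc p) ⟩
          9 * length pinned + 9 * suc p         ≤⟨ ℕₚ.+-monoˡ-≤ (9 * suc p) pinned-few ⟩
          4 * k + 9 * suc p                     ≡⟨ cong (λ z → 4 * k + 9 * z) (ℕₚ.+-comm 1 p) ⟩
          4 * k + 9 * (p + 1)                   ∎
          where open ℕₚ.≤-Reasoning
        plan : Plan pinned [] edges′ rem
        plan = eliminationPlan t vd es es-adj (λ m m≤ → allowed m (bound m m≤))
        perm = names-permuted t vd es es-adj
        pinned-unique : Unique pinned
        pinned-unique = proj₁ (proj₂ (unique-++⁻ rem (unique-permute perm (names-unique vd))))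
        rem≤k : length rem ≤ k
        rem≤k = unique-length (proj₁ (unique-++⁻ rem (unique-permute perm (names-unique vd))))

      largeCmds : List (Cmd k)
      largeCmds = assign (tabulated [] [] (+ 1) r 0 0 []) ∷ planCmds pinned (coef t) r plan

      large-hoare : Hoare largeCmds (Ready r v) (Ready (r + (2 + k)) Result)
      large-hoare pB = outcome-weaken {Post′ = Ready (r + (2 + k)) Result} (λ n H (adj , out , fresh) → adj
          , trans out (cong (λ z → v n H ℤ.+ coef t ℤ.* z)
              (sym (sums-permute n perm (edgeProduct-extensional H edges′) origin)))
          , λ r′ r≤ → fresh r′ (ℕₚ.≤-trans (ℕₚ.≤-trans (ℕₚ.+-monoʳ-≤ (suc r) rem≤k) (ℕₚ.≤-trans (ℕₚ.n≤1+n _) (ℕₚ.≤-reflexive (eq r k)))) r≤))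
        (fullPlan-hoare pinned (coef t) pinned-unique (allowed (length pinned) (bound (length pinned) (ℕₚ.m≤m+n (length pinned) (suc p)))) r v plan 2≤r
          (ℕₚ.≤-<-trans (ℕₚ.+-monoʳ-≤ r rem≤k) r<R) (allowed 0 z≤n) pB)
        where
        eq : ∀ r k → suc (suc r + k) ≡ r + (2 + k)
        eq = ℕ-solve-∀

    -- Statements add to their target, so every table needs an array that is still zero. Each term
    -- is given `2 + k` fresh arrays, whichever method it uses; an elimination fills at most k + 1
    -- of them, a matrix product one.
    termCmds : Σ[ cs ∈ List (Cmd k) ] Hoare cs (Ready r v) (Ready (r + (2 + k)) Result)
    termCmds with 9 * N ℕ.≤? 5 * k
    ... | yes small = Small.smallCmds small , Small.small-hoare small
    ... | no ¬small = Large.largeCmds (ℕₚ.≰⇒> ¬small) , Large.large-hoare (ℕₚ.≰⇒> ¬small)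

  termsCmds : ∀ ts → All Valid ts → ∀ r → 2 ≤ r → r + length ts * (2 + k) ≤ R → ∀ v →
    Σ[ cs ∈ List (Cmd k) ] Hoare cs (Ready r v)
      (λ n H arr → arr 1 0 ≡ v n H ℤ.+ sumTerms (λ t → coef t ℤ.* sums n (names t) (edgeProduct H (renamed (rename t) es)) origin) ts)
  termsCmds []       []         r 2≤r r≤R v = [] , hoare-[] λ n H → λ (adj , out , fresh) → trans out (sym (ℤₚ.+-identityʳ (v n H)))
  termsCmds (t ∷ ts) (vd ∷ vds) r 2≤r r≤R v =
    proj₁ one ++ proj₁ others , hoare-++ (proj₁ one) (proj₂ one) (λ pB → outcome-weaken
      {Post′ = λ n H arr → arr 1 0 ≡ v n H ℤ.+ sumTerms (λ t → coef t ℤ.* sums n (names t) (edgeProduct H (renamed (rename t) es)) origin) (t ∷ ts)}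
      (λ n H out → trans out (ℤₚ.+-assoc (v n H) _ _)) (proj₂ others pB))
    where
    next : r + (2 + k) + length ts * (2 + k) ≤ R
    next = ℕₚ.≤-trans (ℕₚ.≤-reflexive (ℕₚ.+-assoc r (2 + k) _)) r≤R
    room : r + k < R
    room = ℕₚ.≤-trans (ℕₚ.≤-trans (ℕₚ.≤-trans (ℕₚ.n≤1+n _) (ℕₚ.≤-reflexive (eq r k))) (ℕₚ.m≤m+n _ _)) next
      where
      eq : ∀ r k → suc (suc (r + k)) ≡ r + (2 + k)
      eq = ℕ-solve-∀
    one = termCmds t vd r 2≤r room v
    others = termsCmds ts vds (r + (2 + k)) (ℕₚ.≤-trans 2≤r (ℕₚ.m≤m+n r _)) next (Result t vd r 2≤r room v)

-- Embeddings, automorphisms and subgraphs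

-- The pigeonhole principle for a relation. It is applied in both directions between a fibre of
-- embeddings and the automorphisms, which gives equality of the two lengths.
matching-length : ∀ {A B : Set} (R : A → B → Set) {xs : List A} {ys : List B} → Unique xs →
  (∀ x → x ∈ xs → ∃[ y ] y ∈ ys × R x y) → (∀ {x x′ y} → x ∈ xs → x′ ∈ xs → R x y → R x′ y → x ≡ x′) → length xs ≤ length ys
matching-length R {[]}     {ys} _        total inj = z≤n
matching-length R {x ∷ xs} {ys} (x∉ ∷ u) total inj with total x (here refl)
... | y , y∈ , Rxy with ∈-∃++ y∈
...   | as , bs , refl = subst (suc (length xs) ≤_)
    (sym (trans (Listₚ.length-++ as) (trans (ℕₚ.+-suc (length as) (length bs)) (cong suc (sym (Listₚ.length-++ as))))))
    (s≤s (matching-length R u total′ (λ x∈ x′∈ → inj (there x∈) (there x′∈))))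
  where
  total′ : ∀ x′ → x′ ∈ xs → ∃[ y′ ] y′ ∈ as ++ bs × R x′ y′
  total′ x′ x′∈ with total x′ (there x′∈)
  ... | y′ , y′∈ , R′ with ∈-++⁻ as y′∈
  ...   | inj₁ y′∈as         = y′ , ∈-++⁺ˡ y′∈as , R′
  ...   | inj₂ (here refl)   = contradiction (inj (here refl) (there x′∈) Rxy R′) (All.lookup x∉ x′∈)
  ...   | inj₂ (there y′∈bs) = y′ , ∈-++⁺ʳ as y′∈bs , R′

-- Induction on the values: the fibre of the first value is split off, and removing it does not
-- change the fibres of the others.
fibres-length : ∀ {A B : Set} (_≟ᴮ_ : ∀ (x y : B) → Dec (x ≡ y)) (h : A → B) a {ys} xs → Unique ys → (∀ x → x ∈ xs → h x ∈ ys) →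
  (∀ y → y ∈ ys → length (filter (λ x → h x ≟ᴮ y) xs) ≡ a) → length xs ≡ length ys * a
fibres-length _≟ᴮ_ h a {[]}     []       _        into fib = refl
fibres-length _≟ᴮ_ h a {[]}     (x ∷ xs) _        into fib = case into x (here refl) of λ ()
fibres-length _≟ᴮ_ h a {y ∷ ys} xs       (y∉ ∷ u) into fib = begin
  length xs                                       ≡⟨ Permₚ.↭-length (filter-partition is-y? xs) ⟩
  length (filter is-y? xs ++ xs′)                 ≡⟨ Listₚ.length-++ (filter is-y? xs) ⟩
  length (filter is-y? xs) + length xs′           ≡⟨ cong₂ _+_ (fib y (here refl)) (fibres-length _≟ᴮ_ h a xs′ u into′ fib′) ⟩
  a + length ys * a                               ∎
  where
  open ≡-Reasoning
  is-y? = λ x → h x ≟ᴮ y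
  xs′ = filter (¬? ∘ is-y?) xs
  into′ : ∀ x → x ∈ xs′ → h x ∈ ys
  into′ x x∈ with ∈-filter⁻ (¬? ∘ is-y?) {xs = xs} x∈
  ... | x∈xs , ≢y with into x x∈xs
  ...   | here eq   = contradiction eq ≢y
  ...   | there hx∈ = hx∈
  refilter : ∀ y′ → y ≢ y′ → ∀ xs → filter (λ x → h x ≟ᴮ y′) (filter (¬? ∘ is-y?) xs) ≡ filter (λ x → h x ≟ᴮ y′) xs
  refilter y′ ne []       = refl
  refilter y′ ne (x ∷ xs) with h x ≟ᴮ y in eq
  ... | no _ with h x ≟ᴮ y′
  ...   | yes _ = cong (x ∷_) (refilter y′ ne xs)
  ...   | no _  = refilter y′ ne xs
  refilter y′ ne (x ∷ xs) | yes refl with h x ≟ᴮ y′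
  ...   | yes eq′ = contradiction eq′ ne
  ...   | no _    = refilter y′ ne xs
  fib′ : ∀ y′ → y′ ∈ ys → length (filter (λ x → h x ≟ᴮ y′) xs′) ≡ a
  fib′ y′ y′∈ = trans (cong length (refilter y′ (All.lookup y∉ y′∈) xs)) (fib y′ (there y′∈))

sum<-count : ∀ {P : ℕ → Set} (P? : ∀ j → Dec (P j)) m → sum< m (λ j → if ⌊ P? j ⌋ then + 1 else + 0) ≡ + length (filter P? (upTo m))
sum<-count P? zero    = refl
sum<-count P? (suc m) = trans (cong₂ ℤ._+_ (sum<-count P? m) last) (trans (sym (ℤₚ.pos-+ (length (filter P? (upTo m))) _))
  (cong +_ (trans (sym (Listₚ.length-++ (filter P? (upTo m)))) (cong length (trans (sym (Listₚ.filter-++ P? (upTo m) (m ∷ []))) (cong (filter P?) (Listₚ.upTo-∷ʳ m)))))))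
  where
  last : (if ⌊ P? m ⌋ then + 1 else + 0) ≡ + length (filter P? (m ∷ []))
  last with P? m
  ... | yes _ = refl
  ... | no _  = refl

-- Vectors instead of functions, because pointwise equal vectors are propositionally equal; only
-- then can maps be listed without repetition and counted.
vectors : ∀ k m → List (Vec (Fin k) m)
vectors k zero    = [] ∷ []
vectors k (suc m) = cartesianProductWith _∷_ (allFin k) (vectors k m)

∈-vectors : ∀ {k m} (xs : Vec (Fin k) m) → xs ∈ vectors k m
∈-vectors []       = here refl
∈-vectors (x ∷ xs) = ∈-cartesianProductWith⁺ _∷_ (∈-allFin x) (∈-vectors xs)

vectors-unique : ∀ k m → Unique (vectors k m)
vectors-unique k zero    = [] ∷ []
vectors-unique k (suc m) = Uniqueₚ.cartesianProductWith⁺ _∷_ (λ eq → Vecₚ.∷-injective eq) (Uniqueₚ.allFin⁺ k) (vectors-unique k m)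

∈-tabulate⁺ : ∀ {n} {P : Fin n → Set} (P? : ∀ v → Dec (P v)) v → P v → v ∈ˢ Vec.tabulate (λ v → ⌊ P? v ⌋)
∈-tabulate⁺ P? v p = Vecₚ.lookup⇒[]= v _ (trans (Vecₚ.lookup∘tabulate _ v) (is-true (P? v) p))
  where
  is-true : ∀ {P : Set} (d : Dec P) → P → ⌊ d ⌋ ≡ true
  is-true (yes _) _ = refl
  is-true (no ¬p) p = contradiction p ¬p

∈-tabulate⁻ : ∀ {n} {P : Fin n → Set} (P? : ∀ v → Dec (P v)) v → v ∈ˢ Vec.tabulate (λ v → ⌊ P? v ⌋) → P v
∈-tabulate⁻ P? v v∈ = is-true (P? v) (trans (sym (Vecₚ.lookup∘tabulate _ v)) (Vecₚ.[]=⇒lookup v∈))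
  where
  is-true : ∀ {P : Set} (d : Dec P) → ⌊ d ⌋ ≡ true → P
  is-true (yes p) _ = p

vec-ext : ∀ {A : Set} {n} {xs ys : Vec A n} → (∀ i → Vec.lookup xs i ≡ Vec.lookup ys i) → xs ≡ ys
vec-ext {xs = xs} {ys} eq = trans (sym (Vecₚ.tabulate∘lookup xs)) (trans (Vecₚ.tabulate-cong eq) (Vecₚ.tabulate∘lookup ys))

subgraph-ext : ∀ {n} {S S′ : Subgraph n} → (∀ v → Subgraph.Vertex S v ⇔ Subgraph.Vertex S′ v) →
  (∀ u v → Subgraph.Edge S u v ⇔ Subgraph.Edge S′ u v) → S ≡ S′
subgraph-ext {S = S} {S′} vs es = cong₂ (λ p q → record { vertices = p ; neighbours = q })
  (Subsetₚ.⊆-antisym (λ {v} → Equivalence.to (vs v)) (λ {v} → Equivalence.from (vs v)))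
  (vec-ext (λ u → Subsetₚ.⊆-antisym (λ {v} → Equivalence.to (es u v)) (λ {v} → Equivalence.from (es u v))))

_≟ˢ_ : ∀ {n} (S S′ : Subgraph n) → Dec (S ≡ S′)
S ≟ˢ S′ = map′ (λ (eq , eq′) → cong₂ (λ p q → record { vertices = p ; neighbours = q }) eq eq′)
  (λ eq → cong Subgraph.vertices eq , cong Subgraph.neighbours eq)
  (Vecₚ.≡-dec Boolₚ._≟_ (Subgraph.vertices S) (Subgraph.vertices S′)
    ×-dec Vecₚ.≡-dec (Vecₚ.≡-dec Boolₚ._≟_) (Subgraph.neighbours S) (Subgraph.neighbours S′))

module Counting {k : ℕ} (P : Graph k) where

  open Graph

  -- Every edge and every pair occurs in both orders. This does no harm, since at every assignment
  -- the corresponding factors are 0 or 1.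
  patternEdges distinctPairs : List (Edge k)
  patternEdges  = filter (λ (u , v) → T? (adj P u v)) (cartesianProduct (allFin k) (allFin k))
  distinctPairs = filter (λ (u , v) → ¬? (u Finₚ.≟ v)) (cartesianProduct (allFin k) (allFin k))

  record Automorphism (σ : Fin k → Fin k) : Set where
    constructor automorphism
    field
      preserves  : ∀ i j → T (adj P i j) → T (adj P (σ i) (σ j))
      reflects   : ∀ i j → T (adj P (σ i) (σ j)) → T (adj P i j)
      one-to-one : ∀ i j → σ i ≡ σ j → i ≡ j
      surjective : ∀ i → ∃[ j ] σ j ≡ i

  automorphism? : ∀ σ → Dec (Automorphism σ)
  automorphism? σ = map′ (λ (a , b , c , d) → automorphism a b c d) (λ (automorphism a b c d) → a , b , c , d)
    (Finₚ.all? (λ i → Finₚ.all? λ j → T? _ →-dec T? _) ×-dec Finₚ.all? (λ i → Finₚ.all? λ j → T? _ →-dec T? _)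
      ×-dec Finₚ.all? (λ i → Finₚ.all? λ j → (σ i Finₚ.≟ σ j) →-dec (i Finₚ.≟ j))
      ×-dec Finₚ.all? (λ i → Finₚ.any? λ j → σ j Finₚ.≟ i))

  automorphisms : List (Vec (Fin k) k)
  automorphisms = filter (automorphism? ∘ Vec.lookup) (vectors k k)

  instance
    -- The identity is an automorphism. The program will divide the number of embeddings by this
    -- length.
    automorphisms-nonZero : NonZero (length automorphisms)
    automorphisms-nonZero = nonEmpty (∈-filter⁺ (automorphism? ∘ Vec.lookup) (∈-vectors (Vec.allFin k))
        (automorphism (λ i j → subst T (sym (cong₂ (adj P) (Vecₚ.lookup-allFin i) (Vecₚ.lookup-allFin j))))
          (λ i j → subst T (cong₂ (adj P) (Vecₚ.lookup-allFin i) (Vecₚ.lookup-allFin j)))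
          (λ i j eq → trans (sym (Vecₚ.lookup-allFin i)) (trans eq (Vecₚ.lookup-allFin j))) (λ i → i , Vecₚ.lookup-allFin i)))
      where
      nonEmpty : ∀ {A : Set} {x : A} {xs} → x ∈ xs → NonZero (length xs)
      nonEmpty (here _)  = _
      nonEmpty (there _) = _

  module _ (n : ℕ) .{{_ : NonZero n}} (H : Graph n) where

    record Embedding (f : Fin k → Fin n) : Set where
      constructor embedding
      field
        homomorphic : ∀ i j → T (adj P i j) → T (adj H (f i) (f j))
        injective   : ∀ i j → f i ≡ f j → i ≡ j

    embedding? : ∀ f → Dec (Embedding f)
    embedding? f = map′ (λ (a , b) → embedding a b) (λ (embedding a b) → a , b)
      (Finₚ.all? (λ i → Finₚ.all? λ j → T? _ →-dec T? _) ×-dec Finₚ.all? (λ i → Finₚ.all? λ j → (f i Finₚ.≟ f j) →-dec (i Finₚ.≟ j)))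

    image-edge? : ∀ (f : Fin k → Fin n) a b → Dec (∃[ i ] ∃[ j ] f i ≡ a × f j ≡ b × T (adj P i j))
    image-edge? f a b = Finₚ.any? λ i → Finₚ.any? λ j → (f i Finₚ.≟ a) ×-dec (f j Finₚ.≟ b) ×-dec T? _

    image-vertex? : ∀ (f : Fin k → Fin n) v → Dec (∃[ i ] f i ≡ v)
    image-vertex? f v = Finₚ.any? λ i → f i Finₚ.≟ v

    image : (Fin k → Fin n) → Subgraph n
    image f = record
      { vertices   = Vec.tabulate (λ v → ⌊ image-vertex? f v ⌋)
      ; neighbours = Vec.tabulate (λ a → Vec.tabulate (λ b → ⌊ image-edge? f a b ⌋)) }

    image-vertex : ∀ f v → Subgraph.Vertex (image f) v ⇔ (∃[ i ] f i ≡ v)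
    image-vertex f v = mk⇔ (∈-tabulate⁻ (image-vertex? f) v) (∈-tabulate⁺ (image-vertex? f) v)

    image-edge : ∀ f a b → Subgraph.Edge (image f) a b ⇔ (∃[ i ] ∃[ j ] f i ≡ a × f j ≡ b × T (adj P i j))
    image-edge f a b = mk⇔
      (∈-tabulate⁻ (image-edge? f a) b ∘ subst (b ∈ˢ_) (Vecₚ.lookup∘tabulate (λ a → Vec.tabulate (λ b → ⌊ image-edge? f a b ⌋)) a))
      (subst (b ∈ˢ_) (sym (Vecₚ.lookup∘tabulate (λ a → Vec.tabulate (λ b → ⌊ image-edge? f a b ⌋)) a)) ∘ ∈-tabulate⁺ (image-edge? f a) b)

    image-subgraph : ∀ {f} → Embedding f → image f IsSubgraphOf H
    image-subgraph {f} (embedding hom inj) = record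
      { edge-symmetric = λ u v e → let (i , j , fi , fj , ij) = Equivalence.to (image-edge f u v) e in
          Equivalence.from (image-edge f v u) (j , i , fj , fi , subst T (symmetric P i j) ij)
      ; edge-vertex = λ u v e → let (i , j , fi , fj , ij) = Equivalence.to (image-edge f u v) e in Equivalence.from (image-vertex f u) (i , fi)
      ; edge-adj = λ u v e → case Equivalence.to (image-edge f u v) e of λ { (i , j , refl , refl , ij) → hom i j ij } }

    image-isomorphic : ∀ {f} → Embedding f → image f IsIsomorphicTo P
    image-isomorphic {f} (embedding hom inj) = record
      { to = f ; injective = λ {i} {j} → inj i j ; image = image-vertex f
      ; edges = λ i j → mk⇔ (λ ij → Equivalence.from (image-edge f (f i) (f j)) (i , j , refl , refl , ij))
          (λ e → let (i′ , j′ , fi , fj , ij) = Equivalence.to (image-edge f (f i) (f j)) e in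
            subst₂ (λ a b → T (adj P a b)) (inj i′ i fi) (inj j′ j fj) ij) }

    isomorphic-image : ∀ {S} → S IsSubgraphOf H → (iso : S IsIsomorphicTo P) →
      Embedding (_IsIsomorphicTo_.to iso) × S ≡ image (_IsIsomorphicTo_.to iso)
    isomorphic-image {S} S⊆H iso = embedding (λ i j ij → edge-adj _ _ (Equivalence.to (edges i j) ij)) (λ i j → injective)
      , subgraph-ext (λ v → mk⇔ (Equivalence.from (image-vertex to v) ∘ Equivalence.to (img v))
                                (Equivalence.from (img v) ∘ Equivalence.to (image-vertex to v)))
          (λ u v → mk⇔ (λ e → Equivalence.from (image-edge to u v) (forward u v e))
            (λ e → case Equivalence.to (image-edge to u v) e of λ { (i , j , refl , refl , ij) → Equivalence.to (edges i j) ij }))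
      where
      open _IsSubgraphOf_ S⊆H
      open _IsIsomorphicTo_ iso renaming (image to img)
      forward : ∀ u v → Subgraph.Edge S u v → ∃[ i ] ∃[ j ] to i ≡ u × to j ≡ v × T (adj P i j)
      forward u v e with Equivalence.to (img u) (edge-vertex u v e) | Equivalence.to (img v) (edge-vertex v u (edge-symmetric u v e))
      ... | i , refl | j , refl = i , j , refl , refl , Equivalence.from (edges i j) e

    image-cong : ∀ {f g} → (∀ i → f i ≡ g i) → image f ≡ image g
    image-cong {f} {g} eq = subgraph-ext
      (λ v → mk⇔ (λ x → let (i , fi) = Equivalence.to (image-vertex f v) x in Equivalence.from (image-vertex g v) (i , trans (sym (eq i)) fi))
                 (λ x → let (i , gi) = Equivalence.to (image-vertex g v) x in Equivalence.from (image-vertex f v) (i , trans (eq i) gi)))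
      (λ u v → mk⇔ (λ x → let (i , j , fi , fj , ij) = Equivalence.to (image-edge f u v) x in
                            Equivalence.from (image-edge g u v) (i , j , trans (sym (eq i)) fi , trans (sym (eq j)) fj , ij))
                   (λ x → let (i , j , gi , gj , ij) = Equivalence.to (image-edge g u v) x in
                            Equivalence.from (image-edge f u v) (i , j , trans (eq i) gi , trans (eq j) gj , ij)))

    embedding-cong : ∀ {f g} → (∀ i → f i ≡ g i) → Embedding f → Embedding g
    embedding-cong eq (embedding hom inj) = embedding
      (λ i j ij → subst₂ (λ a b → T (adj H a b)) (eq i) (eq j) (hom i j ij))
      (λ i j gi≡gj → inj i j (trans (eq i) (trans gi≡gj (sym (eq j)))))

    -- Maps into the host are represented by the loop counters that encode them. This makes their
    -- equality propositional and ties the list of embeddings to the sum that the program computes.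
    codes : ℕ
    codes = n ^ length (allFin k)

    decode : ℕ → Fin k → Fin n
    decode c x = Fin.fromℕ< (digits-< n (allFin k) c x)

    toℕ-decode : ∀ c x → toℕ (decode c x) ≡ digits n (allFin k) c x
    toℕ-decode c x = Finₚ.toℕ-fromℕ< _

    code : (Fin k → Fin n) → ℕ
    code f = flat n 0 (toℕ ∘ f) (allFin k)

    code-< : ∀ f → code f < codes
    code-< f = flat-< n (toℕ ∘ f) (λ x → Finₚ.toℕ<n (f x)) (allFin k)

    decode-code : ∀ f i → decode (code f) i ≡ f i
    decode-code f i = Finₚ.toℕ-injective (trans (toℕ-decode (code f) i) (digits-flat n (toℕ ∘ f) (λ x → Finₚ.toℕ<n (f x)) (allFin k) i (∈-allFin i)))

    decode-injective : ∀ {c c′} → c < codes → c′ < codes → (∀ i → decode c i ≡ decode c′ i) → c ≡ c′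
    decode-injective {c} {c′} c< c′< eq = trans (sym (flat-digits n (allFin k) c (Uniqueₚ.allFin⁺ k) c<))
      (trans (flat-cong n 0 (allFin k) (λ x _ → trans (sym (toℕ-decode c x)) (trans (cong toℕ (eq x)) (toℕ-decode c′ x))))
        (flat-digits n (allFin k) c′ (Uniqueₚ.allFin⁺ k) c′<))

    embeddings : List ℕ
    embeddings = filter (embedding? ∘ decode) (upTo codes)

    embeddings-unique : Unique embeddings
    embeddings-unique = Uniqueₚ.filter⁺ (embedding? ∘ decode) (Uniqueₚ.upTo⁺ codes)

    in-embeddings : ∀ {c} → c ∈ embeddings → c < codes × Embedding (decode c)
    in-embeddings c∈ = let (c∈′ , emb) = ∈-filter⁻ (embedding? ∘ decode) {xs = upTo codes} c∈ in ∈-upTo⁻ c∈′ , emb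

    code-∈ : ∀ {f} → Embedding f → code f ∈ embeddings
    code-∈ {f} emb = ∈-filter⁺ (embedding? ∘ decode) (∈-upTo⁺ (code-< f)) (embedding-cong (sym ∘ decode-code f) emb)

    subgraphs : List (Subgraph n)
    subgraphs = deduplicate _≟ˢ_ (map (image ∘ decode) embeddings)

    subgraphs-count : SubgraphCount P H (length subgraphs)
    subgraphs-count = subgraphs , UniqueDecₚ.deduplicate-! _≟ˢ_ _ , (λ S → mk⇔ (sound S) (complete S)) , refl
      where
      sound : ∀ S → S ∈ subgraphs → S IsSubgraphOf H × S IsIsomorphicTo P
      sound S S∈ with ∈-map⁻ (image ∘ decode) (∈-deduplicate⁻ _≟ˢ_ _ S∈)
      ... | c , c∈ , refl = image-subgraph (proj₂ (in-embeddings c∈)) , image-isomorphic (proj₂ (in-embeddings c∈))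
      complete : ∀ S → S IsSubgraphOf H × S IsIsomorphicTo P → S ∈ subgraphs
      complete S (S⊆H , iso) with isomorphic-image S⊆H iso
      ... | emb , eq = ∈-deduplicate⁺ _≟ˢ_ (subst (_∈ map (image ∘ decode) embeddings)
              (trans (image-cong (decode-code (_IsIsomorphicTo_.to iso))) (sym eq)) (∈-map⁺ (image ∘ decode) (code-∈ emb)))

    -- Two embeddings have the same image exactly if they differ by an automorphism: `g = f₀ ∘ σ`,
    -- where σ is unique because `f₀` is injective. That σ reflects adjacency uses that the image
    -- records the edges and not only the vertices.
    fibre-length : ∀ S → S ∈ subgraphs → length (filter (λ c → image (decode c) ≟ˢ S) embeddings) ≡ length automorphisms
    fibre-length S S∈ with ∈-map⁻ (image ∘ decode) (∈-deduplicate⁻ _≟ˢ_ _ S∈)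
    ... | c₀ , c₀∈ , refl = ℕₚ.≤-antisym
        (matching-length R (Uniqueₚ.filter⁺ same? embeddings-unique) to-automorphism
          (λ c∈ c′∈ r r′ → decode-injective (proj₁ (in-embeddings (proj₁ (in-fibre c∈)))) (proj₁ (in-embeddings (proj₁ (in-fibre c′∈))))
            (λ i → trans (r i) (sym (r′ i)))))
        (matching-length (λ σ c → R c σ) (Uniqueₚ.filter⁺ (automorphism? ∘ Vec.lookup) (vectors-unique k k)) from-automorphism
          (λ _ _ r r′ → vec-ext (λ i → inj₀ _ _ (trans (sym (r i)) (r′ i)))))
      where
      f₀ = decode c₀
      emb₀ = proj₂ (in-embeddings c₀∈)
      open Embedding emb₀ renaming (injective to inj₀; homomorphic to hom₀)
      same? = λ c → image (decode c) ≟ˢ image f₀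
      fibre = filter same? embeddings
      R : ℕ → Vec (Fin k) k → Set
      R c σ = ∀ i → decode c i ≡ f₀ (Vec.lookup σ i)
      in-fibre : ∀ {c} → c ∈ fibre → c ∈ embeddings × image (decode c) ≡ image f₀
      in-fibre = ∈-filter⁻ same? {xs = embeddings}
      to-automorphism : ∀ c → c ∈ fibre → ∃[ σ ] σ ∈ automorphisms × R c σ
      to-automorphism c c∈ = σ , ∈-filter⁺ (automorphism? ∘ Vec.lookup) (∈-vectors σ) aut , r
        where
        g = decode c
        emb = proj₂ (in-embeddings (proj₁ (in-fibre c∈)))
        same = proj₂ (in-fibre c∈)
        open Embedding emb
        preimage : ∀ i → ∃[ j ] f₀ j ≡ g i
        preimage i = Equivalence.to (image-vertex f₀ (g i)) (subst (λ S → Subgraph.Vertex S (g i)) same (Equivalence.from (image-vertex g (g i)) (i , refl)))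
        σ = Vec.tabulate (proj₁ ∘ preimage)
        s = Vec.lookup σ
        r : R c σ
        r i = trans (sym (proj₂ (preimage i))) (cong f₀ (sym (Vecₚ.lookup∘tabulate (proj₁ ∘ preimage) i)))
        aut : Automorphism s
        aut = automorphism
          (λ i j ij → let (i′ , j′ , ei , ej , ij′) = Equivalence.to (image-edge f₀ (g i) (g j))
                             (subst (λ S → Subgraph.Edge S (g i) (g j)) same (Equivalence.from (image-edge g (g i) (g j)) (i , j , refl , refl , ij)))
                      in subst₂ (λ a b → T (adj P a b)) (inj₀ i′ (s i) (trans ei (r i))) (inj₀ j′ (s j) (trans ej (r j))) ij′)
          (λ i j ij → let (i′ , j′ , ei , ej , ij′) = Equivalence.to (image-edge g (g i) (g j))
                             (subst (λ S → Subgraph.Edge S (g i) (g j)) (sym same) (Equivalence.from (image-edge f₀ (g i) (g j)) (s i , s j , sym (r i) , sym (r j) , ij)))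
                      in subst₂ (λ a b → T (adj P a b)) (injective i′ i ei) (injective j′ j ej) ij′)
          (λ i j eq → injective i j (trans (r i) (trans (cong f₀ eq) (sym (r j)))))
          (λ i → let (j , gj) = Equivalence.to (image-vertex g (f₀ i)) (subst (λ S → Subgraph.Vertex S (f₀ i)) (sym same) (Equivalence.from (image-vertex f₀ (f₀ i)) (i , refl)))
                 in j , inj₀ (s j) i (trans (sym (r j)) gj))
      from-automorphism : ∀ σ → σ ∈ automorphisms → ∃[ c ] c ∈ fibre × R c σ
      from-automorphism σ σ∈ = code g , ∈-filter⁺ same? (code-∈ emb) (trans (image-cong (decode-code g)) same) , decode-code g
        where
        s = Vec.lookup σ
        open Automorphism (proj₂ (∈-filter⁻ (automorphism? ∘ Vec.lookup) {xs = vectors k k} σ∈))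
        g = f₀ ∘ s
        emb : Embedding g
        emb = embedding (λ i j ij → hom₀ (s i) (s j) (preserves i j ij)) (λ i j eq → one-to-one i j (inj₀ (s i) (s j) eq))
        same : image g ≡ image f₀
        same = subgraph-ext
          (λ v → mk⇔ (λ x → let (i , e) = Equivalence.to (image-vertex g v) x in Equivalence.from (image-vertex f₀ v) (s i , e))
                     (λ x → let (i , e) = Equivalence.to (image-vertex f₀ v) x ; (j , sj) = surjective i in
                            Equivalence.from (image-vertex g v) (j , trans (cong f₀ sj) e)))
          (λ u v → mk⇔ (λ x → let (i , j , ei , ej , ij) = Equivalence.to (image-edge g u v) x in
                              Equivalence.from (image-edge f₀ u v) (s i , s j , ei , ej , preserves i j ij))
                       (λ x → let (i , j , ei , ej , ij) = Equivalence.to (image-edge f₀ u v) x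
                                  (i′ , si) = surjective i ; (j′ , sj) = surjective j in
                              Equivalence.from (image-edge g u v) (i′ , j′ , trans (cong f₀ si) ei , trans (cong f₀ sj) ej
                                , reflects i′ j′ (subst₂ (λ a b → T (adj P a b)) (sym si) (sym sj) ij))))

    embeddings-length : length embeddings ≡ length subgraphs * length automorphisms
    embeddings-length = fibres-length _≟ˢ_ (image ∘ decode) (length automorphisms) embeddings (UniqueDecₚ.deduplicate-! _≟ˢ_ _)
      (λ c c∈ → ∈-deduplicate⁺ _≟ˢ_ (∈-map⁺ (image ∘ decode) c∈)) fibre-length

    private
      weight : Assignment k → ℤ
      weight g = edgeProduct H patternEdges g ℤ.* distinctProduct distinctPairs g

      edge-weight : ∀ c u v → edgeValue H (u , v) (digits n (allFin k) c) ≡ (if adj H (decode c u) (decode c v) then + 1 else + 0)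
      edge-weight c u v = trans (cong (contents (hostEntries H)) (cong₂ (λ a b → a + n * b) (sym (toℕ-decode c v))
          (trans (cong (digits n (allFin k) c u ℕ.+_) (ℕₚ.*-zeroʳ n)) (trans (ℕₚ.+-identityʳ _) (sym (toℕ-decode c u))))))
        (contents-entry n n (λ u v → if adj H u v then + 1 else + 0) (decode c u) (decode c v))

      edgeProduct-one : ∀ (es : List (Edge k)) g → All (λ e → edgeValue H e g ≡ + 1) es → edgeProduct H es g ≡ + 1
      edgeProduct-one []       g []         = refl
      edgeProduct-one (e ∷ es) g (eq ∷ eqs) = cong₂ ℤ._*_ (edgeProduct-one es g eqs) eq

      edgeProduct-zero : ∀ {es : List (Edge k)} {e} g → e ∈ es → edgeValue H e g ≡ + 0 → edgeProduct H es g ≡ + 0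
      edgeProduct-zero {e ∷ es} g (here refl) eq = trans (cong (ℤ._*_ (edgeProduct H es g)) eq) (ℤₚ.*-zeroʳ (edgeProduct H es g))
      edgeProduct-zero {f ∷ es} g (there e∈)  eq = trans (cong (ℤ._* edgeValue H f g) (edgeProduct-zero g e∈ eq)) (ℤₚ.*-zeroˡ (edgeValue H f g))

      distinct-one : ∀ (D : List (Edge k)) g → All (λ (u , v) → g u ≢ g v) D → distinctProduct D g ≡ + 1
      distinct-one []            g []         = refl
      distinct-one ((u , v) ∷ D) g (ne ∷ nes) = cong₂ ℤ._*_ (distinct-one D g nes) (cong (λ z → + 1 ℤ.- z) (coincide-no u v g ne))

      distinct-zero : ∀ {D : List (Edge k)} {u v} g → (u , v) ∈ D → g u ≡ g v → distinctProduct D g ≡ + 0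
      distinct-zero {(u , v) ∷ D} g (here refl) eq = trans (cong (λ z → distinctProduct D g ℤ.* (+ 1 ℤ.- z)) (coincide-yes u v g eq)) (ℤₚ.*-zeroʳ (distinctProduct D g))
      distinct-zero {(x , y) ∷ D} g (there e∈)  eq = trans (cong (ℤ._* (+ 1 ℤ.- coincide x y g)) (distinct-zero {D} g e∈ eq)) (ℤₚ.*-zeroˡ (+ 1 ℤ.- coincide x y g))

      pair-∈ : ∀ u v → (u , v) ∈ cartesianProduct (allFin k) (allFin k)
      pair-∈ u v = ∈-cartesianProduct⁺ (∈-allFin u) (∈-allFin v)

      -- The product over the edges is 1 or 0 according to whether the map is a homomorphism, and
      -- the product over the pairs does the same for injectivity. A violated condition on finitely
      -- many vertices yields an explicit pair, whose factor is 0.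
      weight-indicator : ∀ c → weight (digits n (allFin k) c) ≡ (if ⌊ embedding? (decode c) ⌋ then + 1 else + 0)
      weight-indicator c with embedding? (decode c)
      ... | yes (embedding hom inj) = cong₂ ℤ._*_
          (edgeProduct-one patternEdges g (All.tabulate λ {e} e∈ → trans (edge-weight c _ _)
            (value-one (hom _ _ (proj₂ (∈-filter⁻ (λ (u , v) → T? (adj P u v)) {xs = cartesianProduct (allFin k) (allFin k)} e∈))))))
          (distinct-one distinctPairs g (All.tabulate λ {e} e∈ eq →
            proj₂ (∈-filter⁻ (λ (u , v) → ¬? (u Finₚ.≟ v)) {xs = cartesianProduct (allFin k) (allFin k)} e∈)
              (inj _ _ (Finₚ.toℕ-injective (trans (toℕ-decode c _) (trans eq (sym (toℕ-decode c _))))))))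
        where
        g = digits n (allFin k) c
        value-one : ∀ {b} → T b → (if b then + 1 else + 0) ≡ + 1
        value-one {true} _ = refl
      ... | no ¬emb = by (Finₚ.all? λ i → Finₚ.all? λ j → T? (adj P i j) →-dec T? (adj H (decode c i) (decode c j)))
                         (Finₚ.all? λ i → Finₚ.all? λ j → (decode c i Finₚ.≟ decode c j) →-dec (i Finₚ.≟ j))
        where
        g = digits n (allFin k) c
        value-zero : ∀ {b} → ¬ T b → (if b then + 1 else + 0) ≡ + 0
        value-zero {true}  ¬t = contradiction _ ¬t
        value-zero {false} _  = refl
        counterexample : ∀ {Q : Fin k → Fin k → Set} → (∀ i j → Dec (Q i j)) → ¬ (∀ i j → Q i j) → ∃[ i ] ∃[ j ] ¬ Q i j
        counterexample Q? ¬all with Finₚ.¬∀⟶∃¬ k _ (λ i → Finₚ.all? (Q? i)) ¬all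
        ... | i , ¬all′ = i , Finₚ.¬∀⟶∃¬ k _ (Q? i) ¬all′
        split : ∀ {A B : Set} → Dec A → ¬ (A → B) → A × ¬ B
        split (yes a) ¬f = a , λ b → ¬f (λ _ → b)
        split (no ¬a) ¬f = contradiction (λ a → contradiction a ¬a) ¬f
        by : Dec (∀ i j → T (adj P i j) → T (adj H (decode c i) (decode c j))) → Dec (∀ i j → decode c i ≡ decode c j → i ≡ j) → weight g ≡ + 0
        by (yes hom) (yes inj) = contradiction (embedding hom inj) ¬emb
        by (no ¬hom) _ with counterexample (λ i j → T? _ →-dec T? _) ¬hom
        ... | i , j , ¬imp with split (T? _) ¬imp
        ...   | ij , ¬fij = trans (cong (ℤ._* distinctProduct distinctPairs g) (edgeProduct-zero {patternEdges} g
                  (∈-filter⁺ (λ (u , v) → T? (adj P u v)) (pair-∈ i j) ij) (trans (edge-weight c i j) (value-zero ¬fij)))) (ℤₚ.*-zeroˡ (distinctProduct distinctPairs g))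
        by (yes _) (no ¬inj) with counterexample (λ i j → (decode c i Finₚ.≟ decode c j) →-dec (i Finₚ.≟ j)) ¬inj
        ... | i , j , ¬imp with split (decode c i Finₚ.≟ decode c j) ¬imp
        ...   | eq , i≢j = trans (cong (ℤ._*_ (edgeProduct H patternEdges g)) (distinct-zero {distinctPairs} g
                  (∈-filter⁺ (λ (u , v) → ¬? (u Finₚ.≟ v)) (pair-∈ i j) i≢j)
                  (trans (sym (toℕ-decode c i)) (trans (cong toℕ eq) (toℕ-decode c j))))) (ℤₚ.*-zeroʳ (edgeProduct H patternEdges g))

    embeddings-sum : sums n (allFin k) weight origin ≡ + (length subgraphs * length automorphisms)
    embeddings-sum = begin
      sums n (allFin k) weight origin
        ≡⟨ sums-digits n (allFin k) [] weight 0 ⟨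
      sum< codes (λ c → weight (digits n (allFin k ++ []) (c + 0)))
        ≡⟨ sum<-cong codes (λ c _ → trans (cong₂ (λ xs c → weight (digits n xs c)) (Listₚ.++-identityʳ (allFin k)) (ℕₚ.+-identityʳ c)) (weight-indicator c)) ⟩
      sum< codes (λ c → if ⌊ embedding? (decode c) ⌋ then + 1 else + 0)
        ≡⟨ sum<-count (embedding? ∘ decode) codes ⟩
      + length embeddings
        ≡⟨ cong +_ embeddings-length ⟩
      + (length subgraphs * length automorphisms) ∎
      where open ≡-Reasoning

-- Real exponents

ℚ-ring : AlmostCommutativeRing 0ℓ 0ℓ
ℚ-ring = fromCommutativeRing ℚₚ.+-*-commutativeRing (λ x → dec⇒maybe (0ℚ ℚ.≟ x))

difference-≥0 : ∀ {x y} → x ℚ.≤ y → 0ℚ ℚ.≤ y ℚ.- x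
difference-≥0 {x} {y} h = subst (ℚ._≤ y ℚ.- x) (ℚₚ.+-inverseʳ x) (ℚₚ.+-monoˡ-≤ (ℚ.- x) h)

≥0-difference : ∀ {x y} → 0ℚ ℚ.≤ y ℚ.- x → x ℚ.≤ y
≥0-difference {x} {y} h = subst₂ ℚ._≤_ (ℚₚ.+-identityˡ x) (eq x y) (ℚₚ.+-monoˡ-≤ x h)
  where
  eq : ∀ x y → y ℚ.- x ℚ.+ x ≡ y
  eq = solve-∀ ℚ-ring

+-≥0 : ∀ {x y} → 0ℚ ℚ.≤ x → 0ℚ ℚ.≤ y → 0ℚ ℚ.≤ x ℚ.+ y
+-≥0 = ℚₚ.+-mono-≤

*-≥0 : ∀ {x y} → 0ℚ ℚ.≤ x → 0ℚ ℚ.≤ y → 0ℚ ℚ.≤ x ℚ.* y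
*-≥0 {x} {y} hx hy = subst (ℚ._≤ x ℚ.* y) (ℚₚ.*-zeroʳ x) (ℚₚ.*-monoˡ-≤-nonNeg x {{ℚ.nonNegative hx}} hy)

constant-≥0 : ∀ c {_ : ℚ.NonNegative c} → 0ℚ ℚ.≤ c
constant-≥0 c {nn} = ℚₚ.nonNegative⁻¹ c {{nn}}

-- Behind the bound is the identity (3 - ω)(1 - α) = d/18 - (2/3)(ω - 2)(1 - 2α), where d is the
-- denominator of τ: for ω ≥ 2 and α ≤ 1/2 it gives τ ≤ 1/18. Here `t`, `w`, `a` are approximations
-- with error `ε`. If `t` is at least 1/18 + ε, a combination of nonnegative quantities equals
-- -(16/15) ε, so that ε cannot be positive.
module TauBound (t w a ε : ℚ) (0≤ε : 0ℚ ℚ.≤ ε) (ε≤ : ε ℚ.≤ + 1 / 10) (2≤w : + 2 / 1 ℚ.≤ w ℚ.+ ε) (w≤ : w ℚ.≤ + 12 / 5)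
  (≤a : + 3 / 10 ℚ.≤ a) (a≤ : a ℚ.≤ ½ ℚ.+ ε) (≤t : + 1 / 18 ℚ.+ ε ℚ.≤ t)
  (t≤ : t ℚ.* (+ 36 / 1 ℚ.- + 6 / 1 ℚ.* (+ 1 / 1 ℚ.+ w) ℚ.* (+ 1 / 1 ℚ.+ a)) ℚ.≤ (+ 3 / 1 ℚ.- w) ℚ.* (+ 1 / 1 ℚ.- a) ℚ.+ ε) where

  private
    A B C E S G F den prod : ℚ
    A = w ℚ.+ ε ℚ.- + 2 / 1
    B = + 12 / 5 ℚ.- w
    C = a ℚ.- + 3 / 10
    E = ½ ℚ.+ ε ℚ.- a
    S = t ℚ.- (+ 1 / 18 ℚ.+ ε)
    F = + 1 / 10 ℚ.- ε
    den = + 36 / 1 ℚ.- + 6 / 1 ℚ.* (+ 1 / 1 ℚ.+ w) ℚ.* (+ 1 / 1 ℚ.+ a)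
    G = (+ 3 / 1 ℚ.- w) ℚ.* (+ 1 / 1 ℚ.- a) ℚ.+ ε ℚ.- t ℚ.* den
    prod = (w ℚ.- + 2 / 1) ℚ.* (+ 1 / 1 ℚ.- + 2 / 1 ℚ.* a) ℚ.+ + 7 / 5 ℚ.* ε

    -- The factors w - 2 and 1 - 2a are nonnegative only up to multiples of ε. The summand (7/5) ε
    -- of `prod` pays for the mixed terms, whose signs follow from the bounds on w, a and ε.
    prod-≡ : ∀ w a ε → (w ℚ.+ ε ℚ.- + 2 / 1) ℚ.* (+ 2 / 1 ℚ.* (½ ℚ.+ ε ℚ.- a)) ℚ.+ (+ 2 / 1 ℚ.* (ε ℚ.* (+ 12 / 5 ℚ.- w))
      ℚ.+ (+ 2 / 1 ℚ.* (ε ℚ.* (a ℚ.- + 3 / 10)) ℚ.+ + 2 / 1 ℚ.* (ε ℚ.* (+ 1 / 10 ℚ.- ε))))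
      ≡ (w ℚ.- + 2 / 1) ℚ.* (+ 1 / 1 ℚ.- + 2 / 1 ℚ.* a) ℚ.+ + 7 / 5 ℚ.* ε
    prod-≡ = solve-∀ ℚ-ring

    two : 0ℚ ℚ.≤ + 2 / 1
    two = constant-≥0 (+ 2 / 1)

    A≥0 = difference-≥0 2≤w
    B≥0 = difference-≥0 w≤
    C≥0 = difference-≥0 ≤a
    E≥0 = difference-≥0 a≤
    S≥0 = difference-≥0 ≤t
    F≥0 = difference-≥0 ε≤
    G≥0 = difference-≥0 t≤

    prod-≥0 : 0ℚ ℚ.≤ prod
    prod-≥0 = subst (0ℚ ℚ.≤_) (prod-≡ w a ε) (+-≥0 (*-≥0 A≥0 (*-≥0 two E≥0)) (+-≥0 (*-≥0 two (*-≥0 0≤ε B≥0))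
      (+-≥0 (*-≥0 two (*-≥0 0≤ε C≥0)) (*-≥0 two (*-≥0 0≤ε F≥0)))))

    -- The denominator is smallest at w = 12/5, a = 1/2, where it is 27/5; the weaker bound 3 leaves
    -- room for the errors.
    den-≡ : ∀ w a ε → + 18 / 1 ℚ.* (½ ℚ.+ ε ℚ.- a) ℚ.+ (+ 9 / 1 ℚ.* (+ 12 / 5 ℚ.- w)
      ℚ.+ (+ 3 / 1 ℚ.* ((w ℚ.- + 2 / 1) ℚ.* (+ 1 / 1 ℚ.- + 2 / 1 ℚ.* a) ℚ.+ + 7 / 5 ℚ.* ε)
      ℚ.+ (+ 111 / 5 ℚ.* (+ 1 / 10 ℚ.- ε) ℚ.+ + 9 / 50)))
      ≡ + 36 / 1 ℚ.- + 6 / 1 ℚ.* (+ 1 / 1 ℚ.+ w) ℚ.* (+ 1 / 1 ℚ.+ a) ℚ.- + 3 / 1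
    den-≡ = solve-∀ ℚ-ring

    den-≥3 : 0ℚ ℚ.≤ den ℚ.- + 3 / 1
    den-≥3 = subst (0ℚ ℚ.≤_) (den-≡ w a ε) (+-≥0 (*-≥0 (constant-≥0 (+ 18 / 1)) E≥0) (+-≥0 (*-≥0 (constant-≥0 (+ 9 / 1)) B≥0)
      (+-≥0 (*-≥0 (constant-≥0 (+ 3 / 1)) prod-≥0) (+-≥0 (*-≥0 (constant-≥0 (+ 111 / 5)) F≥0) (constant-≥0 (+ 9 / 50))))))

    final-≡ : ∀ t w a ε d → ((+ 3 / 1 ℚ.- w) ℚ.* (+ 1 / 1 ℚ.- a) ℚ.+ ε ℚ.- t ℚ.* d)
      ℚ.+ ((t ℚ.- (+ 1 / 18 ℚ.+ ε)) ℚ.* (d ℚ.- + 3 / 1) ℚ.+ (+ 3 / 1 ℚ.* (t ℚ.- (+ 1 / 18 ℚ.+ ε))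
      ℚ.+ (ε ℚ.* (d ℚ.- + 3 / 1) ℚ.+ + 2 / 3 ℚ.* ((w ℚ.- + 2 / 1) ℚ.* (+ 1 / 1 ℚ.- + 2 / 1 ℚ.* a) ℚ.+ + 7 / 5 ℚ.* ε))))
      ≡ (+ 3 / 1 ℚ.- w) ℚ.* (+ 1 / 1 ℚ.- a) ℚ.+ + 2 / 3 ℚ.* ((w ℚ.- + 2 / 1) ℚ.* (+ 1 / 1 ℚ.- + 2 / 1 ℚ.* a))
        ℚ.- + 1 / 18 ℚ.* d ℚ.- + 16 / 15 ℚ.* ε
    final-≡ = solve-∀ ℚ-ring

    cancel-≡ : ∀ w a ε → (+ 3 / 1 ℚ.- w) ℚ.* (+ 1 / 1 ℚ.- a) ℚ.+ + 2 / 3 ℚ.* ((w ℚ.- + 2 / 1) ℚ.* (+ 1 / 1 ℚ.- + 2 / 1 ℚ.* a))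
        ℚ.- + 1 / 18 ℚ.* (+ 36 / 1 ℚ.- + 6 / 1 ℚ.* (+ 1 / 1 ℚ.+ w) ℚ.* (+ 1 / 1 ℚ.+ a)) ℚ.- + 16 / 15 ℚ.* ε
      ≡ + 16 / 15 ℚ.* (0ℚ ℚ.- ε)
    cancel-≡ = solve-∀ ℚ-ring

  ε≤0 : ε ℚ.≤ 0ℚ
  ε≤0 = ≥0-difference (ℚₚ.*-cancelˡ-≤-pos (+ 16 / 15) (subst (ℚ._≤ + 16 / 15 ℚ.* (0ℚ ℚ.- ε)) (sym (ℚₚ.*-zeroʳ (+ 16 / 15)))
    (subst (0ℚ ℚ.≤_) (trans (final-≡ t w a ε den) (cancel-≡ w a ε))
      (+-≥0 G≥0 (+-≥0 (*-≥0 S≥0 den-≥3) (+-≥0 (*-≥0 (constant-≥0 (+ 3 / 1)) S≥0)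
        (+-≥0 (*-≥0 0≤ε den-≥3) (*-≥0 (constant-≥0 (+ 2 / 3)) prod-≥0))))))))

toℚᵘ-fraction : ∀ m k → ℚ.toℚᵘ (+ m / suc k) ℚᵘ.≃ ℚᵘ.mkℚᵘ (+ m) k
toℚᵘ-fraction m k = ℚₚ.toℚᵘ-fromℚᵘ (ℚᵘ.mkℚᵘ (+ m) k)

fraction-≤⁺ : ∀ {m k m′ l} → m * suc l ≤ m′ * suc k → + m / suc k ℚ.≤ + m′ / suc l
fraction-≤⁺ {m} {k} {m′} {l} h = ℚₚ.toℚᵘ-cancel-≤ (ℚᵘₚ.≤-respˡ-≃ (ℚᵘₚ.≃-sym (toℚᵘ-fraction m k))
  (ℚᵘₚ.≤-respʳ-≃ (ℚᵘₚ.≃-sym (toℚᵘ-fraction m′ l)) (ℚᵘ.*≤* (subst₂ ℤ._≤_ (ℤₚ.pos-* m (suc l)) (ℤₚ.pos-* m′ (suc k)) (ℤ.+≤+ h)))))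

fraction-≤⁻ : ∀ {m k m′ l} → + m / suc k ℚ.≤ + m′ / suc l → m * suc l ≤ m′ * suc k
fraction-≤⁻ {m} {k} {m′} {l} h = ℤₚ.drop‿+≤+ (subst₂ ℤ._≤_ (sym (ℤₚ.pos-* m (suc l))) (sym (ℤₚ.pos-* m′ (suc k)))
  (ℚᵘₚ.drop-*≤* (ℚᵘₚ.≤-respˡ-≃ (toℚᵘ-fraction m k) (ℚᵘₚ.≤-respʳ-≃ (toℚᵘ-fraction m′ l) (ℚₚ.toℚᵘ-mono-≤ h)))))

fraction-* : ∀ m k m′ l → (+ m / suc k) ℚ.* (+ m′ / suc l) ≡ + (m * m′) / suc (l + k * suc l)
fraction-* m k m′ l = ℚₚ.toℚᵘ-injective (ℚᵘₚ.≃-trans (ℚₚ.toℚᵘ-homo-* (+ m / suc k) (+ m′ / suc l))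
  (ℚᵘₚ.≃-trans (ℚᵘₚ.*-cong (toℚᵘ-fraction m k) (toℚᵘ-fraction m′ l))
  (ℚᵘₚ.≃-trans (ℚᵘ.*≡* (cong (ℤ._* + suc (l + k * suc l)) (sym (ℤₚ.pos-* m m′)))) (ℚᵘₚ.≃-sym (toℚᵘ-fraction (m * m′) (l + k * suc l))))))

fraction-+ : ∀ m k m′ l → (+ m / suc k) ℚ.+ (+ m′ / suc l) ≡ + (m * suc l + m′ * suc k) / suc (l + k * suc l)
fraction-+ m k m′ l = ℚₚ.toℚᵘ-injective (ℚᵘₚ.≃-trans (ℚₚ.toℚᵘ-homo-+ (+ m / suc k) (+ m′ / suc l))
  (ℚᵘₚ.≃-trans (ℚᵘₚ.+-cong (toℚᵘ-fraction m k) (toℚᵘ-fraction m′ l))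
  (ℚᵘₚ.≃-trans (ℚᵘ.*≡* (cong (ℤ._* + suc (l + k * suc l)) (sym (trans (ℤₚ.pos-+ (m * suc l) (m′ * suc k))
      (cong₂ ℤ._+_ (ℤₚ.pos-* m (suc l)) (ℤₚ.pos-* m′ (suc k)))))))
    (ℚᵘₚ.≃-sym (toℚᵘ-fraction (m * suc l + m′ * suc k) (l + k * suc l))))))

fraction-cong : ∀ {m k m′ l} → m * suc l ≡ m′ * suc k → + m / suc k ≡ + m′ / suc l
fraction-cong {m} {k} {m′} {l} eq =
  ℚₚ.≤-antisym (fraction-≤⁺ {m} {k} {m′} {l} (ℕₚ.≤-reflexive eq)) (fraction-≤⁺ {m′} {l} {m} {k} (ℕₚ.≤-reflexive (sym eq)))

fromℕ-fraction : ∀ m j → seq (fromℕ m) j ≡ + m / 1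
fromℕ-fraction m j = sym (ℚₚ.fromℚᵘ-toℚᵘ (seq (fromℕ m) j))

fraction-≥0 : ∀ m k → 0ℚ ℚ.≤ + m / suc k
fraction-≥0 m k = ℚₚ.nonNegative⁻¹ (+ m / suc k) {{ℚₚ.normalize-nonNeg m (suc k)}}

fraction-lower : ∀ a b q → + a / suc b ℚ.≤ q → a * ↧ₙ q + neg q * suc b ≤ pos q * suc b
fraction-lower a b q@(mkℚ _ _ _) h = ℤₚ.drop‿+≤+ (begin
  + (a * ↧ₙ q + neg q * suc b)                  ≡⟨ trans (ℤₚ.pos-+ (a * ↧ₙ q) (neg q * suc b)) (cong₂ ℤ._+_ (ℤₚ.pos-* a (↧ₙ q)) (ℤₚ.pos-* (neg q) (suc b))) ⟩
  + a ℤ.* + ↧ₙ q ℤ.+ + neg q ℤ.* + suc b        ≤⟨ ℤₚ.+-monoˡ-≤ (+ neg q ℤ.* + suc b) (ℚᵘₚ.drop-*≤* (ℚᵘₚ.≤-respˡ-≃ (toℚᵘ-fraction a b) (ℚₚ.toℚᵘ-mono-≤ h))) ⟩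
  ↥ q ℤ.* + suc b ℤ.+ + neg q ℤ.* + suc b       ≡⟨ ℤₚ.*-distribʳ-+ (+ suc b) (↥ q) (+ neg q) ⟨
  (↥ q ℤ.+ + neg q) ℤ.* + suc b                 ≡⟨ cong (ℤ._* + suc b) (sym (floorPow-lemmas.pos-neg q)) ⟩
  + pos q ℤ.* + suc b                           ≡⟨ ℤₚ.pos-* (pos q) (suc b) ⟨
  + (pos q * suc b)                             ∎)
  where open ℤₚ.≤-Reasoning

fraction-upper : ∀ a b q → q ℚ.≤ + a / suc b → pos q * suc b ≤ a * ↧ₙ q + neg q * suc b
fraction-upper a b q@(mkℚ _ _ _) h = ℤₚ.drop‿+≤+ (begin
  + (pos q * suc b)                             ≡⟨ ℤₚ.pos-* (pos q) (suc b) ⟩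
  + pos q ℤ.* + suc b                           ≡⟨ cong (ℤ._* + suc b) (floorPow-lemmas.pos-neg q) ⟩
  (↥ q ℤ.+ + neg q) ℤ.* + suc b                 ≡⟨ ℤₚ.*-distribʳ-+ (+ suc b) (↥ q) (+ neg q) ⟩
  ↥ q ℤ.* + suc b ℤ.+ + neg q ℤ.* + suc b       ≤⟨ ℤₚ.+-monoˡ-≤ (+ neg q ℤ.* + suc b) (ℚᵘₚ.drop-*≤* (ℚᵘₚ.≤-respʳ-≃ (toℚᵘ-fraction a b) (ℚₚ.toℚᵘ-mono-≤ h))) ⟩
  + a ℤ.* + ↧ₙ q ℤ.+ + neg q ℤ.* + suc b        ≡⟨ trans (ℤₚ.pos-+ (a * ↧ₙ q) (neg q * suc b)) (cong₂ ℤ._+_ (ℤₚ.pos-* a (↧ₙ q)) (ℤₚ.pos-* (neg q) (suc b))) ⟨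
  + (a * ↧ₙ q + neg q * suc b)                  ∎)
  where open ℤₚ.≤-Reasoning

power-mul : ∀ x e a f y → (x ^ e * y ^ a) ^ f ≡ x ^ (e * f) * y ^ (a * f)
power-mul x e a f y = trans (floorPow-lemmas.^-distribʳ-* (x ^ e) (y ^ a) f) (cong₂ _*_ (ℕₚ.^-*-assoc x e f) (ℕₚ.^-*-assoc y a f))

power-swap : ∀ x e f → x ^ (e * f) ≡ (x ^ f) ^ e
power-swap x e f = trans (cong (x ^_) (ℕₚ.*-comm e f)) (sym (ℕₚ.^-*-assoc x f e))

-- Maximality of the floor speaks about its successor. Both sides are raised to powers that clear
-- the denominators of the exponents, and the factor n^(neg q), which stands for a negative
-- exponent, is cancelled.
floorPow-above : ∀ n .{{_ : NonZero n}} a b q K → + a / suc b ℚ.≤ q → K ^ suc b * n ^ a ≤ suc (floorPow n q K) ^ suc b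
floorPow-above n a b q K h = floorPow-lemmas.^-cancel-≤ _ _ d (subst₂ _≤_
    (trans (cong₂ _*_ (trans (power-swap K d (suc b)) refl) (sym (ℕₚ.^-*-assoc n a d))) (sym (floorPow-lemmas.^-distribʳ-* (K ^ suc b) (n ^ a) d)))
    (power-swap F d (suc b))
    (ℕₚ.*-cancelʳ-≤ _ _ (n ^ (neg q * suc b)) {{ℕₚ.m^n≢0 n (neg q * suc b)}} (begin
      K ^ (d * suc b) * n ^ (a * d) * n ^ (neg q * suc b)     ≡⟨ ℕₚ.*-assoc (K ^ (d * suc b)) _ _ ⟩
      K ^ (d * suc b) * (n ^ (a * d) * n ^ (neg q * suc b))   ≡⟨ cong (K ^ (d * suc b) *_) (ℕₚ.^-distribˡ-+-* n (a * d) (neg q * suc b)) ⟨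
      K ^ (d * suc b) * n ^ (a * d + neg q * suc b)           ≤⟨ ℕₚ.*-monoʳ-≤ (K ^ (d * suc b)) (ℕₚ.^-monoʳ-≤ n (fraction-lower a b q h)) ⟩
      K ^ (d * suc b) * n ^ (pos q * suc b)                   ≡⟨ power-mul K d (pos q) (suc b) n ⟨
      (K ^ d * n ^ pos q) ^ suc b                             ≤⟨ ℕₚ.^-monoˡ-≤ (suc b) (ℕₚ.<⇒≤ (ℕₚ.≰⇒> (floorPow-lemmas.floorPow-maximal n q K))) ⟩
      (F ^ d * n ^ neg q) ^ suc b                             ≡⟨ power-mul F d (neg q) (suc b) n ⟩
      F ^ (d * suc b) * n ^ (neg q * suc b)                   ∎)))
  where
  open ℕₚ.≤-Reasoning
  d = ↧ₙ q
  F = suc (floorPow n q K)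

floorPow-below : ∀ n .{{_ : NonZero n}} a b q K → q ℚ.≤ + a / suc b → floorPow n q K ^ suc b ≤ K ^ suc b * n ^ a
floorPow-below n a b q K h = floorPow-lemmas.^-cancel-≤ _ _ d (subst₂ _≤_
    (power-swap F d (suc b))
    (trans (cong₂ _*_ (power-swap K d (suc b)) (sym (ℕₚ.^-*-assoc n a d))) (sym (floorPow-lemmas.^-distribʳ-* (K ^ suc b) (n ^ a) d)))
    (ℕₚ.*-cancelʳ-≤ _ _ (n ^ (neg q * suc b)) {{ℕₚ.m^n≢0 n (neg q * suc b)}} (begin
      F ^ (d * suc b) * n ^ (neg q * suc b)                   ≡⟨ power-mul F d (neg q) (suc b) n ⟨
      (F ^ d * n ^ neg q) ^ suc b                             ≤⟨ ℕₚ.^-monoˡ-≤ (suc b) (floorPow-lemmas.floorPow-fits n q K) ⟩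
      (K ^ d * n ^ pos q) ^ suc b                             ≡⟨ power-mul K d (pos q) (suc b) n ⟩
      K ^ (d * suc b) * n ^ (pos q * suc b)                   ≤⟨ ℕₚ.*-monoʳ-≤ (K ^ (d * suc b)) (ℕₚ.^-monoʳ-≤ n (fraction-upper a b q h)) ⟩
      K ^ (d * suc b) * n ^ (a * d + neg q * suc b)           ≡⟨ cong (K ^ (d * suc b) *_) (ℕₚ.^-distribˡ-+-* n (a * d) (neg q * suc b)) ⟩
      K ^ (d * suc b) * (n ^ (a * d) * n ^ (neg q * suc b))   ≡⟨ ℕₚ.*-assoc (K ^ (d * suc b)) _ _ ⟨
      K ^ (d * suc b) * n ^ (a * d) * n ^ (neg q * suc b)     ∎)))
  where
  open ℕₚ.≤-Reasoning
  d = ↧ₙ q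
  F = floorPow n q K

-- t ≤ 2 C n^x, read off the approximations of n^x.
powerClock : ℝ → Clock
powerClock x = record
  { Time = λ n C t → ∃[ J ] ∀ j → J ≤ j → suc j * t ≤ C * (f n j + f n j)
  ; time-zero = λ n → 0 , λ j _ → ℕₚ.≤-reflexive (ℕₚ.*-zeroʳ (suc j))
  ; time-+ = λ { n {C} {C′} {t} {t′} (J , h) (J′ , h′) → J ℕ.⊔ J′ , λ j J≤ →
      subst₂ _≤_ (sym (ℕₚ.*-distribˡ-+ (suc j) t t′)) (sym (ℕₚ.*-distribʳ-+ (f n j + f n j) C C′))
        (ℕₚ.+-mono-≤ (h j (ℕₚ.m⊔n≤o⇒m≤o J J′ J≤)) (h′ j (ℕₚ.m⊔n≤o⇒n≤o J J′ J≤))) }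
  ; time-* = λ { n c {C} {t} (J , h) → J , λ j J≤ → subst₂ _≤_ (comm c (suc j) t) (sym (ℕₚ.*-assoc c C _)) (ℕₚ.*-monoʳ-≤ c (h j J≤)) }
  ; time-≤ = λ { n t≤ (J , h) → J , λ j J≤ → ℕₚ.≤-trans (ℕₚ.*-monoʳ-≤ (suc j) t≤) (h j J≤) } }
  where
  f : ∀ n → .{{NonZero n}} → ℕ → ℕ
  f n j = floorPow n (seq x j) (suc j)
  comm : ∀ c k t → c * (k * t) ≡ k * (c * t)
  comm = ℕ-solve-∀

-- With F the floor of K n^q for K = j + 1, the available inequality is K t ≤ C (F + 1). From index
-- `suc J` on j ≥ 1, so K ≥ 2 and F ≥ 1, and F + 1 is at most F + F; this is why `powerClock`
-- measures against twice the power.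
power-time : ∀ x a b → (∃[ J ] ∀ j → J ≤ j → + a / suc b ℚ.≤ seq x j) → ∀ n .{{_ : NonZero n}} C t →
  t ^ suc b ≤ C ^ suc b * n ^ a → Clock.Time (powerClock x) n C t
power-time x a b (J , h) n C t t≤ = suc J , λ j J<j → bound j (h j (ℕₚ.<⇒≤ J<j)) (ℕₚ.≤-trans (s≤s z≤n) J<j)
  where
  bound : ∀ j → + a / suc b ℚ.≤ seq x j → 1 ≤ j → suc j * t ≤ C * (floorPow n (seq x j) (suc j) + floorPow n (seq x j) (suc j))
  bound j le 1≤j = ℕₚ.≤-trans (floorPow-lemmas.^-cancel-≤ (K * t) (C * suc F) (suc b) (begin
      (K * t) ^ suc b                        ≡⟨ floorPow-lemmas.^-distribʳ-* K t (suc b) ⟩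
      K ^ suc b * t ^ suc b                  ≤⟨ ℕₚ.*-monoʳ-≤ (K ^ suc b) t≤ ⟩
      K ^ suc b * (C ^ suc b * n ^ a)        ≡⟨ eq (K ^ suc b) (C ^ suc b) (n ^ a) ⟩
      C ^ suc b * (K ^ suc b * n ^ a)        ≤⟨ ℕₚ.*-monoʳ-≤ (C ^ suc b) above ⟩
      C ^ suc b * suc F ^ suc b              ≡⟨ floorPow-lemmas.^-distribʳ-* C (suc F) (suc b) ⟨
      (C * suc F) ^ suc b                    ∎))
    (ℕₚ.*-monoʳ-≤ C (ℕₚ.+-monoˡ-≤ F 1≤F))
    where
    open ℕₚ.≤-Reasoning
    K = suc j
    F = floorPow n (seq x j) K
    eq : ∀ k c m → k * (c * m) ≡ c * (k * m)
    eq = ℕ-solve-∀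
    above : K ^ suc b * n ^ a ≤ suc F ^ suc b
    above = floorPow-above n a b (seq x j) K le
    1≤F : 1 ≤ F
    1≤F = ℕₚ.≤-pred (ℕₚ.≤-trans (s≤s 1≤j) (floorPow-lemmas.^-cancel-≤ K (suc F) (suc b)
      (ℕₚ.≤-trans (ℕₚ.m≤m*n (K ^ suc b) (n ^ a) {{ℕₚ.m^n≢0 n a}}) above)))

p≤p+q : ∀ p {q} → 0ℚ ℚ.≤ q → p ℚ.≤ p ℚ.+ q
p≤p+q p {q} h = subst (ℚ._≤ p ℚ.+ q) (ℚₚ.+-identityʳ p) (ℚₚ.+-monoʳ-≤ p h)

scaled-sum-≥ : ∀ t C F G j ε → suc j * t ≤ C * (F + F) → 0ℚ ℚ.≤ ε →
  seq (fromℕ t) j ℚ.≤ seq (fromℕ (C + C)) j ℚ.* (+ F / suc j ℚ.+ + G / suc j) ℚ.+ ε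
scaled-sum-≥ t C F G j ε h 0≤ε = begin
  seq (fromℕ t) j                                              ≡⟨ fromℕ-fraction t j ⟩
  + t / 1                                                      ≤⟨ fraction-≤⁺ {t} {0} {(C + C) * F} {j + 0} bound ⟩
  + ((C + C) * F) / suc (j + 0)                                ≡⟨ fraction-* (C + C) 0 F j ⟨
  (+ (C + C) / 1) ℚ.* (+ F / suc j)                            ≤⟨ ℚₚ.*-monoˡ-≤-nonNeg (+ (C + C) / 1) {{ℚₚ.normalize-nonNeg (C + C) 1}} (p≤p+q (+ F / suc j) (fraction-≥0 G j)) ⟩
  (+ (C + C) / 1) ℚ.* (+ F / suc j ℚ.+ + G / suc j)            ≤⟨ p≤p+q ((+ (C + C) / 1) ℚ.* (+ F / suc j ℚ.+ + G / suc j)) 0≤ε ⟩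
  (+ (C + C) / 1) ℚ.* (+ F / suc j ℚ.+ + G / suc j) ℚ.+ ε      ≡⟨ cong (λ c → c ℚ.* (+ F / suc j ℚ.+ + G / suc j) ℚ.+ ε) (fromℕ-fraction (C + C) j) ⟨
  seq (fromℕ (C + C)) j ℚ.* (+ F / suc j ℚ.+ + G / suc j) ℚ.+ ε ∎
  where
  open ℚₚ.≤-Reasoning
  eq : ∀ C F → C * (F + F) ≡ (C + C) * F * 1
  eq = ℕ-solve-∀
  bound : t * suc (j + 0) ≤ (C + C) * F * 1
  bound = ℕₚ.≤-trans (ℕₚ.≤-reflexive (trans (cong (λ z → t * suc z) (ℕₚ.+-identityʳ j)) (ℕₚ.*-comm t (suc j))))
    (ℕₚ.≤-trans h (ℕₚ.≤-reflexive (eq C F)))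

time-real : ∀ x y n .{{_ : NonZero n}} C t → Clock.Time (powerClock x) n C t → ∀ ε → 0ℚ ℚ.< ε → ∃[ J ] ∀ j → J ≤ j →
  seq (fromℕ t) j ℚ.≤ seq (fromℕ (C + C)) j ℚ.* (+ floorPow n (seq x j) (suc j) / suc j ℚ.+ + floorPow n (seq y j) (suc j) / suc j) ℚ.+ ε
time-real x y n C t (J , h) ε 0<ε = J , λ j J≤j →
  scaled-sum-≥ t C (floorPow n (seq x j) (suc j)) (floorPow n (seq y j) (suc j)) j ε (h j J≤j) (ℚₚ.<⇒≤ 0<ε)

scaled-product-≤ : ∀ t C F M j → seq (fromℕ (suc t)) j ℚ.≤ seq (fromℕ C) j ℚ.* (+ F / suc j ℚ.* seq (fromℕ M) j) ℚ.+ 1ℚ →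
  suc j * t ≤ C * (F * M)
scaled-product-≤ t C F M j h = ℕₚ.+-cancelʳ-≤ (suc j) (suc j * t) _ (subst₂ _≤_ (lhs t j) (rhs (C * (F * M)) j)
    (fraction-≤⁻ {suc t} {0} {C * (F * M) * 1 + 1 * suc (j * 1 + 0)} {0 + (j * 1 + 0) * 1} at-j))
  where
  lhs : ∀ t j → suc t * suc (0 + (j * 1 + 0) * 1) ≡ suc j * t + suc j
  lhs = ℕ-solve-∀
  rhs : ∀ c j → (c * 1 + 1 * suc (j * 1 + 0)) * 1 ≡ c + suc j
  rhs = ℕ-solve-∀
  at-j : + suc t / 1 ℚ.≤ + (C * (F * M) * 1 + 1 * suc (j * 1 + 0)) / suc (0 + (j * 1 + 0) * 1)
  at-j = begin
    + suc t / 1                                                         ≡⟨ fromℕ-fraction (suc t) j ⟨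
    seq (fromℕ (suc t)) j                                               ≤⟨ h ⟩
    seq (fromℕ C) j ℚ.* (+ F / suc j ℚ.* seq (fromℕ M) j) ℚ.+ 1ℚ        ≡⟨ cong₂ (λ c m → c ℚ.* (+ F / suc j ℚ.* m) ℚ.+ 1ℚ) (fromℕ-fraction C j) (fromℕ-fraction M j) ⟩
    (+ C / 1) ℚ.* (+ F / suc j ℚ.* (+ M / 1)) ℚ.+ 1ℚ                    ≡⟨ cong (λ z → (+ C / 1) ℚ.* z ℚ.+ 1ℚ) (fraction-* F j M 0) ⟩
    (+ C / 1) ℚ.* (+ (F * M) / suc (j * 1)) ℚ.+ 1ℚ                      ≡⟨ cong (ℚ._+ 1ℚ) (fraction-* C 0 (F * M) (j * 1)) ⟩
    + (C * (F * M)) / suc (j * 1 + 0) ℚ.+ 1ℚ                            ≡⟨ fraction-+ (C * (F * M)) (j * 1 + 0) 1 0 ⟩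
    + (C * (F * M) * 1 + 1 * suc (j * 1 + 0)) / suc (0 + (j * 1 + 0) * 1) ∎
    where open ℚₚ.≤-Reasoning

-- The real inequality is used at a single index and with tolerance 1. This costs one step, hence
-- `pred t`.
product-time : ∀ x C N M t .{{_ : NonZero N}} a b → (∀ ε → 0ℚ ℚ.< ε → ∃[ J ] ∀ j → J ≤ j →
    seq (fromℕ t) j ℚ.≤ seq (fromℕ C) j ℚ.* (+ floorPow N (seq x j) (suc j) / suc j ℚ.* seq (fromℕ M) j) ℚ.+ ε) →
  (∃[ J ] ∀ j → J ≤ j → seq x j ℚ.≤ + a / suc b) → ℕ.pred t ^ suc b ≤ C ^ suc b * (N ^ a * M ^ suc b)
product-time x C N M zero    a b _        _       = z≤n
product-time x C N M (suc t) a b le (J , h) = ℕₚ.*-cancelˡ-≤ (K ^ suc b) {{ℕₚ.m^n≢0 K (suc b)}} (begin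
    K ^ suc b * t ^ suc b                              ≡⟨ floorPow-lemmas.^-distribʳ-* K t (suc b) ⟨
    (K * t) ^ suc b                                    ≤⟨ ℕₚ.^-monoˡ-≤ (suc b) Kt≤ ⟩
    (C * (F * M)) ^ suc b                              ≡⟨ trans (floorPow-lemmas.^-distribʳ-* C (F * M) (suc b)) (cong (C ^ suc b *_) (floorPow-lemmas.^-distribʳ-* F M (suc b))) ⟩
    C ^ suc b * (F ^ suc b * M ^ suc b)                ≤⟨ ℕₚ.*-monoʳ-≤ (C ^ suc b) (ℕₚ.*-monoˡ-≤ (M ^ suc b) (floorPow-below N a b (seq x j) K (h j (ℕₚ.m≤m⊔n J (proj₁ near))))) ⟩
    C ^ suc b * (K ^ suc b * N ^ a * M ^ suc b)        ≡⟨ eq (C ^ suc b) (K ^ suc b) (N ^ a) (M ^ suc b) ⟩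
    K ^ suc b * (C ^ suc b * (N ^ a * M ^ suc b))      ∎)
  where
  open ℕₚ.≤-Reasoning
  near = le 1ℚ (ℚₚ.positive⁻¹ 1ℚ)
  j K F : ℕ
  j = J ℕ.⊔ proj₁ near
  K = suc j
  F = floorPow N (seq x j) K
  eq : ∀ c k n m → c * (k * n * m) ≡ k * (c * (n * m))
  eq = ℕ-solve-∀
  Kt≤ : K * t ≤ C * (F * M)
  Kt≤ = scaled-product-≤ t C F M j (proj₂ near j (ℕₚ.m≤n⊔m J (proj₁ near)))

near-≤ : ∀ p q {ε} → ℚ.∣ p ℚ.- q ∣ ℚ.≤ ε → p ℚ.≤ q ℚ.+ ε
near-≤ p q = floorPow-lemmas.∣-∣≤⇒≤+ {p} {q}

ℚ-<⇒≱ : ∀ {p q} → p ℚ.< q → ¬ (q ℚ.≤ p)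
ℚ-<⇒≱ p<q q≤p = ℚₚ.<-irrefl refl (ℚₚ.<-≤-trans p<q q≤p)

≤ʳ-total : ∀ x y → ¬ (x ≤ʳ y) → ¬ (y ≤ʳ x) → ⊥
≤ʳ-total x y x≰y y≰x = y≰x (*≤* λ ε 0<ε →
  let e = ½ ℚ.* (½ ℚ.* ε)
      0<e = ℝ-lemmas.half-pos (ℝ-lemmas.half-pos 0<ε)
      (Nx , hx) = cauchy x e 0<e
      (Ny , hy) = cauchy y e 0<e
      N = Nx ℕ.⊔ Ny
      x-near = λ i j N≤i N≤j → near-≤ (seq x i) (seq x j) (hx i j (ℕₚ.m⊔n≤o⇒m≤o Nx Ny N≤i) (ℕₚ.m⊔n≤o⇒m≤o Nx Ny N≤j))
      y-near = λ i j N≤i N≤j → near-≤ (seq y i) (seq y j) (hy i j (ℕₚ.m⊔n≤o⇒n≤o Nx Ny N≤i) (ℕₚ.m⊔n≤o⇒n≤o Nx Ny N≤j))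
  in case seq y N ℚ.≤? seq x N ℚ.+ ½ ℚ.* ε of λ
     { (yes yN≤) → N , λ j N≤j → ≥0-difference (subst (0ℚ ℚ.≤_) (eq₁ (seq y j) (seq y N) (seq x N) (seq x j) ε)
         (+-≥0 (difference-≥0 (y-near j N N≤j ℕₚ.≤-refl)) (+-≥0 (difference-≥0 yN≤) (difference-≥0 (x-near N j ℕₚ.≤-refl N≤j)))))
     ; (no yN≰) → contradiction (*≤* λ ε′ 0<ε′ → N , λ j N≤j → ≥0-difference (subst (0ℚ ℚ.≤_) (eq₂ (seq y j) (seq y N) (seq x N) (seq x j) ε ε′)
         (+-≥0 (difference-≥0 (x-near j N N≤j ℕₚ.≤-refl)) (+-≥0 (difference-≥0 (ℚₚ.<⇒≤ (ℚₚ.≰⇒> yN≰)))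
           (+-≥0 (difference-≥0 (y-near N j ℕₚ.≤-refl N≤j)) (ℚₚ.<⇒≤ 0<ε′)))))) x≰y })
  where
  eq₁ : ∀ yj yN xN xj ε → (yN ℚ.+ ½ ℚ.* (½ ℚ.* ε) ℚ.- yj) ℚ.+ ((xN ℚ.+ ½ ℚ.* ε ℚ.- yN) ℚ.+ (xj ℚ.+ ½ ℚ.* (½ ℚ.* ε) ℚ.- xN)) ≡ xj ℚ.+ ε ℚ.- yj
  eq₁ = solve-∀ ℚ-ring
  eq₂ : ∀ yj yN xN xj ε ε′ → (xN ℚ.+ ½ ℚ.* (½ ℚ.* ε) ℚ.- xj) ℚ.+ ((yN ℚ.- (xN ℚ.+ ½ ℚ.* ε)) ℚ.+ ((yj ℚ.+ ½ ℚ.* (½ ℚ.* ε) ℚ.- yN) ℚ.+ ε′)) ≡ yj ℚ.+ ε′ ℚ.- xj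
  eq₂ = solve-∀ ℚ-ring

quotient-≤ : ∀ m c a b j x .{{_ : NonZero m}} → c * suc b ≤ m * a → seq (fromℕ m) j ℚ.* x ℚ.≤ seq (fromℕ c) j → x ℚ.≤ + a / suc b
quotient-≤ m c a b j x h le = ℚₚ.*-cancelˡ-≤-pos (+ m / 1) {{ℚₚ.normalize-pos m 1}} (begin
  (+ m / 1) ℚ.* x                  ≡⟨ cong (ℚ._* x) (fromℕ-fraction m j) ⟨
  seq (fromℕ m) j ℚ.* x            ≤⟨ le ⟩
  seq (fromℕ c) j                  ≡⟨ fromℕ-fraction c j ⟩
  + c / 1                          ≤⟨ fraction-≤⁺ {c} {0} {m * a} {b + 0} (ℕₚ.≤-trans (ℕₚ.≤-trans (ℕₚ.≤-reflexive (cong (λ z → c * suc z) (ℕₚ.+-identityʳ b))) h) (ℕₚ.≤-reflexive (sym (ℕₚ.*-identityʳ (m * a))))) ⟩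
  + (m * a) / suc (b + 0)          ≡⟨ fraction-* m 0 a b ⟨
  (+ m / 1) ℚ.* (+ a / suc b)      ∎)
  where open ℚₚ.≤-Reasoning

module Exponents (ω α τ : ℝ) (mm : MatrixMultiplicationExponents ω α) (isTau : IsTau ω α τ) where

  open MatrixMultiplicationExponents mm
  open IsTau isTau

  ω-upper : ∃[ J ] ∀ j → J ≤ j → seq ω j ℚ.≤ + 12 / 5
  ω-upper = index , λ j J≤j → quotient-≤ 10000000 23728639 12 4 j (seq ω j) (ℕₚ.≤ᵇ⇒≤ _ _ _)
      (ℚₚ.≤-trans (p≤p+q (seq (fromℕ 10000000) j ℚ.* seq ω j) (ℚₚ.<⇒≤ gap-pos)) (separation j J≤j))
    where open _<ʳ_ 10⁷ω<23728639

  ω-1-upper : ∃[ J ] ∀ j → J ≤ j → seq (ω -ʳ fromℕ 1) j ℚ.≤ + 7 / 5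
  ω-1-upper = proj₁ ω-upper , λ j J≤j → ℚₚ.+-monoˡ-≤ (ℚ.- 1ℚ) (proj₂ ω-upper j J≤j)

  -- τ ≤ 1/18, in an approximate form which can be decided.
  τ-upper : ∀ η → 0ℚ ℚ.< η → η ℚ.≤ + 1 / 10 → ∃[ J ] ∀ j → J ≤ j → seq τ j ℚ.≤ + 1 / 18 ℚ.+ (η ℚ.+ (η ℚ.+ η))
  τ-upper η 0<η η≤ = case seq τ N ℚ.≤? + 1 / 18 ℚ.+ (η ℚ.+ η) of λ
      { (yes ≤N) → N , λ j N≤j → ≥0-difference (subst (0ℚ ℚ.≤_) (eq₁ (seq τ j) (seq τ N) η)
          (+-≥0 (difference-≥0 (near-≤ (seq τ j) (seq τ N) (h j N N≤j ℕₚ.≤-refl))) (difference-≥0 ≤N)))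
      -- It cannot be decided which clause of `IsTau` applies. But a too large value of τ at index N
      -- refutes both α ≤ 1/2 and 1/2 ≤ α, and the two refutations contradict each other.
      ; (no ≰N) → ⊥-elim (≤ʳ-total α (fromℚ ½) (small ≰N) (large ≰N)) }
    where
    N = proj₁ (cauchy τ η 0<η)
    h = proj₂ (cauchy τ η 0<η)
    eq₁ : ∀ τj τN η → (τN ℚ.+ η ℚ.- τj) ℚ.+ (+ 1 / 18 ℚ.+ (η ℚ.+ η) ℚ.- τN) ≡ + 1 / 18 ℚ.+ (η ℚ.+ (η ℚ.+ η)) ℚ.- τj
    eq₁ = solve-∀ ℚ-ring
    eq₂ : ∀ τj τN η → (τj ℚ.+ η ℚ.- τN) ℚ.+ (τN ℚ.- (+ 1 / 18 ℚ.+ (η ℚ.+ η))) ≡ τj ℚ.- (+ 1 / 18 ℚ.+ η)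
    eq₂ = solve-∀ ℚ-ring
    eq₃ : ∀ τj η → (τj ℚ.- (+ 1 / 18 ℚ.+ η)) ℚ.+ (+ 1 / 18 ℚ.+ ½ ℚ.* η ℚ.- τj) ≡ 0ℚ ℚ.- ½ ℚ.* η
    eq₃ = solve-∀ ℚ-ring
    low : ¬ (seq τ N ℚ.≤ + 1 / 18 ℚ.+ (η ℚ.+ η)) → ∀ j → N ≤ j → + 1 / 18 ℚ.+ η ℚ.≤ seq τ j
    low ≰N j N≤j = ≥0-difference (subst (0ℚ ℚ.≤_) (eq₂ (seq τ j) (seq τ N) η)
      (+-≥0 (difference-≥0 (near-≤ (seq τ N) (seq τ j) (h N j ℕₚ.≤-refl N≤j))) (difference-≥0 (ℚₚ.<⇒≤ (ℚₚ.≰⇒> ≰N)))))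
    large : ¬ (seq τ N ℚ.≤ + 1 / 18 ℚ.+ (η ℚ.+ η)) → ¬ (fromℚ ½ ≤ʳ α)
    large ≰N ½≤α = ℚ-<⇒≱ (ℝ-lemmas.half-pos 0<η) (≥0-difference (subst (0ℚ ℚ.≤_) (eq₃ (seq τ j) η)
        (+-≥0 (difference-≥0 (low ≰N j (ℕₚ.m≤m⊔n N (proj₁ b)))) (difference-≥0 (proj₂ b j (ℕₚ.m≤n⊔m N (proj₁ b)))))))
      where
      b = _≤ʳ_.below (proj₁ (τ-α≥½ ½≤α)) (½ ℚ.* η) (ℝ-lemmas.half-pos 0<η)
      j = N ℕ.⊔ proj₁ b
    small : ¬ (seq τ N ℚ.≤ + 1 / 18 ℚ.+ (η ℚ.+ η)) → ¬ (α ≤ʳ fromℚ ½)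
    small ≰N α≤½ = ℚ-<⇒≱ 0<η (TauBound.ε≤0 (seq τ j) (seq ω j) (seq α j) η (ℚₚ.<⇒≤ 0<η) η≤
        (proj₂ b₁ j J₁) (proj₂ ω-upper j J₂)
        (ℚₚ.≤-trans (p≤p+q (+ 3 / 10) (ℚₚ.<⇒≤ (_<ʳ_.gap-pos 0·3<α))) (_<ʳ_.separation 0·3<α j J₃))
        (proj₂ b₄ j J₄) (low ≰N j J₀) (proj₂ b₅ j J₅))
      where
      b₁ = _≤ʳ_.below 2≤ω η 0<η
      b₄ = _≤ʳ_.below α≤½ η 0<η
      b₅ = _≤ʳ_.below (proj₁ (τ-α≤½ α≤½)) η 0<η
      j = N + (proj₁ b₁ + (proj₁ ω-upper + (_<ʳ_.index 0·3<α + (proj₁ b₄ + proj₁ b₅))))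
      J₀ : N ≤ j
      J₀ = ℕₚ.m≤m+n N _
      J₁ : proj₁ b₁ ≤ j
      J₁ = ℕₚ.≤-trans (ℕₚ.m≤m+n (proj₁ b₁) _) (ℕₚ.m≤n+m _ N)
      J₂ : proj₁ ω-upper ≤ j
      J₂ = ℕₚ.≤-trans (ℕₚ.m≤m+n (proj₁ ω-upper) _) (ℕₚ.≤-trans (ℕₚ.m≤n+m _ (proj₁ b₁)) (ℕₚ.m≤n+m _ N))
      J₃ : _<ʳ_.index 0·3<α ≤ j
      J₃ = ℕₚ.≤-trans (ℕₚ.m≤m+n (_<ʳ_.index 0·3<α) _) (ℕₚ.≤-trans (ℕₚ.m≤n+m _ (proj₁ ω-upper)) (ℕₚ.≤-trans (ℕₚ.m≤n+m _ (proj₁ b₁)) (ℕₚ.m≤n+m _ N)))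
      J₄ : proj₁ b₄ ≤ j
      J₄ = ℕₚ.≤-trans (ℕₚ.m≤m+n (proj₁ b₄) (proj₁ b₅)) (ℕₚ.≤-trans (ℕₚ.m≤n+m _ (_<ʳ_.index 0·3<α)) (ℕₚ.≤-trans (ℕₚ.m≤n+m _ (proj₁ ω-upper)) (ℕₚ.≤-trans (ℕₚ.m≤n+m _ (proj₁ b₁)) (ℕₚ.m≤n+m _ N))))
      J₅ : proj₁ b₅ ≤ j
      J₅ = ℕₚ.≤-trans (ℕₚ.m≤n+m (proj₁ b₅) (proj₁ b₄)) (ℕₚ.≤-trans (ℕₚ.m≤n+m _ (_<ʳ_.index 0·3<α)) (ℕₚ.≤-trans (ℕₚ.m≤n+m _ (proj₁ ω-upper)) (ℕₚ.≤-trans (ℕₚ.m≤n+m _ (proj₁ b₁)) (ℕₚ.m≤n+m _ N))))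

  -- The constant 20 is a generous choice of c: 1 beside p for a table, 2 for reading the input, 2/5
  -- for rounding in the matrix product, and 1 more for the approximation of τ.
  runExponent : ℕ → ℕ → ℝ
  runExponent k p = (fromℚ ½ -ʳ τ) *ʳ fromℕ k +ʳ fromℕ (2 * p) +ʳ fromℕ 20

  -- τ is known only up to an error 3η, which is multiplied by k. With η = 1/(3k + 10) the loss 3ηk
  -- is at most 1 and is taken from the 20, leaving 19.
  runExponent-lower : ∀ k p → ∃[ J ] ∀ j → J ≤ j → + (4 * k + 9 * (2 * p + 19)) / 9 ℚ.≤ seq (runExponent k p) j
  runExponent-lower k p = proj₁ upper , λ j J≤j → subst₂ (λ a b → + (4 * k + 9 * (2 * p + 19)) / 9 ℚ.≤ (½ ℚ.- seq τ j) ℚ.* a ℚ.+ b ℚ.+ + 20 / 1)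
      (sym (fromℕ-fraction k j)) (sym (fromℕ-fraction (2 * p) j))
      (≥0-difference (subst (0ℚ ℚ.≤_) (trans (eq (seq τ j) η (+ k / 1) (+ (2 * p) / 1)) (cong (λ z → (½ ℚ.- seq τ j) ℚ.* (+ k / 1) ℚ.+ (+ (2 * p) / 1) ℚ.+ + 20 / 1 ℚ.- z) goal))
        (+-≥0 (*-≥0 (difference-≥0 (proj₂ upper j J≤j)) (fraction-≥0 k 0)) (difference-≥0 slack))))
    where
    η = + 1 / suc (3 * k + 9)
    upper = τ-upper η (ℚₚ.positive⁻¹ η {{ℚₚ.normalize-pos 1 (suc (3 * k + 9))}})
      (fraction-≤⁺ {1} {3 * k + 9} {1} {9} (ℕₚ.≤-trans (s≤s (ℕₚ.m≤n+m 9 (3 * k))) (ℕₚ.≤-reflexive (sym (ℕₚ.*-identityˡ _)))))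
    slack : + 3 / 1 ℚ.* (η ℚ.* (+ k / 1)) ℚ.≤ 1ℚ
    slack = begin
      + 3 / 1 ℚ.* (η ℚ.* (+ k / 1))                          ≡⟨ cong ((+ 3 / 1) ℚ.*_) (fraction-* 1 (3 * k + 9) k 0) ⟩
      + 3 / 1 ℚ.* (+ (1 * k) / suc ((3 * k + 9) * 1))        ≡⟨ fraction-* 3 0 (1 * k) ((3 * k + 9) * 1) ⟩
      + (3 * (1 * k)) / suc ((3 * k + 9) * 1 + 0)            ≤⟨ fraction-≤⁺ {3 * (1 * k)} {(3 * k + 9) * 1 + 0} {1} {0} (ℕₚ.≤-trans (ℕₚ.m≤m+n _ 10) (ℕₚ.≤-reflexive (eq′ k))) ⟩
      1ℚ                                                     ∎
      where
      open ℚₚ.≤-Reasoning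
      eq′ : ∀ k → 3 * (1 * k) * 1 + 10 ≡ 1 * suc ((3 * k + 9) * 1 + 0)
      eq′ = ℕ-solve-∀
    eq : ∀ t η k p → (+ 1 / 18 ℚ.+ (η ℚ.+ (η ℚ.+ η)) ℚ.- t) ℚ.* k ℚ.+ (1ℚ ℚ.- + 3 / 1 ℚ.* (η ℚ.* k))
      ≡ (½ ℚ.- t) ℚ.* k ℚ.+ p ℚ.+ + 20 / 1 ℚ.- (+ 4 / 9 ℚ.* k ℚ.+ (p ℚ.+ + 19 / 1))
    eq = solve-∀ ℚ-ring
    goal : + 4 / 9 ℚ.* (+ k / 1) ℚ.+ ((+ (2 * p) / 1) ℚ.+ + 19 / 1) ≡ + (4 * k + 9 * (2 * p + 19)) / 9
    goal = trans (cong₂ ℚ._+_ (fraction-* 4 8 k 0) (fraction-+ (2 * p) 0 19 0))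
      (trans (fraction-+ (4 * k) 8 (2 * p * 1 + 19 * 1) 0) (fraction-cong {4 * k * 1 + (2 * p * 1 + 19 * 1) * 9} {8} {4 * k + 9 * (2 * p + 19)} {8} (eq′ k p)))
      where
      eq′ : ∀ k p → (4 * k * 1 + (2 * p * 1 + 19 * 1) * 9) * 9 ≡ (4 * k + 9 * (2 * p + 19)) * 9
      eq′ = ℕ-solve-∀

  runExponent-above : ∀ k p a b → a * 9 ≤ (4 * k + 9 * (2 * p + 19)) * suc b → ∃[ J ] ∀ j → J ≤ j → + a / suc b ℚ.≤ seq (runExponent k p) j
  runExponent-above k p a b h = proj₁ (runExponent-lower k p) , λ j J≤j →
    ℚₚ.≤-trans (fraction-≤⁺ {a} {b} {4 * k + 9 * (2 * p + 19)} {8} h) (proj₂ (runExponent-lower k p) j J≤j)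

-- The counting program

module OutputCode (R : ℕ) where

  -- The output is expected in cell 0, so the last instruction overwrites n.
  outputCode : ℕ → List Instr
  outputCode d = const 5 (+ (R * 0 + 1)) ∷ add 5 5 1 ∷ load 6 5 ∷ const 7 (+ d) ∷ quotient 0 6 7 ∷ []

module Output (K R n W : ℕ) (8<K : 8 < K) .{{nz : NonZero n}} where

  open Correct K R n W 8<K
  open OutputCode R

  outputCode-ok : ∀ d q .{{_ : NonZero d}} {arr m} → 1 < R → at-array 1 0 ≤ W → d ≤ W → arr 1 0 ≡ + (q * d) → Fitting W m → Rep arr m →
    Exec W (outputCode d) m (λ m′ → m′ 0 ≡ + q)
  outputCode-ok d q {arr} {m} 1<R at≤W d≤W out fit rp =
    go fit (ℕₚ.≤-trans (ℕₚ.m≤n+m (R * 0 + 1) D) at≤W) λ f₁ →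
    go f₁ (eq≤ e₁ at≤W) λ f₂ →
    go f₂ (f₂ ℤ.∣ + (R * 0 + 1) ℤ.+ m 1 ∣) λ f₃ →
    go f₃ d≤W λ f₄ →
    go f₄ (eq≤ e₃ (ℕₚ.≤-trans (ℕₚ.m≤m*n q d) (subst (_≤ W) (cong ℤ.∣_∣ (cells rp 1<R 0 ∙ out)) (fit (at-array 1 0))))) λ f₅ →
    stop f₅ e₃
    where
    m₂ = effects (const 5 (+ (R * 0 + 1)) ∷ add 5 5 1 ∷ []) m
    e₁ : + (R * 0 + 1) ℤ.+ m 1 ≡ + at-array 1 0
    e₁ = cong (ℤ._+_ (+ (R * 0 + 1))) (cell-D rp) ∙ sym (ℤₚ.pos-+ (R * 0 + 1) D) ∙ cong +_ (ℕₚ.+-comm (R * 0 + 1) D)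
    ne : 5 ≢ at-array 1 0
    ne eq = ℕₚ.<⇒≱ (ℕₚ.≤-<-trans (ℕₚ.m≤m+n 5 3) 8<K) (subst (K ≤_) (sym eq) (K≤at-array 1 0))
    e₂ : m₂ ℤ.∣ + (R * 0 + 1) ℤ.+ m 1 ∣ ≡ + (q * d)
    e₂ = cong (λ z → m₂ ℤ.∣ z ∣) e₁ ∙ effects-untouched (const 5 (+ (R * 0 + 1)) ∷ add 5 5 1 ∷ []) m (ne , ne , tt) ∙ cells rp 1<R 0 ∙ out
    e₃ : m₂ ℤ.∣ + (R * 0 + 1) ℤ.+ m 1 ∣ quot (+ d) ≡ + q
    e₃ = cong (_quot (+ d)) e₂ ∙ quot-pos (q * d) d ∙ cong +_ (DivMod.m*n/n≡m q d)

edgeProduct-renamed : ∀ {k n} (H : Graph n) (ρ : Fin k → Fin k) es g →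
  edgeProduct H (map (λ (u , v) → ρ u , ρ v) es) g ≡ edgeProduct H es (g ∘ ρ)
edgeProduct-renamed H ρ []       g = refl
edgeProduct-renamed H ρ (e ∷ es) g = cong (ℤ._* edgeValue H e (g ∘ ρ)) (edgeProduct-renamed H ρ es g)

sumTerms-cong : ∀ {k} {f g : Term k → ℤ} ts → (∀ t → f t ≡ g t) → sumTerms f ts ≡ sumTerms g ts
sumTerms-cong []       eq = refl
sumTerms-cong (t ∷ ts) eq = cong₂ ℤ._+_ (eq t) (sumTerms-cong ts eq)

contents-≤ : ∀ {B} zs → All (λ z → ℤ.∣ z ∣ ≤ B) zs → ∀ a → ℤ.∣ contents zs a ∣ ≤ B
contents-≤ []       []       a       = z≤n
contents-≤ (z ∷ zs) (h ∷ hs) zero    = h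
contents-≤ (z ∷ zs) (h ∷ hs) (suc a) = contents-≤ zs hs a

hostEntries-≤ : ∀ {n} (H : Graph n) a → ℤ.∣ contents (hostEntries H) a ∣ ≤ 1
hostEntries-≤ {n} H = contents-≤ (hostEntries H) (Allₚ.concat⁺ (Allₚ.tabulate⁺ {n = n} λ u → Allₚ.tabulate⁺ {n = n} λ v → bit (Graph.adj H u v)))
  where
  bit : ∀ b → ℤ.∣ (if b then + 1 else + 0) ∣ ≤ 1
  bit true  = s≤s z≤n
  bit false = z≤n

Counted : ∀ {k} → Graph k → Assertion
Counted P n H arr = arr 1 0 ≡ + (length (Counting.subgraphs P n H) * length (Counting.automorphisms P))

module Assembly {k} (P : Graph k) (clock : Clock) (K R : ℕ) (8<K : 8 < K) (1<R : 1 < R) (𝓜 : Algorithm) (cmds : List (Cmd k))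
                (outcome : Logic.Outcome k K R 8<K 𝓜 clock (λ o → Programs.compile K R 𝓜 o cmds) (Ready 2 (λ _ _ → + 0)) (Counted P) (λ _ → 1))
                (time-one : ∀ n .{{_ : NonZero n}} → Clock.Time clock n 1 1)
                (time-square : ∀ n .{{_ : NonZero n}} → Clock.Time clock n 1 (n ^ 2)) where

  open Clock clock
  open Counting P

  private
    aut : ℕ
    aut = length automorphisms

    open InputCode K R using (inputCode; setupCode; copyCode)
    open Programs K R 𝓜 using (compile)
    open OutputCode R using (outputCode)

    body : List Instr
    body = compile (length inputCode) cmds

    program₀ : Program
    program₀ = inputCode ++ body ++ outputCode aut

    module Body = Logic.Outcome outcome

    -- Collects what the input phase, the commands and the output demand of the word size. Its
    -- monomial bound becomes the capacity of `counter`; this is legitimate because the input is at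
    -- least as long as n.
    required : ℕ → ℕ
    required n = Body.word n + (n ^ 1 * (n ^ 1 + (K + n ^ 2)) + ((n ^ 1 * (n ^ 1 + (K + K)) + (R * n ^ 2 + 0)) + (R + aut)))

    required-poly : Poly required
    required-poly = poly-+ Body.word-poly (poly-+ (poly-* (poly-power 1) (poly-+ (poly-power 1) (poly-+ (poly-const K) (poly-power 2))))
      (poly-+ (poly-+ (poly-* (poly-power 1) (poly-+ (poly-power 1) (poly-const (K + K)))) (poly-+ (poly-* (poly-const R) (poly-power 2)) (poly-const 0)))
        (poly-+ (poly-const R) (poly-const aut))))

  counter : Algorithm
  counter = record { program = program₀ ; scale = Poly.factor required-poly ; degree = Poly.exponent required-poly }

  constant : ℕ
  constant = (length setupCode + (length copyCode + 4)) * 1 + (Body.constant + length (outputCode aut) * 1)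

  module _ (n : ℕ) .{{nz : NonZero n}} (H : Graph n) where

    private
      m₀ : Memory
      m₀ = contents (encode H)

      W : ℕ
      W = Algorithm.capacity counter (encode H)

      n≤length : n ≤ length (encode H)
      n≤length = ℕₚ.m≤n⇒m≤1+n (ℕₚ.≤-trans (ℕₚ.m≤m*n n n) (ℕₚ.≤-reflexive (sym (length-rowMajor n n _))))

      required≤W : required n ≤ W
      required≤W = ℕₚ.≤-trans (Poly.below required-poly n) (ℕₚ.*-monoʳ-≤ (Poly.factor required-poly)
        (ℕₚ.^-monoˡ-≤ (Poly.exponent required-poly) (ℕₚ.≤-trans n≤length (ℕₚ.m≤m+n _ _))))

      word≤W : Body.word n ≤ W
      word≤W = ℕₚ.≤-trans (ℕₚ.m≤m+n _ _) required≤W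
      rest≤W = ℕₚ.≤-trans (ℕₚ.m≤n+m _ (Body.word n)) required≤W
      saved≤W : n * (n + (K + n ^ 2)) ≤ W
      saved≤W = subst (λ z → z * (z + (K + n ^ 2)) ≤ W) (ℕₚ.*-identityʳ n) (ℕₚ.≤-trans (ℕₚ.m≤m+n _ _) rest≤W)
      rest′≤W = ℕₚ.≤-trans (ℕₚ.m≤n+m _ (n ^ 1 * (n ^ 1 + (K + n ^ 2)))) rest≤W
      extent≤W : n * (n + (K + K)) + (R * n ^ 2 + 0) ≤ W
      extent≤W = subst (λ z → z * (z + (K + K)) + (R * n ^ 2 + 0) ≤ W) (ℕₚ.*-identityʳ n) (ℕₚ.≤-trans (ℕₚ.m≤m+n _ _) rest′≤W)
      rest″≤W = ℕₚ.≤-trans (ℕₚ.m≤n+m (R + aut) (n ^ 1 * (n ^ 1 + (K + K)) + (R * n ^ 2 + 0))) rest′≤W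
      R≤W : R ≤ W
      R≤W = ℕₚ.≤-trans (ℕₚ.m≤m+n R aut) rest″≤W
      aut≤W : aut ≤ W
      aut≤W = ℕₚ.≤-trans (ℕₚ.m≤n+m aut R) rest″≤W

      open Correct K R n W 8<K using (at-array; Rep)

      output≤W : at-array 1 0 ≤ W
      output≤W = ℕₚ.≤-trans (ℕₚ.+-monoʳ-≤ (n * (n + (K + K))) (ℕₚ.≤-trans (ℕₚ.≤-reflexive (cong (_+ 1) (ℕₚ.*-zeroʳ R)))
        (ℕₚ.≤-trans (ℕ.>-nonZero⁻¹ (n ^ 2) {{ℕₚ.m^n≢0 n 2}}) (ℕₚ.≤-trans (ℕₚ.m≤n*m (n ^ 2) R {{ℕ.>-nonZero (ℕₚ.<-trans (s≤s z≤n) 1<R)}}) (ℕₚ.m≤m+n (R * n ^ 2) 0))))) extent≤W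

      n≤W : n ≤ W
      n≤W = ℕₚ.≤-trans (ℕₚ.≤-trans (ℕₚ.m≤m*n n (n + (K + n ^ 2)) {{ℕ.>-nonZero (ℕₚ.<-≤-trans (ℕ.>-nonZero⁻¹ n) (ℕₚ.m≤m+n n _))}}) ℕₚ.≤-refl) saved≤W

      fit₀ : Fitting W m₀
      fit₀ zero    = n≤W
      fit₀ (suc a) = ℕₚ.≤-trans (hostEntries-≤ H a) (ℕₚ.≤-trans (ℕₚ.<⇒≤ 1<R) R≤W)

      corner : m₀ 1 ≡ + 0
      corner = corner′ n H
        where
        corner′ : ∀ n .{{_ : NonZero n}} (H : Graph n) → contents (encode H) 1 ≡ + 0
        corner′ (suc n) H = cong (λ b → if b then + 1 else + 0) (Graph.irreflexive H Fin.zero)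

      beyond : ∀ c → n * n < c → m₀ c ≡ + 0
      beyond (suc c) (s≤s h) = contents-beyond (hostEntries H) c (ℕₚ.≤-trans (ℕₚ.≤-reflexive (length-rowMajor n n _)) h)

      whole : Located program₀ 0 program₀
      whole = located-self program₀
      at-body : Located program₀ (length inputCode) (body ++ outputCode aut)
      at-body = located-++ʳ inputCode whole

      input = Input.inputCode-ok K R n W 8<K R≤W m₀ fit₀ refl corner beyond saved≤W extent≤W {program₀} (ℕₚ.<-trans (s≤s z≤n) 1<R) (located-++ˡ inputCode whole)

      bounded : ∀ r a → ℤ.∣ inputArrays m₀ r a ∣ ≤ 1
      bounded zero    a = hostEntries-≤ H a
      bounded (suc r) a = z≤n

      middle = Body.run n H W R≤W word≤W {o = length inputCode} (located-++ˡ body at-body) (proj₂ (proj₂ input)) bounded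
        ((λ a → refl) , refl , λ { (suc r) _ a → refl ; zero () })

    private
      m₂ = proj₁ (proj₂ middle)
      arr₂ = proj₁ (proj₂ (proj₂ middle))
      holds₂ = proj₁ (proj₂ (proj₂ (proj₂ (proj₂ middle))))
      counted = proj₁ (proj₂ (proj₂ (proj₂ (proj₂ (proj₂ (proj₂ middle))))))
      spent = proj₂ (proj₂ (proj₂ (proj₂ (proj₂ (proj₂ (proj₂ middle))))))

      output = Output.outputCode-ok K R n W 8<K aut (length (subgraphs n H)) 1<R output≤W aut≤W counted (proj₁ holds₂) (proj₂ holds₂)

      steps : ℕ
      steps = (length setupCode + n ^ 2 * (length copyCode + 4)) + (proj₁ middle + length (outputCode aut))

      time-spent : Time n constant steps
      time-spent = time-+ n (time-≤ n input-≤ (time-* n (length setupCode + (length copyCode + 4)) (time-square n)))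
        (time-+ n spent (time-≤ n (ℕₚ.≤-reflexive (sym (ℕₚ.*-identityʳ (length (outputCode aut))))) (time-* n (length (outputCode aut)) (time-one n))))
        where
        input-≤ : length setupCode + n ^ 2 * (length copyCode + 4) ≤ (length setupCode + (length copyCode + 4)) * n ^ 2
        input-≤ = begin
          length setupCode + n ^ 2 * (length copyCode + 4)          ≤⟨ ℕₚ.+-mono-≤ (ℕₚ.m≤m*n (length setupCode) (n ^ 2) {{ℕₚ.m^n≢0 n 2}}) (ℕₚ.≤-reflexive (ℕₚ.*-comm (n ^ 2) _)) ⟩
          length setupCode * n ^ 2 + (length copyCode + 4) * n ^ 2  ≡⟨ ℕₚ.*-distribʳ-+ (n ^ 2) (length setupCode) (length copyCode + 4) ⟨
          (length setupCode + (length copyCode + 4)) * n ^ 2        ∎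
          where open ℕₚ.≤-Reasoning

      all-steps : Reach program₀ W (0 , m₀) steps (length program₀ , result output)
      all-steps = reach-trans (proj₁ (proj₂ input)) (reach-trans (proj₁ (proj₂ (proj₂ (proj₂ middle))))
        (reach-pc (trans (ℕₚ.+-assoc (length inputCode) (length body) _)
            (trans (cong (length inputCode ℕ.+_) (sym (Listₚ.length-++ body))) (sym (Listₚ.length-++ inputCode))))
          (exec-reach (located-++ʳ body at-body) output)))

    correct : ∃[ m ] SubgraphCount P H m × ComputesWithin clock counter n constant (encode H) (+ m ∷ [])
    correct = length (subgraphs n H) , subgraphs-count n H
      , steps , result output , reach-run all-steps (fitting output) (fetch-end program₀)
      , (λ { Fin.zero → post output ; (Fin.suc ()) }) , time-spent

module Times (ω α τ : ℝ) (mm : MatrixMultiplicationExponents ω α) (isTau : IsTau ω α τ)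
  (𝓜 : Algorithm) (C : ℕ) (multiplies : ∀ N M .{{_ : NonZero N}} .{{_ : NonZero M}} → N ≤ M → Multiplies 𝓜 N M (fromℕ C *ʳ (N ^ʳ (ω -ʳ fromℕ 1) *ʳ fromℕ M)))
  (k p : ℕ) where

  open Exponents ω α τ mm isTau

  x : ℝ
  x = runExponent k p

  clock : Clock
  clock = powerClock x

  open Clock clock

  time-power : ∀ m → 9 * m ≤ 4 * k + 9 * (2 * p + 19) → ∀ n .{{_ : NonZero n}} → Time n 1 (n ^ m)
  time-power m h n = power-time x m 0 (runExponent-above k p m 0 (ℕₚ.≤-trans (ℕₚ.≤-reflexive (ℕₚ.*-comm m 9))
    (ℕₚ.≤-trans h (ℕₚ.≤-reflexive (sym (ℕₚ.*-identityʳ _)))))) n 1 (n ^ m) (ℕₚ.≤-reflexive (eq (n ^ m)))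
    where
    eq : ∀ z → z ^ 1 ≡ 1 ^ 1 * z
    eq z = trans (ℕₚ.*-identityʳ z) (sym (ℕₚ.*-identityˡ z))

  time-one : ∀ n .{{_ : NonZero n}} → Time n 1 1
  time-one n = time-power 0 z≤n n

  allowed : ∀ m → 9 * m ≤ 4 * k + 9 * (p + 1) → ∀ n .{{_ : NonZero n}} → Time n 1 (n ^ m)
  allowed m h = time-power m (ℕₚ.≤-trans h (ℕₚ.+-monoʳ-≤ (4 * k) (ℕₚ.*-monoʳ-≤ 9 (ℕₚ.+-mono-≤ (ℕₚ.m≤n*m p 2) (s≤s z≤n)))))

  mult : ∀ a b → a ≤ b → 9 * (7 * a + 5 * b) ≤ 20 * k + 18 → Σ[ C ∈ ℕ ] MultipliesWithin clock 𝓜 a b C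
  -- `C` pays for `pred t` steps and the additional 1 for the step lost to the tolerance.
  mult a b a≤b h = C + 1 , λ n A B →
      let (t , mem , run , out , t≤) = multiplies (n ^ a) (n ^ b) {{ℕₚ.m^n≢0 n a}} {{ℕₚ.m^n≢0 n b}} (ℕₚ.^-monoʳ-≤ n a≤b) A B
      in t , mem , run , out , within n t (_≤ʳ_.below t≤)
    where
    pred-≤ : ∀ t → t ≤ suc (ℕ.pred t)
    pred-≤ zero    = z≤n
    pred-≤ (suc t) = ℕₚ.≤-refl
    powers : ∀ n → (n ^ a) ^ 7 * (n ^ b) ^ 5 ≡ n ^ (7 * a + 5 * b)
    powers n = trans (cong₂ _*_ (trans (ℕₚ.^-*-assoc n a 7) (cong (n ^_) (ℕₚ.*-comm a 7))) (trans (ℕₚ.^-*-assoc n b 5) (cong (n ^_) (ℕₚ.*-comm b 5))))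
      (sym (ℕₚ.^-distribˡ-+-* n (7 * a) (5 * b)))
    room : 18 ≤ 9 * (2 * p + 19) * 5
    room = ℕₚ.≤-trans (ℕₚ.*-monoʳ-≤ 9 (ℕₚ.≤-trans (ℕₚ.m≤m+n 2 17) (ℕₚ.m≤n+m 19 (2 * p)))) (ℕₚ.m≤m*n (9 * (2 * p + 19)) 5)
    slack : (7 * a + 5 * b) * 9 ≤ (4 * k + 9 * (2 * p + 19)) * 5
    slack = begin
      (7 * a + 5 * b) * 9               ≡⟨ ℕₚ.*-comm (7 * a + 5 * b) 9 ⟩
      9 * (7 * a + 5 * b)               ≤⟨ h ⟩
      20 * k + 18                       ≤⟨ ℕₚ.+-monoʳ-≤ (20 * k) room ⟩
      20 * k + 9 * (2 * p + 19) * 5     ≡⟨ eq k (9 * (2 * p + 19)) ⟩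
      (4 * k + 9 * (2 * p + 19)) * 5    ∎
      where
      open ℕₚ.≤-Reasoning
      eq : ∀ k z → 20 * k + z * 5 ≡ (4 * k + z) * 5
      eq = ℕ-solve-∀
    within : ∀ n .{{_ : NonZero n}} t → (∀ ε → 0ℚ ℚ.< ε → ∃[ J ] ∀ j → J ≤ j → seq (fromℕ t) j ℚ.≤
        seq (fromℕ C) j ℚ.* (+ floorPow (n ^ a) (seq (ω -ʳ fromℕ 1) j) (suc j) / suc j ℚ.* seq (fromℕ (n ^ b)) j) ℚ.+ ε) →
      Time n (C + 1) t
    within n t t≤ =
      time-≤ n {C + 1} {t} {ℕ.pred t + 1} (ℕₚ.≤-trans (pred-≤ t) (ℕₚ.≤-reflexive (ℕₚ.+-comm 1 (ℕ.pred t))))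
        (time-+ n {C} {1} {ℕ.pred t} {1}
          (power-time x (7 * a + 5 * b) 4 (runExponent-above k p (7 * a + 5 * b) 4 slack) n C (ℕ.pred t)
            (ℕₚ.≤-trans (product-time (ω -ʳ fromℕ 1) C (n ^ a) (n ^ b) t {{ℕₚ.m^n≢0 n a}} 7 4 t≤ ω-1-upper)
              (ℕₚ.≤-reflexive (cong (C ^ 5 *_) (powers n)))))
          (time-one n))

  time-square : ∀ n .{{_ : NonZero n}} → Time n 1 (n ^ 2)
  time-square = time-power 2 (ℕₚ.≤-trans (ℕₚ.*-monoʳ-≤ 9 (ℕₚ.≤-trans (ℕₚ.m≤m+n 2 17) (ℕₚ.m≤n+m 19 (2 * p)))) (ℕₚ.m≤n+m _ (4 * k)))

module Algorithms (clock : Clock) (𝓜 : Algorithm) (k p : ℕ) (P : Graph k) (D : PathDecomposition P) (width : HasWidth≤ D p)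
  (allowed : ∀ m → 9 * m ≤ 4 * k + 9 * (p + 1) → ∀ n .{{_ : NonZero n}} → Clock.Time clock n 1 (n ^ m))
  (mult : ∀ a b → a ≤ b → 9 * (7 * a + 5 * b) ≤ 20 * k + 18 → Σ[ C ∈ ℕ ] MultipliesWithin clock 𝓜 a b C)
  (time-square : ∀ n .{{_ : NonZero n}} → Clock.Time clock n 1 (n ^ 2)) where

  open Counting P
  open PathDecomposition D

  private
    start : Term k
    start = term (+ 1) (allFin k) (λ i → i)

    start-valid : Valid start
    start-valid = valid (Uniqueₚ.allFin⁺ k) ∈-allFin (λ _ _ → refl)

    terms : List (Term k)
    terms = expand start distinctPairs

    -- Arrays 0 and 1 are the host and the result; each term has `2 + k` more. The low cells are the
    -- registers 0 to 7, at most k loop variables, and the cleared cell for absent variables.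
    R K : ℕ
    R = 2 + length terms * (2 + k)
    K = 9 + k

    8<K : 8 < K
    8<K = ℕₚ.m≤m+n 9 k

    edges-covered : All (λ e → ∃[ b ] (proj₁ e ∈ˢ bag b × proj₂ e ∈ˢ bag b)) patternEdges
    edges-covered = All.tabulate λ {e} e∈ → covers-edges (proj₁ e) (proj₂ e)
      (proj₂ (∈-filter⁻ (λ (u , v) → T? (Graph.adj P u v)) {xs = cartesianProduct (allFin k) (allFin k)} e∈))

    commands : Σ[ cs ∈ List (Cmd k) ] Logic.Hoare k K R 8<K 𝓜 clock cs (Ready 2 (λ _ _ → + 0)) (Counted P)
    commands = proj₁ cmds , λ pB → Logic.outcome-weaken k K R 8<K 𝓜 clock {Post′ = Counted P}
        (λ n H out → trans out (trans (ℤₚ.+-identityˡ _) (value n H))) (proj₂ cmds pB)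
      where
      cmds = Terms.termsCmds k R 𝓜 clock P p D width allowed mult patternEdges edges-covered
        terms (expand-valid start distinctPairs start-valid) 2 ℕₚ.≤-refl ℕₚ.≤-refl (λ _ _ → + 0)
      weight-ext : ∀ n (H : Graph n) (es : List (Edge k)) → Extensional (edgeProduct H es)
      weight-ext n H []             g g′ eq = refl
      weight-ext n H ((u , v) ∷ es) g g′ eq = cong₂ ℤ._*_ (weight-ext n H es g g′ eq)
        (cong₂ (λ a b → contents (hostEntries H) (a + n * (b + n * 0))) (eq v) (eq u))
      value : ∀ n .{{_ : NonZero n}} (H : Graph n) →
        sumTerms (λ t → coef t ℤ.* sums n (names t) (edgeProduct H (map (λ (u , v) → rename t u , rename t v) patternEdges)) origin) terms
          ≡ + (length (subgraphs n H) * length automorphisms)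
      value n H = trans (sumTerms-cong terms (λ t → cong (ℤ._*_ (coef t)) (sums-ext n (names t) (edgeProduct-renamed H (rename t) patternEdges) origin)))
        (trans (expand-value n (edgeProduct H patternEdges) (weight-ext n H patternEdges) start distinctPairs start-valid)
        (trans (ℤₚ.*-identityˡ _) (embeddings-sum n H)))

  open Assembly P clock K R 8<K (s≤s (s≤s z≤n)) 𝓜 (proj₁ commands) (proj₂ commands (poly-const 1)) (allowed 0 z≤n) time-square
    public using (counter; constant; correct)

theorem3 : Σ[ c ∈ ℝ ] fromℕ 0 ≤ʳ c × (
    ∀ (ω α τ : ℝ) → MatrixMultiplicationExponents ω α → IsTau ω α τ →
    ∀ (k p : ℕ) (P : Graph k) → HasPathwidth P p →
    CountsSubgraphsInTimeO P (λ n →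
    n ^ʳ ((fromℚ ½ -ʳ τ) *ʳ fromℕ k +ʳ fromℕ (2 * p) +ʳ c)
    +ʳ n ^ʳ (fromℚ (+ k / 3) +ʳ fromℕ (3 * p) +ʳ c)))
theorem3 = fromℕ 20
  , *≤* (λ ε 0<ε → 0 , λ _ _ → ℚₚ.≤-trans (fraction-≥0 20 0) (p≤p+q (+ 20 / 1) (ℚₚ.<⇒≤ 0<ε)))
  , λ ω α τ mm isTau k p P ((D , width) , _) →
      let (𝓜 , C , multiplies) = MatrixMultiplicationExponents.M2 mm
          open Times ω α τ mm isTau 𝓜 C multiplies k p
          open Algorithms clock 𝓜 k p P D width allowed mult time-square
      -- Doubled because `powerClock` compares the time with twice the power.
      in counter , constant + constant , λ n H →
        let (m , count , t , mem , run , out , time) = correct n H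
        in m , count , t , mem , run , out
           , *≤* (time-real x (fromℚ (+ k / 3) +ʳ fromℕ (3 * p) +ʳ fromℕ 20) n constant t time)
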